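{- Let $d$ be a positive integer and let $M$ be a plane map of outer degree $d$ having no face of degree less than $d$. Then $M$ admits a $d/(d-2)$-orientation if and only if $M$ has girth $d$. In this case, there exists a unique $d/(d-2)$-orientation of $M$ that is suitable.
   Context: A planar map is a connected graph (loops and multiple edges allowed) embedded without edge-crossings in the oriented sphere, considered up to continuous deformation; its faces are the connected components of the complement. Each edge consists of two half-edges, each incident to one endpoint. A corner is the angular section between two consecutive half-edges around a vertex; the degree of a vertex or face is its number of incident corners. The girth is the minimal length of a cycle. A plane map is a planar map with a distinguished face, the root-face, drawn as the unbounded (outer) face; its degree is the outer degree. Vertices, edges, half-edges incident to (lying on edges incident to) the root-face are outer, the others inner; faces other than the root-face are inner. A biorientation assigns to each half-edge a direction: ingoing (toward its vertex) or outgoing. An edge is $i$-way if exactly $i$ of its half-edges are ingoing. An edge $\{u,v\}$ can be traversed from $u$ to $v$ if it is 2-way, or 1-way with its ingoing half-edge at $v$. A biorientation is accessible from a vertex $v$ if every vertex can be reached from $v$ by a path traversing each edge in an allowed direction. A counterclockwise circuit is a simple cycle $C$ such that every edge of $C$ can be traversed in the direction that keeps the interior of $C$ on its left. A biorientation of a plane map is minimal if it has no counterclockwise circuit. A $\mathbb{Z}$-biorientation is a biorientation with an integer weight on each half-edge, positive if ingoing and non-positive if outgoing. The weight of an edge is the sum of the weights of its two half-edges; the weight of a vertex is the sum of the weights of the ingoing half-edges incident to it; the weight $w(f)$ of a face $f$ is the sum of the weights of the outgoing half-edges $h$ incident to $f$ such that $f$ lies on the right of $h$ (when $h$ is traversed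 from its vertex toward the middle of its edge). A $\mathbb{Z}$-biorientation of a plane map is admissible if the contour of the outer face is a simple cycle of 1-way edges each having weight $0$ on its outgoing half-edge and $1$ on its ingoing half-edge, and every inner half-edge incident to an outer vertex is outgoing. It is suitable if it is minimal, admissible, and accessible from every outer vertex. A $d/(d-2)$-orientation of $M$ is an admissible $\mathbb{Z}$-biorientation in which every outgoing half-edge has weight $0$, $-1$ or $-2$, and (i) each inner edge has weight $d-2$, (ii) each inner vertex has weight $d$, (iii) each inner face $f$ satisfies $\deg(f)+w(f)=d$. -}

module Defs where

open import Data.Nat as ℕ using (ℕ; zero; suc; _+_; _*_)
open import Data.Integer as ℤ using (ℤ; +_; _-_)
open import Data.Fin using (Fin; zero; suc; toℕ; inject₁; fromℕ)
import Data.Fin.Properties as FinP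
open import Data.Fin.Permutation using (Permutation′; _⟨$⟩ʳ_)
open import Data.Bool using (Bool; true; false; if_then_else_)
open import Data.Product using (Σ; ∃; _×_; _,_)
open import Data.Sum using (_⊎_)
open import Data.Empty using (⊥)
open import Relation.Nullary using (¬_; Dec)
open import Relation.Nullary.Decidable using (⌊_⌋)
open import Relation.Binary.PropositionalEquality using (_≡_; _≢_)
open import Relation.Binary.Construct.Closure.ReflexiveTransitive using (Star)

iter : ∀ {n} → (Fin n → Fin n) → ℕ → Fin n → Fin n
iter f zero    x = x
iter f (suc k) x = f (iter f k x)

-- g lies in the orbit of h under the permutation f (orbits of a
-- permutation of Fin n are reached in fewer than n steps)
SameOrbit : ∀ {n} → (Fin n → Fin n) → Fin n → Fin n → Set
SameOrbit {n} f h g = ∃ λ (k : Fin n) → iter f (toℕ k) h ≡ g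

sameOrbit? : ∀ {n} (f : Fin n → Fin n) (h g : Fin n) → Dec (SameOrbit f h g)
sameOrbit? f h g = FinP.any? (λ k → iter f (toℕ k) h FinP.≟ g)

count : ∀ {n} → (Fin n → Bool) → ℕ
count {zero}  p = 0
count {suc n} p = (if p zero then 1 else 0) + count (λ i → p (suc i))

sumℤ : ∀ {n} → (Fin n → ℤ) → ℤ
sumℤ {zero}  f = + 0
sumℤ {suc n} f = f zero ℤ.+ sumℤ (λ i → f (suc i))

orbitSize : ∀ {n} → (Fin n → Fin n) → Fin n → ℕ
orbitSize f h = count (λ g → ⌊ sameOrbit? f h g ⌋)

IsRep : ∀ {n} → (Fin n → Fin n) → Fin n → Set
IsRep {n} f h = (k : Fin n) → toℕ h ℕ.≤ toℕ (iter f (toℕ k) h)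

isRep? : ∀ {n} (f : Fin n → Fin n) (h : Fin n) → Dec (IsRep f h)
isRep? f h = FinP.all? (λ k → toℕ h ℕ.≤? toℕ (iter f (toℕ k) h))

numOrbits : ∀ {n} → (Fin n → Fin n) → ℕ
numOrbits f = count (λ h → ⌊ isRep? f h ⌋)

-- Combinatorial maps (rotation systems)
--
-- Half-edges are Fin n.  σ is the counterclockwise rotation of
-- half-edges around their vertex, α is the fixed-point-free involution
-- pairing the two half-edges of an edge.  Vertices = σ-orbits,
-- edges = α-orbits.  A half-edge h also names the corner (h , σ h).
-- Faces are the orbits of φ = α ∘ σ acting on corners; the face to the
-- left of h (traversed from its vertex toward the middle of its edge)
-- is the face of h, the face to its right is the face of α h.

phiOf : ∀ {n} → Permutation′ n → Permutation′ n → Fin n → Fin n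
phiOf σ α h = α ⟨$⟩ʳ (σ ⟨$⟩ʳ h)

-- A plane map: a connected planar map (Euler's formula V - E + F = 2,
-- with E = n/2) together with a root half-edge whose face (the face on
-- its left) is the root face.
record PlaneMap : Set where
  field
    n        : ℕ
    σ        : Permutation′ n
    α        : Permutation′ n
    α-invol  : ∀ h → α ⟨$⟩ʳ (α ⟨$⟩ʳ h) ≡ h
    α-free   : ∀ h → α ⟨$⟩ʳ h ≢ h
    connected : ∀ h g → Star (λ x y → (y ≡ σ ⟨$⟩ʳ x) ⊎ (y ≡ α ⟨$⟩ʳ x)) h g
    planar   : 2 * (numOrbits (σ ⟨$⟩ʳ_) + numOrbits (phiOf σ α)) ≡ n + 4
    root     : Fin n

module _ (M : PlaneMap) where
  open PlaneMap M

  HalfEdge : Set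
  HalfEdge = Fin n

  σ′ α′ φ : HalfEdge → HalfEdge
  σ′ h = σ ⟨$⟩ʳ h
  α′ h = α ⟨$⟩ʳ h
  φ = phiOf σ α

  SameVertex SameFace : HalfEdge → HalfEdge → Set
  SameVertex = SameOrbit σ′
  SameFace   = SameOrbit φ

  sameVertex? : ∀ h g → Dec (SameVertex h g)
  sameVertex? = sameOrbit? σ′

  sameFace? : ∀ h g → Dec (SameFace h g)
  sameFace? = sameOrbit? φ

  faceDeg : HalfEdge → ℕ
  faceDeg = orbitSize φ

  outerDeg : ℕ
  outerDeg = faceDeg root

  InRootFace : HalfEdge → Set
  InRootFace h = SameFace h root

  OuterEdge : HalfEdge → Set
  OuterEdge h = InRootFace h ⊎ InRootFace (α′ h)

  OuterVertex : HalfEdge → Set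
  OuterVertex h = ∃ λ g → SameVertex h g × InRootFace g

  -- Simple cycles and girth.
  -- A cycle of length suc m is a sequence of half-edges hs 0 .. hs m,
  -- where hs i leaves vertex v_i along edge e_i and α (hs i) is at v_{i+1}
  -- (indices mod suc m), with pairwise distinct vertices v_i and
  -- pairwise distinct edges e_i.
  record IsCycle (m : ℕ) (hs : Fin (suc m) → HalfEdge) : Set where
    field
      step    : ∀ (i : Fin m) → SameVertex (α′ (hs (inject₁ i))) (hs (suc i))
      close   : SameVertex (α′ (hs (fromℕ m))) (hs zero)
      vdist   : ∀ i j → SameVertex (hs i) (hs j) → i ≡ j
      edist   : ∀ i j → hs i ≢ α′ (hs j)

  HasCycle : ℕ → Set
  HasCycle zero    = ⊥
  HasCycle (suc m) = ∃ λ hs → IsCycle m hs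

  Girth : ℕ → Set
  Girth d = HasCycle d × (∀ k → k ℕ.< d → ¬ HasCycle k)

  -- Z-biorientations: an integer weight on each half-edge; a half-edge
  -- is ingoing iff its weight is positive, outgoing iff non-positive
  -- (so the biorientation is determined by the weights).
  ZBiorientation : Set
  ZBiorientation = HalfEdge → ℤ

  module _ (w : ZBiorientation) where

    Ingoing Outgoing : HalfEdge → Set
    Ingoing h  = + 0 ℤ.< w h
    Outgoing h = w h ℤ.≤ + 0

    ingoing? : ∀ h → Dec (Ingoing h)
    ingoing? h = + 0 ℤ.<? w h

    outgoing? : ∀ h → Dec (Outgoing h)
    outgoing? h = w h ℤ.≤? + 0

    -- the edge of h can be traversed from the vertex of h to the other
    -- endpoint (2-way, or 1-way with its ingoing half-edge at the far end)
    Traversable : HalfEdge → Set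
    Traversable h = Ingoing (α′ h)

    vertexWeight : HalfEdge → ℤ
    vertexWeight h =
      sumℤ (λ g → if ⌊ sameVertex? h g ⌋ then (if ⌊ ingoing? g ⌋ then w g else + 0) else + 0)

    -- weight of the face of corner h: sum of weights of outgoing
    -- half-edges g having that face on their right (face of α g)
    faceWeight : HalfEdge → ℤ
    faceWeight h =
      sumℤ (λ g → if ⌊ sameFace? h (α′ g) ⌋ then (if ⌊ outgoing? g ⌋ then w g else + 0) else + 0)

    edgeWeight : HalfEdge → ℤ
    edgeWeight h = w h ℤ.+ w (α′ h)

    AccStep : HalfEdge → HalfEdge → Set
    AccStep x y = (y ≡ σ′ x) ⊎ (Traversable x × y ≡ α′ x)

    AccessibleFrom : HalfEdge → Set
    AccessibleFrom h0 = ∀ g → Star AccStep h0 g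

    -- counterclockwise circuits: a simple cycle hs traversable along each
    -- hs i, whose left faces (faces of hs i) lie in the interior of the
    -- cycle, i.e. cannot be reached from the root face in the dual graph
    -- without crossing an edge of the cycle.
    module _ {m : ℕ} (hs : Fin (suc m) → HalfEdge) where
      OnCycle : HalfEdge → Set
      OnCycle x = ∃ λ i → (x ≡ hs i) ⊎ (x ≡ α′ (hs i))

      DualStep : HalfEdge → HalfEdge → Set
      DualStep x y = (y ≡ φ x) ⊎ ((¬ OnCycle x) × y ≡ α′ x)

      Interior : HalfEdge → Set
      Interior x = ¬ Star DualStep root x

    IsCCWCircuit : (m : ℕ) → (Fin (suc m) → HalfEdge) → Set
    IsCCWCircuit m hs =
      IsCycle m hs × (∀ i → Traversable (hs i) × Interior hs (hs i))

    Minimal : Set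
    Minimal = ∀ m hs → ¬ IsCCWCircuit m hs

    -- the contour of the root face is a simple cycle: its corners lie at
    -- pairwise distinct vertices and the edges it traverses (edge of σ g
    -- for each corner g of the root face) are pairwise distinct
    SimpleOuterContour : Set
    SimpleOuterContour =
      (∀ g g′ → InRootFace g → InRootFace g′ → SameVertex g g′ → g ≡ g′) ×
      (∀ g g′ → InRootFace g → InRootFace g′ → σ′ g ≡ α′ (σ′ g′) → ⊥)

    Admissible : Set
    Admissible =
      SimpleOuterContour ×
      (∀ h → OuterEdge h →
         (w h ≡ + 0 × w (α′ h) ≡ + 1) ⊎ (w h ≡ + 1 × w (α′ h) ≡ + 0)) ×
      (∀ h → ¬ OuterEdge h → OuterVertex h → Outgoing h)

    Suitable : Set
    Suitable = Minimal × Admissible × (∀ h → OuterVertex h → AccessibleFrom h)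

    IsDOrientation : ℕ → Set
    IsDOrientation d =
      Admissible ×
      (∀ h → Outgoing h → ℤ.- (+ 2) ℤ.≤ w h) ×
      (∀ h → ¬ OuterEdge h → edgeWeight h ≡ + d - + 2) ×
      (∀ h → ¬ OuterVertex h → vertexWeight h ≡ + d) ×
      (∀ h → ¬ InRootFace h → + faceDeg h ℤ.+ faceWeight h ≡ + d)

{-# OPTIONS --safe #-}

-- Let x and y be the positive and negative parts of w.  Conditions (i)-(iii) say that x and y form a
-- flow on the vertices, edges and faces of M: every inner face sends deg - d units to its edges, every
-- inner edge adds d - 2 units and passes everything on to its endpoints, and every inner vertex receives
-- d units; moreover no half-edge carries both x and y.
--
-- Planarity enters only through Euler's formula and linear algebra: in the derived map (whose faces are
-- the corners of M) gradients of node functions and curls of corner functions are orthogonal and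
-- together have full rank, hence cycles are boundaries and cocycles are gradients up to a scalar.
--
-- Counting inside a cycle shows that an orientation forces girth d.  Conversely, if the girth is d, a
-- count of the regions cut out by a subgraph gives the cut condition for the flow to exist (without the
-- requirement x y = 0).  Adding the curl of a corner function Q to a flow gives another one; taking for
-- Q the distance from the root, with the flow as lengths, every corner can be reached from the root by
-- moves that cross no flow.  Such a flooded flow satisfies x y = 0, and it is minimal and accessible.
-- Conversely every suitable orientation is flooded.  The difference of two flooded flows is the curl of
-- a corner function that is monotone along both floods, hence constant.

module Submission where

open import Defs
open import Data.Nat as ℕ using (ℕ; zero; suc)
import Data.Nat.Properties as ℕP
open import Data.Integer using (ℤ; +_; -[1+_]; _+_; _*_; -_; _-_; _≤_; _<_; _≤?_; _<?_; +≤+; +<+)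
import Data.Integer as ℤ
import Data.Integer.Properties as ℤP
open import Data.Integer.Tactic.RingSolver using (solve-∀)
open import Data.Fin using (Fin; zero; suc; toℕ; inject₁; fromℕ; fromℕ<; _↑ˡ_; _↑ʳ_; splitAt)
import Data.Fin.Properties as FinP
open import Data.Fin.Permutation using (_⟨$⟩ˡ_; inverseˡ; inverseʳ)
open import Data.Bool using (Bool; true; false; if_then_else_; not; _∧_; _∨_)
open import Data.Bool.Properties using (∧-assoc; ∧-comm; ∧-identityʳ; ∧-zeroʳ) renaming (_≟_ to _≟ᵇ_)
open import Data.List using (List; []; _∷_; length; _++_)
import Data.List.Properties as ListP
open import Data.List.Relation.Unary.All using (All; []; _∷_)
open import Data.Product using (∃; _×_; _,_; proj₁; proj₂)
open import Data.Sum using (_⊎_; inj₁; inj₂; [_,_]′)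
open import Data.Empty using (⊥; ⊥-elim)
open import Function.Base using (_∘_)
open import Function.Bundles using (_⇔_; mk⇔)
open import Relation.Nullary using (¬_; Dec; yes; no)
open import Relation.Nullary.Decidable using (⌊_⌋; _×-dec_; _⊎-dec_; ¬?)
open import Relation.Binary.PropositionalEquality using (_≡_; _≢_; refl; sym; trans; cong; cong₂; subst; subst₂; module ≡-Reasoning)
open import Relation.Binary.Definitions using (tri<; tri≈; tri>)
open import Relation.Binary.Construct.Closure.ReflexiveTransitive using (Star; ε; _◅_; _◅◅_)

-- Booleans, masks and finite sums

-- Permutations of half-edges carry no topology, so planarity arguments rest on two facts:
-- orthogonal families of integer functions meet only in zero, because a sum of squares vanishes
-- only termwise, and Euler's formula counts the unknowns of a linear system. Elimination over the
-- integers cannot divide, so potentials are obtained for a positive multiple of a chain; only their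
-- signs, maxima and constancy are used. The condition x y = 0 is not linear and cannot enter a cut
-- condition; nor is the bound -2 imposed. Distances provide the former: each corner has two moves
-- into it, crossing the parts x and y of the weight of one and the same half-edge, and a shortest
-- path enters by a move whose flow has become zero. The bound -2 is then a consequence of (i) and
-- (ii). For accessibility, and for the flooding of suitable orientations, the set that a search
-- fails to reach need not have a usable boundary. In both cases closed walks around the obstruction
-- are added up, and the part of that set where the potential of the sum is maximal has the boundary
-- that gives the contradiction.

Mask : ℕ → Set
Mask n = Fin n → Bool

module _ {A : Set} where

  ⌊⌋-true⁺ : (d : Dec A) → A → ⌊ d ⌋ ≡ true
  ⌊⌋-true⁺ (yes _) _ = refl
  ⌊⌋-true⁺ (no ¬a) a = ⊥-elim (¬a a)

  ⌊⌋-true⁻ : (d : Dec A) → ⌊ d ⌋ ≡ true → A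
  ⌊⌋-true⁻ (yes a) _ = a

  ⌊⌋-false⁺ : (d : Dec A) → ¬ A → ⌊ d ⌋ ≡ false
  ⌊⌋-false⁺ (yes a) ¬a = ⊥-elim (¬a a)
  ⌊⌋-false⁺ (no _) _ = refl

  ⌊⌋-false⁻ : (d : Dec A) → ⌊ d ⌋ ≡ false → ¬ A
  ⌊⌋-false⁻ (no ¬a) _ = ¬a

⌊⌋-cong : {A B : Set} (d : Dec A) (e : Dec B) → (A → B) → (B → A) → ⌊ d ⌋ ≡ ⌊ e ⌋
⌊⌋-cong (yes a) e f g = sym (⌊⌋-true⁺ e (f a))
⌊⌋-cong (no ¬a) e f g = sym (⌊⌋-false⁺ e (λ b → ¬a (g b)))

true≢false : ∀ {b} → b ≡ true → b ≡ false → ⊥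
true≢false refl ()

true? : ∀ b → (b ≡ true) ⊎ (b ≡ false)
true? true  = inj₁ refl
true? false = inj₂ refl

not-true : ∀ {b} → ¬ (b ≡ true) → b ≡ false
not-true {true}  h = ⊥-elim (h refl)
not-true {false} _ = refl

not-false : ∀ {b} → ¬ (b ≡ false) → b ≡ true
not-false {true}  _ = refl
not-false {false} h = ⊥-elim (h refl)

bool-ext : ∀ {a b} → (a ≡ true → b ≡ true) → (b ≡ true → a ≡ true) → a ≡ b
bool-ext {true}  {b}     f _ = sym (f refl)
bool-ext {false} {true}  _ g = g refl
bool-ext {false} {false} _ _ = refl

∧-true⁻ : ∀ {a b} → a ∧ b ≡ true → (a ≡ true) × (b ≡ true)
∧-true⁻ {true} e = refl , e

∧-true⁺ : ∀ {a b} → a ≡ true → b ≡ true → a ∧ b ≡ true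
∧-true⁺ refl e = e

∨-true⁻ : ∀ {a b} → a ∨ b ≡ true → (a ≡ true) ⊎ (b ≡ true)
∨-true⁻ {true}  _ = inj₁ refl
∨-true⁻ {false} e = inj₂ e

∨-trueˡ : ∀ {a b} → a ≡ true → a ∨ b ≡ true
∨-trueˡ refl = refl

∨-trueʳ : ∀ {a b} → b ≡ true → a ∨ b ≡ true
∨-trueʳ {true}  _ = refl
∨-trueʳ {false} e = e

not-true⁻ : ∀ {a} → not a ≡ true → a ≡ false
not-true⁻ {false} _ = refl

not-true⁺ : ∀ {a} → a ≡ false → not a ≡ true
not-true⁺ refl = refl

𝟙 : Bool → ℤ
𝟙 true  = + 1
𝟙 false = + 0

0≤𝟙 : ∀ b → + 0 ≤ 𝟙 b
0≤𝟙 true  = +≤+ ℕ.z≤n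
0≤𝟙 false = +≤+ ℕ.z≤n

𝟙-mono : ∀ {x y} → (x ≡ true → y ≡ true) → 𝟙 x ≤ 𝟙 y
𝟙-mono {true}      h rewrite h refl = ℤP.≤-refl
𝟙-mono {false} {y} h = 0≤𝟙 y

𝟙*-cong : ∀ b {u v : ℤ} → (b ≡ true → u ≡ v) → 𝟙 b * u ≡ 𝟙 b * v
𝟙*-cong true  h = cong (+ 1 *_) (h refl)
𝟙*-cong false {u} {v} h = trans (ℤP.*-zeroˡ u) (sym (ℤP.*-zeroˡ v))

𝟙-∧ : ∀ x y → 𝟙 (x ∧ y) ≡ 𝟙 x * 𝟙 y
𝟙-∧ true  y = sym (ℤP.*-identityˡ (𝟙 y))
𝟙-∧ false y = sym (ℤP.*-zeroˡ (𝟙 y))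

𝟙-not : ∀ b → 𝟙 (not b) ≡ + 1 - 𝟙 b
𝟙-not true  = refl
𝟙-not false = refl

if-𝟙 : ∀ b (v : ℤ) → (if b then v else + 0) ≡ 𝟙 b * v
if-𝟙 true  v = sym (ℤP.*-identityˡ v)
if-𝟙 false v = sym (ℤP.*-zeroˡ v)

≤-by : ∀ {a b} e → + 0 ≤ e → b ≡ a + e → a ≤ b
≤-by {a} e 0≤e refl = subst (_≤ a + e) (ℤP.+-identityʳ a) (ℤP.+-monoʳ-≤ a 0≤e)

0≤+ : ∀ {a b} → + 0 ≤ a → + 0 ≤ b → + 0 ≤ a + b
0≤+ = ℤP.+-mono-≤

0≤- : ∀ {a b} → a ≤ b → + 0 ≤ b - a
0≤- = ℤP.i≤j⇒0≤j-i

0≤* : ∀ {a b} → + 0 ≤ a → + 0 ≤ b → + 0 ≤ a * b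
0≤* {+ a} {+ b} _ _ = subst (+ 0 ≤_) (ℤP.pos-* a b) (+≤+ ℕ.z≤n)
0≤* {+ _} { -[1+ _ ] } _ ()
0≤* { -[1+ _ ] } ()

0≤k* : ∀ k {x} → + 0 ≤ x → + 0 ≤ + k * x
0≤k* k = 0≤* {+ k} (+≤+ ℕ.z≤n)

0≤-square : ∀ a → + 0 ≤ a * a
0≤-square (+ a) = 0≤* {+ a} {+ a} (+≤+ ℕ.z≤n) (+≤+ ℕ.z≤n)
0≤-square -[1+ a ] = +≤+ ℕ.z≤n

square≡0 : ∀ a → a * a ≡ + 0 → a ≡ + 0
square≡0 a e = [ (λ z → z) , (λ z → z) ]′ (ℤP.i*j≡0⇒i≡0∨j≡0 a e)

<⇒1+≤ : ∀ {a b} → a < b → a + + 1 ≤ b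
<⇒1+≤ {a} a<b = subst (_≤ _) (ℤP.+-comm (+ 1) a) (ℤP.i<j⇒suc[i]≤j a<b)

1+≤⇒< : ∀ {a b} → a + + 1 ≤ b → a < b
1+≤⇒< {a} p = ℤP.suc[i]≤j⇒i<j (subst (_≤ _) (ℤP.+-comm a (+ 1)) p)

+1-cancel-≤ : ∀ a b → a + + 1 ≤ b + + 1 → a ≤ b
+1-cancel-≤ a b p = ≤-by ((b + + 1) - (a + + 1)) (0≤- p) (lemma a b)
  where
    lemma : ∀ a b → b ≡ a + ((b + + 1) - (a + + 1))
    lemma = solve-∀

≤-cases : ∀ a b → (a ≤ b) ⊎ (b < a)
≤-cases a b with a ≤? b
... | yes p = inj₁ p
... | no ¬p = inj₂ (ℤP.≰⇒> ¬p)

≤<-absurd : ∀ {a b} → a ≤ b → b < a → ⊥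
≤<-absurd p q = ℤP.<-irrefl refl (ℤP.≤-<-trans p q)

nat-≤-or-< : ∀ a → + 0 ≤ a → (a ≡ + 0) ⊎ (+ 0 < a)
nat-≤-or-< (+ zero)  _ = inj₁ refl
nat-≤-or-< (+ suc k) _ = inj₂ (+<+ (ℕ.s≤s ℕ.z≤n))

a-b≡0⇒a≡b : ∀ {a b} → a - b ≡ + 0 → a ≡ b
a-b≡0⇒a≡b {a} {b} = ℤP.i-j≡0⇒i≡j a b

module _ where

  private
    assoc₄ : ∀ a b c d → (a + b) + (c + d) ≡ (a + c) + (b + d)
    assoc₄ = solve-∀

  sum-cong : ∀ {n} {f g : Fin n → ℤ} → (∀ i → f i ≡ g i) → sumℤ f ≡ sumℤ g
  sum-cong {zero}  e = refl
  sum-cong {suc n} e = cong₂ _+_ (e zero) (sum-cong (λ i → e (suc i)))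

  sum-0 : ∀ {n} → sumℤ {n} (λ _ → + 0) ≡ + 0
  sum-0 {zero}  = refl
  sum-0 {suc n} = trans (ℤP.+-identityˡ _) (sum-0 {n})

  sum-zero : ∀ {n} {f : Fin n → ℤ} → (∀ i → f i ≡ + 0) → sumℤ f ≡ + 0
  sum-zero {n} e = trans (sum-cong e) (sum-0 {n})

  sum-+ : ∀ {n} (f g : Fin n → ℤ) → sumℤ (λ i → f i + g i) ≡ sumℤ f + sumℤ g
  sum-+ {zero}  f g = refl
  sum-+ {suc n} f g = trans (cong (_+_ ((f zero + g zero))) (sum-+ (f ∘ suc) (g ∘ suc)))
    (assoc₄ (f zero) (g zero) (sumℤ (f ∘ suc)) (sumℤ (g ∘ suc)))

  sum-* : ∀ {n} c (f : Fin n → ℤ) → sumℤ (λ i → c * f i) ≡ c * sumℤ f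
  sum-* {zero}  c f = sym (ℤP.*-zeroʳ c)
  sum-* {suc n} c f = trans (cong (_+_ (c * f zero)) (sum-* c (f ∘ suc)))
    (sym (ℤP.*-distribˡ-+ c (f zero) _))

  sum-neg : ∀ {n} (f : Fin n → ℤ) → sumℤ (λ i → - f i) ≡ - sumℤ f
  sum-neg {zero}  f = refl
  sum-neg {suc n} f = trans (cong (_+_ (- f zero)) (sum-neg (f ∘ suc))) (sym (ℤP.neg-distrib-+ (f zero) _))

  sum-sub : ∀ {n} (f g : Fin n → ℤ) → sumℤ (λ i → f i - g i) ≡ sumℤ f - sumℤ g
  sum-sub f g = trans (sum-+ f (λ i → - g i)) (cong (_+_ (sumℤ f)) (sum-neg g))

  sum-swap : ∀ {m n} (f : Fin m → Fin n → ℤ) →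
    sumℤ (λ i → sumℤ (f i)) ≡ sumℤ (λ j → sumℤ (λ i → f i j))
  sum-swap {zero} {n} f = sym (sum-0 {n})
  sum-swap {suc m} f = trans (cong (_+_ (sumℤ (f zero))) (sum-swap (f ∘ suc)))
    (sym (sum-+ (f zero) (λ j → sumℤ (λ i → f (suc i) j))))

  sum-mono : ∀ {n} {f g : Fin n → ℤ} → (∀ i → f i ≤ g i) → sumℤ f ≤ sumℤ g
  sum-mono {zero}  e = ℤP.≤-refl
  sum-mono {suc n} e = ℤP.+-mono-≤ (e zero) (sum-mono (e ∘ suc))

  sum-nonneg : ∀ {n} {f : Fin n → ℤ} → (∀ i → + 0 ≤ f i) → + 0 ≤ sumℤ f
  sum-nonneg {n} {f} e = subst (_≤ sumℤ f) (sum-0 {n}) (sum-mono e)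

  sum-nonneg-term : ∀ {n} {f : Fin n → ℤ} → (∀ i → + 0 ≤ f i) → ∀ i → f i ≤ sumℤ f
  sum-nonneg-term {suc n} {f} e zero =
    subst (_≤ f zero + sumℤ (f ∘ suc)) (ℤP.+-identityʳ _) (ℤP.+-monoʳ-≤ (f zero) (sum-nonneg (e ∘ suc)))
  sum-nonneg-term {suc n} {f} e (suc i) =
    subst (_≤ f zero + sumℤ (f ∘ suc)) (ℤP.+-identityˡ _)
      (ℤP.+-mono-≤ (e zero) (sum-nonneg-term (e ∘ suc) i))

  sum-nonneg-zero : ∀ {n} {f : Fin n → ℤ} → (∀ i → + 0 ≤ f i) → sumℤ f ≡ + 0 → ∀ i → f i ≡ + 0
  sum-nonneg-zero e s i = ℤP.≤-antisym (subst (_ ≤_) s (sum-nonneg-term e i)) (e i)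

δ : ∀ {n} → Fin n → Fin n → ℤ
δ i j = 𝟙 ⌊ i FinP.≟ j ⌋

δ-refl : ∀ {n} (i : Fin n) → δ i i ≡ + 1
δ-refl i = cong 𝟙 (⌊⌋-true⁺ (i FinP.≟ i) refl)

δ-≢ : ∀ {n} {i j : Fin n} → i ≢ j → δ i j ≡ + 0
δ-≢ {i = i} {j} p = cong 𝟙 (⌊⌋-false⁺ (i FinP.≟ j) p)

0≤δ : ∀ {n} (i j : Fin n) → + 0 ≤ δ i j
0≤δ i j = 0≤𝟙 ⌊ i FinP.≟ j ⌋

δ-iff : ∀ {m n} {i j : Fin m} {k l : Fin n} → (i ≡ j → k ≡ l) → (k ≡ l → i ≡ j) → δ i j ≡ δ k l
δ-iff {i = i} {j} {k} {l} f g = cong 𝟙 (⌊⌋-cong (i FinP.≟ j) (k FinP.≟ l) f g)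

sum-single : ∀ {n} (i : Fin n) (f : Fin n → ℤ) → (∀ j → j ≢ i → f j ≡ + 0) → sumℤ f ≡ f i
sum-single {suc n} zero f e =
  trans (cong (_+_ (f zero)) (sum-zero (λ j → e (suc j) (λ ())))) (ℤP.+-identityʳ _)
sum-single {suc n} (suc i) f e =
  trans (cong₂ _+_ (e zero (λ ())) (sum-single i (f ∘ suc) (λ j p → e (suc j) (p ∘ FinP.suc-injective))))
        (ℤP.+-identityˡ _)

sum-δ : ∀ {n} (i : Fin n) (f : Fin n → ℤ) → sumℤ (λ j → δ i j * f j) ≡ f i
sum-δ i f = trans (sum-single i (λ j → δ i j * f j) (λ j p → trans (cong (_* f j) (δ-≢ (p ∘ sym))) (ℤP.*-zeroˡ (f j))))
  (trans (cong (_* f i) (δ-refl i)) (ℤP.*-identityˡ (f i)))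

-- Writing `f (π i)` as a sum against `δ` and exchanging the sums reduces reindexing to
-- `δ (π i) j ≡ δ (π⁻ j) i`.
sum-perm : ∀ {n} (π π⁻ : Fin n → Fin n) → (∀ x → π (π⁻ x) ≡ x) → (∀ x → π⁻ (π x) ≡ x) →
  (f : Fin n → ℤ) → sumℤ (λ i → f (π i)) ≡ sumℤ f
sum-perm π π⁻ ππ⁻ π⁻π f = begin
  sumℤ (λ i → f (π i))                       ≡⟨ sum-cong (λ i → sym (sum-δ (π i) f)) ⟩
  sumℤ (λ i → sumℤ (λ j → δ (π i) j * f j))  ≡⟨ sum-swap (λ i j → δ (π i) j * f j) ⟩
  sumℤ (λ j → sumℤ (λ i → δ (π i) j * f j))  ≡⟨ sum-cong (λ j → sum-cong (λ i → cong (_* f j) (move i j))) ⟩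
  sumℤ (λ j → sumℤ (λ i → δ (π⁻ j) i * f j)) ≡⟨ sum-cong (λ j → sum-δ (π⁻ j) (λ _ → f j)) ⟩
  sumℤ f ∎
  where
    open ≡-Reasoning
    move : ∀ i j → δ (π i) j ≡ δ (π⁻ j) i
    move i j = δ-iff (λ p → trans (cong π⁻ (sym p)) (π⁻π i)) (λ p → trans (cong π (sym p)) (ππ⁻ j))

# : ∀ {n} → Mask n → ℤ
# p = sumℤ (λ i → 𝟙 (p i))

count≡# : ∀ {n} (p : Mask n) → + count p ≡ # p
count≡# {zero}  p = refl
count≡# {suc n} p with p zero
... | true  = trans (ℤP.pos-+ 1 (count (p ∘ suc))) (cong (_+_ (+ 1)) (count≡# (p ∘ suc)))
... | false = trans (count≡# (p ∘ suc)) (sym (ℤP.+-identityˡ _))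

#-all : ∀ {n} → sumℤ {n} (λ _ → + 1) ≡ + n
#-all {zero}  = refl
#-all {suc n} = trans (cong (_+_ (+ 1)) (#-all {n})) (sym (ℤP.pos-+ 1 n))

#-not : ∀ {n} (p : Mask n) → # (not ∘ p) ≡ + n - # p
#-not {n} p = trans (sum-cong (λ i → 𝟙-not (p i)))
  (trans (sum-sub (λ _ → + 1) (λ i → 𝟙 (p i))) (cong (_- # p) (#-all {n})))

argmax : ∀ {n} (R : Mask n) (p : Fin n → ℤ) {x₀ : Fin n} → R x₀ ≡ true →
  ∃ λ x → (R x ≡ true) × (∀ y → R y ≡ true → p y ≤ p x)
argmax {suc n} R p {x₀} r with FinP.any? (λ i → R (suc i) ≟ᵇ true)
argmax {suc n} R p {zero}   r | no ¬e = zero , r , λ where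
  zero _ → ℤP.≤-refl
  (suc y) ry → ⊥-elim (¬e (y , ry))
argmax {suc n} R p {suc x₀} r | no ¬e = ⊥-elim (¬e (x₀ , r))
argmax {suc n} R p {x₀}     r | yes (i , ri)
  with argmax (R ∘ suc) (p ∘ suc) ri | true? (R zero)
... | x , rx , mx | inj₂ r0 = suc x , rx , λ where
  zero ry → ⊥-elim (true≢false ry r0)
  (suc y) ry → mx y ry
... | x , rx , mx | inj₁ r0 with ≤-cases (p (suc x)) (p zero)
...   | inj₁ q = zero , r0 , λ where
  zero _ → ℤP.≤-refl
  (suc y) ry → ℤP.≤-trans (mx y ry) q
...   | inj₂ q = suc x , rx , λ where
  zero _ → ℤP.<⇒≤ q
  (suc y) ry → mx y ry

-- Equivalence classes and orbits

module Classes {n : ℕ} (_~_ : Fin n → Fin n → Set) (_~?_ : ∀ x y → Dec (x ~ y))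
  (~-refl : ∀ x → x ~ x) (~-sym : ∀ {x y} → x ~ y → y ~ x)
  (~-trans : ∀ {x y z} → x ~ y → y ~ z → x ~ z) where

  -- Classes are represented by their members of least index because `numOrbits` counts orbits in
  -- this way.
  Least : Fin n → Set
  Least r = ∀ g → r ~ g → toℕ r ℕ.≤ toℕ g

  least? : ∀ r → Dec (Least r)
  least? r with FinP.all? (λ g → ¬? (r ~? g) ⊎-dec (toℕ r ℕ.≤? toℕ g))
  ... | yes p = yes λ g r~g → [ (λ ¬q → ⊥-elim (¬q r~g)) , (λ q → q) ]′ (p g)
  ... | no ¬p = no λ l → ¬p λ g → help l g (r ~? g)
    where
      help : Least r → ∀ g → Dec (r ~ g) → ¬ (r ~ g) ⊎ (toℕ r ℕ.≤ toℕ g)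
      help l g (yes q) = inj₂ (l g q)
      help l g (no ¬q) = inj₁ ¬q

  least : Mask n
  least r = ⌊ least? r ⌋

  [_~_] : Fin n → Fin n → ℤ
  [ x ~ y ] = 𝟙 ⌊ x ~? y ⌋

  []-cong : ∀ {x y u v} → (x ~ y → u ~ v) → (u ~ v → x ~ y) → [ x ~ y ] ≡ [ u ~ v ]
  []-cong {x} {y} {u} {v} f g = cong 𝟙 (⌊⌋-cong (x ~? y) (u ~? v) f g)

  []-yes : ∀ {x y} → x ~ y → [ x ~ y ] ≡ + 1
  []-yes {x} {y} p = cong 𝟙 (⌊⌋-true⁺ (x ~? y) p)

  []-no : ∀ {x y} → ¬ (x ~ y) → [ x ~ y ] ≡ + 0
  []-no {x} {y} p = cong 𝟙 (⌊⌋-false⁺ (x ~? y) p)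

  rep-of : ∀ x → ∃ λ r → Least r × r ~ x
  rep-of x with argmax (λ g → ⌊ x ~? g ⌋) (λ g → - (+ toℕ g)) {x} (⌊⌋-true⁺ (x ~? x) (~-refl x))
  ... | r , m , mx = r , (λ g r~g → ℤP.drop‿+≤+ (ℤP.neg-cancel-≤ (mx g (⌊⌋-true⁺ (x ~? g) (~-trans x~r r~g))))) , ~-sym x~r
    where
      x~r : x ~ r
      x~r = ⌊⌋-true⁻ (x ~? r) m

  rep : Fin n → Fin n
  rep x = proj₁ (rep-of x)

  rep-least : ∀ x → Least (rep x)
  rep-least x = proj₁ (proj₂ (rep-of x))

  rep-~ : ∀ x → rep x ~ x
  rep-~ x = proj₂ (proj₂ (rep-of x))

  least-unique : ∀ {r s} → Least r → Least s → r ~ s → r ≡ s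
  least-unique lr ls p = FinP.toℕ-injective (ℕP.≤-antisym (lr _ p) (ls _ (~-sym p)))

  rep-cong : ∀ {x y} → x ~ y → rep x ≡ rep y
  rep-cong {x} {y} p = least-unique (rep-least x) (rep-least y)
    (~-trans (rep-~ x) (~-trans p (~-sym (rep-~ y))))

  rep-fix : ∀ {r} → Least r → rep r ≡ r
  rep-fix {r} l = least-unique (rep-least r) l (rep-~ r)

  one-rep : ∀ g → sumℤ (λ r → 𝟙 (least r) * [ r ~ g ]) ≡ + 1
  one-rep g = trans (sum-single (rep g) _ other)
    (cong₂ _*_ (cong 𝟙 (⌊⌋-true⁺ (least? (rep g)) (rep-least g))) ([]-yes (rep-~ g)))
    where
      other : ∀ r → r ≢ rep g → 𝟙 (least r) * [ r ~ g ] ≡ + 0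
      other r r≢ with least? r | r ~? g
      ... | yes l | yes p = ⊥-elim (r≢ (least-unique l (rep-least g) (~-trans p (~-sym (rep-~ g)))))
      ... | yes l | no _  = refl
      ... | no _  | yes _ = refl
      ... | no _  | no _  = refl

  one-rep-sym : ∀ g → sumℤ (λ r → [ g ~ r ] * 𝟙 (least r)) ≡ + 1
  one-rep-sym g = trans (sum-cong (λ r → trans (ℤP.*-comm [ g ~ r ] (𝟙 (least r))) (cong (𝟙 (least r) *_)
    ([]-cong {g} {r} {r} {g} ~-sym ~-sym)))) (one-rep g)

  class-sum : (Fin n → ℤ) → Fin n → ℤ
  class-sum F r = sumℤ (λ g → [ r ~ g ] * F g)

  -- Each `g` has exactly one least representative (`one-rep`); inserting this 1 and exchanging the
  -- sums groups the terms by class.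
  sum-by-class : ∀ F → sumℤ F ≡ sumℤ (λ r → 𝟙 (least r) * class-sum F r)
  sum-by-class F = begin
    sumℤ F                                                       ≡⟨ sum-cong (λ g → sym (expand g)) ⟩
    sumℤ (λ g → sumℤ (λ r → F g * (𝟙 (least r) * [ r ~ g ])))    ≡⟨ sum-swap (λ g r → F g * (𝟙 (least r) * [ r ~ g ])) ⟩
    sumℤ (λ r → sumℤ (λ g → F g * (𝟙 (least r) * [ r ~ g ])))    ≡⟨ sum-cong (λ r → sum-cong (λ g → shuffle (F g)
      (𝟙 (least r)) [ r ~ g ])) ⟩
    sumℤ (λ r → sumℤ (λ g → 𝟙 (least r) * ([ r ~ g ] * F g)))    ≡⟨ sum-cong (λ r → sum-* (𝟙 (least r)) (λ g → [ r ~ g ] * F g)) ⟩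
    sumℤ (λ r → 𝟙 (least r) * class-sum F r) ∎
    where
      open ≡-Reasoning
      expand : ∀ g → sumℤ (λ r → F g * (𝟙 (least r) * [ r ~ g ])) ≡ F g
      expand g = trans (sum-* (F g) (λ r → 𝟙 (least r) * [ r ~ g ])) (trans (cong (F g *_) (one-rep g)) (ℤP.*-identityʳ (F g)))
      shuffle : ∀ a b c → a * (b * c) ≡ b * (c * a)
      shuffle = solve-∀

  class-sum-≡ : ∀ {F G} r → (∀ g → r ~ g → F g ≡ G g) → class-sum F r ≡ class-sum G r
  class-sum-≡ {F} {G} r e = sum-cong (λ g → help g (r ~? g))
    where
      help : ∀ g (d : Dec (r ~ g)) → 𝟙 ⌊ d ⌋ * F g ≡ 𝟙 ⌊ d ⌋ * G g
      help g (yes p) = cong (+ 1 *_) (e g p)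
      help g (no _)  = trans (ℤP.*-zeroˡ (F g)) (sym (ℤP.*-zeroˡ (G g)))

  class-sum-zero : ∀ {F} r → (∀ g → r ~ g → F g ≡ + 0) → class-sum F r ≡ + 0
  class-sum-zero {F} r e = trans (class-sum-≡ {F} {λ _ → + 0} r e) (sum-zero (λ g → ℤP.*-zeroʳ [ r ~ g ]))

  class-sum-+ : ∀ F G r → class-sum (λ g → F g + G g) r ≡ class-sum F r + class-sum G r
  class-sum-+ F G r = trans (sum-cong (λ g → ℤP.*-distribˡ-+ [ r ~ g ] (F g) (G g))) (sum-+ (λ g → [ r ~ g ] * F g) (λ g → [ r ~ g ] * G g))

  class-sum-neg : ∀ F r → class-sum (λ g → - F g) r ≡ - class-sum F r
  class-sum-neg F r = trans (sum-cong (λ g → sym (ℤP.neg-distribʳ-* [ r ~ g ] (F g)))) (sum-neg (λ g → [ r ~ g ] * F g))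

  class-sum-scale : ∀ (t F : Fin n → ℤ) → (∀ {x y} → x ~ y → t x ≡ t y) → ∀ r →
    class-sum (λ g → t g * F g) r ≡ t r * class-sum F r
  class-sum-scale t F inv r = trans (sum-cong term) (sum-* (t r) (λ g → [ r ~ g ] * F g))
    where
      shuffle : ∀ a b c → a * (b * c) ≡ b * (a * c)
      shuffle = solve-∀
      term : ∀ g → [ r ~ g ] * (t g * F g) ≡ t r * ([ r ~ g ] * F g)
      term g with r ~? g
      ... | yes p = trans (shuffle (+ 1) (t g) (F g)) (cong (_* (+ 1 * F g)) (sym (inv p)))
      ... | no _  = trans (ℤP.*-zeroˡ (t g * F g)) (sym (trans (cong (t r *_) (ℤP.*-zeroˡ (F g))) (ℤP.*-zeroʳ (t r))))

  weighted-by-class : ∀ (t F : Fin n → ℤ) → (∀ {x y} → x ~ y → t x ≡ t y) →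
    sumℤ (λ g → t g * F g) ≡ sumℤ (λ r → 𝟙 (least r) * (t r * class-sum F r))
  weighted-by-class t F inv = trans (sum-by-class (λ g → t g * F g))
    (sum-cong (λ r → cong (𝟙 (least r) *_) (class-sum-scale t F inv r)))

iter-+ : ∀ {n} (f : Fin n → Fin n) a b x → iter f (a ℕ.+ b) x ≡ iter f a (iter f b x)
iter-+ f zero    b x = refl
iter-+ f (suc a) b x = cong f (iter-+ f a b x)

module Orbits {n : ℕ} (f f⁻ : Fin n → Fin n)
  (ff⁻ : ∀ x → f (f⁻ x) ≡ x) (f⁻f : ∀ x → f⁻ (f x) ≡ x) where

  f-injective : ∀ {x y} → f x ≡ f y → x ≡ y
  f-injective {x} {y} p = trans (sym (f⁻f x)) (trans (cong f⁻ p) (f⁻f y))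

  iter-injective : ∀ k {x y} → iter f k x ≡ iter f k y → x ≡ y
  iter-injective zero    p = p
  iter-injective (suc k) p = iter-injective k (f-injective p)

  -- Two of the first `n + 1` iterates coincide, and injectivity cancels the smaller exponent.
  period : ∀ x → ∃ λ p → (suc p ℕ.≤ n) × (iter f (suc p) x ≡ x)
  period x with FinP.pigeonhole ℕP.≤-refl (λ (i : Fin (suc n)) → iter f (toℕ i) x)
  ... | i , j , i<j , e = toℕ j ℕ.∸ suc (toℕ i) , bound , iter-injective (toℕ i) (trans back (sym e))
    where
      open ≡-Reasoning
      sum≡ : suc (toℕ j ℕ.∸ suc (toℕ i)) ℕ.+ toℕ i ≡ toℕ j
      sum≡ = trans (sym (ℕP.+-suc (toℕ j ℕ.∸ suc (toℕ i)) (toℕ i))) (ℕP.m∸n+n≡m i<j)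
      bound : suc (toℕ j ℕ.∸ suc (toℕ i)) ℕ.≤ n
      bound = ℕP.≤-trans (ℕP.m≤m+n _ (toℕ i)) (subst (ℕ._≤ n) (sym sum≡) (ℕP.≤-pred (FinP.toℕ<n j)))
      back : iter f (toℕ i) (iter f (suc (toℕ j ℕ.∸ suc (toℕ i))) x) ≡ iter f (toℕ j) x
      back = begin
        iter f (toℕ i) (iter f (suc (toℕ j ℕ.∸ suc (toℕ i))) x) ≡⟨ sym (iter-+ f (toℕ i) _ x) ⟩
        iter f (toℕ i ℕ.+ suc (toℕ j ℕ.∸ suc (toℕ i))) x         ≡⟨ cong (λ k → iter f k x) (trans (ℕP.+-comm (toℕ i) _) sum≡) ⟩
        iter f (toℕ j) x ∎

  _~_ : Fin n → Fin n → Set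
  _~_ = SameOrbit f

  -- `SameOrbit` admits only exponents below `n`. When the next exponent equals `n`, a period, which
  -- is at most `n`, is subtracted from it.
  ~-next : ∀ {x y} → x ~ y → x ~ f y
  ~-next {x} (k , refl) with suc (toℕ k) ℕP.<? n
  ... | yes q = fromℕ< q , cong (λ j → iter f j x) (FinP.toℕ-fromℕ< q)
  ... | no ¬q with period x
  ...   | p , p≤n , e = fromℕ< small , trans (cong (λ j → iter f j x) (FinP.toℕ-fromℕ< small)) (sym wrap)
    where
      open ≡-Reasoning
      k≡ : suc (toℕ k) ≡ n
      k≡ = ℕP.≤-antisym (FinP.toℕ<n k) (ℕP.≮⇒≥ ¬q)
      p≤k : p ℕ.≤ toℕ k
      p≤k = ℕP.≤-pred (subst (suc p ℕ.≤_) (sym k≡) p≤n)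
      small : toℕ k ℕ.∸ p ℕ.< n
      small = ℕP.≤-<-trans (ℕP.m∸n≤m (toℕ k) p) (FinP.toℕ<n k)
      wrap : iter f (suc (toℕ k)) x ≡ iter f (toℕ k ℕ.∸ p) x
      wrap = begin
        iter f (suc (toℕ k)) x                          ≡⟨ cong (λ j → iter f (suc j) x) (sym (ℕP.m∸n+n≡m p≤k)) ⟩
        iter f (suc (toℕ k ℕ.∸ p ℕ.+ p)) x              ≡⟨ cong (λ j → iter f j x) (sym (ℕP.+-suc (toℕ k ℕ.∸ p) p)) ⟩
        iter f (toℕ k ℕ.∸ p ℕ.+ suc p) x                ≡⟨ iter-+ f (toℕ k ℕ.∸ p) (suc p) x ⟩
        iter f (toℕ k ℕ.∸ p) (iter f (suc p) x)         ≡⟨ cong (iter f (toℕ k ℕ.∸ p)) e ⟩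
        iter f (toℕ k ℕ.∸ p) x ∎

  ~-refl : ∀ x → x ~ x
  ~-refl x = fromℕ< 0<n , cong (λ j → iter f j x) (FinP.toℕ-fromℕ< 0<n)
    where
      0<n : 0 ℕ.< n
      0<n = ℕP.≤-<-trans ℕ.z≤n (FinP.toℕ<n x)

  ~-iter : ∀ k x → x ~ iter f k x
  ~-iter zero    x = ~-refl x
  ~-iter (suc k) x = ~-next (~-iter k x)

  ~-trans : ∀ {x y z} → x ~ y → y ~ z → x ~ z
  ~-trans {x} (k , refl) (l , refl) = subst (x ~_) (iter-+ f (toℕ l) (toℕ k) x) (~-iter (toℕ l ℕ.+ toℕ k) x)

  ~-f : ∀ x → x ~ f x
  ~-f x = ~-next (~-refl x)

  ~-f⁻ : ∀ x → x ~ f⁻ x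
  ~-f⁻ x with period x
  ... | p , _ , e = subst (x ~_) (trans (sym (f⁻f _)) (cong f⁻ e)) (~-iter p x)

  ~-ind : (P : Fin n → Set) → (∀ x → P x → P (f x)) → ∀ {x y} → x ~ y → P x → P y
  ~-ind P c {x} (k , refl) p = go (toℕ k)
    where
      go : ∀ j → P (iter f j x)
      go zero    = p
      go (suc j) = c _ (go j)

  ~-sym : ∀ {x y} → x ~ y → y ~ x
  ~-sym {x} q = ~-ind (_~ x) (λ z z~x → ~-trans (subst (f z ~_) (f⁻f z) (~-f⁻ (f z))) z~x) q (~-refl x)

  open Classes _~_ (sameOrbit? f) ~-refl ~-sym ~-trans public

  ~-const : ∀ {A : Set} (t : Fin n → A) → (∀ x → t (f x) ≡ t x) → ∀ {x y} → x ~ y → t x ≡ t y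
  ~-const t inv {x} q = ~-ind (λ z → t x ≡ t z) (λ z e → trans e (sym (inv z))) q refl

  -- On a finite orbit `f⁻ x` is an iterate of `f` at `x`, so closure under `f` suffices.
  mask-inverse : (S : Mask n) → (∀ x → S x ≡ true → S (f x) ≡ true) → ∀ x → S x ≡ true → S (f⁻ x) ≡ true
  mask-inverse S c x = ~-ind (λ z → S z ≡ true) c (~-f⁻ x)

  mask-const : (S : Mask n) → (∀ x → S x ≡ true → S (f x) ≡ true) → ∀ x → S (f x) ≡ S x
  mask-const S c x = bool-ext (λ p → subst (λ z → S z ≡ true) (f⁻f x) (mask-inverse S c (f x) p)) (c x)

  numOrbits≡ : + numOrbits f ≡ # least
  numOrbits≡ = trans (count≡# (λ h → ⌊ isRep? f h ⌋)) (sum-cong λ h →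
    cong 𝟙 (⌊⌋-cong (isRep? f h) (least? h)
      (λ { r g (k , refl) → r k }) (λ l k → l _ (k , refl))))

  orbit-sum-const : ∀ (t F : Fin n → ℤ) → (∀ x → t (f x) ≡ t x) → (∀ r → class-sum F r ≡ + 0) →
    sumℤ (λ g → t g * F g) ≡ + 0
  orbit-sum-const t F inv z = trans (weighted-by-class t F (~-const t inv)) (sum-zero λ r →
    trans (cong (𝟙 (least r) *_) (trans (cong (t r *_) (z r)) (ℤP.*-zeroʳ (t r)))) (ℤP.*-zeroʳ (𝟙 (least r))))

  -- This turns a local condition, total `c` at each vertex or face of a region, into a count of the
  -- vertices or faces of the region.
  orbit-total : ∀ (N : Mask n) (X : Fin n → ℤ) c → (∀ h → N h ≡ true → N (f h) ≡ true) → (∀ r → N r ≡ true → class-sum X r ≡ c) →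
    sumℤ (λ h → 𝟙 (N h) * X h) ≡ c * # (λ h → least h ∧ N h)
  orbit-total N X c N-f cs = trans (weighted-by-class (𝟙 ∘ N) X (λ e → cong 𝟙 (~-const N (mask-const N N-f) e)))
    (trans (sum-cong (λ r → trans (cong (𝟙 (least r) *_) (𝟙*-cong (N r) (cs r)))
        (trans (pull (𝟙 (least r)) (𝟙 (N r)) c) (cong (c *_) (sym (𝟙-∧ (least r) (N r)))))))
      (sum-* c (λ r → 𝟙 (least r ∧ N r))))
    where
      pull : ∀ l t d → l * (t * d) ≡ d * (l * t)
      pull = solve-∀

  class-sum-shift : ∀ F r → class-sum (λ g → F (f g)) r ≡ class-sum F r
  class-sum-shift F r = trans (sum-cong λ g → cong (_* F (f g)) ([]-cong ~-next (λ q → ~-trans q (subst (f g ~_) (f⁻f g) (~-f⁻ (f g))))))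
    (sum-perm f f⁻ ff⁻ f⁻f (λ g → [ r ~ g ] * F g))

-- Reachable sets

insert : ∀ {n} → Fin n → Mask n → Mask n
insert y S z = ⌊ y FinP.≟ z ⌋ ∨ S z

insert-here : ∀ {n} (y : Fin n) S → insert y S y ≡ true
insert-here y S rewrite ⌊⌋-true⁺ (y FinP.≟ y) refl = refl

insert-there : ∀ {n} (y : Fin n) S {z} → S z ≡ true → insert y S z ≡ true
insert-there y S = ∨-trueʳ

insert⁻ : ∀ {n} (y : Fin n) S {z} → insert y S z ≡ true → (y ≡ z) ⊎ (S z ≡ true)
insert⁻ y S {z} p with ∨-true⁻ {⌊ y FinP.≟ z ⌋} p
... | inj₁ q = inj₁ (⌊⌋-true⁻ (y FinP.≟ z) q)
... | inj₂ q = inj₂ q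

count-insert : ∀ {n} (y : Fin n) S → S y ≡ false →
  count (not ∘ S) ≡ suc (count (not ∘ insert y S))
count-insert y S y∉ = ℤP.+-injective (begin
  + count (not ∘ S)                                   ≡⟨ count≡# (not ∘ S) ⟩
  # (not ∘ S)                                         ≡⟨ sum-cong term ⟩
  sumℤ (λ z → 𝟙 (not (insert y S z)) + δ y z * + 1)    ≡⟨ sum-+ (λ z → 𝟙 (not (insert y S z))) (λ z → δ y z * + 1) ⟩
  # (not ∘ insert y S) + sumℤ (λ z → δ y z * + 1)      ≡⟨ cong₂ _+_ (sym (count≡# (not ∘ insert y S))) (sum-δ y (λ _ → + 1)) ⟩
  + count (not ∘ insert y S) + + 1                     ≡⟨ ℤP.+-comm (+ count (not ∘ insert y S)) (+ 1) ⟩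
  + 1 + + count (not ∘ insert y S)                     ≡⟨ sym (ℤP.pos-+ 1 _) ⟩
  + suc (count (not ∘ insert y S)) ∎)
  where
    open ≡-Reasoning
    term : ∀ z → 𝟙 (not (S z)) ≡ 𝟙 (not (insert y S z)) + δ y z * + 1
    term z with y FinP.≟ z
    ... | yes refl rewrite y∉ = refl
    ... | no _ = sym (ℤP.+-identityʳ _)

module _ {n : ℕ} (Step : Fin n → Fin n → Set) (step? : ∀ x y → Dec (Step x y)) where

  Closed : Mask n → Set
  Closed S = ∀ x y → S x ≡ true → Step x y → S y ≡ true

  closed-star : ∀ {S} → Closed S → ∀ {x y} → Star Step x y → S x ≡ true → S y ≡ true
  closed-star c ε       p = p
  closed-star c (s ◅ r) p = closed-star c r (c _ _ p s)

  -- The invariant is a parameter because the closure has two uses: for reachable sets it records a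
  -- path to each member, for the augmentation of flows a way to move one unit to each member. The
  -- number of non-members bounds the recursion.
  grow : (Inv : Mask n → Set) →
    (∀ S x y → Inv S → S x ≡ true → S y ≡ false → Step x y → Inv (insert y S)) →
    ∀ S → Inv S → ∃ λ S′ → Inv S′ × (∀ x → S x ≡ true → S′ x ≡ true) × Closed S′
  grow Inv extend S₀ i₀ = go (count (not ∘ S₀)) S₀ ℕP.≤-refl i₀
    where
      go : ∀ k S → count (not ∘ S) ℕ.≤ k → Inv S →
        ∃ λ S′ → Inv S′ × (∀ x → S x ≡ true → S′ x ≡ true) × Closed S′
      go k S b i with FinP.any? (λ x → FinP.any? (λ y → (S x ≟ᵇ true) ×-dec (S y ≟ᵇ false) ×-dec step? x y))
      go k S b i | no ¬e = S , i , (λ _ p → p) ,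
        λ x y sx st → not-false (λ sy → ¬e (x , y , sx , sy , st))
      go zero S b i | yes (x , y , sx , sy , st) with subst (ℕ._≤ 0) (count-insert y S sy) b
      ... | ()
      go (suc k) S b i | yes (x , y , sx , sy , st)
        with go k (insert y S) (ℕP.≤-pred (subst (ℕ._≤ suc k) (count-insert y S sy) b)) (extend S x y i sx sy st)
      ... | S′ , i′ , sub , c = S′ , i′ , (λ z p → sub z (insert-there y S p)) , c

  reach-set : ∀ s → ∃ λ S → (S s ≡ true) × (∀ x → S x ≡ true → Star Step s x) × Closed S
  reach-set s with grow (λ S → ∀ x → S x ≡ true → Star Step s x) extend (λ z → ⌊ s FinP.≟ z ⌋)
                     (λ x p → subst (Star Step s) (⌊⌋-true⁻ (s FinP.≟ x) p) ε)
    where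
      extend : ∀ S x y → (∀ z → S z ≡ true → Star Step s z) → S x ≡ true → S y ≡ false → Step x y →
        ∀ z → insert y S z ≡ true → Star Step s z
      extend S x y i sx _ st z p with insert⁻ y S p
      ... | inj₁ refl = i x sx ◅◅ (st ◅ ε)
      ... | inj₂ q    = i z q
  ... | S , r , sub , c = S , sub s (⌊⌋-true⁺ (s FinP.≟ s) refl) , r , c

  star? : ∀ x y → Dec (Star Step x y)
  star? x y with reach-set x
  ... | S , sx , r , c with true? (S y)
  ...   | inj₁ p = yes (r y p)
  ...   | inj₂ p = no λ q → true≢false (closed-star c q sx) p

-- Homogeneous linear systems with more unknowns than equations

Row : ℕ → Set
Row m = Fin m → ℤ

dot : ∀ {m} → Row m → Row m → ℤ
dot r u = sumℤ (λ j → r j * u j)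

private
  -- The last component transports any predicate along the rearrangement that puts the pivot row
  -- first, so no permutation has to be recorded.
  pivot : ∀ {m} (eqs : List (Row (suc m))) → All (λ r → r zero ≡ + 0) eqs ⊎
    (∃ λ e → ∃ λ rest → (e zero ≢ + 0) × (length eqs ≡ suc (length rest)) ×
      (∀ (P : Row (suc m) → Set) → P e → All P rest → All P eqs))
  pivot [] = inj₁ []
  pivot (r ∷ rs) with r zero ℤ.≟ + 0
  ... | no  r≢ = inj₂ (r , rs , r≢ , refl , λ P pe ps → pe ∷ ps)
  ... | yes r≡ with pivot rs
  ...   | inj₁ a = inj₁ (r≡ ∷ a)
  ...   | inj₂ (e , rest , e≢ , l , t) =
    inj₂ (e , r ∷ rest , e≢ , cong suc l , λ { P pe (pr ∷ ps) → pr ∷ t P pe ps })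

  -- Cross-multiplication in place of division keeps the rows integral; for the same reason
  -- `back-substitute` multiplies the later unknowns by the pivot.
  eliminate : ∀ {m} → Row (suc m) → Row (suc m) → Row m
  eliminate e r j = e zero * r (suc j) - r zero * e (suc j)

  mapRows : ∀ {a b} → (Row a → Row b) → List (Row a) → List (Row b)
  mapRows f []       = []
  mapRows f (r ∷ rs) = f r ∷ mapRows f rs

  mapRows-length : ∀ {a b} (f : Row a → Row b) rs → length (mapRows f rs) ≡ length rs
  mapRows-length f []       = refl
  mapRows-length f (r ∷ rs) = cong suc (mapRows-length f rs)

  back-substitute : ∀ {m} → Row (suc m) → Row m → Row (suc m)
  back-substitute e u zero    = - dot (e ∘ suc) u
  back-substitute e u (suc j) = e zero * u j

  dot-back : ∀ {m} (e r : Row (suc m)) u → dot r (back-substitute e u) ≡ dot (eliminate e r) u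
  dot-back e r u = begin
    r zero * - dot (e ∘ suc) u + sumℤ (λ j → r (suc j) * (e zero * u j))
      ≡⟨ cong₂ _+_ (neg-out (r zero) (dot (e ∘ suc) u)) refl ⟩
    - r zero * dot (e ∘ suc) u + sumℤ (λ j → r (suc j) * (e zero * u j))
      ≡⟨ cong₂ _+_ (sym (sum-* (- r zero) (λ j → e (suc j) * u j))) refl ⟩
    sumℤ (λ j → - r zero * (e (suc j) * u j)) + sumℤ (λ j → r (suc j) * (e zero * u j))
      ≡⟨ sym (sum-+ (λ j → - r zero * (e (suc j) * u j)) (λ j → r (suc j) * (e zero * u j))) ⟩
    sumℤ (λ j → - r zero * (e (suc j) * u j) + r (suc j) * (e zero * u j))
      ≡⟨ sum-cong (λ j → collect (r zero) (e (suc j)) (u j) (r (suc j)) (e zero)) ⟩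
    dot (eliminate e r) u ∎
    where
      open ≡-Reasoning
      neg-out : ∀ a b → a * - b ≡ - a * b
      neg-out = solve-∀
      collect : ∀ a b c d e → - a * (b * c) + d * (e * c) ≡ (e * d - a * b) * c
      collect = solve-∀

  dot-self : ∀ {m} (e : Row (suc m)) u → dot (eliminate e e) u ≡ + 0
  dot-self e u = sum-zero (λ j → cancel (e zero) (e (suc j)) (u j))
    where
      cancel : ∀ a b c → (a * b - a * b) * c ≡ + 0
      cancel = solve-∀

  unmap : ∀ {m} (e : Row (suc m)) u rs → All (λ r → dot r u ≡ + 0) (mapRows (eliminate e) rs) →
    All (λ r → dot r (back-substitute e u) ≡ + 0) rs
  unmap e u []       []       = []
  unmap e u (r ∷ rs) (p ∷ ps) = trans (dot-back e r u) p ∷ unmap e u rs ps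

  all-unit : ∀ {m} {eqs : List (Row (suc m))} → All (λ r → r zero ≡ + 0) eqs → All (λ r → dot r (δ zero) ≡ + 0) eqs
  all-unit []                 = []
  all-unit (_∷_ {x = r} p ps) = trans (sum-cong (λ j → ℤP.*-comm (r j) (δ zero j))) (trans (sum-δ zero r) p) ∷ all-unit ps

-- Each elimination removes one row and one unknown, so an unknown is left over in the end. A
-- nonzero entry stays nonzero because it is multiplied by a nonzero pivot. If no row involves the
-- first unknown, the first unit vector is a solution.
nontrivial-solution : ∀ m (eqs : List (Row m)) → length eqs ℕ.< m →
  ∃ λ u → (∃ λ j → u j ≢ + 0) × All (λ r → dot r u ≡ + 0) eqs
nontrivial-solution (suc m) eqs l with pivot eqs
... | inj₁ a = δ zero , (zero , λ ()) , all-unit a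
... | inj₂ (e , rest , e≢ , len , t)
  with nontrivial-solution m (mapRows (eliminate e) rest)
         (subst (ℕ._< m) (sym (mapRows-length (eliminate e) rest)) (ℕP.≤-pred (subst (ℕ._< suc m) len l)))
...   | u , (j , u≢) , sol = back-substitute e u
  , (suc j , λ z → [ e≢ , u≢ ]′ (ℤP.i*j≡0⇒i≡0∨j≡0 (e zero) z))
  , t _ (trans (dot-back e e u) (dot-self e u)) (unmap e u rest sol)

maskRows : ∀ {k m} → Mask k → (Fin k → Row m) → List (Row m)
maskRows {zero}  p A = []
maskRows {suc k} p A = if p zero then A zero ∷ maskRows (p ∘ suc) (A ∘ suc) else maskRows (p ∘ suc) (A ∘ suc)

maskRows-length : ∀ {k m} (p : Mask k) (A : Fin k → Row m) → length (maskRows p A) ≡ count p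
maskRows-length {zero}  p A = refl
maskRows-length {suc k} p A with p zero
... | true  = cong suc (maskRows-length (p ∘ suc) (A ∘ suc))
... | false = maskRows-length (p ∘ suc) (A ∘ suc)

maskRows-All : ∀ {k m} {P : Row m → Set} (p : Mask k) (A : Fin k → Row m) →
  All P (maskRows p A) → ∀ i → p i ≡ true → P (A i)
maskRows-All {suc k} p A a i q with p zero in eq
maskRows-All {suc k} p A (x ∷ a) zero    q | true = x
maskRows-All {suc k} p A (x ∷ a) (suc i) q | true = maskRows-All (p ∘ suc) (A ∘ suc) a i q
maskRows-All {suc k} p A a zero    q | false = ⊥-elim (true≢false q eq)
maskRows-All {suc k} p A a (suc i) q | false = maskRows-All (p ∘ suc) (A ∘ suc) a i q

All-++⁻ : ∀ {A : Set} {P : A → Set} (xs ys : List A) → All P (xs ++ ys) → All P xs × All P ys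
All-++⁻ []       ys a       = [] , a
All-++⁻ (x ∷ xs) ys (p ∷ a) = let (q , r) = All-++⁻ xs ys a in p ∷ q , r

-- Linear forms as sparse lists of coefficients

Form : ℕ → Set
Form m = List (ℤ × Fin m)

rowOf : ∀ {m} → Form m → Row m
rowOf []            j = + 0
rowOf ((c , i) ∷ l) j = c * δ i j + rowOf l j

eval : ∀ {m} → Form m → Row m → ℤ
eval []            u = + 0
eval ((c , i) ∷ l) u = c * u i + eval l u

dot-rowOf : ∀ {m} (l : Form m) u → dot (rowOf l) u ≡ eval l u
dot-rowOf []            u = sum-zero (λ j → ℤP.*-zeroˡ (u j))
dot-rowOf ((c , i) ∷ l) u = begin
  sumℤ (λ j → (c * δ i j + rowOf l j) * u j)                 ≡⟨ sum-cong (λ j → split c (δ i j) (rowOf l j) (u j)) ⟩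
  sumℤ (λ j → c * (δ i j * u j) + rowOf l j * u j)           ≡⟨ sum-+ (λ j → c * (δ i j * u j)) (λ j → rowOf l j * u j) ⟩
  sumℤ (λ j → c * (δ i j * u j)) + dot (rowOf l) u           ≡⟨ cong₂ _+_ (trans (sum-* c (λ j → δ i j * u j))
    (cong (c *_) (sum-δ i u))) (dot-rowOf l u) ⟩
  c * u i + eval l u ∎
  where
    open ≡-Reasoning
    split : ∀ c x r v → (c * x + r) * v ≡ c * (x * v) + r * v
    split = solve-∀

unit-form : ∀ {m} (i : Fin m) u → eval ((+ 1 , i) ∷ []) u ≡ u i
unit-form i u = trans (ℤP.+-identityʳ _) (ℤP.*-identityˡ (u i))

↑-cases : ∀ m {n} (i : Fin (m ℕ.+ n)) → (∃ λ j → i ≡ j ↑ˡ n) ⊎ (∃ λ j → i ≡ m ↑ʳ j)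
↑-cases m i with splitAt m i in eq
... | inj₁ j = inj₁ (j , sym (FinP.splitAt⁻¹-↑ˡ eq))
... | inj₂ j = inj₂ (j , sym (FinP.splitAt⁻¹-↑ʳ eq))

#-true : ∀ {n} → count {n} (λ _ → true) ≡ n
#-true {zero}  = refl
#-true {suc n} = cong suc (#-true {n})

private
  minus-left : ∀ x y → y ≡ (x + y) - x
  minus-left = solve-∀

  solve-row : ∀ x z v e q q⁻ → x * z + (- + 1 * v + (+ 1 * e + (- + 1 * q + (+ 1 * q⁻ + + 0)))) ≡ z * x - ((v - e) + (q - q⁻))
  solve-row = solve-∀

-- Vertices, edges and faces of a plane map as classes of half-edges

module Basics (M : PlaneMap) where
  open PlaneMap M public

  s s⁻ a f f⁻ : Fin n → Fin n
  s    = σ′ M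
  s⁻ h = σ ⟨$⟩ˡ h
  a    = α′ M
  f    = φ M
  f⁻ h = s⁻ (a h)

  ss⁻ : ∀ h → s (s⁻ h) ≡ h
  ss⁻ h = inverseʳ σ

  s⁻s : ∀ h → s⁻ (s h) ≡ h
  s⁻s h = inverseˡ σ

  aa : ∀ h → a (a h) ≡ h
  aa = α-invol

  ff⁻ : ∀ h → f (f⁻ h) ≡ h
  ff⁻ h = trans (cong a (ss⁻ (a h))) (aa h)

  f⁻f : ∀ h → f⁻ (f h) ≡ h
  f⁻f h = trans (cong s⁻ (aa (s h))) (s⁻s h)

  fs⁻ : ∀ h → f (s⁻ h) ≡ a h
  fs⁻ h = cong a (ss⁻ h)

  a-injective : ∀ {x y} → a x ≡ a y → x ≡ y
  a-injective {x} {y} p = trans (sym (aa x)) (trans (cong a p) (aa y))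

  module V = Orbits s s⁻ ss⁻ s⁻s
  module F = Orbits f f⁻ ff⁻ f⁻f

  _~ₑ_ : Fin n → Fin n → Set
  x ~ₑ y = (x ≡ y) ⊎ (a x ≡ y)

  _~ₑ?_ : ∀ x y → Dec (x ~ₑ y)
  x ~ₑ? y = (x FinP.≟ y) ⊎-dec (a x FinP.≟ y)

  ~ₑ-refl : ∀ x → x ~ₑ x
  ~ₑ-refl _ = inj₁ refl

  ~ₑ-sym : ∀ {x y} → x ~ₑ y → y ~ₑ x
  ~ₑ-sym (inj₁ refl) = inj₁ refl
  ~ₑ-sym (inj₂ refl) = inj₂ (aa _)

  ~ₑ-trans : ∀ {x y z} → x ~ₑ y → y ~ₑ z → x ~ₑ z
  ~ₑ-trans (inj₁ refl) q           = q
  ~ₑ-trans (inj₂ refl) (inj₁ refl) = inj₂ refl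
  ~ₑ-trans (inj₂ refl) (inj₂ refl) = inj₁ (sym (aa _))

  module E = Classes _~ₑ_ _~ₑ?_ ~ₑ-refl ~ₑ-sym ~ₑ-trans

  [~ₑ] : ∀ r g → E.[ r ~ g ] ≡ δ r g + δ (a r) g
  [~ₑ] r g with r FinP.≟ g | a r FinP.≟ g
  ... | yes refl | yes q = ⊥-elim (α-free r q)
  ... | yes refl | no  _ = refl
  ... | no _     | yes _ = refl
  ... | no _     | no  _ = refl

  edge-class-sum : ∀ F r → E.class-sum F r ≡ F r + F (a r)
  edge-class-sum F r = begin
    sumℤ (λ g → E.[ r ~ g ] * F g)                    ≡⟨ sum-cong (λ g → trans (cong (_* F g) ([~ₑ] r g)) (ℤP.*-distribʳ-+ (F g)
      (δ r g) (δ (a r) g))) ⟩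
    sumℤ (λ g → δ r g * F g + δ (a r) g * F g)        ≡⟨ sum-+ (λ g → δ r g * F g) (λ g → δ (a r) g * F g) ⟩
    sumℤ (λ g → δ r g * F g) + sumℤ (λ g → δ (a r) g * F g) ≡⟨ cong₂ _+_ (sum-δ r F) (sum-δ (a r) F) ⟩
    F r + F (a r) ∎
    where open ≡-Reasoning

  sum-a : ∀ (F : Fin n → ℤ) → sumℤ (λ h → F (a h)) ≡ sumℤ F
  sum-a = sum-perm a a aa aa

  sum-s⁻ : ∀ (F : Fin n → ℤ) → sumℤ (λ h → F (s⁻ h)) ≡ sumℤ F
  sum-s⁻ = sum-perm s⁻ s s⁻s ss⁻

  sum-f⁻ : ∀ (F : Fin n → ℤ) → sumℤ (λ h → F (f⁻ h)) ≡ sumℤ F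
  sum-f⁻ = sum-perm f⁻ f f⁻f ff⁻

  -- Each edge has two half-edges; sums over edges are kept doubled so that no halves occur.
  twice-edge-reps : ∀ (F : Fin n → ℤ) → (∀ h → F (a h) ≡ F h) →
    + 2 * sumℤ (λ h → 𝟙 (E.least h) * F h) ≡ sumℤ F
  twice-edge-reps F inv = sym (trans (E.sum-by-class F) (trans (sum-cong term) (sum-* (+ 2) (λ h → 𝟙 (E.least h) * F h))))
    where
      double : ∀ b x → b * (x + x) ≡ + 2 * (b * x)
      double = solve-∀
      term : ∀ h → 𝟙 (E.least h) * E.class-sum F h ≡ + 2 * (𝟙 (E.least h) * F h)
      term h = trans (cong (𝟙 (E.least h) *_) (trans (edge-class-sum F h) (cong (_+_ (F h)) (inv h))))
        (double (𝟙 (E.least h)) (F h))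

  edge-count : + 2 * # E.least ≡ + n
  edge-count = trans (cong (+ 2 *_) (sum-cong (λ h → sym (ℤP.*-identityʳ (𝟙 (E.least h))))))
    (trans (twice-edge-reps (λ _ → + 1) (λ _ → refl)) (#-all {n}))

  euler : + 2 * (# V.least + # F.least) ≡ + n + + 4
  euler = begin
    + 2 * (# V.least + # F.least)                       ≡⟨ cong₂ (λ x y → + 2 * (x + y)) (sym V.numOrbits≡) (sym F.numOrbits≡) ⟩
    + 2 * (+ numOrbits s + + numOrbits f)               ≡⟨ cong (+ 2 *_) (sym (ℤP.pos-+ (numOrbits s) (numOrbits f))) ⟩
    + 2 * + (numOrbits s ℕ.+ numOrbits f)               ≡⟨ sym (ℤP.pos-* 2 (numOrbits s ℕ.+ numOrbits f)) ⟩
    + (2 ℕ.* (numOrbits s ℕ.+ numOrbits f))             ≡⟨ cong +_ planar ⟩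
    + (n ℕ.+ 4)                                         ≡⟨ ℤP.pos-+ n 4 ⟩
    + n + + 4 ∎
    where open ≡-Reasoning

  connected-ind : (P : Fin n → Set) → (∀ x → P x → P (s x)) → (∀ x → P x → P (a x)) → ∀ x y → P x → P y
  connected-ind P cs ca x y = go (connected x y)
    where
      go : ∀ {x y} → Star (λ x y → (y ≡ s x) ⊎ (y ≡ a x)) x y → P x → P y
      go ε                p = p
      go (inj₁ refl ◅ r)  p = go r (cs _ p)
      go (inj₂ refl ◅ r)  p = go r (ca _ p)

  connected-const : ∀ {A : Set} (t : Fin n → A) → (∀ x → t (s x) ≡ t x) → (∀ x → t (a x) ≡ t x) → ∀ x y → t x ≡ t y
  connected-const t is ia x y = connected-ind (λ z → t x ≡ t z) (λ z e → trans e (sym (is z))) (λ z e → trans e (sym (ia z))) x y refl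

  s⁻-inv : ∀ {A : Set} (t : Fin n → A) → (∀ x → t (s x) ≡ t x) → ∀ x → t (s⁻ x) ≡ t x
  s⁻-inv t inv x = trans (sym (inv (s⁻ x))) (cong t (ss⁻ x))

  f⁻-inv : ∀ {A : Set} (t : Fin n → A) → (∀ x → t (f x) ≡ t x) → ∀ x → t (f⁻ x) ≡ t x
  f⁻-inv t inv x = trans (sym (inv (f⁻ x))) (cong t (ff⁻ x))

-- Cellular (co)homology of the derived map: its vertices are the vertices, edges and faces of M, its
-- edges join an edge to an endpoint (indexed by half-edges h) or to an incident face (indexed by the
-- half-edge c having the face on its left), and its faces are the corners of M.

module Derived (M : PlaneMap) where
  open Basics M public

  record Node : Set where
    constructor node
    field
      tV tE tF : Fin n → ℤ
      tV-inv   : ∀ h → tV (s h) ≡ tV h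
      tE-inv   : ∀ h → tE (a h) ≡ tE h
      tF-inv   : ∀ h → tF (f h) ≡ tF h
  open Node public

  ∇ᵛ ∇ᶠ : Node → Fin n → ℤ
  ∇ᵛ t h = tV t h - tE t h
  ∇ᶠ t c = tE t c - tF t c

  -- The derived edge at the half-edge `h` separates the corners `h` and `s⁻ h` of its vertex. The
  -- one from the edge of `c` to the face on its left separates the corners of that face at the two
  -- ends of `c`, which are `c` and `f⁻ c`.
  curlᵛ curlᶠ : (Fin n → ℤ) → Fin n → ℤ
  curlᵛ Q h = Q h - Q (s⁻ h)
  curlᶠ Q c = Q c - Q (f⁻ c)

  ⟨_,_∣_,_⟩ : (p q p′ q′ : Fin n → ℤ) → ℤ
  ⟨ p , q ∣ p′ , q′ ⟩ = sumℤ (λ h → p h * p′ h + q h * q′ h)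

  inv-pair : (π : Fin n → Fin n) → (∀ (F : Fin n → ℤ) → sumℤ (λ h → F (π h)) ≡ sumℤ F) →
    ∀ (t Q : Fin n → ℤ) → (∀ h → t (π h) ≡ t h) → sumℤ (λ h → t h * Q (π h)) ≡ sumℤ (λ h → t h * Q h)
  inv-pair π perm t Q inv = trans (sum-cong (λ h → cong (_* Q (π h)) (sym (inv h)))) (perm (λ h → t h * Q h))

  -- Summation by parts: a vertex function is unchanged by `s⁻` and a face function by `f⁻`, and as
  -- `f⁻ h` is `s⁻ (a h)`, an edge function pairs equally with `Q ∘ s⁻` and `Q ∘ f⁻`.
  ∇⊥curl : ∀ t Q → ⟨ ∇ᵛ t , ∇ᶠ t ∣ curlᵛ Q , curlᶠ Q ⟩ ≡ + 0
  ∇⊥curl (node tV tE tF iV iE iF) Q = begin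
    sumℤ (λ h → (tV h - tE h) * (Q h - Q (s⁻ h)) + (tE h - tF h) * (Q h - Q (f⁻ h)))
      ≡⟨ sum-cong (λ h → expand (tV h) (tE h) (tF h) (Q h) (Q (s⁻ h)) (Q (f⁻ h))) ⟩
    sumℤ (λ h → (vq h - vq⁻ h) + ((eq⁻ h - eqf h) - (fq h - fq⁻ h)))
      ≡⟨ trans (sum-+ (λ h → vq h - vq⁻ h) (λ h → (eq⁻ h - eqf h) - (fq h - fq⁻ h)))
          (cong₂ _+_ (sum-sub vq vq⁻) (trans (sum-sub (λ h → eq⁻ h - eqf h) (λ h → fq h - fq⁻ h))
            (cong₂ _-_ (sum-sub eq⁻ eqf) (sum-sub fq fq⁻)))) ⟩
    (sumℤ vq - sumℤ vq⁻) + ((sumℤ eq⁻ - sumℤ eqf) - (sumℤ fq - sumℤ fq⁻))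
      ≡⟨ cong₂ (λ x y → (sumℤ vq - x) + ((sumℤ eq⁻ - y) - (sumℤ fq - sumℤ fq⁻)))
          (inv-pair s⁻ sum-s⁻ tV Q (s⁻-inv tV iV)) (inv-pair a sum-a tE (Q ∘ s⁻) iE) ⟩
    (sumℤ vq - sumℤ vq) + ((sumℤ eq⁻ - sumℤ eq⁻) - (sumℤ fq - sumℤ fq⁻))
      ≡⟨ cong (λ x → (sumℤ vq - sumℤ vq) + ((sumℤ eq⁻ - sumℤ eq⁻) - (sumℤ fq - x)))
          (inv-pair f⁻ sum-f⁻ tF Q (f⁻-inv tF iF)) ⟩
    (sumℤ vq - sumℤ vq) + ((sumℤ eq⁻ - sumℤ eq⁻) - (sumℤ fq - sumℤ fq))
      ≡⟨ cancel (sumℤ vq) (sumℤ eq⁻) (sumℤ fq) ⟩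
    + 0 ∎
    where
      open ≡-Reasoning
      vq vq⁻ eq⁻ eqf fq fq⁻ : Fin n → ℤ
      vq h  = tV h * Q h
      vq⁻ h = tV h * Q (s⁻ h)
      eq⁻ h = tE h * Q (s⁻ h)
      eqf h = tE h * Q (f⁻ h)
      fq h  = tF h * Q h
      fq⁻ h = tF h * Q (f⁻ h)
      expand : ∀ v e f q q⁻ qf → (v - e) * (q - q⁻) + (e - f) * (q - qf) ≡
        (v * q - v * q⁻) + ((e * q⁻ - e * qf) - (f * q - f * qf))
      expand = solve-∀
      cancel : ∀ x y z → (x - x) + ((y - y) - (z - z)) ≡ + 0
      cancel = solve-∀

  norm-zero : ∀ (p q : Fin n → ℤ) → ⟨ p , q ∣ p , q ⟩ ≡ + 0 → (∀ h → p h ≡ + 0) × (∀ h → q h ≡ + 0)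
  norm-zero p q e = (λ h → square≡0 (p h) (proj₁ (parts h))) , (λ h → square≡0 (q h) (proj₂ (parts h)))
    where
      zeros : ∀ h → p h * p h + q h * q h ≡ + 0
      zeros = sum-nonneg-zero (λ h → 0≤+ (0≤-square (p h)) (0≤-square (q h))) e
      split : ∀ x y → + 0 ≤ x → + 0 ≤ y → x + y ≡ + 0 → (x ≡ + 0) × (y ≡ + 0)
      split x y px py q = ℤP.≤-antisym (≤-by y py (sym q)) px , ℤP.≤-antisym (≤-by x px (trans (sym q) (ℤP.+-comm x y))) py
      parts : ∀ h → (p h * p h ≡ + 0) × (q h * q h ≡ + 0)
      parts h = split _ _ (0≤-square (p h)) (0≤-square (q h)) (zeros h)

  ∇-zero-const : ∀ t → (∀ h → ∇ᵛ t h ≡ + 0) → (∀ h → ∇ᶠ t h ≡ + 0) → ∀ h → (tV t h ≡ tV t root) × (tE t h ≡ tV t root) ×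
    (tF t h ≡ tV t root)
  ∇-zero-const t zv zf h = v h , e h , trans (sym (a-b≡0⇒a≡b (zf h))) (e h)
    where
      v≡e : ∀ h → tV t h ≡ tE t h
      v≡e h = a-b≡0⇒a≡b (zv h)
      v : ∀ h → tV t h ≡ tV t root
      v h = connected-const (tV t) (tV-inv t) (λ x → trans (v≡e (a x)) (trans (tE-inv t x) (sym (v≡e x)))) h root
      e : ∀ h → tE t h ≡ tV t root
      e h = trans (sym (v≡e h)) (v h)

  curl-zero-const : ∀ Q → (∀ h → curlᵛ Q h ≡ + 0) → (∀ h → curlᶠ Q h ≡ + 0) → ∀ h → Q h ≡ Q root
  curl-zero-const Q zv zf h = connected-const Q is ia h root
    where
      is : ∀ x → Q (s x) ≡ Q x
      is x = trans (a-b≡0⇒a≡b (zv (s x))) (cong Q (s⁻s x))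
      ia : ∀ x → Q (a x) ≡ Q x
      ia x = trans (a-b≡0⇒a≡b (zf (a x))) (trans (cong (Q ∘ s⁻) (aa x)) (sym (a-b≡0⇒a≡b (zv x))))

  -- The squared norm of the gradient is minus its pairing with the curl, which is zero by
  -- orthogonality.
  opposite-zero : ∀ t Q → (∀ h → curlᵛ Q h ≡ - ∇ᵛ t h) → (∀ h → curlᶠ Q h ≡ - ∇ᶠ t h) →
    (∀ h → ∇ᵛ t h ≡ + 0) × (∀ h → ∇ᶠ t h ≡ + 0)
  opposite-zero t Q ov of = norm-zero (∇ᵛ t) (∇ᶠ t) (begin
    ⟨ ∇ᵛ t , ∇ᶠ t ∣ ∇ᵛ t , ∇ᶠ t ⟩ ≡⟨ sum-cong (λ h → trans (neg-pair (∇ᵛ t h) (∇ᶠ t h))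
      (cong₂ (λ x y → - (∇ᵛ t h * x + ∇ᶠ t h * y)) (sym (ov h)) (sym (of h)))) ⟩
    sumℤ (λ h → - (∇ᵛ t h * curlᵛ Q h + ∇ᶠ t h * curlᶠ Q h)) ≡⟨ sum-neg (λ h → ∇ᵛ t h * curlᵛ Q h + ∇ᶠ t h * curlᶠ Q h) ⟩
    - ⟨ ∇ᵛ t , ∇ᶠ t ∣ curlᵛ Q , curlᶠ Q ⟩ ≡⟨ cong -_ (∇⊥curl t Q) ⟩
    + 0 ∎)
    where
      open ≡-Reasoning
      neg-pair : ∀ x y → x * x + y * y ≡ - (x * - x + y * - y)
      neg-pair = solve-∀

  record Decomposition (za zb : Fin n → ℤ) : Set where
    field
      μ   : ℤ
      μ≢0 : μ ≢ + 0
      t   : Node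
      Q   : Fin n → ℤ
      eqᵛ : ∀ h → μ * za h ≡ ∇ᵛ t h + curlᵛ Q h
      eqᶠ : ∀ h → μ * zb h ≡ ∇ᶠ t h + curlᶠ Q h

  private
    m₀ : ℕ
    m₀ = suc (n ℕ.+ (n ℕ.+ (n ℕ.+ n)))

    iV iE iF iQ : Fin n → Fin m₀
    iV j = suc (j ↑ˡ (n ℕ.+ (n ℕ.+ n)))
    iE j = suc (n ↑ʳ (j ↑ˡ (n ℕ.+ n)))
    iF j = suc (n ↑ʳ (n ↑ʳ (j ↑ˡ n)))
    iQ j = suc (n ↑ʳ (n ↑ʳ (n ↑ʳ j)))

    index-cases : ∀ i → (i ≡ zero) ⊎ (∃ λ j → i ≡ iV j) ⊎ (∃ λ j → i ≡ iE j) ⊎ (∃ λ j → i ≡ iF j) ⊎ (∃ λ j → i ≡ iQ j)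
    index-cases zero = inj₁ refl
    index-cases (suc i) with ↑-cases n i
    ... | inj₁ (j , refl) = inj₂ (inj₁ (j , refl))
    ... | inj₂ (i′ , refl) with ↑-cases n i′
    ...   | inj₁ (j , refl) = inj₂ (inj₂ (inj₁ (j , refl)))
    ...   | inj₂ (i″ , refl) with ↑-cases n i″
    ...     | inj₁ (j , refl) = inj₂ (inj₂ (inj₂ (inj₁ (j , refl))))
    ...     | inj₂ (j , refl) = inj₂ (inj₂ (inj₂ (inj₂ (j , refl))))

    one : Fin m₀ → Row m₀
    one i = rowOf ((+ 1 , i) ∷ [])

  module _ (za zb : Fin n → ℤ) where

    private
      formA formB : Fin n → Form m₀
      formA h = ((za h , zero) ∷ (- + 1 , iV (V.rep h)) ∷ (+ 1 , iE (E.rep h)) ∷ (- + 1 , iQ h) ∷ (+ 1 , iQ (s⁻ h)) ∷ [])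
      formB h = ((zb h , zero) ∷ (- + 1 , iE (E.rep h)) ∷ (+ 1 , iF (F.rep h)) ∷ (- + 1 , iQ h) ∷ (+ 1 , iQ (f⁻ h)) ∷ [])

      rowA rowB : Fin n → Row m₀
      rowA h = rowOf (formA h)
      rowB h = rowOf (formB h)

      rows₁ rows₂ rows₃ rows₄ rows₅ rows₆ eqs₅ eqs₄ eqs₃ eqs₂ eqs : List (Row m₀)
      rows₁ = maskRows (λ _ → true) rowA
      rows₂ = maskRows (λ _ → true) rowB
      rows₃ = maskRows (not ∘ V.least) (one ∘ iV)
      rows₄ = maskRows (not ∘ E.least) (one ∘ iE)
      rows₅ = maskRows (not ∘ F.least) (one ∘ iF)
      -- Gradients and curls do not see additive constants; fixing one value of `t` and one of `Q`
      -- at the root removes this freedom.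
      rows₆ = one (iV (V.rep root)) ∷ one (iQ root) ∷ []
      eqs₅ = rows₅ ++ rows₆
      eqs₄ = rows₄ ++ eqs₅
      eqs₃ = rows₃ ++ eqs₄
      eqs₂ = rows₂ ++ eqs₃
      eqs  = rows₁ ++ eqs₂

      len : + length eqs ≡ + n + (+ n + ((+ n - # V.least) + ((+ n - # E.least) + ((+ n - # F.least) + + 2))))
      len = step rows₁ eqs₂ (full rowA) (step rows₂ eqs₃ (full rowB) (step rows₃ eqs₄ (part V.least (one ∘ iV))
              (step rows₄ eqs₅ (part E.least (one ∘ iE)) (step rows₅ rows₆ (part F.least (one ∘ iF)) refl))))
        where
          step : ∀ (xs ys : List (Row m₀)) {x y} → + length xs ≡ x → + length ys ≡ y → + length (xs ++ ys) ≡ x + y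
          step xs ys p q = trans (cong +_ (ListP.length-++ xs)) (trans (ℤP.pos-+ (length xs) (length ys)) (cong₂ _+_ p q))
          full : ∀ (A : Fin n → Row m₀) → + length (maskRows (λ _ → true) A) ≡ + n
          full A = cong +_ (trans (maskRows-length (λ _ → true) A) (#-true {n}))
          part : ∀ (p : Mask n) (A : Fin n → Row m₀) → + length (maskRows (not ∘ p) A) ≡ + n - # p
          part p A = trans (cong +_ (maskRows-length (not ∘ p) A)) (trans (count≡# (not ∘ p)) (#-not p))

      -- There are `2n` decomposition equations, one equation for each half-edge that does not
      -- represent its vertex, edge or face, and two normalisations. By Euler's formula this makes
      -- `4n`, one less than the number of unknowns.
      len≡ : length eqs ≡ n ℕ.+ (n ℕ.+ (n ℕ.+ n))
      len≡ = ℤP.+-injective (ℤP.*-cancelˡ-≡ (+ 2) _ _ (begin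
        + 2 * + length eqs ≡⟨ cong (+ 2 *_) len ⟩
        + 2 * (+ n + (+ n + ((+ n - # V.least) + ((+ n - # E.least) + ((+ n - # F.least) + + 2)))))
          ≡⟨ rearrange (+ n) (# V.least) (# E.least) (# F.least) ⟩
        + 10 * + n - (+ 2 * (# V.least + # F.least)) - + 2 * # E.least + + 4
          ≡⟨ cong₂ (λ x y → + 10 * + n - x - y + + 4) euler edge-count ⟩
        + 10 * + n - (+ n + + 4) - + n + + 4 ≡⟨ simplify (+ n) ⟩
        + 2 * (+ n + (+ n + (+ n + + n))) ≡⟨ cong (+ 2 *_) (sym cast) ⟩
        + 2 * + (n ℕ.+ (n ℕ.+ (n ℕ.+ n))) ∎))
        where
          open ≡-Reasoning
          rearrange : ∀ n v e f → + 2 * (n + (n + ((n - v) + ((n - e) + ((n - f) + + 2))))) ≡ + 10 * n - (+ 2 * (v + f)) - + 2 * e + + 4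
          rearrange = solve-∀
          simplify : ∀ n → + 10 * n - (n + + 4) - n + + 4 ≡ + 2 * (n + (n + (n + n)))
          simplify = solve-∀
          cast : + (n ℕ.+ (n ℕ.+ (n ℕ.+ n))) ≡ + n + (+ n + (+ n + + n))
          cast = trans (ℤP.pos-+ n _) (cong (_+_ (+ n)) (trans (ℤP.pos-+ n _) (cong (_+_ (+ n)) (ℤP.pos-+ n n))))

      solution : ∀ u → (∃ λ j → u j ≢ + 0) → All (λ r → dot r u ≡ + 0) eqs → Decomposition za zb
      solution u (j , uj≢0) sol = record { μ = u zero ; μ≢0 = μ≢0 ; t = t ; Q = Q ; eqᵛ = eqᵛ ; eqᶠ = eqᶠ }
        where
          Sol : List (Row m₀) → Set
          Sol = All (λ r → dot r u ≡ + 0)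
          sol₂ : Sol rows₁ × Sol eqs₂
          sol₂ = All-++⁻ rows₁ eqs₂ sol
          sol₃ : Sol rows₂ × Sol eqs₃
          sol₃ = All-++⁻ rows₂ eqs₃ (proj₂ sol₂)
          sol₄ : Sol rows₃ × Sol eqs₄
          sol₄ = All-++⁻ rows₃ eqs₄ (proj₂ sol₃)
          sol₅ : Sol rows₄ × Sol eqs₅
          sol₅ = All-++⁻ rows₄ eqs₅ (proj₂ sol₄)
          sol₆ : Sol rows₅ × Sol rows₆
          sol₆ = All-++⁻ rows₅ rows₆ (proj₂ sol₅)
          t : Node
          t = node (λ h → u (iV (V.rep h))) (λ h → u (iE (E.rep h))) (λ h → u (iF (F.rep h)))
            (λ h → cong (u ∘ iV) (sym (V.rep-cong (V.~-f h))))
            (λ h → cong (u ∘ iE) (sym (E.rep-cong (inj₂ refl))))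
            (λ h → cong (u ∘ iF) (sym (F.rep-cong (F.~-f h))))
          Q : Fin n → ℤ
          Q h = u (iQ h)
          eqᵛ : ∀ h → u zero * za h ≡ ∇ᵛ t h + curlᵛ Q h
          eqᵛ h = a-b≡0⇒a≡b (trans (sym (solve-row (za h) (u zero) (tV t h) (tE t h) (Q h) (Q (s⁻ h))))
            (trans (sym (dot-rowOf (formA h) u)) (maskRows-All (λ _ → true) rowA (proj₁ sol₂) h refl)))
          eqᶠ : ∀ h → u zero * zb h ≡ ∇ᶠ t h + curlᶠ Q h
          eqᶠ h = a-b≡0⇒a≡b (trans (sym (solve-row (zb h) (u zero) (tE t h) (tF t h) (Q h) (Q (f⁻ h))))
            (trans (sym (dot-rowOf (formB h) u)) (maskRows-All (λ _ → true) rowB (proj₁ sol₃) h refl)))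
          unit : ∀ i → dot (one i) u ≡ + 0 → u i ≡ + 0
          unit i e = trans (sym (unit-form i u)) (trans (sym (dot-rowOf ((+ 1 , i) ∷ []) u)) e)
          masked : ∀ (p : Mask n) (i : Fin n → Fin m₀) → All (λ r → dot r u ≡ + 0) (maskRows (not ∘ p) (one ∘ i)) →
            ∀ h → p h ≡ false → u (i h) ≡ + 0
          masked p i al h e = unit (i h) (maskRows-All (not ∘ p) (one ∘ i) al h (not-true⁺ e))
          last : (tV t root ≡ + 0) × (Q root ≡ + 0)
          last = pair (proj₂ sol₆)
            where
              pair : Sol rows₆ → (tV t root ≡ + 0) × (Q root ≡ + 0)
              pair (p ∷ q ∷ []) = unit (iV (V.rep root)) p , unit (iQ root) q
          μ≢0 : u zero ≢ + 0
          -- With multiplier zero the gradient and the curl would be opposite, hence both zero; `t`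
          -- and `Q` would be constant, and zero at the root, so that the solution would be trivial.
          μ≢0 uz = uj≢0 (all-zero j)
            where
              opp : ∀ z x y → z ≡ x + y → z ≡ + 0 → y ≡ - x
              opp z x y p q = trans (minus-left x y) (trans (cong (_- x) (trans (sym p) q)) (ℤP.+-identityˡ (- x)))
              ov : ∀ h → curlᵛ Q h ≡ - ∇ᵛ t h
              ov h = opp _ _ _ (eqᵛ h) (trans (cong (_* za h) uz) (ℤP.*-zeroˡ (za h)))
              of : ∀ h → curlᶠ Q h ≡ - ∇ᶠ t h
              of h = opp _ _ _ (eqᶠ h) (trans (cong (_* zb h) uz) (ℤP.*-zeroˡ (zb h)))
              zt : (∀ h → ∇ᵛ t h ≡ + 0) × (∀ h → ∇ᶠ t h ≡ + 0)
              zt = opposite-zero t Q ov of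
              tz : ∀ h → (tV t h ≡ + 0) × (tE t h ≡ + 0) × (tF t h ≡ + 0)
              tz h = let (x , y , z) = ∇-zero-const t (proj₁ zt) (proj₂ zt) h
                     in trans x (proj₁ last) , trans y (proj₁ last) , trans z (proj₁ last)
              qz : ∀ h → Q h ≡ + 0
              qz h = trans (curl-zero-const Q (λ h → trans (ov h) (cong -_ (proj₁ zt h))) (λ h → trans (of h)
                (cong -_ (proj₂ zt h))) h) (proj₂ last)
              vertex : ∀ k → (V.least k ≡ true) ⊎ (V.least k ≡ false) → u (iV k) ≡ + 0
              vertex k (inj₂ e) = masked V.least iV (proj₁ sol₄) k e
              vertex k (inj₁ e) = trans (cong (u ∘ iV) (sym (V.rep-fix (⌊⌋-true⁻ (V.least? k) e)))) (proj₁ (tz k))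
              edge : ∀ k → (E.least k ≡ true) ⊎ (E.least k ≡ false) → u (iE k) ≡ + 0
              edge k (inj₂ e) = masked E.least iE (proj₁ sol₅) k e
              edge k (inj₁ e) = trans (cong (u ∘ iE) (sym (E.rep-fix (⌊⌋-true⁻ (E.least? k) e)))) (proj₁ (proj₂ (tz k)))
              face : ∀ k → (F.least k ≡ true) ⊎ (F.least k ≡ false) → u (iF k) ≡ + 0
              face k (inj₂ e) = masked F.least iF (proj₁ sol₆) k e
              face k (inj₁ e) = trans (cong (u ∘ iF) (sym (F.rep-fix (⌊⌋-true⁻ (F.least? k) e)))) (proj₂ (proj₂ (tz k)))
              all-zero : ∀ j → u j ≡ + 0
              all-zero j with index-cases j
              ... | inj₁ e = trans (cong u e) uz
              ... | inj₂ (inj₁ (k , e)) = trans (cong u e) (vertex k (true? (V.least k)))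
              ... | inj₂ (inj₂ (inj₁ (k , e))) = trans (cong u e) (edge k (true? (E.least k)))
              ... | inj₂ (inj₂ (inj₂ (inj₁ (k , e)))) = trans (cong u e) (face k (true? (F.least k)))
              ... | inj₂ (inj₂ (inj₂ (inj₂ (k , e)))) = trans (cong u e) (qz k)

    decompose : Decomposition za zb
    decompose = let (u , u≢0 , sol) = nontrivial-solution m₀ eqs (subst (ℕ._< m₀) (sym len≡) ℕP.≤-refl)
                in solution u u≢0 sol

  private
    positive-square : ∀ {μ} → μ ≢ + 0 → + 0 < μ * μ
    positive-square {μ} μ≢0 with nat-≤-or-< (μ * μ) (0≤-square μ)
    ... | inj₁ e = ⊥-elim (μ≢0 (square≡0 μ e))
    ... | inj₂ p = p

  -- Pairing `μ z = g + c` with `g` leaves `⟨g , g⟩ = μ ⟨g , z⟩ - ⟨g , c⟩`, and both terms on the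
  -- right vanish.
  no-component : ∀ (gᵛ gᶠ cᵛ cᶠ za zb : Fin n → ℤ) μ → (∀ h → μ * za h ≡ gᵛ h + cᵛ h) → (∀ h → μ * zb h ≡ gᶠ h + cᶠ h) →
    ⟨ gᵛ , gᶠ ∣ cᵛ , cᶠ ⟩ ≡ + 0 → ⟨ gᵛ , gᶠ ∣ za , zb ⟩ ≡ + 0 → (∀ h → gᵛ h ≡ + 0) × (∀ h → gᶠ h ≡ + 0)
  no-component gᵛ gᶠ cᵛ cᶠ za zb μ eᵛ eᶠ gc gz = norm-zero gᵛ gᶠ (begin
    ⟨ gᵛ , gᶠ ∣ gᵛ , gᶠ ⟩
      ≡⟨ sum-cong (λ h → trans (lemma (gᵛ h) (gᶠ h) (cᵛ h) (cᶠ h)) (cong (_- (gᵛ h * cᵛ h + gᶠ h * cᶠ h))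
           (trans (cong₂ (λ u v → gᵛ h * u + gᶠ h * v) (sym (eᵛ h)) (sym (eᶠ h))) (out (gᵛ h) (gᶠ h) μ (za h) (zb h))))) ⟩
    sumℤ (λ h → μ * (gᵛ h * za h + gᶠ h * zb h) - (gᵛ h * cᵛ h + gᶠ h * cᶠ h))
      ≡⟨ trans (sum-sub (λ h → μ * (gᵛ h * za h + gᶠ h * zb h)) (λ h → gᵛ h * cᵛ h + gᶠ h * cᶠ h))
           (cong (_- ⟨ gᵛ , gᶠ ∣ cᵛ , cᶠ ⟩) (sum-* μ (λ h → gᵛ h * za h + gᶠ h * zb h))) ⟩
    μ * ⟨ gᵛ , gᶠ ∣ za , zb ⟩ - ⟨ gᵛ , gᶠ ∣ cᵛ , cᶠ ⟩ ≡⟨ cong₂ (λ x y → μ * x - y) gz gc ⟩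
    μ * + 0 - + 0 ≡⟨ cong (_- + 0) (ℤP.*-zeroʳ μ) ⟩
    + 0 ∎)
    where
      open ≡-Reasoning
      lemma : ∀ x y c d → x * x + y * y ≡ (x * (x + c) + y * (y + d)) - (x * c + y * d)
      lemma = solve-∀
      out : ∀ x y m z z′ → x * (m * z) + y * (m * z′) ≡ m * (x * z + y * z′)
      out = solve-∀

  ⟨⟩-comm : ∀ p q p′ q′ → ⟨ p , q ∣ p′ , q′ ⟩ ≡ ⟨ p′ , q′ ∣ p , q ⟩
  ⟨⟩-comm p q p′ q′ = sum-cong (λ h → cong₂ _+_ (ℤP.*-comm (p h) (p′ h)) (ℤP.*-comm (q h) (q′ h)))

  private
    rescale : ∀ m z u v k → m * z ≡ k + (u - v) → k ≡ + 0 → m * m * z ≡ m * u - m * v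
    rescale m z u v k p refl = trans (ℤP.*-assoc m m z) (trans (cong (m *_) p) (out m u v))
      where
        out : ∀ m u v → m * (+ 0 + (u - v)) ≡ m * u - m * v
        out = solve-∀

  -- Orthogonality to all gradients means being a cycle, so this is the vanishing of the rational
  -- first homology of the sphere. One more factor `μ` makes the multiplier a positive square, so
  -- that signs survive.
  corner-potential : ∀ za zb → (∀ t → ⟨ ∇ᵛ t , ∇ᶠ t ∣ za , zb ⟩ ≡ + 0) →
    ∃ λ μ → (+ 0 < μ) × ∃ λ Q → (∀ h → μ * za h ≡ curlᵛ Q h) × (∀ h → μ * zb h ≡ curlᶠ Q h)
  corner-potential za zb orth = μ * μ , positive-square μ≢0 , (λ h → μ * Q h) ,
      (λ h → rescale μ (za h) (Q h) (Q (s⁻ h)) (∇ᵛ t h) (eqᵛ h) (proj₁ zt h)) ,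
      (λ h → rescale μ (zb h) (Q h) (Q (f⁻ h)) (∇ᶠ t h) (eqᶠ h) (proj₂ zt h))
    where
      open Decomposition (decompose za zb)
      zt : (∀ h → ∇ᵛ t h ≡ + 0) × (∀ h → ∇ᶠ t h ≡ + 0)
      zt = no-component (∇ᵛ t) (∇ᶠ t) (curlᵛ Q) (curlᶠ Q) za zb μ eqᵛ eqᶠ (∇⊥curl t Q) (orth t)

  -- The cohomological counterpart: orthogonality to all curls says that the signed sum around every
  -- corner is zero.
  node-potential : ∀ za zb → (∀ Q → ⟨ za , zb ∣ curlᵛ Q , curlᶠ Q ⟩ ≡ + 0) →
    ∃ λ μ → (+ 0 < μ) × ∃ λ t → (∀ h → μ * za h ≡ ∇ᵛ t h) × (∀ h → μ * zb h ≡ ∇ᶠ t h)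
  node-potential za zb orth = μ * μ , positive-square μ≢0 ,
      node (λ h → μ * tV t h) (λ h → μ * tE t h) (λ h → μ * tF t h)
        (λ h → cong (μ *_) (tV-inv t h)) (λ h → cong (μ *_) (tE-inv t h)) (λ h → cong (μ *_) (tF-inv t h)) ,
      (λ h → rescale μ (za h) (tV t h) (tE t h) (curlᵛ Q h) (swapᵛ h) (proj₁ zq h)) ,
      (λ h → rescale μ (zb h) (tE t h) (tF t h) (curlᶠ Q h) (swapᶠ h) (proj₂ zq h))
    where
      open Decomposition (decompose za zb)
      swapᵛ : ∀ h → μ * za h ≡ curlᵛ Q h + ∇ᵛ t h
      swapᵛ h = trans (eqᵛ h) (ℤP.+-comm (∇ᵛ t h) (curlᵛ Q h))
      swapᶠ : ∀ h → μ * zb h ≡ curlᶠ Q h + ∇ᶠ t h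
      swapᶠ h = trans (eqᶠ h) (ℤP.+-comm (∇ᶠ t h) (curlᶠ Q h))
      zq : (∀ h → curlᵛ Q h ≡ + 0) × (∀ h → curlᶠ Q h ≡ + 0)
      zq = no-component (curlᵛ Q) (curlᶠ Q) (∇ᵛ t) (∇ᶠ t) za zb μ swapᵛ swapᶠ
        (trans (⟨⟩-comm (curlᵛ Q) (curlᶠ Q) (∇ᵛ t) (∇ᶠ t)) (∇⊥curl t Q)) (trans (⟨⟩-comm (curlᵛ Q) (curlᶠ Q) za zb) (orth Q))

-- Euler's inequality for a part of the map

𝟙-∨-≤ : ∀ x y → 𝟙 (x ∨ y) ≤ 𝟙 x + 𝟙 y
𝟙-∨-≤ true  y = ≤-by (𝟙 y) (0≤𝟙 y) refl
𝟙-∨-≤ false y = ℤP.≤-reflexive (sym (ℤP.+-identityˡ (𝟙 y)))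

#-split : ∀ {n} (p q : Mask n) → # p ≡ # (λ h → p h ∧ q h) + # (λ h → p h ∧ not (q h))
#-split p q = trans (sum-cong (λ h → term (p h) (q h)))
  (sum-+ (λ h → 𝟙 (p h ∧ q h)) (λ h → 𝟙 (p h ∧ not (q h))))
  where
    term : ∀ x y → 𝟙 x ≡ 𝟙 (x ∧ y) + 𝟙 (x ∧ not y)
    term true  true  = refl
    term true  false = refl
    term false _     = refl

#-pick : ∀ {n} (i : Fin n) → # (λ h → ⌊ i FinP.≟ h ⌋) ≡ + 1
#-pick i = trans (sum-cong (λ h → sym (ℤP.*-identityʳ (δ i h)))) (sum-δ i (λ _ → + 1))

private
  rank-row : ∀ t t′ p p′ → + 1 * t + (- + 1 * t′ + (+ 1 * p + (- + 1 * p′ + + 0))) ≡ (t - t′) + (p - p′)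
  rank-row = solve-∀

  neg-square : ∀ x y → x + y ≡ + 0 → x * x ≡ - (x * y)
  neg-square x y e = trans (lemma x y) (trans (cong (λ z → x * z - x * y) e) (zero′ x y))
    where
      lemma : ∀ x y → x * x ≡ x * (x + y) - x * y
      lemma = solve-∀
      zero′ : ∀ x y → x * + 0 - x * y ≡ - (x * y)
      zero′ = solve-∀

  pair-expand : ∀ t t′ p p′ → (t - t′) * (p - p′) ≡ (t * p - t * p′) + (t′ * p′ - t′ * p)
  pair-expand = solve-∀

-- Gradients t - t ∘ a of vertex functions are orthogonal to differences p - p ∘ a of face functions;
-- so functions t supported on V′ and face functions p modulo those constant across the edges of E′
-- are independent as functions on E′.

module Rank (M : PlaneMap) where
  open Derived M public

  -- The right face of `h` is the left face of `s⁻ h`, so `p (a h) ≡ p (s⁻ h)`, and the differences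
  -- of `p` cancel around each vertex.
  vertex⊥face : ∀ (t p : Fin n → ℤ) → (∀ h → t (s h) ≡ t h) → (∀ h → p (f h) ≡ p h) →
    sumℤ (λ h → (t h - t (a h)) * (p h - p (a h))) ≡ + 0
  vertex⊥face t p is ip = begin
    sumℤ (λ h → (t h - t (a h)) * (p h - p (a h)))
      ≡⟨ sum-cong (λ h → pair-expand (t h) (t (a h)) (p h) (p (a h))) ⟩
    sumℤ (λ h → G h + (t (a h) * p (a h) - t (a h) * p h))
      ≡⟨ sum-cong (λ h → cong (λ z → G h + (t (a h) * p (a h) - t (a h) * p z)) (sym (aa h))) ⟩
    sumℤ (λ h → G h + G (a h))  ≡⟨ sum-+ G (G ∘ a) ⟩
    sumℤ G + sumℤ (G ∘ a)       ≡⟨ cong₂ _+_ zeroG (trans (sum-a G) zeroG) ⟩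
    + 0 ∎
    where
      open ≡-Reasoning
      G : Fin n → ℤ
      G h = t h * p h - t h * p (a h)
      zeroG : sumℤ G ≡ + 0
      zeroG = begin
        sumℤ G ≡⟨ sum-sub (λ h → t h * p h) (λ h → t h * p (a h)) ⟩
        sumℤ (λ h → t h * p h) - sumℤ (λ h → t h * p (a h))
          ≡⟨ cong (_-_ (sumℤ (λ h → t h * p h))) (sum-cong (λ h → cong (t h *_) (trans (cong p (sym (fs⁻ h))) (ip (s⁻ h))))) ⟩
        sumℤ (λ h → t h * p h) - sumℤ (λ h → t h * p (s⁻ h))
          ≡⟨ cong (_-_ (sumℤ (λ h → t h * p h))) (inv-pair s⁻ sum-s⁻ t p (s⁻-inv t is)) ⟩
        sumℤ (λ h → t h * p h) - sumℤ (λ h → t h * p h) ≡⟨ ℤP.+-inverseʳ (sumℤ (λ h → t h * p h)) ⟩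
        + 0 ∎

  -- `V′` is a set of vertices all of whose edges lie in `E′`. The marked faces `r` meet every
  -- component of the dual graph with edge set `E′`; `hit` expresses this by functions, so that the
  -- components need not be formed.
  module _ (V′ E′ r : Mask n)
    (V′-s : ∀ h → V′ h ≡ true → V′ (s h) ≡ true)
    (E′-a : ∀ h → E′ h ≡ true → E′ (a h) ≡ true)
    (V′⊆E′ : ∀ h → V′ h ≡ true → E′ h ≡ true)
    (h₀ : Fin n) (h₀∉ : V′ h₀ ≡ false)
    (r-least : ∀ h → r h ≡ true → F.Least h)
    (hit : ∀ (p : Fin n → ℤ) → (∀ h → p (f h) ≡ p h) → (∀ h → E′ h ≡ true → p (a h) ≡ p h) →
      (∀ h → r h ≡ true → p h ≡ + 0) → ∀ h → p h ≡ + 0) where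

    E′-a⁻ : ∀ h → E′ h ≡ false → E′ (a h) ≡ false
    E′-a⁻ h e = not-true λ q → true≢false (subst (λ z → E′ z ≡ true) (aa h) (E′-a (a h) q)) e

    -- On `E′` the differences of `t` and `p` are opposite, and off `E′` that of `t` vanishes; so
    -- the squared norm of the first is minus its pairing with the second, which is zero.
    -- Connectedness and `h₀` then kill `t`, and `hit` kills `p`.
    independent : ∀ (t p : Fin n → ℤ) → (∀ h → t (s h) ≡ t h) → (∀ h → p (f h) ≡ p h) →
      (∀ h → V′ h ≡ false → t h ≡ + 0) → (∀ h → r h ≡ true → p h ≡ + 0) →
      (∀ h → E′ h ≡ true → (t h - t (a h)) + (p h - p (a h)) ≡ + 0) →
      (∀ h → t h ≡ + 0) × (∀ h → p h ≡ + 0)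
    independent t p is ip t0 p0 eq = t≡0 , hit p ip pa p0
      where
        open ≡-Reasoning
        dt dp : Fin n → ℤ
        dt h = t h - t (a h)
        dp h = p h - p (a h)
        outside : ∀ h → E′ h ≡ false → dt h ≡ + 0
        outside h e = cong₂ _-_ (t0 h (not-true λ v → true≢false (V′⊆E′ h v) e))
          (t0 (a h) (not-true λ v → true≢false (V′⊆E′ (a h) v) (E′-a⁻ h e)))
        term : ∀ h → dt h * dt h ≡ - (dt h * dp h)
        term h with true? (E′ h)
        ... | inj₁ e = neg-square (dt h) (dp h) (eq h e)
        ... | inj₂ e rewrite outside h e = refl
        dt0 : ∀ h → dt h ≡ + 0
        dt0 h = square≡0 (dt h) (sum-nonneg-zero (λ h → 0≤-square (dt h)) (begin
          sumℤ (λ h → dt h * dt h)     ≡⟨ sum-cong term ⟩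
          sumℤ (λ h → - (dt h * dp h)) ≡⟨ sum-neg (λ h → dt h * dp h) ⟩
          - sumℤ (λ h → dt h * dp h)   ≡⟨ cong -_ (vertex⊥face t p is ip) ⟩
          + 0 ∎) h)
        t≡0 : ∀ h → t h ≡ + 0
        t≡0 h = trans (connected-const t is (λ x → sym (a-b≡0⇒a≡b (dt0 x))) h h₀) (t0 h₀ h₀∉)
        pa : ∀ h → E′ h ≡ true → p (a h) ≡ p h
        pa h e = sym (a-b≡0⇒a≡b (trans (sym (ℤP.+-identityˡ (dp h))) (trans (cong (_+ dp h) (sym (dt0 h))) (eq h e))))

    private
      m₁ : ℕ
      m₁ = n ℕ.+ n

      iV iF : Fin n → Fin m₁
      iV j = j ↑ˡ n
      iF j = n ↑ʳ j

      form : Fin n → Form m₁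
      form h = (+ 1 , iV (V.rep h)) ∷ (- + 1 , iV (V.rep (a h))) ∷ (+ 1 , iF (F.rep h)) ∷ (- + 1 , iF (F.rep (a h))) ∷ []

      one : Fin m₁ → Row m₁
      one i = rowOf ((+ 1 , i) ∷ [])

      maskE maskV maskF : Mask n
      maskE h = E.least h ∧ E′ h
      maskV h = V.least h ∧ V′ h
      maskF h = not (F.least h) ∨ r h

      rows₁ rows₂ rows₃ eqs₂ eqs : List (Row m₁)
      rows₁ = maskRows maskE (rowOf ∘ form)
      rows₂ = maskRows (not ∘ maskV) (one ∘ iV)
      rows₃ = maskRows maskF (one ∘ iF)
      eqs₂  = rows₂ ++ rows₃
      eqs   = rows₁ ++ eqs₂

      length≡ : + length eqs ≡ # maskE + ((+ n - # maskV) + # maskF)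
      length≡ = begin
        + length (rows₁ ++ eqs₂) ≡⟨ cong +_ (ListP.length-++ rows₁) ⟩
        + (length rows₁ ℕ.+ length eqs₂) ≡⟨ ℤP.pos-+ (length rows₁) (length eqs₂) ⟩
        + length rows₁ + + length (rows₂ ++ rows₃) ≡⟨ cong (λ z → + length rows₁ + + z) (ListP.length-++ rows₂) ⟩
        + length rows₁ + + (length rows₂ ℕ.+ length rows₃) ≡⟨ cong (_+_ (+ length rows₁)) (ℤP.pos-+ (length rows₂) (length rows₃)) ⟩
        + length rows₁ + (+ length rows₂ + + length rows₃)
          ≡⟨ cong₂ _+_ (len maskE (rowOf ∘ form)) (cong₂ _+_ (trans (len (not ∘ maskV) (one ∘ iV)) (#-not maskV)) (len maskF (one ∘ iF))) ⟩
        # maskE + ((+ n - # maskV) + # maskF) ∎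
        where
          open ≡-Reasoning
          len : ∀ (p : Mask n) (A : Fin n → Row m₁) → + length (maskRows p A) ≡ # p
          len p A = trans (cong +_ (maskRows-length p A)) (count≡# p)

      #maskF : # maskF ≤ (+ n - # F.least) + # r
      #maskF = subst (# maskF ≤_)
        (trans (sum-+ (λ h → 𝟙 (not (F.least h))) (λ h → 𝟙 (r h))) (cong (_+ # r) (#-not F.least)))
        (sum-mono (λ h → 𝟙-∨-≤ (not (F.least h)) (r h)))

      #maskE : + 2 * # maskE ≡ # E′
      #maskE = trans (cong (+ 2 *_) (sum-cong (λ h → 𝟙-∧ (E.least h) (E′ h))))
        (twice-edge-reps (λ h → 𝟙 (E′ h)) (λ h → cong 𝟙 (bool-ext (λ q → subst (λ z → E′ z ≡ true) (aa h) (E′-a (a h) q)) (E′-a h))))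

      no-solution : ¬ (length eqs ℕ.< m₁)
      no-solution l = let (u , (j , uj≢0) , sol) = nontrivial-solution m₁ eqs l in contra u j uj≢0 sol
        where
          module _ (u : Row m₁) (j : Fin m₁) (uj≢0 : u j ≢ + 0) (sol : All (λ r → dot r u ≡ + 0) eqs) where
            Sol : List (Row m₁) → Set
            Sol = All (λ r → dot r u ≡ + 0)
            sol₂ : Sol rows₁ × Sol eqs₂
            sol₂ = All-++⁻ rows₁ eqs₂ sol
            sol₃ : Sol rows₂ × Sol rows₃
            sol₃ = All-++⁻ rows₂ rows₃ (proj₂ sol₂)
            unit : ∀ i → dot (one i) u ≡ + 0 → u i ≡ + 0
            unit i e = trans (sym (unit-form i u)) (trans (sym (dot-rowOf ((+ 1 , i) ∷ []) u)) e)
            t p : Fin n → ℤ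
            t h = u (iV (V.rep h))
            p h = u (iF (F.rep h))
            is : ∀ h → t (s h) ≡ t h
            is h = cong (u ∘ iV) (sym (V.rep-cong (V.~-f h)))
            ip : ∀ h → p (f h) ≡ p h
            ip h = cong (u ∘ iF) (sym (F.rep-cong (F.~-f h)))
            uV0 : ∀ k → maskV k ≡ false → u (iV k) ≡ + 0
            uV0 k e = unit (iV k) (maskRows-All (not ∘ maskV) (one ∘ iV) (proj₁ sol₃) k (not-true⁺ e))
            uF0 : ∀ k → maskF k ≡ true → u (iF k) ≡ + 0
            uF0 k e = unit (iF k) (maskRows-All maskF (one ∘ iF) (proj₂ sol₃) k e)
            V′-rep : ∀ h → V′ (V.rep h) ≡ V′ h
            V′-rep h = V.~-const V′ (V.mask-const V′ V′-s) (V.rep-~ h)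
            t0 : ∀ h → V′ h ≡ false → t h ≡ + 0
            t0 h e = uV0 (V.rep h) (not-true λ q → true≢false (proj₂ (∧-true⁻ {V.least (V.rep h)} q)) (trans (V′-rep h) e))
            p0 : ∀ h → r h ≡ true → p h ≡ + 0
            p0 h e = trans (cong (u ∘ iF) (F.rep-fix (r-least h e))) (uF0 h (∨-trueʳ {not (F.least h)} e))
            row : ∀ h → maskE h ≡ true → (t h - t (a h)) + (p h - p (a h)) ≡ + 0
            row h e = trans (sym (rank-row (t h) (t (a h)) (p h) (p (a h))))
              (trans (sym (dot-rowOf (form h) u)) (maskRows-All maskE (rowOf ∘ form) (proj₁ sol₂) h e))
            flip′ : ∀ x x′ y y′ → (x′ - x) + (y′ - y) ≡ + 0 → (x - x′) + (y - y′) ≡ + 0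
            flip′ x x′ y y′ e = trans (neg-both x x′ y y′) (cong -_ e)
              where
                neg-both : ∀ x x′ y y′ → (x - x′) + (y - y′) ≡ - ((x′ - x) + (y′ - y))
                neg-both = solve-∀
            eq : ∀ h → E′ h ≡ true → (t h - t (a h)) + (p h - p (a h)) ≡ + 0
            eq h e = [ (λ q → subst (λ z → (t z - t (a z)) + (p z - p (a z)) ≡ + 0) q
              (row (E.rep h) (∧-true⁺ rl (subst (λ z → E′ z ≡ true) (sym q) e))))
                     , (λ q → flip′ (t h) (t (a h)) (p h) (p (a h))
                         (subst (λ z → (t (E.rep h) - t z) + (p (E.rep h) - p z) ≡ + 0) q
                           (row (E.rep h) (∧-true⁺ rl (subst (λ z → E′ z ≡ true) (rep≡ q) (E′-a h e)))) ⟪ rep≡ q ⟫)) ]′ (E.rep-~ h)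
              where
                rl : E.least (E.rep h) ≡ true
                rl = ⌊⌋-true⁺ (E.least? (E.rep h)) (E.rep-least h)
                rep≡ : a (E.rep h) ≡ h → a h ≡ E.rep h
                rep≡ q = trans (cong a (sym q)) (aa (E.rep h))
                _⟪_⟫ : (t (E.rep h) - t h) + (p (E.rep h) - p h) ≡ + 0 → a h ≡ E.rep h → (t (a h) - t h) + (p (a h) - p h) ≡ + 0
                x ⟪ y ⟫ = subst (λ z → (t z - t h) + (p z - p h) ≡ + 0) (sym y) x
            ind : (∀ h → t h ≡ + 0) × (∀ h → p h ≡ + 0)
            ind = independent t p is ip t0 p0 eq
            vertex : ∀ k → (maskV k ≡ true) ⊎ (maskV k ≡ false) → u (iV k) ≡ + 0
            vertex k (inj₂ e) = uV0 k e
            vertex k (inj₁ e) = trans (cong (u ∘ iV) (sym (V.rep-fix (⌊⌋-true⁻ (V.least? k) (proj₁ (∧-true⁻ e)))))) (proj₁ ind k)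
            face : ∀ k → (F.least k ≡ true) ⊎ (F.least k ≡ false) → u (iF k) ≡ + 0
            face k (inj₂ e) = uF0 k (∨-trueˡ {not (F.least k)} (not-true⁺ e))
            face k (inj₁ e) = trans (cong (u ∘ iF) (sym (F.rep-fix (⌊⌋-true⁻ (F.least? k) e)))) (proj₂ ind k)
            contra : ⊥
            contra = [ (λ { (k , e) → uj≢0 (trans (cong u e) (vertex k (true? (maskV k)))) })
                     , (λ { (k , e) → uj≢0 (trans (cong u e) (face k (true? (F.least k)))) }) ]′ (↑-cases n j)

    -- Fewer edges would leave a nontrivial solution, against `independent`. In the dual graph it
    -- says that the components number at least vertices of `V′` plus faces minus edges of `E′`.
    rank-bound : + 2 * (# (λ h → V.least h ∧ V′ h) + # F.least) ≤ # E′ + + 2 * # r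
    rank-bound = bound (# maskE) (# maskV) (# F.least) (# maskF) (# r) (+ n) (+ length eqs) length≡ #maskF
      (subst (_≤ + length eqs) (ℤP.pos-+ n n) (+≤+ (ℕP.≮⇒≥ no-solution))) #maskE
      where
        bound : ∀ e v f m r n l {E} → l ≡ e + ((n - v) + m) → m ≤ (n - f) + r → n + n ≤ l → + 2 * e ≡ E → + 2 * (v + f) ≤ E + + 2 * r
        bound e v f m r n l refl q c refl = ≤-by (+ 2 * (e + ((n - v) + m) - (n + n)) + + 2 * (((n - f) + r) - m))
          (0≤+ (0≤k* 2 (0≤- c)) (0≤k* 2 (0≤- q))) (lemma e v f m r n)
          where
            lemma : ∀ e v f m r n → + 2 * e + + 2 * r ≡ + 2 * (v + f) + (+ 2 * (e + ((n - v) + m) - (n + n)) + + 2 * (((n - f) + r) - m))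
            lemma = solve-∀

-- Cycles

private
  neg-swap : ∀ x y → x - y ≡ - (y - x)
  neg-swap = solve-∀

top-view : ∀ {m} (j : Fin (suc m)) → (∃ λ i → j ≡ inject₁ i) ⊎ (j ≡ fromℕ m)
top-view {zero}  zero    = inj₂ refl
top-view {suc m} zero    = inj₁ (zero , refl)
top-view {suc m} (suc j) with top-view j
... | inj₁ (i , e) = inj₁ (suc i , cong suc e)
... | inj₂ e       = inj₂ (cong suc e)

fin-const : ∀ {m} {A : Set} (v : Fin (suc m) → A) → (∀ i → v (suc i) ≡ v (inject₁ i)) → ∀ j → v j ≡ v zero
fin-const {m}     v e zero    = refl
fin-const {suc m} v e (suc j) = trans (fin-const (v ∘ suc) (λ i → e (suc i)) j) (e zero)

-- Stopping at the first repeated class makes the cycle between the two visits simple.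
module FirstRepeat {n : ℕ} (_~_ : Fin n → Fin n → Set) (_~?_ : ∀ x y → Dec (x ~ y)) (~-refl : ∀ x → x ~ x)
  (q : ℕ → Fin n) where

  NoRepeat : ℕ → Set
  NoRepeat j = ∀ i k → i ℕ.< k → k ℕ.< j → ¬ (q i ~ q k)

  Repeat : Set
  Repeat = ∃ λ j → NoRepeat j × ∃ λ i → (i ℕ.< j) × (q i ~ q j)

  search : ∀ j → Repeat ⊎ NoRepeat j
  search zero = inj₂ (λ i k _ ())
  search (suc j) with search j
  ... | inj₁ r = inj₁ r
  ... | inj₂ nr with FinP.any? (λ (i : Fin j) → q (toℕ i) ~? q j)
  ...   | yes (i , e) = inj₁ (j , nr , toℕ i , FinP.toℕ<n i , e)
  ...   | no ¬e = inj₂ extend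
    where
      extend : NoRepeat (suc j)
      extend i k i<k k<sj e with ℕP.m≤n⇒m<n∨m≡n (ℕP.≤-pred k<sj)
      ... | inj₁ k<j  = nr i k i<k k<j e
      ... | inj₂ refl = ¬e (fromℕ< i<k , subst (λ z → q z ~ q j) (sym (FinP.toℕ-fromℕ< i<k)) e)

  first-repeat : Repeat
  first-repeat with search (suc n)
  ... | inj₁ r = r
  ... | inj₂ nr with FinP.pigeonhole ℕP.≤-refl (λ (i : Fin (suc n)) → q (toℕ i))
  ...   | i , k , i<k , e = ⊥-elim (nr (toℕ i) (toℕ k) i<k (FinP.toℕ<n k) (subst (q (toℕ i) ~_) e (~-refl _)))

module Cycles (M : PlaneMap) where
  open Rank M public

  -- The boundary of a union of faces as a signed chain: 1 where `S` lies only on the left, -1 where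
  -- it lies only on the right.
  jump : Mask n → Fin n → ℤ
  jump S h = 𝟙 (S h) - 𝟙 (S (a h))

  jump-a : ∀ S h → jump S (a h) ≡ - jump S h
  jump-a S h = trans (cong (λ z → 𝟙 (S (a h)) - 𝟙 (S z)) (aa h)) (neg-swap (𝟙 (S (a h))) (𝟙 (S h)))

  FaceMask : Mask n → Set
  FaceMask S = ∀ h → S h ≡ true → S (f h) ≡ true

  -- Shifting the second half of the sum by `s` replaces `a g` by `f g`, which lies in the face of
  -- `g`, and the two halves cancel.
  jump-balanced : ∀ S → FaceMask S → ∀ r → V.class-sum (jump S) r ≡ + 0
  jump-balanced S c r = begin
    sumℤ (λ g → V.[ r ~ g ] * (𝟙 (S g) - 𝟙 (S (a g))))
      ≡⟨ sum-cong (λ g → distrib V.[ r ~ g ] (𝟙 (S g)) (𝟙 (S (a g)))) ⟩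
    sumℤ (λ g → V.[ r ~ g ] * 𝟙 (S g) - V.[ r ~ g ] * 𝟙 (S (a g)))
      ≡⟨ sum-sub (λ g → V.[ r ~ g ] * 𝟙 (S g)) (λ g → V.[ r ~ g ] * 𝟙 (S (a g))) ⟩
    V.class-sum (𝟙 ∘ S) r - V.class-sum (𝟙 ∘ S ∘ a) r
      ≡⟨ cong (_-_ (V.class-sum (𝟙 ∘ S) r)) (sym (V.class-sum-shift (𝟙 ∘ S ∘ a) r)) ⟩
    V.class-sum (𝟙 ∘ S) r - V.class-sum (λ g → 𝟙 (S (f g))) r
      ≡⟨ cong (_-_ (V.class-sum (𝟙 ∘ S) r)) (sum-cong (λ g → cong (λ z → V.[ r ~ g ] * 𝟙 z) (F.mask-const S c g))) ⟩
    V.class-sum (𝟙 ∘ S) r - V.class-sum (𝟙 ∘ S) r ≡⟨ ℤP.+-inverseʳ (V.class-sum (𝟙 ∘ S) r) ⟩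
    + 0 ∎
    where
      open ≡-Reasoning
      distrib : ∀ x y z → x * (y - z) ≡ x * y - x * z
      distrib x y z = trans (ℤP.*-distribˡ-+ x y (- z)) (cong (_+_ (x * y)) (sym (ℤP.neg-distribʳ-* x z)))

  -- `s` is `a` after `f`, so a union of faces closed under `a` would be closed under both `s` and
  -- `a`, hence everything by connectedness.
  frontier : ∀ S → FaceMask S → ∀ {x y} → S x ≡ true → S y ≡ false → ∃ λ h → (S h ≡ true) × (S (a h) ≡ false)
  frontier S c {x} {y} sx sy with FinP.any? (λ h → (S h ≟ᵇ true) ×-dec (S (a h) ≟ᵇ false))
  ... | yes e = e
  ... | no ¬e = ⊥-elim (true≢false (connected-ind (λ z → S z ≡ true) cs ca x y sx) sy)
    where
      ca : ∀ z → S z ≡ true → S (a z) ≡ true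
      ca z p = not-false (λ q → ¬e (z , p , q))
      cs : ∀ z → S z ≡ true → S (s z) ≡ true
      cs z p = subst (λ z → S z ≡ true) (aa (s z)) (ca (f z) (c z p))

  module _ (R : Mask n) (R-f : FaceMask R) where

    -- The half-edge `a h` contributes -1 to the balanced sum of `jump R` at its vertex, so another
    -- one there contributes 1.
    next-boundary : ∀ h → R h ≡ true → R (a h) ≡ false →
      ∃ λ g → SameVertex M (a h) g × (R g ≡ true) × (R (a g) ≡ false)
    next-boundary h rh rah with FinP.any? (λ g → sameVertex? M (a h) g ×-dec (R g ≟ᵇ true) ×-dec (R (a g) ≟ᵇ false))
    ... | yes e = e
    ... | no ¬e = ⊥-elim (-1≢0 (trans (sym value) (sum-nonneg-zero-neg here)))
      where
        -1≢0 : - + 1 ≢ + 0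
        -1≢0 ()
        term : Fin n → ℤ
        term g = V.[ a h ~ g ] * jump R g
        term≤0 : ∀ g → + 0 ≤ - term g
        term≤0 g = sign (sameVertex? M (a h) g) (true? (R g)) (true? (R (a g)))
          where
            sign : (d : Dec (SameVertex M (a h) g)) → (R g ≡ true) ⊎ (R g ≡ false) → (R (a g) ≡ true) ⊎ (R (a g) ≡ false) →
              + 0 ≤ - (𝟙 ⌊ d ⌋ * jump R g)
            sign (no _) _ _ rewrite ℤP.*-zeroˡ (jump R g) = ℤP.≤-refl
            sign (yes p) (inj₁ x) (inj₂ y) = ⊥-elim (¬e (g , p , x , y))
            sign (yes p) (inj₁ x) (inj₁ y) rewrite x | y = ℤP.≤-refl
            sign (yes p) (inj₂ x) (inj₁ y) rewrite x | y = +≤+ ℕ.z≤n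
            sign (yes p) (inj₂ x) (inj₂ y) rewrite x | y = ℤP.≤-refl
        here : - term (a h) ≡ + 0
        here = sum-nonneg-zero term≤0 (trans (sum-neg term) (cong -_ (jump-balanced R R-f (a h)))) (a h)
        sum-nonneg-zero-neg : - term (a h) ≡ + 0 → term (a h) ≡ + 0
        sum-nonneg-zero-neg e = trans (sym (ℤP.neg-involutive (term (a h)))) (cong -_ e)
        value : term (a h) ≡ - + 1
        value = trans (cong₂ _*_ (V.[]-yes (V.~-refl (a h))) (trans (jump-a R h) (cong -_ (cong₂ (λ x y → 𝟙 x - 𝟙 y) rh rah)))) refl

    Boundary : Set
    Boundary = ∃ λ h → (R h ≡ true) × (R (a h) ≡ false)

    follow : Boundary → Boundary
    follow (h , p , q) = let (g , _ , rg , rag) = next-boundary h p q in g , rg , rag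

    follow-~ : ∀ b → SameVertex M (a (proj₁ b)) (proj₁ (follow b))
    follow-~ (h , p , q) = proj₁ (proj₂ (next-boundary h p q))

    walk : Boundary → ℕ → Boundary
    walk b zero    = b
    walk b (suc k) = follow (walk b k)

    boundary-cycle : Boundary → ∃ λ m → ∃ λ hs → IsCycle M m hs × (∀ i → (R (hs i) ≡ true) × (R (a (hs i)) ≡ false))
    boundary-cycle b = build first-repeat
      where
        q : ℕ → Fin n
        q k = proj₁ (walk b k)
        open FirstRepeat (SameVertex M) (sameVertex? M) V.~-refl q
        build : Repeat → ∃ λ m → ∃ λ hs → IsCycle M m hs × (∀ i → (R (hs i) ≡ true) × (R (a (hs i)) ≡ false))
        build (j , nr , i , i<j , e) = m , hs , record { step = step ; close = close ; vdist = vdist ; edist = edist } , side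
          where
            m : ℕ
            m = j ℕ.∸ suc i
            j≡ : suc (i ℕ.+ m) ≡ j
            j≡ = ℕP.m+[n∸m]≡n i<j
            hs : Fin (suc m) → Fin n
            hs k = q (i ℕ.+ toℕ k)
            side : ∀ k → (R (hs k) ≡ true) × (R (a (hs k)) ≡ false)
            side k = proj₂ (walk b (i ℕ.+ toℕ k))
            link : ∀ k → SameVertex M (a (q k)) (q (suc k))
            link k = follow-~ (walk b k)
            step : ∀ (k : Fin m) → SameVertex M (a (hs (inject₁ k))) (hs (suc k))
            step k = subst₂ (λ x y → SameVertex M (a (q x)) (q y)) (cong (i ℕ.+_) (sym (FinP.toℕ-inject₁ k)))
              (sym (ℕP.+-suc i (toℕ k))) (link (i ℕ.+ toℕ k))
            close : SameVertex M (a (hs (fromℕ m))) (hs zero)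
            close = V.~-trans (subst₂ (λ x y → SameVertex M (a (q x)) (q y)) (cong (i ℕ.+_) (sym (FinP.toℕ-fromℕ m)))
              j≡ (link (i ℕ.+ m))) (V.~-sym (subst (λ z → SameVertex M (q z) (q j)) (sym (ℕP.+-identityʳ i)) e))
            small : ∀ (k : Fin (suc m)) → i ℕ.+ toℕ k ℕ.< j
            small k = subst (i ℕ.+ toℕ k ℕ.<_) j≡ (ℕ.s≤s (ℕP.+-monoʳ-≤ i (ℕP.≤-pred (FinP.toℕ<n k))))
            vdist : ∀ k l → SameVertex M (hs k) (hs l) → k ≡ l
            vdist k l v with ℕP.<-cmp (toℕ k) (toℕ l)
            ... | tri< k<l _ _ = ⊥-elim (nr _ _ (ℕP.+-monoʳ-< i k<l) (small l) v)
            ... | tri≈ _ k≡l _ = FinP.toℕ-injective k≡l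
            ... | tri> _ _ l<k = ⊥-elim (nr _ _ (ℕP.+-monoʳ-< i l<k) (small k) (V.~-sym v))
            -- The walk has `R` on its left and not on its right, so no edge is walked in both
            -- directions.
            edist : ∀ k l → hs k ≢ a (hs l)
            edist k l v = true≢false (trans (cong R (sym v)) (proj₁ (side k))) (proj₂ (side l))

  -- A representative for notions of the map alone, such as `DualStep` and `SimpleOuterContour`.
  -- These unfold to the same type for every biorientation, so results for `w₀` apply to all.
  w₀ : ZBiorientation M
  w₀ _ = + 0

  module Cycle {m : ℕ} {hs : Fin (suc m) → Fin n} (cyc : IsCycle M m hs) where
    open IsCycle cyc

    onCycle? : ∀ x → Dec (OnCycle M w₀ hs x)
    onCycle? x = FinP.any? (λ i → (x FinP.≟ hs i) ⊎-dec (x FinP.≟ a (hs i)))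

    onC onV : Mask n
    onC x = ⌊ onCycle? x ⌋
    onV x = ⌊ FinP.any? (λ i → sameVertex? M x (hs i)) ⌋

    hs-injective : ∀ {i j} → hs i ≡ hs j → i ≡ j
    hs-injective {i} {j} e = vdist i j (subst (SameVertex M (hs i)) e (V.~-refl (hs i)))

    succ : ∀ j → ∃ λ k → SameVertex M (a (hs j)) (hs k)
    succ j with top-view j
    ... | inj₁ (i , refl) = suc i , step i
    ... | inj₂ refl       = zero , close

    pred-unique : ∀ i j → SameVertex M (a (hs j)) (hs (suc i)) → j ≡ inject₁ i
    pred-unique i j v with top-view j
    ... | inj₁ (k , refl) = cong inject₁ (FinP.suc-injective (vdist _ _ (V.~-trans (V.~-sym (step k)) v)))
    ... | inj₂ refl with vdist _ _ (V.~-trans (V.~-sym close) v)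
    ...   | ()

    OnCycle-a : ∀ {x} → OnCycle M w₀ hs x → OnCycle M w₀ hs (a x)
    OnCycle-a (i , inj₁ refl) = i , inj₂ refl
    OnCycle-a (i , inj₂ refl) = i , inj₁ (aa (hs i))

    OnCycle⇒onV : ∀ {x} → OnCycle M w₀ hs x → onV x ≡ true
    OnCycle⇒onV {x} (i , inj₁ refl) = ⌊⌋-true⁺ (FinP.any? (λ j → sameVertex? M x (hs j))) (i , V.~-refl x)
    OnCycle⇒onV {x} (i , inj₂ refl) = ⌊⌋-true⁺ (FinP.any? (λ j → sameVertex? M x (hs j))) (succ i)

    onV-s : ∀ h → onV h ≡ true → onV (s h) ≡ true
    onV-s h e with ⌊⌋-true⁻ (FinP.any? (λ j → sameVertex? M h (hs j))) e
    ... | i , v = ⌊⌋-true⁺ (FinP.any? (λ j → sameVertex? M (s h) (hs j))) (i , V.~-trans (V.~-sym (V.~-f h)) v)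

    onC-δ : ∀ h → 𝟙 (onC h) ≡ sumℤ (λ i → δ (hs i) h) + sumℤ (λ i → δ (a (hs i)) h)
    onC-δ h with onCycle? h
    ... | yes (i , inj₁ refl) = sym (cong₂ _+_
            (trans (sum-single i (λ j → δ (hs j) (hs i)) (λ j j≢ → δ-≢ (j≢ ∘ hs-injective))) (δ-refl (hs i)))
            (sum-zero (λ j → δ-≢ (λ e → edist i j (sym e)))))
    ... | yes (i , inj₂ refl) = sym (cong₂ _+_ (sum-zero (λ j → δ-≢ (edist j i)))
            (trans (sum-single i (λ j → δ (a (hs j)) (a (hs i))) (λ j j≢ → δ-≢ (j≢ ∘ hs-injective ∘ a-injective))) (δ-refl (a (hs i)))))
    ... | no ¬c = sym (cong₂ _+_ (sum-zero (λ j → δ-≢ (λ e → ¬c (j , inj₁ (sym e))))) (sum-zero (λ j → δ-≢ (λ e → ¬c (j , inj₂ (sym e))))))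

    sum-δ-index : ∀ (g : Fin (suc m) → Fin n) → sumℤ (λ h → sumℤ (λ i → δ (g i) h)) ≡ + suc m
    sum-δ-index g = trans (sum-swap (λ h i → δ (g i) h))
      (trans (sum-cong (λ i → trans (sum-cong (λ h → sym (ℤP.*-identityʳ (δ (g i) h)))) (sum-δ (g i) (λ _ → + 1)))) (#-all {suc m}))

    #onC : # onC ≡ + suc m + + suc m
    #onC = trans (sum-cong onC-δ) (trans (sum-+ (λ h → sumℤ (λ i → δ (hs i) h)) (λ h → sumℤ (λ i → δ (a (hs i)) h)))
      (cong₂ _+_ (sum-δ-index hs) (sum-δ-index (λ i → a (hs i)))))

    onV-sum : ∀ r → V.class-sum (λ h → sumℤ (λ i → δ (hs i) h)) r ≡ 𝟙 (onV r)
    onV-sum r = begin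
      sumℤ (λ g → V.[ r ~ g ] * sumℤ (λ i → δ (hs i) g))   ≡⟨ sum-cong (λ g → trans (sym (sum-* V.[ r ~ g ] (λ i → δ (hs i) g)))
        (sum-cong (λ i → ℤP.*-comm V.[ r ~ g ] (δ (hs i) g)))) ⟩
      sumℤ (λ g → sumℤ (λ i → δ (hs i) g * V.[ r ~ g ]))   ≡⟨ sum-swap (λ g i → δ (hs i) g * V.[ r ~ g ]) ⟩
      sumℤ (λ i → sumℤ (λ g → δ (hs i) g * V.[ r ~ g ]))   ≡⟨ sum-cong (λ i → sum-δ (hs i) (λ g → V.[ r ~ g ])) ⟩
      sumℤ (λ i → V.[ r ~ hs i ])                          ≡⟨ indicator (FinP.any? (λ i → sameVertex? M r (hs i))) ⟩
      𝟙 (onV r) ∎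
      where
        open ≡-Reasoning
        indicator : (d : Dec (∃ λ i → SameVertex M r (hs i))) → sumℤ (λ i → V.[ r ~ hs i ]) ≡ 𝟙 ⌊ d ⌋
        indicator (yes (i , v)) = trans (sum-single i (λ j → V.[ r ~ hs j ]) (λ j j≢ → V.[]-no
          (λ u → j≢ (vdist j i (V.~-trans (V.~-sym u) v))))) (V.[]-yes v)
        indicator (no ¬v) = sum-zero (λ i → V.[]-no (λ v → ¬v (i , v)))

    #onV : # (λ h → V.least h ∧ onV h) ≡ + suc m
    #onV = trans (sum-cong (λ r → trans (𝟙-∧ (V.least r) (onV r)) (cong (𝟙 (V.least r) *_) (sym (onV-sum r)))))
      (trans (sym (V.sum-by-class (λ h → sumℤ (λ i → δ (hs i) h)))) (sum-δ-index hs))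

    -- `S` is the outside of the cycle, in the sense in which `Interior` is defined.
    module Side (S : Mask n) (S-root : S root ≡ true)
      (S-reach : ∀ x → S x ≡ true → Star (DualStep M w₀ hs) root x)
      (S-closed : ∀ x y → S x ≡ true → DualStep M w₀ hs x y → S y ≡ true) where

      S-f : FaceMask S
      S-f h e = S-closed h (f h) e (inj₁ refl)

      S-a : ∀ {h} → ¬ OnCycle M w₀ hs h → S (a h) ≡ S h
      S-a {h} ¬c = bool-ext
        (λ p → subst (λ z → S z ≡ true) (aa h) (S-closed (a h) (a (a h)) p
          (inj₂ ((λ c → ¬c (subst (OnCycle M w₀ hs) (aa h) (OnCycle-a c))) , refl))))
        (λ p → S-closed h (a h) p (inj₂ (¬c , refl)))

      S-s : ∀ h → onV h ≡ false → S (s h) ≡ S h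
      S-s h e = trans (sym (S-a {s h} (λ c → true≢false (OnCycle⇒onV c) (not-true (λ q → true≢false (subst (λ z → onV z ≡ true)
        (s⁻s h) (V.mask-inverse onV onV-s (s h) q)) e)))))
        (F.mask-const S S-f h)

      Vout Vin Eout Ein Fin′ : Mask n
      Vout h = not (onV h) ∧ S h
      Vin  h = not (onV h) ∧ not (S h)
      Eout h = not (onC h) ∧ S h
      Ein  h = not (onC h) ∧ not (S h)
      Fin′ h = F.least h ∧ not (S h)

      private
        r : Mask n
        -- The outside faces are joined to the root face across edges off the cycle, so the root
        -- face and all inside faces together meet every component.
        r h = ⌊ F.rep root FinP.≟ h ⌋ ∨ Fin′ h

        ¬onC : ∀ {h} → onC h ≡ false → ¬ OnCycle M w₀ hs h
        ¬onC {h} e = ⌊⌋-false⁻ (onCycle? h) e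

        V-s : ∀ h → Vout h ≡ true → Vout (s h) ≡ true
        V-s h e with ∧-true⁻ {not (onV h)} e
        ... | p , q = ∧-true⁺ (trans (cong not (V.mask-const onV onV-s h)) p) (trans (S-s h (not-true⁻ p)) q)

        E-a : ∀ h → Eout h ≡ true → Eout (a h) ≡ true
        E-a h e with ∧-true⁻ {not (onC h)} e
        ... | p , q = ∧-true⁺ (not-true⁺ (⌊⌋-false⁺ (onCycle? (a h)) (λ c → ¬onC (not-true⁻ p) (subst (OnCycle M w₀ hs) (aa h)
            (OnCycle-a c)))))
                        (trans (S-a (¬onC (not-true⁻ p))) q)

        V⊆E : ∀ h → Vout h ≡ true → Eout h ≡ true
        V⊆E h e with ∧-true⁻ {not (onV h)} e
        ... | p , q = ∧-true⁺ (not-true⁺ (⌊⌋-false⁺ (onCycle? h) (λ c → true≢false (OnCycle⇒onV c) (not-true⁻ p)))) q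

        r-least : ∀ h → r h ≡ true → F.Least h
        r-least h e with ∨-true⁻ {⌊ F.rep root FinP.≟ h ⌋} e
        ... | inj₁ p = subst F.Least (⌊⌋-true⁻ (F.rep root FinP.≟ h) p) (F.rep-least root)
        ... | inj₂ p = ⌊⌋-true⁻ (F.least? h) (proj₁ (∧-true⁻ {F.least h} p))

        hit : ∀ (p : Fin n → ℤ) → (∀ h → p (f h) ≡ p h) → (∀ h → Eout h ≡ true → p (a h) ≡ p h) →
          (∀ h → r h ≡ true → p h ≡ + 0) → ∀ h → p h ≡ + 0
        hit p ip ia p0 h = [ (λ e → trans (along (S-reach h e) S-root) root0) , inside ]′ (true? (S h))
          where
            root0 : p root ≡ + 0
            root0 = trans (sym (F.~-const p ip (F.rep-~ root))) (p0 (F.rep root) (∨-trueˡ (⌊⌋-true⁺ (F.rep root FinP.≟ F.rep root) refl)))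
            along : ∀ {x y} → Star (DualStep M w₀ hs) x y → S x ≡ true → p y ≡ p x
            along ε _ = refl
            along (inj₁ refl ◅ st) e = trans (along st (S-f _ e)) (ip _)
            along {x} (inj₂ (¬c , refl) ◅ st) e = trans (along st (trans (S-a ¬c) e))
              (ia _ (∧-true⁺ (not-true⁺ (⌊⌋-false⁺ (onCycle? x) ¬c)) e))
            inside : S h ≡ false → p h ≡ + 0
            inside e = trans (sym (F.~-const p ip (F.rep-~ h))) (p0 (F.rep h) (∨-trueʳ {⌊ F.rep root FinP.≟ F.rep h ⌋}
              (∧-true⁺ (⌊⌋-true⁺ (F.least? (F.rep h)) (F.rep-least h)) (not-true⁺ (trans (F.~-const S (F.mask-const S S-f)
                (F.rep-~ h)) e)))))

        hs₀∉ : Vout (hs zero) ≡ false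
        hs₀∉ = cong (λ z → not z ∧ S (hs zero)) (OnCycle⇒onV (zero , inj₁ refl))

        outer-bound : + 2 * (# (λ h → V.least h ∧ Vout h) + # F.least) ≤ # Eout + + 2 * # r
        outer-bound = rank-bound Vout Eout r V-s E-a V⊆E (hs zero) hs₀∉ r-least hit

        #r : # r ≤ + 1 + # Fin′
        #r = subst (# r ≤_) (trans (sum-+ (λ h → 𝟙 ⌊ F.rep root FinP.≟ h ⌋) (λ h → 𝟙 (Fin′ h))) (cong (_+ # Fin′) (#-pick (F.rep root))))
          (sum-mono (λ h → 𝟙-∨-≤ ⌊ F.rep root FinP.≟ h ⌋ (Fin′ h)))

        #V : # V.least ≡ + suc m + (# (λ h → V.least h ∧ Vout h) + # (λ h → V.least h ∧ Vin h))
        #V = trans (#-split V.least onV) (cong₂ _+_ #onV (trans (#-split (λ h → V.least h ∧ not (onV h)) S)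
          (cong₂ _+_ (sum-cong (λ h → cong 𝟙 (∧-assoc (V.least h) (not (onV h)) (S h))))
            (sum-cong (λ h → cong 𝟙 (∧-assoc (V.least h) (not (onV h)) (not (S h))))))))

        #E : + n ≡ (+ suc m + + suc m) + (# Eout + # Ein)
        #E = trans (sym (#-all {n})) (trans (#-split (λ _ → true) onC) (cong₂ _+_ #onC (#-split (λ h → not (onC h)) S)))

      -- `rank-bound` gives an upper bound for the outside; subtracted from Euler's formula for the
      -- whole map it is a lower bound for the inside. The cycle drops out, having as many vertices
      -- as edges.
      inner-euler : # Ein + + 2 ≤ + 2 * (# (λ h → V.least h ∧ Vin h) + # Fin′)
      inner-euler = arith (# V.least) (# (λ h → V.least h ∧ Vout h)) (# (λ h → V.least h ∧ Vin h)) (# F.least) (# Eout) (# Ein)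
        (# r) (# Fin′) (+ suc m) (+ n)
        #V #E euler outer-bound #r
        where
          arith : ∀ v vo vi f eo ei r fi k n → v ≡ k + (vo + vi) → n ≡ (k + k) + (eo + ei) → + 2 * (v + f) ≡ n + + 4 →
            + 2 * (vo + f) ≤ eo + + 2 * r → r ≤ + 1 + fi → ei + + 2 ≤ + 2 * (vi + fi)
          arith v vo vi f eo ei r fi k n refl refl eu b c = ≤-by ((eo + + 2 * r - + 2 * (vo + f)) + + 2 * ((+ 1 + fi) - r))
            (0≤+ (0≤- b) (0≤k* 2 (0≤- c)))
            (trans (lemma₁ vo vi fi f k) (trans (cong (λ z → z + (+ 2 * fi - + 2 * vo - + 2 * f - + 2 * k)) eu) (lemma₂ vo fi f k eo ei r)))
            where
              lemma₁ : ∀ vo vi fi f k → + 2 * (vi + fi) ≡ + 2 * ((k + (vo + vi)) + f) + (+ 2 * fi - + 2 * vo - + 2 * f - + 2 * k)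
              lemma₁ = solve-∀
              lemma₂ : ∀ vo fi f k eo ei r → ((k + k) + (eo + ei) + + 4) + (+ 2 * fi - + 2 * vo - + 2 * f - + 2 * k) ≡
                (ei + + 2) + ((eo + + 2 * r - + 2 * (vo + f)) + + 2 * ((+ 1 + fi) - r))
              lemma₂ = solve-∀

      private
        inside-exists : ∃ λ h → S h ≡ false
        inside-exists with FinP.any? (λ h → S h ≟ᵇ false)
        ... | yes e = e
        -- With nothing inside, the right-hand side of `inner-euler` would be 0 and its left-hand
        -- side at least 2: a cycle separates.
        ... | no ¬e = ⊥-elim (≤<-absurd inner-euler (subst (_< # Ein + + 2) (sym empty) positive))
          where
            none : ∀ h → not (S h) ≡ false
            none h = cong not (not-false (λ e → ¬e (h , e)))
            zero′ : ∀ (p : Mask n) → # (λ h → p h ∧ not (S h)) ≡ + 0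
            zero′ p = sum-zero (λ h → cong 𝟙 (not-true (λ e → true≢false (proj₂ (∧-true⁻ {p h} e)) (none h))))
            empty : + 2 * (# (λ h → V.least h ∧ Vin h) + # Fin′) ≡ + 0
            empty = cong (+ 2 *_)
              (cong₂ _+_ (sum-zero
              (λ h → cong 𝟙 (not-true (λ e → true≢false (proj₂ (∧-true⁻ {not (onV h)} (proj₂ (∧-true⁻ {V.least h} e))))
              (none h))))) (zero′ F.least))
            positive : + 0 < # Ein + + 2
            positive = ℤP.<-≤-trans (+<+ (ℕ.s≤s ℕ.z≤n)) (ℤP.+-monoˡ-≤ (+ 2) (sum-nonneg (λ h → 0≤𝟙 (Ein h))))

        jump-off : ∀ {g} → ¬ OnCycle M w₀ hs g → jump S g ≡ + 0
        jump-off {g} ¬c = trans (cong (λ z → 𝟙 (S g) - 𝟙 z) (S-a ¬c)) (ℤP.+-inverseʳ (𝟙 (S g)))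

        -- `jump S` vanishes off the cycle, so at the vertex between two consecutive cycle edges
        -- only these two contribute to the balanced sum.
        jump-along : ∀ i → jump S (hs (suc i)) ≡ jump S (hs (inject₁ i))
        jump-along i = a-b≡0⇒a≡b (begin
          jump S y - jump S x              ≡⟨ cong (_+_ (jump S y)) (sym (jump-a S x)) ⟩
          jump S y + jump S (a x)          ≡⟨ cong₂ _+_ (sym (sum-δ y (jump S))) (sym (sum-δ (a x) (jump S))) ⟩
          sumℤ (λ g → δ y g * jump S g) + sumℤ (λ g → δ (a x) g * jump S g) ≡⟨ sym (sum-+ (λ g → δ y g * jump S g)
            (λ g → δ (a x) g * jump S g)) ⟩
          sumℤ (λ g → δ y g * jump S g + δ (a x) g * jump S g) ≡⟨ sum-cong (λ g → sym (term g (onCycle? g))) ⟩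
          V.class-sum (jump S) y           ≡⟨ jump-balanced S S-f y ⟩
          + 0 ∎)
          where
            open ≡-Reasoning
            x y : Fin n
            x = hs (inject₁ i)
            y = hs (suc i)
            combine : ∀ {b} c d v → b ≡ c + d → b * v ≡ c * v + d * v
            combine c d v refl = ℤP.*-distribʳ-+ v c d
            term : ∀ g → Dec (OnCycle M w₀ hs g) → V.[ y ~ g ] * jump S g ≡ δ y g * jump S g + δ (a x) g * jump S g
            term g (no ¬c) rewrite jump-off ¬c = trans (ℤP.*-zeroʳ V.[ y ~ g ]) (sym (cong₂ _+_ (ℤP.*-zeroʳ (δ y g))
              (ℤP.*-zeroʳ (δ (a x) g))))
            term g (yes (j , inj₁ refl)) = combine (δ y g) (δ (a x) g) (jump S g)
              (trans (cong 𝟙 (⌊⌋-cong (sameVertex? M y (hs j)) (y FinP.≟ hs j)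
                (λ v → cong hs (vdist _ _ v)) (λ e → subst (SameVertex M y) e (V.~-refl y))))
              (sym (trans (cong (_+_ (δ y g)) (δ-≢ (λ e → edist j (inject₁ i) (sym e)))) (ℤP.+-identityʳ (δ y g)))))
            term g (yes (j , inj₂ refl)) = combine (δ y g) (δ (a x) g) (jump S g)
              (trans (cong 𝟙 (⌊⌋-cong (sameVertex? M y (a (hs j))) (a x FinP.≟ a (hs j))
                (λ v → cong (a ∘ hs) (sym (pred-unique i j (V.~-sym v)))) (λ e → subst (SameVertex M y) e (V.~-sym (step i)))))
              (sym (trans (cong (_+ δ (a x) g) (δ-≢ (edist (suc i) j))) (ℤP.+-identityˡ (δ (a x) g)))))

        jump-const : ∀ i j → jump S (hs i) ≡ jump S (hs j)
        jump-const i j = trans (fin-const (jump S ∘ hs) jump-along i) (sym (fin-const (jump S ∘ hs) jump-along j))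

      -- `frontier` provides one edge between outside and inside. It lies on the cycle, and since
      -- `jump S` is constant along the cycle, it decides the sides everywhere.
      jordan : (∀ i → (S (hs i) ≡ true) × (S (a (hs i)) ≡ false)) ⊎ (∀ i → (S (hs i) ≡ false) × (S (a (hs i)) ≡ true))
      jordan with frontier S S-f S-root (proj₂ inside-exists)
      ... | x , p , q with onCycle? x
      ...   | no ¬c = ⊥-elim (true≢false (trans (S-a ¬c) p) q)
      ...   | yes (i , inj₁ refl) = inj₁ (λ j → sides (S (hs j)) (S (a (hs j))) (trans (jump-const j i) (cong₂ (λ u v → 𝟙 u - 𝟙 v) p q)))
        where
          sides : ∀ u v → 𝟙 u - 𝟙 v ≡ + 1 → (u ≡ true) × (v ≡ false)
          sides true  false _ = refl , refl
          sides true  true  ()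
          sides false true  ()
          sides false false ()
      ...   | yes (i , inj₂ refl) = inj₂ (λ j → sides (S (hs j)) (S (a (hs j))) (trans (jump-const j i)
          (cong₂ (λ u v → 𝟙 u - 𝟙 v) (trans (cong S (sym (aa (hs i)))) q) p)))
        where
          sides : ∀ u v → 𝟙 u - 𝟙 v ≡ - + 1 → (u ≡ false) × (v ≡ true)
          sides false true  _ = refl , refl
          sides true  false ()
          sides true  true  ()
          sides false false ()

    dualStep? : ∀ x y → Dec (DualStep M w₀ hs x y)
    dualStep? x y = (y FinP.≟ f x) ⊎-dec (¬? (onCycle? x) ×-dec (y FinP.≟ a x))

  -- Filling the holes of R leaves a region whose complement is connected, and then every boundary
  -- cycle has that region on its inner side.
  ccw-circuit : ∀ w (R : Mask n) → FaceMask R → R root ≡ false → (∀ h → R h ≡ true → R (a h) ≡ false → + 0 < w (a h)) →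
    ∀ {h₀} → R h₀ ≡ true → ∃ λ m → ∃ λ hs → IsCCWCircuit M w m hs
  ccw-circuit w R R-f R-root trav {h₀} Rh₀ = m , hs , cyc , λ i → traverse i , interior i
    where
      Step : Fin n → Fin n → Set
      Step x y = (R y ≡ false) × ((y ≡ f x) ⊎ (y ≡ a x))
      step? : ∀ x y → Dec (Step x y)
      step? x y = (R y ≟ᵇ false) ×-dec ((y FinP.≟ f x) ⊎-dec (y FinP.≟ a x))
      Out-all = reach-set Step step? root
      Out : Mask n
      Out = proj₁ Out-all
      Out-root : Out root ≡ true
      Out-root = proj₁ (proj₂ Out-all)
      Out-closed : ∀ x y → Out x ≡ true → Step x y → Out y ≡ true
      Out-closed = proj₂ (proj₂ (proj₂ Out-all))
      out-star : ∀ x → Out x ≡ true → Star Step root x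
      out-star = proj₁ (proj₂ (proj₂ Out-all))
      Out⇒¬R : ∀ x → Out x ≡ true → R x ≡ false
      Out⇒¬R x e = go (out-star x e) R-root
        where
          go : ∀ {y z} → Star Step y z → R y ≡ false → R z ≡ false
          go ε           p = p
          go ((q , _) ◅ st) p = go st q
      Out-f : FaceMask Out
      Out-f x e = Out-closed x (f x) e (trans (F.mask-const R R-f x) (Out⇒¬R x e) , inj₁ refl)
      R₂ : Mask n
      R₂ x = not (Out x)
      R₂-f : FaceMask R₂
      R₂-f x e = trans (cong not (F.mask-const Out Out-f x)) e
      Out-h₀ : Out h₀ ≡ false
      Out-h₀ = not-true (λ e → true≢false Rh₀ (Out⇒¬R h₀ e))
      front = frontier Out Out-f Out-root Out-h₀
      start : Boundary R₂ R₂-f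
      start = a (proj₁ front) , not-true⁺ (proj₂ (proj₂ front)) , cong not (trans (cong Out (aa (proj₁ front))) (proj₁ (proj₂ front)))
      cycle-all = boundary-cycle R₂ R₂-f start
      m : ℕ
      m = proj₁ cycle-all
      hs : Fin (suc m) → Fin n
      hs = proj₁ (proj₂ cycle-all)
      cyc : IsCycle M m hs
      cyc = proj₁ (proj₂ (proj₂ cycle-all))
      hs-in : ∀ i → Out (hs i) ≡ false
      hs-in i = not-true⁻ (proj₁ (proj₂ (proj₂ (proj₂ cycle-all)) i))
      ahs-out : ∀ i → Out (a (hs i)) ≡ true
      ahs-out i = not-false (λ e → true≢false (not-true⁺ e) (proj₂ (proj₂ (proj₂ (proj₂ cycle-all)) i)))
      -- A hole of `R` cannot border `Out`, which absorbs every neighbouring corner that is not in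
      -- `R`; so the boundary of `R₂` is part of the boundary of `R`.
      R-hs : ∀ i → R (hs i) ≡ true
      R-hs i = not-false (λ e → true≢false (Out-closed (a (hs i)) (hs i) (ahs-out i) (e , inj₂ (sym (aa (hs i))))) (hs-in i))
      traverse : ∀ i → + 0 < w (a (hs i))
      traverse i = trav (hs i) (R-hs i) (Out⇒¬R _ (ahs-out i))
      open Cycle cyc
      S-all = reach-set (DualStep M w₀ hs) dualStep? root
      S : Mask n
      S = proj₁ S-all
      S-closed : ∀ x y → S x ≡ true → DualStep M w₀ hs x y → S y ≡ true
      S-closed = proj₂ (proj₂ (proj₂ S-all))
      off-cycle : ∀ {x} → Out x ≡ true → Out (a x) ≡ true → ¬ OnCycle M w₀ hs x
      off-cycle p q (i , inj₁ refl) = true≢false p (hs-in i)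
      off-cycle p q (i , inj₂ refl) = true≢false (trans (cong Out (sym (aa (hs i)))) q) (hs-in i)
      Out⊆S : ∀ {x y} → Star Step x y → Out x ≡ true → S x ≡ true → S y ≡ true
      Out⊆S ε o p = p
      Out⊆S ((q , inj₁ refl) ◅ st) o p = Out⊆S st (Out-f _ o) (S-closed _ _ p (inj₁ refl))
      Out⊆S {x} ((q , inj₂ refl) ◅ st) o p =
        Out⊆S st o′ (S-closed _ _ p (inj₂ (off-cycle o o′ , refl)))
        where
          o′ : Out (a x) ≡ true
          o′ = Out-closed _ _ o (q , inj₂ refl)
      -- `Out` is connected without crossing the cycle and contains its right side, so the right
      -- side is reached from the root. This excludes the first case of `jordan`.
      S-hs : ∀ i → S (hs i) ≡ false
      S-hs = [ (λ j i → ⊥-elim (true≢false (Out⊆S (out-star _ (ahs-out zero)) Out-root (proj₁ (proj₂ S-all)))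
        (proj₂ (j zero)))) , (λ j i → proj₁ (j i)) ]′
        (Side.jordan S (proj₁ (proj₂ S-all)) (proj₁ (proj₂ (proj₂ S-all))) S-closed)
      interior : ∀ i → Interior M w hs (hs i)
      interior i st = true≢false (closed-star (DualStep M w₀ hs) dualStep? S-closed st (proj₁ (proj₂ S-all))) (S-hs i)

-- Positive and negative parts

-- Written with the conditionals of `vertexWeight` and `faceWeight`, so that these become sums of
-- `pos` and `neg`.
pos neg : ℤ → ℤ
pos z = if ⌊ + 0 <? z ⌋ then z else + 0
neg z = - (if ⌊ z ≤? + 0 ⌋ then z else + 0)

data SignView (z : ℤ) : Set where
  positive    : + 0 < z → pos z ≡ z → neg z ≡ + 0 → SignView z
  nonpositive : z ≤ + 0 → pos z ≡ + 0 → neg z ≡ - z → SignView z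

sign-view : ∀ z → SignView z
sign-view z with ≤-cases z (+ 0)
... | inj₁ z≤0 = nonpositive z≤0
  (cong (λ b → if b then z else + 0) (⌊⌋-false⁺ (+ 0 <? z) (ℤP.≤⇒≯ z≤0)))
  (cong (λ b → - (if b then z else + 0)) (⌊⌋-true⁺ (z ≤? + 0) z≤0))
... | inj₂ 0<z = positive 0<z
  (cong (λ b → if b then z else + 0) (⌊⌋-true⁺ (+ 0 <? z) 0<z))
  (cong (λ b → - (if b then z else + 0)) (⌊⌋-false⁺ (z ≤? + 0) (ℤP.<⇒≱ 0<z)))

pos-neg : ∀ z → pos z - neg z ≡ z
pos-neg z with sign-view z
... | positive _ p q    rewrite p | q = ℤP.+-identityʳ z
... | nonpositive _ p q rewrite p | q = trans (ℤP.+-identityˡ (- - z)) (ℤP.neg-involutive z)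

0≤pos : ∀ z → + 0 ≤ pos z
0≤pos z with sign-view z
... | positive 0<z p _  rewrite p = ℤP.<⇒≤ 0<z
... | nonpositive _ p _ rewrite p = ℤP.≤-refl

0≤neg : ∀ z → + 0 ≤ neg z
0≤neg z with sign-view z
... | positive _ _ q      rewrite q = ℤP.≤-refl
... | nonpositive z≤0 _ q rewrite q = ℤP.neg-mono-≤ z≤0

pos≡0 : ∀ {z} → z ≤ + 0 → pos z ≡ + 0
pos≡0 {z} z≤0 with sign-view z
... | positive 0<z _ _  = ⊥-elim (≤<-absurd z≤0 0<z)
... | nonpositive _ p _ = p

neg≡0 : ∀ {z} → + 0 ≤ z → neg z ≡ + 0
neg≡0 {z} 0≤z with sign-view z
... | positive _ _ q = q
... | nonpositive z≤0 _ q rewrite ℤP.≤-antisym z≤0 0≤z = q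

-- Girth, the outer contour and the density of subgraphs

#-image : ∀ {n k} (hs : Fin k → Fin n) → (∀ {i j} → hs i ≡ hs j → i ≡ j) → (p : Mask n) → (∀ i → p (hs i) ≡ true) →
  (+ k ≤ # p) × (# p ≤ + k → ∀ h → p h ≡ true → ∃ λ i → hs i ≡ h)
#-image {n} {k} hs inj p hp = subst (_≤ # p) total (sum-mono image≤p) , λ q h ph → surj q h ph
  where
    image : Fin n → ℤ
    image h = sumℤ (λ i → δ (hs i) h)
    total : sumℤ image ≡ + k
    total = trans (sum-swap (λ h i → δ (hs i) h))
      (trans (sum-cong (λ i → trans (sum-cong (λ h → sym (ℤP.*-identityʳ (δ (hs i) h)))) (sum-δ (hs i) (λ _ → + 1)))) (#-all {k}))
    hit? : ∀ h → Dec (∃ λ i → hs i ≡ h)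
    hit? h = FinP.any? (λ i → hs i FinP.≟ h)
    image-no : ∀ h → ¬ (∃ λ i → hs i ≡ h) → image h ≡ + 0
    image-no h ¬e = sum-zero (λ i → δ-≢ (λ e → ¬e (i , e)))
    image≤p : ∀ h → image h ≤ 𝟙 (p h)
    image≤p h with hit? h
    ... | no ¬e rewrite image-no h ¬e = 0≤𝟙 (p h)
    ... | yes (i , refl) rewrite hp i = ℤP.≤-reflexive (trans (sum-single i (λ j → δ (hs j) (hs i)) (λ j j≢ → δ-≢ (j≢ ∘ inj)))
        (δ-refl (hs i)))
    surj : # p ≤ + k → ∀ h → p h ≡ true → ∃ λ i → hs i ≡ h
    surj q h ph with hit? h
    ... | yes e = e
    ... | no ¬e = ⊥-elim (1≢0 (trans (sym (cong₂ (λ u v → 𝟙 u - v) ph (image-no h ¬e)))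
        (sum-nonneg-zero (λ h → 0≤- (image≤p h)) zero-sum h)))
      where
        1≢0 : + 1 ≢ + 0
        1≢0 ()
        zero-sum : sumℤ (λ h → 𝟙 (p h) - image h) ≡ + 0
        zero-sum = trans (sum-sub (λ h → 𝟙 (p h)) image) (ℤP.i≡j⇒i-j≡0 (ℤP.≤-antisym (subst (# p ≤_) (sym total) q) (sum-mono image≤p)))

private
  density-distrib : ∀ x d y → x * (+ 1 - d * y) ≡ x * + 1 - d * (x * y)
  density-distrib = solve-∀

  density-A : ∀ o d l → + 0 + o ≡ (d + (o - d * l)) + d * (l - + 1)
  density-A = solve-∀

  density-root : ∀ d g → d - d * + 1 + g ≡ g
  density-root = solve-∀

  density-noroot : ∀ d g → d - d * + 0 + g ≡ d + g
  density-noroot = solve-∀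

  density-expand : ∀ l d e g → l * (d - d * e + g) ≡ (d * l - d * (l * e)) + l * g
  density-expand = solve-∀

  density₁ : ∀ d u v f → + 2 * d * u ≡ d * (+ 2 * ((u + v) + f)) - + 2 * d * (v + f)
  density₁ = solve-∀

  density₂ : ∀ d b k v f n g → d * (n + + 4) - + 2 * d * (v + f) ≡ ((d - + 2) * b + + 2 * g + + 2 * d) +
    (d * (((n - b) + + 2 * k) - + 2 * (v + f)) + + 2 * (b - (d * k - d + g)))
  density₂ = solve-∀

module Girths (M : PlaneMap) where
  open Cycles M public

  ρ : Mask n
  ρ h = ⌊ sameFace? M h root ⌋

  ρ⁺ : ∀ {h} → InRootFace M h → ρ h ≡ true
  ρ⁺ {h} = ⌊⌋-true⁺ (sameFace? M h root)

  ρ⁻ : ∀ {h} → ρ h ≡ true → InRootFace M h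
  ρ⁻ {h} = ⌊⌋-true⁻ (sameFace? M h root)

  ρ-root : ρ root ≡ true
  ρ-root = ρ⁺ (F.~-refl root)

  ρ-f : FaceMask ρ
  ρ-f h e = ρ⁺ (F.~-trans (F.~-sym (F.~-f h)) (ρ⁻ e))

  ρ-f⁻ : ∀ h → ρ h ≡ true → ρ (f⁻ h) ≡ true
  ρ-f⁻ = F.mask-inverse ρ ρ-f

  faceDeg≡ : ∀ h → + faceDeg M h ≡ F.class-sum (λ _ → + 1) h
  faceDeg≡ h = trans (count≡# (λ g → ⌊ sameFace? M h g ⌋)) (sum-cong (λ g → sym (ℤP.*-identityʳ F.[ h ~ g ])))

  #ρ : # ρ ≡ + outerDeg M
  #ρ = trans (sum-cong (λ g → F.[]-cong {g} {root} {root} {g} F.~-sym F.~-sym)) (sym (count≡# (λ g → ⌊ sameFace? M root g ⌋)))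

  one-sided : SimpleOuterContour M w₀ → ∀ {h} → ρ h ≡ true → ρ (a h) ≡ false
  one-sided c {h} e = not-true λ e′ → proj₂ c (f⁻ (a h)) (f⁻ h) (ρ⁻ (ρ-f⁻ (a h) e′)) (ρ⁻ (ρ-f⁻ h e))
    (trans (ss⁻ (a (a h))) (cong a (sym (ss⁻ (a h)))))

  RootIn : ∀ {S} → FaceMask S → S root ≡ true → ∀ {h} → ρ h ≡ true → S h ≡ true
  RootIn {S} c e p = F.~-ind (λ z → S z ≡ true) c (F.~-sym (ρ⁻ p)) e

  module _ (d : ℕ) (no-short : ∀ k → k ℕ.< d → ¬ HasCycle M k) where

    long : ∀ {m hs} → IsCycle M m hs → d ℕ.≤ suc m
    long {m} {hs} cyc = ℕP.≮⇒≥ (λ l → no-short (suc m) l (hs , cyc))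

    -- A nonempty boundary contains a simple cycle, and no cycle is shorter than `d`.
    boundary-size : ∀ R (R-f : FaceMask R) → Boundary R R-f → + d ≤ # (λ h → R h ∧ not (R (a h)))
    boundary-size R R-f b = let (m , hs , cyc , side) = boundary-cycle R R-f b in
      ℤP.≤-trans (+≤+ (long cyc)) (proj₁ (#-image hs (Cycle.hs-injective cyc) (λ h → R h ∧ not (R (a h)))
        (λ i → ∧-true⁺ (proj₁ (side i)) (not-true⁺ (proj₂ (side i))))))

    -- The boundary of the root face contains a cycle of length at least `d`, and the root face has
    -- only `d` half-edges; so the cycle is the whole contour. The corner `h₁` of another face
    -- ensures that there is a boundary.
    outer-contour : outerDeg M ≡ d → (∃ λ h → ρ h ≡ false) → SimpleOuterContour M w₀ × HasCycle M d
    outer-contour od (h₁ , h₁∉) = (distinct , opposite) , has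
      where
        fr = frontier ρ ρ-f ρ-root h₁∉
        bc = boundary-cycle ρ ρ-f fr
        m : ℕ
        m = proj₁ bc
        hs : Fin (suc m) → Fin n
        hs = proj₁ (proj₂ bc)
        cyc : IsCycle M m hs
        cyc = proj₁ (proj₂ (proj₂ bc))
        side : ∀ i → (ρ (hs i) ≡ true) × (ρ (a (hs i)) ≡ false)
        side = proj₂ (proj₂ (proj₂ bc))
        img = #-image hs (Cycle.hs-injective cyc) ρ (λ i → proj₁ (side i))
        #ρ≡d : # ρ ≡ + d
        #ρ≡d = trans #ρ (cong +_ od)
        length≡ : suc m ≡ d
        length≡ = ℕP.≤-antisym (ℤP.drop‿+≤+ (subst (+ suc m ≤_) #ρ≡d (proj₁ img))) (long cyc)
        has : HasCycle M d
        has = subst (HasCycle M) length≡ (hs , cyc)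
        cover : ∀ h → ρ h ≡ true → ∃ λ i → hs i ≡ h
        cover = proj₂ img (ℤP.≤-reflexive (trans #ρ≡d (cong +_ (sym length≡))))
        distinct : ∀ g g′ → InRootFace M g → InRootFace M g′ → SameVertex M g g′ → g ≡ g′
        distinct g g′ p p′ v = let (i , e) = cover g (ρ⁺ p) ; (j , e′) = cover g′ (ρ⁺ p′) in
          trans (sym e) (trans (cong hs (IsCycle.vdist cyc i j (subst₂ (SameVertex M) (sym e) (sym e′) v))) e′)
        opposite : ∀ g g′ → InRootFace M g → InRootFace M g′ → s g ≡ a (s g′) → ⊥
        opposite g g′ p p′ e = let (i , q) = cover (f g′) (ρ-f g′ (ρ⁺ p′)) in
          true≢false (ρ-f g (ρ⁺ p)) (trans (cong (ρ ∘ a) (trans e (sym q))) (proj₂ (side i)))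

    -- Deleting the edges outside B merges faces into regions.  Except possibly for the region of the
    -- root face, each of them has at least d edges of B on its boundary, and rank-bound bounds their
    -- number from below.
    module Density (U B A : Mask n)
      (U-s : ∀ h → U h ≡ true → U (s h) ≡ true) (B-a : ∀ h → B h ≡ true → B (a h) ≡ true)
      (B⊆U : ∀ h → B h ≡ true → U h ≡ true) (A-f : FaceMask A) (A⊆B : ∀ h → A h ≡ true → B h ≡ true)
      (root∉A : A root ≡ false) (h₀ : Fin n) (h₀∈U : U h₀ ≡ true) where

      Step : Fin n → Fin n → Set
      Step x y = (y ≡ f x) ⊎ ((B x ≡ false) × (y ≡ a x))

      step? : ∀ x y → Dec (Step x y)
      step? x y = (y FinP.≟ f x) ⊎-dec ((B x ≟ᵇ false) ×-dec (y FinP.≟ a x))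

      Same : Fin n → Fin n → Set
      Same = Star Step

      orbit⇒same : ∀ {x y} → SameFace M x y → Same x y
      orbit⇒same {x} e = F.~-ind (Same x) (λ z p → p ◅◅ (inj₁ refl ◅ ε)) e ε

      B-a⁻ : ∀ h → B h ≡ false → B (a h) ≡ false
      B-a⁻ h e = not-true λ q → true≢false (subst (λ z → B z ≡ true) (aa h) (B-a (a h) q)) e

      same-sym : ∀ {x y} → Same x y → Same y x
      same-sym ε = ε
      same-sym {x} (inj₁ refl ◅ r) = same-sym r ◅◅ orbit⇒same (F.~-sym (F.~-f x))
      same-sym {x} (inj₂ (b , refl) ◅ r) = same-sym r ◅◅ (inj₂ (B-a⁻ x b , sym (aa x)) ◅ ε)

      module K = Classes Same (star? Step step?) (λ _ → ε) same-sym _◅◅_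

      same-const : ∀ {C : Set} (t : Fin n → C) → (∀ x → t (f x) ≡ t x) → (∀ x → B x ≡ false → t (a x) ≡ t x) →
        ∀ {x y} → Same x y → t x ≡ t y
      same-const t tf ta ε = refl
      same-const t tf ta (inj₁ refl ◅ r) = trans (sym (tf _)) (same-const t tf ta r)
      same-const t tf ta (inj₂ (b , refl) ◅ r) = trans (sym (ta _ b)) (same-const t tf ta r)

      A-same : ∀ {x y} → Same x y → A x ≡ A y
      A-same = same-const A (F.mask-const A A-f) (λ x b → bool-ext
        (λ p → ⊥-elim (true≢false (A⊆B (a x) p) (B-a⁻ x b))) (λ p → ⊥-elim (true≢false (A⊆B x p) b)))

      notroot : ∀ {r g} → ¬ Same r root → Same r g → ρ g ≡ false
      notroot ¬rt st = not-true (λ e → ¬rt (st ◅◅ orbit⇒same (ρ⁻ e)))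

      private
        vN vU : ℤ
        vN = # (λ h → V.least h ∧ not (U h))
        vU = # (λ h → V.least h ∧ U h)

        regions : + 2 * (vN + # F.least) ≤ # (not ∘ B) + + 2 * # K.least
        regions = rank-bound (not ∘ U) (not ∘ B) K.least
          (λ h e → trans (cong not (V.mask-const U U-s h)) e)
          (λ h e → not-true⁺ (B-a⁻ h (not-true⁻ e)))
          (λ h e → not-true⁺ (not-true (λ b → true≢false (B⊆U h b) (not-true⁻ e))))
          h₀ (cong not h₀∈U)
          (λ h e g v → ⌊⌋-true⁻ (K.least? h) e g (orbit⇒same v))
          (λ p ip ia p0 h → trans (sym (same-const p ip (λ x b → ia x (not-true⁺ b)) (K.rep-~ h)))
            (p0 (K.rep h) (⌊⌋-true⁺ (K.least? (K.rep h)) (K.rep-least h))))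

      -- Over a face of `A` the first term adds up to the degree minus `d`. The second one credits
      -- the root region, which is exempt from the bound `d`, with the half-edges of `B` on the root
      -- face.
      G : Fin n → ℤ
      G h = 𝟙 (A h) * (+ 1 - + d * 𝟙 (F.least h)) + 𝟙 (ρ h ∧ B h)

      private
        term≤ : ∀ r {u v : Fin n → ℤ} → (∀ g → Same r g → u g ≤ v g) → K.class-sum u r ≤ K.class-sum v r
        term≤ r {u} {v} le = sum-mono (λ g → help g (star? Step step? r g))
          where
            help : ∀ g (dec : Dec (Same r g)) → 𝟙 ⌊ dec ⌋ * u g ≤ 𝟙 ⌊ dec ⌋ * v g
            help g (yes p) = subst₂ _≤_ (sym (ℤP.*-identityˡ (u g))) (sym (ℤP.*-identityˡ (v g))) (le g p)
            help g (no _)  = ℤP.≤-reflexive (trans (ℤP.*-zeroˡ (u g)) (sym (ℤP.*-zeroˡ (v g))))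

        G-notA : ∀ g → A g ≡ false → G g ≡ 𝟙 (ρ g ∧ B g)
        G-notA g e rewrite e = trans (cong (_+ 𝟙 (ρ g ∧ B g)) (ℤP.*-zeroˡ (+ 1 - + d * 𝟙 (F.least g)))) (ℤP.+-identityˡ _)

        root-region : ∀ r → Same r root → K.class-sum G r ≤ K.class-sum (𝟙 ∘ B) r
        root-region r rt = term≤ r λ g st → subst (_≤ 𝟙 (B g)) (sym (G-notA g (trans (A-same (same-sym st ◅◅ rt)) root∉A))) (∧≤ (ρ g) (B g))
          where
            ∧≤ : ∀ x y → 𝟙 (x ∧ y) ≤ 𝟙 y
            ∧≤ true  y = ℤP.≤-refl
            ∧≤ false y = 0≤𝟙 y

        -- All half-edges of such a region are in `B`. It contains at least one face representative,
        -- so the terms `- d` of `G` make up for the additional `d`.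
        A-region : ∀ r → K.Least r → ¬ Same r root → A r ≡ true → + d + K.class-sum G r ≤ K.class-sum (𝟙 ∘ B) r
        A-region r lr ¬rt Ar = ℤP.≤-trans (ℤP.+-monoʳ-≤ (+ d) (term≤ r {G} {H} (λ g st → ℤP.≤-reflexive (G≡ g st))))
          (ℤP.≤-trans (≤-by (+ d * (Λ - + 1)) (0≤k* d (0≤- Λ≥1)) (trans (ℤP.+-comm ones (+ 0)) (arith)))
            (ℤP.≤-trans (ℤP.≤-reflexive (ℤP.+-identityʳ ones)) (term≤ r {λ _ → + 1} {𝟙 ∘ B} (λ g st → ℤP.≤-reflexive
              (sym (cong 𝟙 (A⊆B g (trans (sym (A-same st)) Ar))))))))
          where
            H : Fin n → ℤ
            H g = + 1 - + d * 𝟙 (F.least g)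
            ones Λ : ℤ
            ones = K.class-sum (λ _ → + 1) r
            Λ = K.class-sum (𝟙 ∘ F.least) r
            G≡ : ∀ g → Same r g → G g ≡ H g
            G≡ g st = trans (cong₂ (λ u v → 𝟙 u * H g + 𝟙 (v ∧ B g)) (trans (sym (A-same st)) Ar) (notroot ¬rt st))
              (trans (ℤP.+-identityʳ _) (ℤP.*-identityˡ (H g)))
            Λ≥1 : + 1 ≤ Λ
            Λ≥1 = subst (_≤ Λ) (cong₂ _*_ (K.[]-yes {r} {r} ε) (cong 𝟙 (⌊⌋-true⁺ (F.least? r) (λ g v → lr g (orbit⇒same v)))))
              (sum-nonneg-term (λ g → 0≤* (0≤𝟙 ⌊ star? Step step? r g ⌋) (0≤𝟙 (F.least g))) r)
            H-sum : K.class-sum H r ≡ ones - + d * Λ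
            H-sum = trans (sum-cong (λ g → density-distrib K.[ r ~ g ] (+ d) (𝟙 (F.least g))))
              (trans (sum-sub (λ g → K.[ r ~ g ] * + 1) (λ g → + d * (K.[ r ~ g ] * 𝟙 (F.least g))))
                (cong (_-_ ones) (sum-* (+ d) (λ g → K.[ r ~ g ] * 𝟙 (F.least g)))))
            arith : + 0 + ones ≡ (+ d + K.class-sum H r) + + d * (Λ - + 1)
            arith = trans (density-A ones (+ d) Λ) (cong (λ z → (+ d + z) + + d * (Λ - + 1)) (sym H-sum))

        -- Here `G` vanishes, and the region is a proper union of faces whose boundary lies in `B`,
        -- so `boundary-size` applies.
        other-region : ∀ r → ¬ Same r root → A r ≡ false → + d + K.class-sum G r ≤ K.class-sum (𝟙 ∘ B) r
        other-region r ¬rt Ar = ℤP.≤-trans (ℤP.+-monoʳ-≤ (+ d) (ℤP.≤-reflexive G0)) (ℤP.≤-trans (ℤP.≤-reflexive (ℤP.+-identityʳ (+ d)))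
          (ℤP.≤-trans (boundary-size R R-f bd) (sum-mono pointwise)))
          where
            R : Mask n
            R g = ⌊ star? Step step? r g ⌋
            R⁺ : ∀ {g} → Same r g → R g ≡ true
            R⁺ {g} = ⌊⌋-true⁺ (star? Step step? r g)
            R⁻ : ∀ {g} → R g ≡ true → Same r g
            R⁻ {g} = ⌊⌋-true⁻ (star? Step step? r g)
            R-f : FaceMask R
            R-f h e = R⁺ (R⁻ e ◅◅ (inj₁ refl ◅ ε))
            bd : Boundary R R-f
            bd = frontier R R-f {r} {root} (R⁺ ε) (⌊⌋-false⁺ (star? Step step? r root) ¬rt)
            G0 : K.class-sum G r ≡ + 0
            G0 = sum-zero (λ g → help g (star? Step step? r g))
              where
                help : ∀ g (dec : Dec (Same r g)) → 𝟙 ⌊ dec ⌋ * G g ≡ + 0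
                help g (no _) = ℤP.*-zeroˡ (G g)
                help g (yes st) = trans (ℤP.*-identityˡ (G g)) (trans (G-notA g (trans (sym (A-same st)) Ar))
                  (cong (λ z → 𝟙 (z ∧ B g)) (notroot ¬rt st)))
            pointwise : ∀ g → 𝟙 (R g ∧ not (R (a g))) ≤ K.[ r ~ g ] * 𝟙 (B g)
            pointwise g = subst (𝟙 (R g ∧ not (R (a g))) ≤_) (𝟙-∧ (R g) (B g)) (𝟙-mono (λ e → let (p , q) = ∧-true⁻ {R g} e in
              ∧-true⁺ p (not-false (λ b → true≢false (R⁺ (R⁻ p ◅◅ (inj₂ (b , refl) ◅ ε))) (not-true⁻ q)))))

        region : ∀ r → 𝟙 (K.least r) * (+ d - + d * K.[ r ~ root ] + K.class-sum G r) ≤ 𝟙 (K.least r) * K.class-sum (𝟙 ∘ B) r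
        region r = cases (K.least? r) (star? Step step? r root) (true? (A r))
          where
            one* : ∀ {x y} → x ≤ y → + 1 * x ≤ + 1 * y
            one* {x} {y} = subst₂ _≤_ (sym (ℤP.*-identityˡ x)) (sym (ℤP.*-identityˡ y))
            cases : (l : Dec (K.Least r)) (e : Dec (Same r root)) → (A r ≡ true) ⊎ (A r ≡ false) →
              𝟙 ⌊ l ⌋ * (+ d - + d * 𝟙 ⌊ e ⌋ + K.class-sum G r) ≤ 𝟙 ⌊ l ⌋ * K.class-sum (𝟙 ∘ B) r
            cases (no _) e _ = ℤP.≤-reflexive (trans (ℤP.*-zeroˡ (+ d - + d * 𝟙 ⌊ e ⌋ + K.class-sum G r))
              (sym (ℤP.*-zeroˡ (K.class-sum (𝟙 ∘ B) r))))
            cases (yes l) (yes e) _ = one* (subst (_≤ K.class-sum (𝟙 ∘ B) r) (sym (density-root (+ d) (K.class-sum G r))) (root-region r e))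
            cases (yes l) (no e) (inj₁ x) = one* (subst (_≤ K.class-sum (𝟙 ∘ B) r) (sym (density-noroot (+ d) (K.class-sum G r)))
              (A-region r l e x))
            cases (yes l) (no e) (inj₂ x) = one* (subst (_≤ K.class-sum (𝟙 ∘ B) r) (sym (density-noroot (+ d) (K.class-sum G r)))
              (other-region r e x))

        many-B : + d * # K.least - + d + sumℤ G ≤ # B
        many-B = subst₂ _≤_ total (sym (K.sum-by-class (𝟙 ∘ B))) (sum-mono region)
          where
            open ≡-Reasoning
            l : Fin n → ℤ
            l r = 𝟙 (K.least r)
            total : sumℤ (λ r → l r * (+ d - + d * K.[ r ~ root ] + K.class-sum G r)) ≡ + d * # K.least - + d + sumℤ G
            total = begin
              sumℤ (λ r → l r * (+ d - + d * K.[ r ~ root ] + K.class-sum G r))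
                ≡⟨ sum-cong (λ r → density-expand (l r) (+ d) K.[ r ~ root ] (K.class-sum G r)) ⟩
              sumℤ (λ r → (+ d * l r - + d * (l r * K.[ r ~ root ])) + l r * K.class-sum G r)
                ≡⟨ sum-+ (λ r → + d * l r - + d * (l r * K.[ r ~ root ])) (λ r → l r * K.class-sum G r) ⟩
              sumℤ (λ r → + d * l r - + d * (l r * K.[ r ~ root ])) + sumℤ (λ r → l r * K.class-sum G r)
                ≡⟨ cong₂ _+_ (trans (sum-sub (λ r → + d * l r) (λ r → + d * (l r * K.[ r ~ root ])))
                     (cong₂ _-_ (sum-* (+ d) l) (trans (sum-* (+ d) (λ r → l r * K.[ r ~ root ]))
                       (trans (cong (+ d *_) (K.one-rep root)) (ℤP.*-identityʳ (+ d))))))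
                     (sym (K.sum-by-class G)) ⟩
              + d * # K.least - + d + sumℤ G ∎

      -- `many-B` bounds the number of regions from above and `regions` bounds it from below;
      -- eliminating it leaves edges against vertices. The constant `2 d` is the `4 d` from Euler's
      -- formula less the `2 d` lost at the root region.
      density : (+ d - + 2) * # B + + 2 * sumℤ G + + 2 * + d ≤ + 2 * + d * vU
      density = arith (+ d) (# B) (# K.least) vU vN (# F.least) (+ n) (sumℤ G) many-B
        (subst (λ z → + 2 * (vN + # F.least) ≤ z + + 2 * # K.least) (#-not B) regions)
        (trans (cong (λ z → + 2 * (z + # F.least)) (sym (#-split V.least U))) euler)
        where
          arith : ∀ d b k u v f n g → d * k - d + g ≤ b → + 2 * (v + f) ≤ (n - b) + + 2 * k → + 2 * ((u + v) + f) ≡ n + + 4 →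
            {{_ : ℤ.NonNegative d}} → (d - + 2) * b + + 2 * g + + 2 * d ≤ + 2 * d * u
          arith d b k u v f n g p q e = ≤-by (d * (((n - b) + + 2 * k) - + 2 * (v + f)) + + 2 * (b - (d * k - d + g)))
            (0≤+ (0≤* {d} (ℤP.nonNegative⁻¹ d) (0≤- q)) (0≤k* 2 (0≤- p)))
            (trans (density₁ d u v f) (trans (cong (λ z → d * z - + 2 * d * (v + f)) e) (density₂ d b k v f n g)))

-- An orientation forces the girth

private
  girth-arith : ∀ d k e n y x v f → n ≤ e + k → d * f ≤ n - y → d * v ≤ x → e + + 2 ≤ + 2 * (v + f) →
    (d - + 2) * e ≡ + 2 * (x - y) → + 0 ≤ d → + 2 * d ≤ + 2 * k
  girth-arith d k e n y x v f p q r t u 0≤d = ≤-by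
    ((+ 2 * ((e + k) - n) + + 2 * ((n - y) - d * f)) + (+ 2 * (x - d * v) + d * (+ 2 * (v + f) - (e + + 2))))
    (0≤+ (0≤+ (0≤k* 2 (0≤- p)) (0≤k* 2 (0≤- q))) (0≤+ (0≤k* 2 (0≤- r)) (0≤* 0≤d (0≤- t))))
    (trans (lemma₁ k x y) (trans (cong (λ z → + 2 * k + + 2 * (x - y) - z) (sym u)) (lemma₂ d k e n y x v f)))
    where
      lemma₁ : ∀ k x y → + 2 * k ≡ + 2 * k + + 2 * (x - y) - + 2 * (x - y)
      lemma₁ = solve-∀
      lemma₂ : ∀ d k e n y x v f → + 2 * k + + 2 * (x - y) - (d - + 2) * e ≡
        + 2 * d + ((+ 2 * ((e + k) - n) + + 2 * ((n - y) - d * f)) + (+ 2 * (x - d * v) + d * (+ 2 * (v + f) - (e + + 2))))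
      lemma₂ = solve-∀

𝟙*-mono : ∀ {x y} {u v : ℤ} → (x ≡ true → y ≡ true) → (x ≡ true → u ≤ v) → + 0 ≤ v → 𝟙 x * u ≤ 𝟙 y * v
𝟙*-mono {true} {y} {u} {v} h k 0≤v rewrite h refl = subst₂ _≤_ (sym (ℤP.*-identityˡ u)) (sym (ℤP.*-identityˡ v)) (k refl)
𝟙*-mono {false} {y} {u} {v} h k 0≤v = subst (_≤ 𝟙 y * v) (sym (ℤP.*-zeroˡ u)) (0≤* (0≤𝟙 y) 0≤v)

module Orientations (M : PlaneMap) where
  open Girths M public

  module _ (w : ZBiorientation M) where

    xOf yOf : Fin n → ℤ
    xOf h = pos (w h)
    yOf h = neg (w h)

    vertexWeight≡ : ∀ h → vertexWeight M w h ≡ V.class-sum xOf h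
    vertexWeight≡ h = sum-cong (λ g → if-𝟙 ⌊ sameVertex? M h g ⌋ (xOf g))

    -- The definition sums over half-edges with the face on their right; replacing `g` by `a g`
    -- moves the face to the left, where orbits of `f` index it.
    faceWeight≡ : ∀ h → faceWeight M w h ≡ - F.class-sum (yOf ∘ a) h
    faceWeight≡ h = begin
      faceWeight M w h ≡⟨ sum-cong (λ g → if-𝟙 ⌊ sameFace? M h (a g) ⌋ (if ⌊ w g ≤? + 0 ⌋ then w g else + 0)) ⟩
      sumℤ (λ g → F.[ h ~ a g ] * (if ⌊ w g ≤? + 0 ⌋ then w g else + 0))
        ≡⟨ sum-cong (λ g → trans (cong (F.[ h ~ a g ] *_) (sym (ℤP.neg-involutive (if ⌊ w g ≤? + 0 ⌋ then w g else + 0))))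
          (sym (ℤP.neg-distribʳ-* F.[ h ~ a g ] (yOf g)))) ⟩
      sumℤ (λ g → - (F.[ h ~ a g ] * yOf g)) ≡⟨ sum-neg (λ g → F.[ h ~ a g ] * yOf g) ⟩
      - sumℤ (λ g → F.[ h ~ a g ] * yOf g) ≡⟨ cong -_ (sum-cong (λ g → cong (λ z → F.[ h ~ a g ] * yOf z) (sym (aa g)))) ⟩
      - sumℤ (λ g → F.[ h ~ a g ] * yOf (a (a g))) ≡⟨ cong -_ (sum-a (λ c → F.[ h ~ c ] * yOf (a c))) ⟩
      - F.class-sum (yOf ∘ a) h ∎
      where open ≡-Reasoning

    face-sum : ∀ h → + faceDeg M h + faceWeight M w h ≡ F.class-sum (λ c → + 1 - yOf (a c)) h
    face-sum h = trans (cong₂ _+_ (faceDeg≡ h) (faceWeight≡ h)) (sym (trans (sum-cong (λ c → distrib F.[ h ~ c ] (yOf (a c))))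
      (sum-sub (λ c → F.[ h ~ c ] * + 1) (λ c → F.[ h ~ c ] * yOf (a c)))))
      where
        distrib : ∀ x y → x * (+ 1 - y) ≡ x * + 1 - x * y
        distrib = solve-∀

  mask-a : ∀ (N : Mask n) → (∀ h → N h ≡ true → N (a h) ≡ true) → ∀ h → N (a h) ≡ N h
  mask-a N N-a h = bool-ext (λ p → subst (λ z → N z ≡ true) (aa h) (N-a (a h) p)) (N-a h)

  edge-swap : ∀ (N : Mask n) → (∀ h → N h ≡ true → N (a h) ≡ true) → ∀ (X : Fin n → ℤ) →
    sumℤ (λ h → 𝟙 (N h) * X (a h)) ≡ sumℤ (λ h → 𝟙 (N h) * X h)
  edge-swap N N-a X = trans (sum-cong (λ h → cong (λ z → 𝟙 z * X (a h)) (sym (mask-a N N-a h)))) (sum-a (λ h → 𝟙 (N h) * X h))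

  edge-total : ∀ (N : Mask n) (X : Fin n → ℤ) c → (∀ h → N h ≡ true → N (a h) ≡ true) → (∀ h → N h ≡ true → X h + X (a h) ≡ c) →
    + 2 * sumℤ (λ h → 𝟙 (N h) * X h) ≡ c * # N
  edge-total N X c N-a cs = begin
    + 2 * sumℤ (λ h → 𝟙 (N h) * X h)                              ≡⟨ double (sumℤ (λ h → 𝟙 (N h) * X h)) ⟩
    sumℤ (λ h → 𝟙 (N h) * X h) + sumℤ (λ h → 𝟙 (N h) * X h)       ≡⟨ cong (_+_ (sumℤ (λ h → 𝟙 (N h) * X h))) (sym (edge-swap N N-a X)) ⟩
    sumℤ (λ h → 𝟙 (N h) * X h) + sumℤ (λ h → 𝟙 (N h) * X (a h))   ≡⟨ sym (sum-+ (λ h → 𝟙 (N h) * X h) (λ h → 𝟙 (N h) * X (a h))) ⟩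
    sumℤ (λ h → 𝟙 (N h) * X h + 𝟙 (N h) * X (a h))                ≡⟨ sum-cong
      (λ h → trans (sym (ℤP.*-distribˡ-+ (𝟙 (N h)) (X h) (X (a h)))) (trans (𝟙*-cong (N h) (cs h)) (ℤP.*-comm (𝟙 (N h)) c))) ⟩
    sumℤ (λ h → c * 𝟙 (N h))                                      ≡⟨ sum-* c (𝟙 ∘ N) ⟩
    c * # N ∎
    where
      open ≡-Reasoning
      double : ∀ x → + 2 * x ≡ x + x
      double = solve-∀

  module _ {d : ℕ} {w : ZBiorientation M} (or : IsDOrientation M w d) where

    private
      x y : Fin n → ℤ
      x = xOf w
      y = yOf w

    edge-weight : ∀ h → ¬ OuterEdge M h → w h + w (a h) ≡ + d - + 2
    edge-weight = proj₁ (proj₂ (proj₂ or))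

    vertex-class : ∀ h → ¬ OuterVertex M h → V.class-sum x h ≡ + d
    vertex-class h p = trans (sym (vertexWeight≡ w h)) (proj₁ (proj₂ (proj₂ (proj₂ or))) h p)

    face-class : ∀ h → ρ h ≡ false → F.class-sum (λ c → + 1 - y (a c)) h ≡ + d
    face-class h p = trans (sym (face-sum w h)) (proj₂ (proj₂ (proj₂ (proj₂ or))) h (⌊⌋-false⁻ (sameFace? M h root) p))

    module _ {m : ℕ} {hs : Fin (suc m) → Fin n} (cyc : IsCycle M m hs) where
      open Cycle cyc

      module _ (S : Mask n) (S-root : S root ≡ true)
        (S-reach : ∀ x → S x ≡ true → Star (DualStep M w₀ hs) root x)
        (S-closed : ∀ x y → S x ≡ true → DualStep M w₀ hs x y → S y ≡ true) where
        open Side S S-root S-reach S-closed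

        private
          N : Mask n
          N h = not (S h)

          not-ρ : ∀ {h} → N h ≡ true → ρ h ≡ false
          not-ρ e = not-true (λ p → true≢false (RootIn {S} S-f S-root p) (not-true⁻ e))

          Ein⁻ : ∀ {h} → Ein h ≡ true → ¬ OnCycle M w₀ hs h × (S h ≡ false)
          Ein⁻ {h} e = let (p , q) = ∧-true⁻ {not (onC h)} e in ⌊⌋-false⁻ (onCycle? h) (not-true⁻ p) , not-true⁻ q

          Ein-a : ∀ h → Ein h ≡ true → Ein (a h) ≡ true
          Ein-a h e = let (p , q) = Ein⁻ e in
            ∧-true⁺ (not-true⁺ (⌊⌋-false⁺ (onCycle? (a h)) (λ c → p (subst (OnCycle M w₀ hs) (aa h) (OnCycle-a c)))))
              (not-true⁺ (trans (S-a p) q))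

          Vin-s : ∀ h → Vin h ≡ true → Vin (s h) ≡ true
          Vin-s h e = let (p , q) = ∧-true⁻ {not (onV h)} e in
            ∧-true⁺ (trans (cong not (V.mask-const onV onV-s h)) p) (trans (cong not (S-s h (not-true⁻ p))) q)

          Vin⊆Ein : ∀ h → Vin h ≡ true → Ein h ≡ true
          Vin⊆Ein h e = let (p , q) = ∧-true⁻ {not (onV h)} e in
            ∧-true⁺ (not-true⁺ (⌊⌋-false⁺ (onCycle? h) (λ c → true≢false (OnCycle⇒onV c) (not-true⁻ p)))) q

          inner-edge : ∀ h → Ein h ≡ true → w h + w (a h) ≡ + d - + 2
          inner-edge h e = edge-weight h λ where
            (inj₁ o) → true≢false (ρ⁺ o) (not-ρ (not-true⁺ (proj₂ (Ein⁻ e))))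
            (inj₂ o) → true≢false (ρ⁺ o) (not-ρ (not-true⁺ (proj₂ (Ein⁻ (Ein-a h e)))))

          inner-vertex : ∀ r → Vin r ≡ true → V.class-sum x r ≡ + d
          inner-vertex r e = vertex-class r λ { (g , v , o) → true≢false (ρ⁺ o)
            (not-ρ (proj₂ (∧-true⁻ {not (onV g)} (trans (sym (V.~-const Vin (V.mask-const Vin Vin-s) v)) e)))) }

          X Y : ℤ
          X = sumℤ (λ h → 𝟙 (Ein h) * x h)
          Y = sumℤ (λ h → 𝟙 (Ein h) * y h)

          -- Only an inequality, because flow from inside faces into the cycle is missing from `Y`;
          -- in `vertices`, because `X` also contains flow into vertices of the cycle. Both have the
          -- sign that the bound needs.
          faces : + d * # Fin′ ≤ # N - Y
          faces = subst₂ _≤_ (F.orbit-total N (λ c → + 1 - y (a c)) (+ d) (λ h e → trans (cong not (F.mask-const S S-f h)) e)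
            (λ r e → face-class r (not-ρ e)))
            (trans (sum-sub (𝟙 ∘ N) (λ h → 𝟙 (Ein h) * y (a h))) (cong (_-_ (# N)) (edge-swap Ein Ein-a y)))
            (sum-mono (λ h → subst (_≤ 𝟙 (N h) - 𝟙 (Ein h) * y (a h)) (sym (distrib (𝟙 (N h)) (y (a h))))
              (ℤP.+-monoʳ-≤ (𝟙 (N h)) (ℤP.neg-mono-≤ (𝟙*-mono {Ein h} {N h} (λ e → proj₂ (∧-true⁻ {not (onC h)} e))
                (λ _ → ℤP.≤-refl) (0≤neg (w (a h))))))))
            where
              distrib : ∀ u v → u * (+ 1 - v) ≡ u - u * v
              distrib u v = trans (ℤP.*-distribˡ-+ u (+ 1) (- v)) (cong₂ _+_ (ℤP.*-identityʳ u) (sym (ℤP.neg-distribʳ-* u v)))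

          vertices : + d * # (λ h → V.least h ∧ Vin h) ≤ X
          vertices = subst (_≤ X) (V.orbit-total Vin x (+ d) Vin-s inner-vertex)
            (sum-mono (λ h → 𝟙*-mono {Vin h} {Ein h} (Vin⊆Ein h) (λ _ → ℤP.≤-refl) (0≤pos (w h))))

          edges : (+ d - + 2) * # Ein ≡ + 2 * (X - Y)
          edges = trans (sym (edge-total Ein w (+ d - + 2) Ein-a inner-edge)) (cong (+ 2 *_)
            (trans (sum-cong (λ h → trans (cong (𝟙 (Ein h) *_) (sym (pos-neg (w h)))) (trans (ℤP.*-distribˡ-+ (𝟙 (Ein h)) (x h)
              (- y h)) (cong (_+_ (𝟙 (Ein h) * x h)) (sym (ℤP.neg-distribʳ-* (𝟙 (Ein h)) (y h)))))))
              (sum-sub (λ h → 𝟙 (Ein h) * x h) (λ h → 𝟙 (Ein h) * y h))))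

          one-side : ∀ (g g′ : Fin (suc m) → Fin n) → (∀ h → 𝟙 (onC h) ≡ sumℤ (λ i → δ (g i) h) + sumℤ (λ i → δ (g′ i) h)) →
            (∀ i → S (g′ i) ≡ true) → # (λ h → N h ∧ onC h) ≤ + suc m
          one-side g g′ split out = subst (# (λ h → N h ∧ onC h) ≤_) (sum-δ-index g) (sum-mono λ h → bound h (true? (S h)))
            where
              bound : ∀ h → (S h ≡ true) ⊎ (S h ≡ false) → 𝟙 (N h ∧ onC h) ≤ sumℤ (λ i → δ (g i) h)
              bound h (inj₁ e) rewrite e = sum-nonneg (λ i → 0≤δ (g i) h)
              bound h (inj₂ e) rewrite e = ℤP.≤-reflexive (trans (split h) (trans (cong (_+_ (sumℤ (λ i → δ (g i) h)))
                (sum-zero (λ i → δ-≢ (λ q → true≢false (trans (cong S (sym q)) (out i)) e)))) (ℤP.+-identityʳ _)))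

          -- Of the two half-edges of a cycle edge only one has the inside on its left.
          #N : # N ≤ # Ein + + suc m
          #N = subst (_≤ # Ein + + suc m) (sym (trans (#-split N onC) (trans (ℤP.+-comm (# (λ h → N h ∧ onC h)) _)
            (cong (_+ # (λ h → N h ∧ onC h)) (sum-cong (λ h → cong 𝟙 (∧-comm (N h) (not (onC h)))))))))
            (ℤP.+-monoʳ-≤ (# Ein)
              ([ (λ j → one-side (λ i → a (hs i)) hs (λ h → trans (onC-δ h) (ℤP.+-comm (sumℤ (λ i → δ (hs i) h)) _)) (λ i → proj₁ (j i)))
                                    , (λ j → one-side hs (λ i → a (hs i)) onC-δ (λ i → proj₂ (j i))) ]′ jordan))

        -- The face, vertex and edge conditions inside the cycle, combined with `inner-euler`,
        -- eliminate `X`, `Y` and all counts except the length of the cycle.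
        girth-side : d ℕ.≤ suc m
        girth-side = ℤP.drop‿+≤+ (ℤP.*-cancelˡ-≤-pos (+ d) (+ suc m) (+ 2)
          (girth-arith (+ d) (+ suc m) (# Ein) (# N) Y X (# (λ h → V.least h ∧ Vin h))
            (# Fin′) #N faces vertices inner-euler edges (+≤+ ℕ.z≤n)))

      girth-bound : d ℕ.≤ suc m
      girth-bound = let (S , p , q , r) = reach-set (DualStep M w₀ hs) dualStep? root in girth-side S p q r

    orientation⇒girth : outerDeg M ≡ d → Girth M d
    orientation⇒girth od = proj₂ (outer-contour d no-short od (a root , inside)) , no-short
      where
        no-short : ∀ k → k ℕ.< d → ¬ HasCycle M k
        no-short (suc k) l (hs , cyc) = ℕP.<⇒≱ l (girth-bound cyc)
        inside : ρ (a root) ≡ false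
        inside = one-sided (proj₁ (proj₁ or)) ρ-root

-- Uniqueness

step-cancel : ∀ t t′ u → (t - t′) + (t′ - u) ≡ t - u
step-cancel = solve-∀

private
  split₂ : ∀ u v e q → (v - e) * u + (e - q) * + 0 ≡ v * u - e * u
  split₂ = solve-∀

  distrib₂ : ∀ t u v → t * (u - v) ≡ t * u - t * v
  distrib₂ = solve-∀

  orth-expand : ∀ v e q x y → (v - e) * x + (e - q) * y ≡ (v * x - q * y) + (e * y - e * x)
  orth-expand = solve-∀

  loop-cancel : ∀ r b c → ((r - b) + (b - c)) - (r - c) ≡ + 0
  loop-cancel = solve-∀

sum-all : ∀ {m k} (T : Mask m) (G : Fin m → Fin k → ℤ) → Fin k → ℤ
sum-all T G h = sumℤ (λ c → 𝟙 (T c) * G c h)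

sum-all-zero : ∀ {m k} (T : Mask m) (G : Fin m → Fin k → ℤ) h → (∀ c → T c ≡ true → G c h ≡ + 0) → sum-all T G h ≡ + 0
sum-all-zero T G h z = sum-zero (λ c → trans (𝟙*-cong (T c) (z c)) (ℤP.*-zeroʳ (𝟙 (T c))))

sum-all-nonneg : ∀ {m k} (T : Mask m) (G : Fin m → Fin k → ℤ) h → (∀ c → + 0 ≤ G c h) → + 0 ≤ sum-all T G h
sum-all-nonneg T G h z = sum-nonneg (λ c → 0≤* (0≤𝟙 (T c)) (z c))

sum-all-term : ∀ {m k} (T : Mask m) (G : Fin m → Fin k → ℤ) h → (∀ c → + 0 ≤ G c h) → ∀ c → T c ≡ true → G c h ≤ sum-all T G h
sum-all-term T G h z c e = subst (_≤ sum-all T G h) (trans (cong (λ b → 𝟙 b * G c h) e) (ℤP.*-identityˡ (G c h)))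
  (sum-nonneg-term (λ c → 0≤* (0≤𝟙 (T c)) (z c)) c)

pos-cancel : ∀ {μ x} → + 0 < μ → + 0 < μ * x → + 0 < x
pos-cancel {μ} {x} 0<μ 0<μx with ≤-cases x (+ 0)
... | inj₂ q = q
... | inj₁ q = ⊥-elim (≤<-absurd (subst (μ * x ≤_) (ℤP.*-zeroʳ μ) (ℤP.*-monoˡ-≤-nonNeg μ {{ℤ.nonNegative (ℤP.<⇒≤ 0<μ)}} q)) 0<μx)

pos-mult : ∀ {μ x} → + 0 < μ → + 0 < x → + 0 < μ * x
pos-mult {μ} {x} 0<μ 0<x = subst (_< μ * x) (ℤP.*-zeroʳ μ) (ℤP.*-monoˡ-<-pos μ {{ℤ.positive 0<μ}} 0<x)

sub-pos : ∀ {x y} → y < x → + 0 < x - y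
sub-pos {x} {y} p = subst (_< x - y) (ℤP.+-inverseʳ y) (ℤP.+-monoˡ-< (- y) p)

sub-pos⁻ : ∀ {x y} → + 0 < x - y → y < x
sub-pos⁻ {x} {y} p = subst₂ _<_ (ℤP.+-identityˡ y) (back x y) (ℤP.+-monoˡ-< y p)
  where
    back : ∀ x y → (x - y) + y ≡ x
    back = solve-∀

module Flows (M : PlaneMap) where
  open Orientations M public

  -- A circulation is a cycle of the derived map supported on the derived edges between vertices and
  -- edges. As the other component is zero, its corner potential is constant on each face.
  face-potential : ∀ (Y : Fin n → ℤ) → (∀ (t : Fin n → ℤ) → (∀ h → t (s h) ≡ t h) → sumℤ (λ h → t h * (Y h - Y (a h))) ≡ + 0) →
    ∃ λ μ → (+ 0 < μ) × ∃ λ p → (∀ h → p (f h) ≡ p h) × (∀ h → p h - p (a h) ≡ μ * (Y h - Y (a h)))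
  face-potential Y orth = μ , proj₁ (proj₂ pot) , Q , Q-f , diff
    where
      X : Fin n → ℤ
      X h = Y h - Y (a h)
      tE-zero : ∀ (t : Fin n → ℤ) → (∀ h → t (a h) ≡ t h) → sumℤ (λ h → t h * X h) ≡ + 0
      tE-zero t inv = trans (sum-cong (λ h → distrib₂ (t h) (Y h) (Y (a h)))) (trans (sum-sub (λ h → t h * Y h) (λ h → t h * Y (a h)))
        (trans (cong (_-_ (sumℤ (λ h → t h * Y h))) (inv-pair a sum-a t Y inv)) (ℤP.+-inverseʳ (sumℤ (λ h → t h * Y h)))))
      zero-orth : ∀ t → ⟨ ∇ᵛ t , ∇ᶠ t ∣ X , (λ _ → + 0) ⟩ ≡ + 0
      zero-orth t = trans (sum-cong (λ h → split₂ (X h) (tV t h) (tE t h) (tF t h))) (trans (sum-sub (λ h → tV t h * X h)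
        (λ h → tE t h * X h))
        (cong₂ _-_ (orth (tV t) (tV-inv t)) (tE-zero (tE t) (tE-inv t))))
      pot = corner-potential X (λ _ → + 0) zero-orth
      μ : ℤ
      μ = proj₁ pot
      Q : Fin n → ℤ
      Q = proj₁ (proj₂ (proj₂ pot))
      Q-f : ∀ h → Q (f h) ≡ Q h
      Q-f h = trans (a-b≡0⇒a≡b (trans (sym (proj₂ (proj₂ (proj₂ (proj₂ pot))) (f h))) (ℤP.*-zeroʳ μ))) (cong Q (f⁻f h))
      diff : ∀ h → Q h - Q (a h) ≡ μ * X h
      diff h = trans (cong (_-_ (Q h)) (trans (cong Q (sym (fs⁻ h))) (Q-f (s⁻ h)))) (sym (proj₁ (proj₂ (proj₂ (proj₂ pot))) h))

  module Contour {w : ZBiorientation M} (adm : Admissible M w) where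

    contour-distinct : ∀ {g g′} → ρ g ≡ true → ρ g′ ≡ true → SameVertex M g g′ → g ≡ g′
    contour-distinct p q = proj₁ (proj₁ adm) _ _ (ρ⁻ p) (ρ⁻ q)

    contour-one-sided : ∀ {h} → ρ h ≡ true → ρ (a h) ≡ false
    contour-one-sided = one-sided (proj₁ adm)

    outer-weights : ∀ {h} → ρ h ≡ true → (w h ≡ + 0 × w (a h) ≡ + 1) ⊎ (w h ≡ + 1 × w (a h) ≡ + 0)
    outer-weights e = proj₁ (proj₂ adm) _ (inj₁ (ρ⁻ e))

    inner-out : ∀ {h} → ρ h ≡ false → ρ (a h) ≡ false → OuterVertex M h → w h ≤ + 0
    inner-out {h} p q = proj₂ (proj₂ adm) h
      [ (λ o → true≢false (ρ⁺ o) p) , (λ o → true≢false (ρ⁺ o) q) ]′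

  -- A flow x of edges into vertices and y of faces into edges crosses the moves h ↦ s⁻ h and h ↦ f⁻ h
  -- between corners; the flood makes the moves that cross no flow.
  FloodStep : ZBiorientation M → Fin n → Fin n → Set
  FloodStep w x y = ((w x ≤ + 0) × (y ≡ s⁻ x)) ⊎ ((+ 0 ≤ w (a x)) × (y ≡ f⁻ x))

  floodStep? : ∀ w x y → Dec (FloodStep w x y)
  floodStep? w x y = ((w x ≤? + 0) ×-dec (y FinP.≟ s⁻ x)) ⊎-dec ((+ 0 ≤? w (a x)) ×-dec (y FinP.≟ f⁻ x))

  -- The root face is on the left of its half-edges, so a contour traversed along them has the inner
  -- faces on its right.
  Clockwise : ZBiorientation M → Set
  Clockwise w = ∀ g → ρ g ≡ true → (w g ≡ + 0) × (w (a g) ≡ + 1)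

  module _ {w : ZBiorientation M} (suit : Suitable M w) where
    open Contour (proj₁ (proj₂ suit))

    private
      entering : ∀ v {x y} → Star (AccStep M w) x y → ¬ SameVertex M v x → SameVertex M v y → ∃ λ z → SameVertex M v z × (+ 0 < w z)
      entering v ε p q = ⊥-elim (p q)
      entering v {x} (inj₁ refl ◅ r) p q = entering v r (λ u → p (V.~-trans u (V.~-sym (V.~-f x)))) q
      entering v {x} (inj₂ (tr , refl) ◅ r) p q with sameVertex? M v (a x)
      ... | yes u = a x , u , tr
      ... | no ¬u = entering v r ¬u q

      -- The vertex of `a g` must be enterable. Inner half-edges there are outgoing and the edge of
      -- `g` leaves it, so the other contour edge enters it. A contour with a single edge is treated
      -- apart.
      propagate : ∀ g → ρ g ≡ true → w g ≡ + 1 → w (a g) ≡ + 0 → w (f⁻ g) ≡ + 1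
      propagate g e w1 w0 with f⁻ g FinP.≟ g
      ... | yes q = trans (cong w q) w1
      ... | no ¬q with entering (f⁻ g) (proj₂ (proj₂ suit) g (g , V.~-refl g , ρ⁻ e) (f⁻ g)) (λ u → ¬q (contour-distinct (ρ-f⁻ g e) e u)) (V.~-refl (f⁻ g))
      ...   | z , v , 0<z with true? (ρ z) | true? (ρ (a z))
      ...     | inj₁ ez | _ = [
          (λ { (q , _) → ⊥-elim (ℤP.<-irrefl (sym q)
          (subst (+ 0 <_) (cong w (sym (contour-distinct (ρ-f⁻ g e) ez v))) 0<z)) }) , proj₁ ]′ (outer-weights (ρ-f⁻ g e))
      ...     | inj₂ ez | inj₁ eaz = ⊥-elim (ℤP.<-irrefl (sym (trans (cong w z≡) w0)) 0<z)
        where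
          z≡ : z ≡ a g
          z≡ = trans (sym (ss⁻ z))
            (trans (cong s (trans (cong s⁻ (sym (aa z))) (sym (contour-distinct (ρ-f⁻ g e) (ρ-f⁻ (a z) eaz)
            (V.~-trans v (subst (SameVertex M z) (cong s⁻ (sym (aa z))) (V.~-f⁻ z))))))) (ss⁻ (a g)))
      ...     | inj₂ ez | inj₂ eaz = ⊥-elim (≤<-absurd (inner-out ez eaz (f⁻ g , V.~-sym v , ρ⁻ (ρ-f⁻ g e))) 0<z)

      forward : ∀ g → (ρ g ≡ true) × (w g ≡ + 0) → (ρ (f g) ≡ true) × (w (f g) ≡ + 0)
      forward g (e , w0) = ρ-f g e , [ proj₁ , (λ { (p , q) → ⊥-elim (1≢0 (trans (sym (propagate (f g) (ρ-f g e) p q))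
        (trans (cong w (f⁻f g)) w0))) }) ]′ (outer-weights (ρ-f g e))
        where
          1≢0 : + 1 ≢ + 0
          1≢0 ()

    suitable⇒clockwise : Clockwise w
    suitable⇒clockwise g e with outer-weights e
    ... | inj₁ p = p
    -- One contour edge against the clockwise direction forces all of them, and then the complement
    -- of the root face has a counterclockwise boundary circuit.
    ... | inj₂ (p , q) = ⊥-elim (let (m , hs , ccw) = ccw-circuit w R R-f (cong not ρ-root) trav {a root} (not-true⁺ (contour-one-sided ρ-root)) in proj₁ suit m hs ccw)
      where
        1≢0 : + 1 ≢ + 0
        1≢0 ()
        R : Mask n
        R h = not (ρ h)
        R-f : FaceMask R
        R-f h = trans (cong not (F.mask-const ρ ρ-f h))
        trav : ∀ h → R h ≡ true → R (a h) ≡ false → + 0 < w (a h)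
        trav h _ r = [ (λ { (z , _) → ⊥-elim (1≢0 (trans (sym p) (proj₂ (F.~-ind (λ z → (ρ z ≡ true) × (w z ≡ + 0)) forward
          (F.~-trans (ρ⁻ eah) (F.~-sym (ρ⁻ e))) (eah , z))))) })
                     , (λ { (z , _) → subst (+ 0 <_) (sym z) (+<+ (ℕ.s≤s ℕ.z≤n)) }) ]′ (outer-weights eah)
          where
            eah : ρ (a h) ≡ true
            eah = not-false (λ q → true≢false (not-true⁺ q) r)

  module _ (w : ZBiorientation M) where

    -- A path as the chain of half-edges that it traverses; turns around a vertex leave no trace. In
    -- `floodCount` the moves that run along an edge are those by `f⁻`.
    accCount : ∀ {x y} → Star (AccStep M w) x y → Fin n → ℤ
    accCount ε h = + 0
    accCount (inj₁ _ ◅ r) h = accCount r h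
    accCount {x} (inj₂ _ ◅ r) h = δ x h + accCount r h

    0≤accCount : ∀ {x y} (r : Star (AccStep M w) x y) h → + 0 ≤ accCount r h
    0≤accCount ε h = ℤP.≤-refl
    0≤accCount (inj₁ _ ◅ r) h = 0≤accCount r h
    0≤accCount {x} (inj₂ _ ◅ r) h = 0≤+ (0≤δ x h) (0≤accCount r h)

    accCount-zero : ∀ {x y} (r : Star (AccStep M w) x y) h → w (a h) ≤ + 0 → accCount r h ≡ + 0
    accCount-zero ε h p = refl
    accCount-zero (inj₁ _ ◅ r) h p = accCount-zero r h p
    accCount-zero {x} (inj₂ (tr , _) ◅ r) h p = cong₂ _+_ (δ-≢ {i = x} {h} (λ { refl → ≤<-absurd p tr })) (accCount-zero r h p)

    floodCount : ∀ {x y} → Star (FloodStep w) x y → Fin n → ℤ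
    floodCount ε h = + 0
    floodCount (inj₁ _ ◅ r) h = floodCount r h
    floodCount {x} (inj₂ _ ◅ r) h = δ x h + floodCount r h

    floodCount-zero : ∀ (S : Mask n) → (∀ x y → S x ≡ true → FloodStep w x y → S y ≡ true) →
      ∀ {x y} (r : Star (FloodStep w) x y) → S x ≡ true → ∀ h → (S h ≡ false) ⊎ (S (f⁻ h) ≡ false) → floodCount r h ≡ + 0
    floodCount-zero S c ε p h q = refl
    floodCount-zero S c (st@(inj₁ _) ◅ r) p h q = floodCount-zero S c r (c _ _ p st) h q
    floodCount-zero S c {x} (st@(inj₂ (_ , refl)) ◅ r) p h q = cong₂ _+_
      (δ-≢ {i = x} {h} (λ { refl → [ true≢false p , true≢false (c _ _ p st) ]′ q })) (floodCount-zero S c r (c _ _ p st) h q)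

    private
      sum-step : ∀ (t Z : Fin n → ℤ) x → sumℤ (λ h → t h * ((δ x h + Z h) - (δ x (a h) + Z (a h)))) ≡ (t x - t (a x)) + sumℤ
        (λ h → t h * (Z h - Z (a h)))
      sum-step t Z x = begin
        sumℤ (λ h → t h * ((δ x h + Z h) - (δ x (a h) + Z (a h))))
          ≡⟨ sum-cong (λ h → trans (expand (t h) (δ x h) (Z h) (δ x (a h)) (Z (a h)))
            (cong (λ z → (δ x h * t h - z * t h) + t h * (Z h - Z (a h))) (δ-iff (λ e → trans (cong a e) (aa h))
            (λ e → trans (sym (aa x)) (cong a e))))) ⟩
        sumℤ (λ h → (δ x h * t h - δ (a x) h * t h) + t h * (Z h - Z (a h)))
          ≡⟨ sum-+ (λ h → δ x h * t h - δ (a x) h * t h) (λ h → t h * (Z h - Z (a h))) ⟩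
        sumℤ (λ h → δ x h * t h - δ (a x) h * t h) + sumℤ (λ h → t h * (Z h - Z (a h)))
          ≡⟨ cong (_+ sumℤ (λ h → t h * (Z h - Z (a h)))) (trans (sum-sub (λ h → δ x h * t h) (λ h → δ (a x) h * t h))
            (cong₂ _-_ (sum-δ x t) (sum-δ (a x) t))) ⟩
        (t x - t (a x)) + sumℤ (λ h → t h * (Z h - Z (a h))) ∎
        where
          open ≡-Reasoning
          expand : ∀ t u z u′ z′ → t * ((u + z) - (u′ + z′)) ≡ (u * t - u′ * t) + t * (z - z′)
          expand = solve-∀

      sum-nil : ∀ (t : Fin n → ℤ) x → sumℤ (λ h → t h * (+ 0 - + 0)) ≡ t x - t x
      sum-nil t x = trans (sum-zero (λ h → ℤP.*-zeroʳ (t h))) (sym (ℤP.+-inverseʳ (t x)))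

    accCount-div : ∀ (t : Fin n → ℤ) → (∀ h → t (s h) ≡ t h) → ∀ {x y} (r : Star (AccStep M w) x y) →
      sumℤ (λ h → t h * (accCount r h - accCount r (a h))) ≡ t x - t y
    accCount-div t inv {x} ε = sum-nil t x
    accCount-div t inv {x} {y} (inj₁ refl ◅ r) = trans (accCount-div t inv r) (cong (_- t y) (inv x))
    accCount-div t inv {x} {y} (inj₂ (_ , refl) ◅ r) = trans (sum-step t (accCount r) x)
      (trans (cong (_+_ (t x - t (a x))) (accCount-div t inv r)) (step-cancel (t x) (t (a x)) (t y)))

    floodCount-div : ∀ (t : Fin n → ℤ) → (∀ h → t (s h) ≡ t h) → ∀ {x y} (r : Star (FloodStep w) x y) →
      sumℤ (λ h → t h * (floodCount r h - floodCount r (a h))) ≡ t x - t y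
    floodCount-div t inv {x} ε = sum-nil t x
    floodCount-div t inv {x} {y} (inj₁ (_ , refl) ◅ r) = trans (floodCount-div t inv r) (cong (_- t y) (s⁻-inv t inv x))
    floodCount-div t inv {x} {y} (inj₂ (_ , refl) ◅ r) = trans (sum-step t (floodCount r) x)
      (trans (cong (_+_ (t x - t (a x))) (trans (floodCount-div t inv r) (cong (_- t y) (s⁻-inv t inv (a x)))))
        (step-cancel (t x) (t (a x)) (t y)))

    single-div : ∀ (t : Fin n → ℤ) x → sumℤ (λ h → t h * (δ x h - δ x (a h))) ≡ t x - t (a x)
    single-div t x = trans (sum-cong (λ h → cong₂ (λ u v → t h * (u - v)) (sym (ℤP.+-identityʳ (δ x h)))
      (sym (ℤP.+-identityʳ (δ x (a h))))))
      (trans (sum-step t (λ _ → + 0) x) (trans (cong (_+_ (t x - t (a x))) (sum-zero (λ h → ℤP.*-zeroʳ (t h))))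
        (ℤP.+-identityʳ (t x - t (a x)))))

  -- Let R be the complement of the set S flooded from the root.  For each corner c of S with f⁻ c in R,
  -- a directed path from the root to the edge of c, closed up through S, is a closed chain crossing
  -- that edge.  On R the sum of the face potentials of these chains is maximal on a union of faces
  -- whose boundary is traversable counterclockwise.
  module FloodAll (w : ZBiorientation M) (minimal : Minimal M w) (acc : AccessibleFrom M w root)
    (S : Mask n) (S-root : S root ≡ true) (S-reach : ∀ x → S x ≡ true → Star (FloodStep w) root x)
    (S-closed : ∀ x y → S x ≡ true → FloodStep w x y → S y ≡ true) where

    private
      T : Mask n
      T c = S c ∧ not (S (f⁻ c))

      -- The move from `c` to the unflooded corner `f⁻ c` is blocked, which determines the sign of
      -- `w (a c)`. Then the move `s⁻` from `a c` to the same corner is open, so `a c` is not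
      -- flooded either.
      T⁻ : ∀ {c} → T c ≡ true → (S c ≡ true) × (S (f⁻ c) ≡ false) × (w (a c) ≤ + 0) × (S (a c) ≡ false)
      T⁻ {c} e = p , q , neg′ , not-true (λ r → true≢false (S-closed (a c) (f⁻ c) r (inj₁ (neg′ , refl))) q)
        where
          p : S c ≡ true
          p = proj₁ (∧-true⁻ {S c} e)
          q : S (f⁻ c) ≡ false
          q = not-true⁻ (proj₂ (∧-true⁻ {S c} e))
          neg′ : w (a c) ≤ + 0
          neg′ = [ (λ l → l) , (λ l → ⊥-elim (true≢false (S-closed c (f⁻ c) p (inj₂ (ℤP.<⇒≤ l , refl))) q)) ]′ (≤-cases (w (a c)) (+ 0))

      A N : Fin n → Fin n → ℤ
      A c h = accCount w (acc (a c)) h + δ (a c) h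
      N c h = [ (λ e → floodCount w (S-reach c e) h) , (λ _ → + 0) ]′ (true? (S c))

      N-true : ∀ c → S c ≡ true → ∃ λ (r : Star (FloodStep w) root c) → ∀ h → N c h ≡ floodCount w r h
      N-true c e with true? (S c)
      ... | inj₁ e′ = S-reach c e′ , λ h → refl
      ... | inj₂ e′ = ⊥-elim (true≢false e e′)

      Y : Fin n → ℤ
      Y h = sumℤ (λ c → 𝟙 (T c) * (A c h - N c h))

      loop : ∀ c → T c ≡ true → ∀ (t : Fin n → ℤ) → (∀ h → t (s h) ≡ t h) → sumℤ
        (λ h → t h * ((A c h - N c h) - (A c (a h) - N c (a h)))) ≡ + 0
      loop c e t inv = begin
        sumℤ (λ h → t h * ((A c h - N c h) - (A c (a h) - N c (a h))))
          ≡⟨ sum-cong (λ h → trans (cong₂ (λ u v → t h * ((A c h - u) - (A c (a h) - v))) (proj₂ nt h) (proj₂ nt (a h)))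
               (expand (t h) (accCount w p h) (δ (a c) h) (floodCount w r h) (accCount w p (a h)) (δ (a c) (a h)) (floodCount w r (a h)))) ⟩
        sumℤ (λ h → (t h * (accCount w p h - accCount w p (a h)) + t h * (δ (a c) h - δ (a c) (a h))) - t h *
          (floodCount w r h - floodCount w r (a h)))
          ≡⟨ trans (sum-sub (λ h → t h * (accCount w p h - accCount w p (a h)) + t h * (δ (a c) h - δ (a c) (a h)))
            (λ h → t h * (floodCount w r h - floodCount w r (a h))))
               (cong₂ _-_ (trans (sum-+ (λ h → t h * (accCount w p h - accCount w p (a h))) (λ h → t h * (δ (a c) h - δ (a c) (a h))))
                 (cong₂ _+_ (accCount-div w t inv p) (trans (single-div w t (a c)) (cong (λ z → t (a c) - t z) (aa c)))))
                   (floodCount-div w t inv r)) ⟩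
        ((t root - t (a c)) + (t (a c) - t c)) - (t root - t c) ≡⟨ loop-cancel (t root) (t (a c)) (t c) ⟩
        + 0 ∎
        where
          open ≡-Reasoning
          p = acc (a c)
          nt = N-true c (proj₁ (T⁻ e))
          r = proj₁ nt
          expand : ∀ t u v r u′ v′ r′ → t * (((u + v) - r) - ((u′ + v′) - r′)) ≡ (t * (u - u′) + t * (v - v′)) - t * (r - r′)
          expand = solve-∀

      orth : ∀ (t : Fin n → ℤ) → (∀ h → t (s h) ≡ t h) → sumℤ (λ h → t h * (Y h - Y (a h))) ≡ + 0
      orth t inv = begin
        sumℤ (λ h → t h * (Y h - Y (a h)))
          ≡⟨ sum-cong (λ h → trans (cong (t h *_) (sym (sum-sub (λ c → 𝟙 (T c) * (A c h - N c h))
            (λ c → 𝟙 (T c) * (A c (a h) - N c (a h))))))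
               (sym (sum-* (t h) (λ c → 𝟙 (T c) * (A c h - N c h) - 𝟙 (T c) * (A c (a h) - N c (a h)))))) ⟩
        sumℤ (λ h → sumℤ (λ c → t h * (𝟙 (T c) * (A c h - N c h) - 𝟙 (T c) * (A c (a h) - N c (a h)))))
          ≡⟨ sum-swap (λ h c → t h * (𝟙 (T c) * (A c h - N c h) - 𝟙 (T c) * (A c (a h) - N c (a h)))) ⟩
        sumℤ (λ c → sumℤ (λ h → t h * (𝟙 (T c) * (A c h - N c h) - 𝟙 (T c) * (A c (a h) - N c (a h)))))
          ≡⟨ sum-cong (λ c → trans (sum-cong (λ h → pull′ (t h) (𝟙 (T c)) (A c h - N c h) (A c (a h) - N c (a h))))
               (sum-* (𝟙 (T c)) (λ h → t h * ((A c h - N c h) - (A c (a h) - N c (a h)))))) ⟩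
        sumℤ (λ c → 𝟙 (T c) * sumℤ (λ h → t h * ((A c h - N c h) - (A c (a h) - N c (a h)))))
          ≡⟨ sum-zero (λ c → trans (𝟙*-cong (T c) (λ e → loop c e t inv)) (ℤP.*-zeroʳ (𝟙 (T c)))) ⟩
        + 0 ∎
        where
          open ≡-Reasoning
          pull′ : ∀ t b u v → t * (b * u - b * v) ≡ b * (t * (u - v))
          pull′ = solve-∀

      Y≡ : ∀ h → Y h ≡ sum-all T A h - sum-all T N h
      Y≡ h = trans (sum-cong (λ c → distrib₂ (𝟙 (T c)) (A c h) (N c h))) (sum-sub (λ c → 𝟙 (T c) * A c h) (λ c → 𝟙 (T c) * N c h))

      0≤A : ∀ h → + 0 ≤ sum-all T A h
      0≤A h = sum-all-nonneg T A h (λ c → 0≤+ (0≤accCount w (acc (a c)) h) (0≤δ (a c) h))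

      A-zero : ∀ h → w (a h) ≤ + 0 → S (a h) ≡ false → sum-all T A h ≡ + 0
      A-zero h p q = sum-all-zero T A h (λ c e → cong₂ _+_ (accCount-zero w (acc (a c)) h p)
        (δ-≢ (λ r → true≢false (proj₁ (T⁻ e)) (trans (cong S (trans (sym (aa c)) (cong a r))) q))))

      N-zero : ∀ h → (S h ≡ false) ⊎ (S (f⁻ h) ≡ false) → sum-all T N h ≡ + 0
      N-zero h p = sum-all-zero T N h (λ c e → let (r , eq) = N-true c (proj₁ (T⁻ e)) in trans (eq h) (floodCount-zero w S S-closed r S-root h p))

      -- No chain of the sum runs along `c`: a directed path would need `w (a c)` positive, a
      -- closing edge `a c` in `S`, a flood path `f⁻ c` in `S`. No flood path starts a move at
      -- `a c`, whereas the closing edge of the chain of `c` runs along it.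
      crossing : ∀ c → T c ≡ true → + 1 ≤ Y (a c) - Y (a (a c))
      crossing c e = subst (+ 1 ≤_) (sym (trans (cong₂ _-_ (Y≡ (a c)) (trans (cong Y (aa c)) (Y≡ c)))
        (trans (cong₂ (λ u v → (sum-all T A (a c) - u) - v) n₁ zero₂) (tidy (sum-all T A (a c)))))) big
        where
          facts = T⁻ e
          n₁ : sum-all T N (a c) ≡ + 0
          n₁ = N-zero (a c) (inj₁ (proj₂ (proj₂ (proj₂ facts))))
          zero₂ : sum-all T A c - sum-all T N c ≡ + 0
          zero₂ = cong₂ _-_ (A-zero c (proj₁ (proj₂ (proj₂ facts))) (proj₂ (proj₂ (proj₂ facts))))
            (N-zero c (inj₂ (proj₁ (proj₂ facts))))
          tidy : ∀ u → (u - + 0) - + 0 ≡ u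
          tidy = solve-∀
          big : + 1 ≤ sum-all T A (a c)
          big = ℤP.≤-trans (≤-by (accCount w (acc (a c)) (a c)) (0≤accCount w (acc (a c)) (a c))
            (trans (cong (_+_ (accCount w (acc (a c)) (a c))) (δ-refl (a c))) (ℤP.+-comm (accCount w (acc (a c)) (a c)) (+ 1))))
            (sum-all-term T A (a c) (λ c′ → 0≤+ (0≤accCount w (acc (a c′)) (a c)) (0≤δ (a c′) (a c))) c e)

      module _ (μ : ℤ) (0<μ : + 0 < μ) (p : Fin n → ℤ) (p-f : ∀ h → p (f h) ≡ p h)
        (p-a : ∀ h → p h - p (a h) ≡ μ * (Y h - Y (a h))) (x₀ : Fin n) (x₀∉ : S x₀ ≡ false) (x₀-max : ∀ y → S y ≡ false → p y ≤ p x₀) where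

        R : Mask n
        R x = not (S x) ∧ ⌊ p x ℤ.≟ p x₀ ⌋

        R⁻ : ∀ {x} → R x ≡ true → (S x ≡ false) × (p x ≡ p x₀)
        R⁻ {x} e = let (u , v) = ∧-true⁻ {not (S x)} e in not-true⁻ u , ⌊⌋-true⁻ (p x ℤ.≟ p x₀) v

        R⁺ : ∀ {x} → S x ≡ false → p x ≡ p x₀ → R x ≡ true
        R⁺ {x} u v = ∧-true⁺ (not-true⁺ u) (⌊⌋-true⁺ (p x ℤ.≟ p x₀) v)

        -- A face is left towards `S` only at a corner of `T`, and `crossing` makes the potential
        -- beyond that edge exceed the maximum.
        R-f : FaceMask R
        R-f x e = R⁺ (not-true (λ sf → no-escape sf)) (trans (p-f x) (proj₂ (R⁻ e)))
          where
            no-escape : S (f x) ≡ true → ⊥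
            no-escape sf = ≤<-absurd (x₀-max (a (f x)) (proj₂ (proj₂ (proj₂ (T⁻ t)))))
              (subst (_< p (a (f x))) (trans (cong p (aa (f x))) (trans (p-f x) (proj₂ (R⁻ e))))
                (sub-pos⁻ (subst (+ 0 <_) (sym (p-a (a (f x)))) (pos-mult 0<μ (ℤP.<-≤-trans (+<+ (ℕ.s≤s ℕ.z≤n)) (crossing (f x) t))))))
              where
                t : T (f x) ≡ true
                t = ∧-true⁺ sf (not-true⁺ (trans (cong S (f⁻f x)) (proj₁ (R⁻ e))))

        -- If the edge were not traversable, both its sides would be outside `S`. Then no chain runs
        -- along `x`, and the potential cannot drop from `x` to `a x` as the choice of `R` requires.
        R-trav : ∀ x → R x ≡ true → R (a x) ≡ false → + 0 < w (a x)
        R-trav x e e′ = [ (λ l → ⊥-elim (blocked l (true? (S (a x))))) , (λ l → l) ]′ (≤-cases (w (a x)) (+ 0))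
          where
            blocked : w (a x) ≤ + 0 → (S (a x) ≡ true) ⊎ (S (a x) ≡ false) → ⊥
            blocked l (inj₁ sa) = true≢false (S-closed (a x) (f⁻ x) sa (inj₁ (l , refl))) (proj₁ (R⁻ (F.mask-inverse R R-f x e)))
            blocked l (inj₂ sa) = ≤<-absurd small (pos-cancel 0<μ (subst (+ 0 <_) (p-a x) (sub-pos lower)))
              where
                lower : p (a x) < p x
                lower = subst (p (a x) <_) (sym (proj₂ (R⁻ e))) (ℤP.≤∧≢⇒< (x₀-max (a x) sa) (λ q → true≢false (R⁺ sa q) e′))
                small : Y x - Y (a x) ≤ + 0
                small = subst (_≤ + 0) (sym (trans (cong₂ _-_ (Y≡ x) (Y≡ (a x))) (trans (cong₂ (λ u v → u - (sum-all T A (a x) - v))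
                    (cong₂ _-_ (A-zero x l sa) (N-zero x (inj₁ (proj₁ (R⁻ e))))) (N-zero (a x) (inj₁ sa))) (tidy (sum-all T A (a x))))))
                  (ℤP.neg-mono-≤ (0≤A (a x)))
                  where
                    tidy : ∀ u → + 0 - (u - + 0) ≡ - u
                    tidy = solve-∀

        no-maximum : ⊥
        no-maximum = let (m , hs , ccw) = ccw-circuit w R R-f (cong (λ z → not z ∧ ⌊ p root ℤ.≟ p x₀ ⌋) S-root) R-trav {x₀} (R⁺ x₀∉ refl) in minimal m hs ccw

    flooded : ∀ h → S h ≡ true
    flooded h = not-false λ h∉ →
      let (μ , 0<μ , p , p-f , p-a) = face-potential Y orth
          (x₀ , x₀∉ , mx) = argmax (not ∘ S) p {h} (not-true⁺ h∉)
      in no-maximum μ 0<μ p p-f p-a x₀ (not-true⁻ x₀∉) (λ y e → mx y (not-true⁺ e))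

  flood-all : ∀ w → Minimal M w → AccessibleFrom M w root → ∀ h → Star (FloodStep w) root h
  flood-all w mn acc h = let (S , S-root , S-reach , S-closed) = reach-set (FloodStep w) (floodStep? w) root in
    S-reach h (FloodAll.flooded w mn acc S S-root S-reach S-closed h)

  module _ {d : ℕ} {w w′ : ZBiorientation M} (or : IsDOrientation M w d) (or′ : IsDOrientation M w′ d)
    (cw : Clockwise w) (cw′ : Clockwise w′) where

    private
      module C = Contour (proj₁ or)
      module C′ = Contour (proj₁ or′)

      Δx Δy : Fin n → ℤ
      Δx h = xOf w′ h - xOf w h
      Δy h = yOf w′ h - yOf w h

      outer-same : ∀ h → (ρ h ≡ true) ⊎ (ρ (a h) ≡ true) → w′ h ≡ w h
      outer-same h (inj₁ e) = trans (proj₁ (cw′ h e)) (sym (proj₁ (cw h e)))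
      outer-same h (inj₂ e) = subst (λ z → w′ z ≡ w z) (aa h) (trans (proj₂ (cw′ (a h) e)) (sym (proj₂ (cw (a h) e))))

      inner? : ∀ h → ((ρ h ≡ true) ⊎ (ρ (a h) ≡ true)) ⊎ ((ρ h ≡ false) × (ρ (a h) ≡ false))
      inner? h with true? (ρ h) | true? (ρ (a h))
      ... | inj₁ e | _      = inj₁ (inj₁ e)
      ... | inj₂ _ | inj₁ e = inj₁ (inj₂ e)
      ... | inj₂ e | inj₂ q = inj₂ (e , q)

      not-outer : ∀ {h} → (ρ h ≡ false) × (ρ (a h) ≡ false) → ¬ OuterEdge M h
      not-outer (p , q) = [ (λ o → true≢false (ρ⁺ o) p) , (λ o → true≢false (ρ⁺ o) q) ]′

      vertex-zero : ∀ r → V.class-sum Δx r ≡ + 0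
      vertex-zero r = trans (sum-cong (λ g → distrib₂ V.[ r ~ g ] (xOf w′ g) (xOf w g)))
        (trans (sum-sub (λ g → V.[ r ~ g ] * xOf w′ g) (λ g → V.[ r ~ g ] * xOf w g)) (diff outer?))
        where
          outer? : Dec (OuterVertex M r)
          outer? = FinP.any? (λ g → sameVertex? M r g ×-dec sameFace? M g root)
          same-x : OuterVertex M r → ∀ g → (d : Dec (SameVertex M r g)) → 𝟙 ⌊ d ⌋ * xOf w′ g ≡ 𝟙 ⌊ d ⌋ * xOf w g
          same-x o g (no _) = trans (ℤP.*-zeroˡ (xOf w′ g)) (sym (ℤP.*-zeroˡ (xOf w g)))
          same-x (g′ , v′ , o) g (yes v) = cong (+ 1 *_) ([ (λ e → cong pos (outer-same g e)) , (λ { (p , q) →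
            trans (pos≡0 (C′.inner-out p q (g′ , V.~-trans (V.~-sym v) v′ , o)))
              (sym (pos≡0 (C.inner-out p q (g′ , V.~-trans (V.~-sym v) v′ , o)))) }) ]′ (inner? g))
          diff : Dec (OuterVertex M r) → V.class-sum (xOf w′) r - V.class-sum (xOf w) r ≡ + 0
          diff (no ¬o) = ℤP.i≡j⇒i-j≡0 (trans (vertex-class or′ r ¬o) (sym (vertex-class or r ¬o)))
          diff (yes o) = ℤP.i≡j⇒i-j≡0 (sum-cong (λ g → same-x o g (sameVertex? M r g)))

      face-zero : ∀ r → F.class-sum (Δy ∘ a) r ≡ + 0
      face-zero r = [ on-root , inside ]′ (true? (ρ r))
        where
          on-root : ρ r ≡ true → F.class-sum (Δy ∘ a) r ≡ + 0
          on-root e = sum-zero (λ g → help g (sameFace? M r g))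
            where
              help : ∀ g → (d : Dec (SameFace M r g)) → 𝟙 ⌊ d ⌋ * Δy (a g) ≡ + 0
              help g (no _) = ℤP.*-zeroˡ (Δy (a g))
              help g (yes v) = trans (ℤP.*-identityˡ (Δy (a g)))
                (ℤP.i≡j⇒i-j≡0 (cong neg (outer-same (a g) (inj₂ (trans (cong ρ (aa g)) (ρ⁺ (F.~-trans (F.~-sym v) (ρ⁻ e))))))))
          inside : ρ r ≡ false → F.class-sum (Δy ∘ a) r ≡ + 0
          inside e = trans (sum-cong (λ c → trans (complement-diff F.[ r ~ c ] (yOf w (a c)) (yOf w′ (a c))) refl))
            (trans (sum-sub (λ c → F.[ r ~ c ] * (+ 1 - yOf w (a c))) (λ c → F.[ r ~ c ] * (+ 1 - yOf w′ (a c))))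
              (ℤP.i≡j⇒i-j≡0 (trans (face-class or r e) (sym (face-class or′ r e)))))
            where
              complement-diff : ∀ b y y′ → b * (y′ - y) ≡ b * (+ 1 - y) - b * (+ 1 - y′)
              complement-diff = solve-∀

      D : Fin n → ℤ
      D h = w′ h - w h

      D-a : ∀ h → D (a h) ≡ - D h
      D-a h = opp (w′ h) (w′ (a h)) (w h) (w (a h)) (edge-same (inner? h))
        where
          edge-same : ((ρ h ≡ true) ⊎ (ρ (a h) ≡ true)) ⊎ ((ρ h ≡ false) × (ρ (a h) ≡ false)) → w′ h + w′ (a h) ≡ w h + w (a h)
          edge-same (inj₁ e) = cong₂ _+_ (outer-same h e) (outer-same (a h) ([ (λ p → inj₂ (trans (cong ρ (aa h)) p)) , inj₁ ]′ e))
          edge-same (inj₂ e) = trans (edge-weight or′ h (not-outer e)) (sym (edge-weight or h (not-outer e)))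
          opp : ∀ p q p′ q′ → p + q ≡ p′ + q′ → q - q′ ≡ - (p - p′)
          opp p q p′ q′ e = trans (lemma₁ p q q′) (trans (cong (λ z → (z - p) - q′) e) (lemma₂ p p′ q′))
            where
              lemma₁ : ∀ p q q′ → q - q′ ≡ ((p + q) - p) - q′
              lemma₁ = solve-∀
              lemma₂ : ∀ p p′ q′ → ((p′ + q′) - p) - q′ ≡ - (p - p′)
              lemma₂ = solve-∀

      edge-zero : ∀ (t : Fin n → ℤ) → (∀ h → t (a h) ≡ t h) → sumℤ (λ h → t h * D h) ≡ + 0
      edge-zero t inv = self-neg (sumℤ (λ h → t h * D h)) (trans (sym (sum-a (λ h → t h * D h)))
        (trans (sum-cong (λ h → trans (cong₂ _*_ (inv h) (D-a h)) (sym (ℤP.neg-distribʳ-* (t h) (D h))))) (sum-neg (λ h → t h * D h))))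
        where
          self-neg : ∀ z → z ≡ - z → z ≡ + 0
          self-neg (+ zero)  e = refl
          self-neg (+ suc _) ()
          self-neg -[1+ _ ] ()

      orth : ∀ t → ⟨ ∇ᵛ t , ∇ᶠ t ∣ Δx , Δy ∘ a ⟩ ≡ + 0
      orth t = begin
        ⟨ ∇ᵛ t , ∇ᶠ t ∣ Δx , Δy ∘ a ⟩
          ≡⟨ sum-cong (λ h → orth-expand (tV t h) (tE t h) (tF t h) (Δx h) (Δy (a h))) ⟩
        sumℤ (λ h → (tV t h * Δx h - tF t h * Δy (a h)) + (tE t h * Δy (a h) - tE t h * Δx h))
          ≡⟨ trans (sum-+ (λ h → tV t h * Δx h - tF t h * Δy (a h)) (λ h → tE t h * Δy (a h) - tE t h * Δx h))
              (cong₂ _+_ (sum-sub (λ h → tV t h * Δx h) (λ h → tF t h * Δy (a h))) (sum-sub (λ h → tE t h * Δy (a h))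
                (λ h → tE t h * Δx h))) ⟩
        (sumℤ (λ h → tV t h * Δx h) - sumℤ (λ h → tF t h * Δy (a h))) + (sumℤ (λ h → tE t h * Δy (a h)) - sumℤ (λ h → tE t h * Δx h))
          ≡⟨ cong₂ _+_ (cong₂ _-_ (V.orbit-sum-const (tV t) Δx (tV-inv t) vertex-zero) (F.orbit-sum-const (tF t) (Δy ∘ a)
            (tF-inv t) face-zero))
              (cong (_- sumℤ (λ h → tE t h * Δx h)) (inv-pair a sum-a (tE t) Δy (tE-inv t))) ⟩
        + 0 + (sumℤ (λ h → tE t h * Δy h) - sumℤ (λ h → tE t h * Δx h))
          ≡⟨ trans (ℤP.+-identityˡ _) (sym (sum-sub (λ h → tE t h * Δy h) (λ h → tE t h * Δx h))) ⟩
        sumℤ (λ h → tE t h * Δy h - tE t h * Δx h)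
          ≡⟨ sum-cong (λ h → trans (collect (tE t h) (xOf w h) (yOf w h) (xOf w′ h) (yOf w′ h))
            (cong₂ (λ u v → - (tE t h * (u - v))) (pos-neg (w′ h)) (pos-neg (w h)))) ⟩
        sumℤ (λ h → - (tE t h * D h)) ≡⟨ trans (sum-neg (λ h → tE t h * D h)) (cong -_ (edge-zero (tE t) (tE-inv t))) ⟩
        + 0 ∎
        where
          open ≡-Reasoning
          collect : ∀ t x y x′ y′ → t * (y′ - y) - t * (x′ - x) ≡ - (t * ((x′ - y′) - (x - y)))
          collect = solve-∀

    -- A flood move of `w` crosses no flow of `w`, so the difference of flows across it is
    -- nonnegative and `Q` does not increase; along the flood of `w′` it does not decrease. Both
    -- floods start at the root and reach everything.
    unique : (∀ h → Star (FloodStep w) root h) → (∀ h → Star (FloodStep w′) root h) → ∀ h → w′ h ≡ w h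
    unique fl fl′ h = trans (sym (pos-neg (w′ h))) (trans (cong₂ _-_ (a-b≡0⇒a≡b {xOf w′ h} {xOf w h} (Δx0 h))
      (a-b≡0⇒a≡b {yOf w′ h} {yOf w h} (Δy0 h))) (pos-neg (w h)))
      where
        pot = corner-potential Δx (Δy ∘ a) orth
        μ : ℤ
        μ = proj₁ pot
        0<μ : + 0 < μ
        0<μ = proj₁ (proj₂ pot)
        Q : Fin n → ℤ
        Q = proj₁ (proj₂ (proj₂ pot))
        Qᵛ : ∀ h → μ * Δx h ≡ Q h - Q (s⁻ h)
        Qᵛ = proj₁ (proj₂ (proj₂ (proj₂ pot)))
        Qᶠ : ∀ h → μ * Δy (a h) ≡ Q h - Q (f⁻ h)
        Qᶠ = proj₂ (proj₂ (proj₂ (proj₂ pot)))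
        0≤μ : + 0 ≤ μ
        0≤μ = ℤP.<⇒≤ 0<μ
        down : ∀ {u v u′ v′ z} → μ * (u′ - u) ≡ v - v′ → u ≡ + 0 → + 0 ≤ u′ → v ≤ z → v′ ≤ z
        down {u} {v} {u′} {v′} e refl p q = ℤP.≤-trans
          (≤-by (v - v′) (subst (+ 0 ≤_) e (0≤* 0≤μ (subst (+ 0 ≤_) (sym (ℤP.+-identityʳ u′)) p))) (lemma v v′)) q
          where
            lemma : ∀ v v′ → v ≡ v′ + (v - v′)
            lemma = solve-∀
        up : ∀ {u v u′ v′ z} → μ * (u′ - u) ≡ v - v′ → u′ ≡ + 0 → + 0 ≤ u → z ≤ v → z ≤ v′
        up {u} {v} {u′} {v′} e refl p q = ℤP.≤-trans q (≤-by (- (v - v′)) (subst (+ 0 ≤_) (trans (pull-neg μ u) (cong -_ e))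
          (0≤* 0≤μ p)) (lemma v v′))
          where
            pull-neg : ∀ m u → m * u ≡ - (m * (+ 0 - u))
            pull-neg = solve-∀
            lemma : ∀ v v′ → v′ ≡ v + - (v - v′)
            lemma = solve-∀
        below : ∀ {x y} → Star (FloodStep w) x y → Q x ≤ Q root → Q y ≤ Q root
        below ε p = p
        below {x} (inj₁ (l , refl) ◅ r) p = below r (down (Qᵛ x) (pos≡0 l) (0≤pos (w′ x)) p)
        below {x} (inj₂ (l , refl) ◅ r) p = below r (down (Qᶠ x) (neg≡0 l) (0≤neg (w′ (a x))) p)
        above : ∀ {x y} → Star (FloodStep w′) x y → Q root ≤ Q x → Q root ≤ Q y
        above ε p = p
        above {x} (inj₁ (l , refl) ◅ r) p = above r (up (Qᵛ x) (pos≡0 l) (0≤pos (w x)) p)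
        above {x} (inj₂ (l , refl) ◅ r) p = above r (up (Qᶠ x) (neg≡0 l) (0≤neg (w (a x))) p)
        Q≡ : ∀ x → Q x ≡ Q root
        Q≡ x = ℤP.≤-antisym (below (fl x) ℤP.≤-refl) (above (fl′ x) ℤP.≤-refl)
        cancel : ∀ z → μ * z ≡ + 0 → z ≡ + 0
        cancel z e = [ (λ q → ⊥-elim (ℤP.<-irrefl (sym q) 0<μ)) , (λ q → q) ]′ (ℤP.i*j≡0⇒i≡0∨j≡0 μ e)
        Δx0 : ∀ h → Δx h ≡ + 0
        Δx0 h = cancel (Δx h) (trans (Qᵛ h) (ℤP.i≡j⇒i-j≡0 (trans (Q≡ h) (sym (Q≡ (s⁻ h))))))
        Δy0 : ∀ h → Δy h ≡ + 0
        Δy0 h = subst (λ z → Δy z ≡ + 0) (aa h) (cancel (Δy (a (a h))) (trans (Qᶠ (a h))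
          (ℤP.i≡j⇒i-j≡0 (trans (Q≡ (a h)) (sym (Q≡ (f⁻ (a h))))))))

-- Flows in networks without capacities

private
  excess-shift : ∀ e p q y → (e - p + q) + (y - q) ≡ e - p + y
  excess-shift = solve-∀

-- Without capacities a cut restricts the flow only if no arc leaves the set, so `hall` is required
-- of closed sets alone.
module Transport {N K : ℕ} (tail head : Fin K → Fin N) (b : Fin N → ℤ) (b-total : sumℤ b ≡ + 0)
  (hall : ∀ (S : Mask N) → (∀ k → S (tail k) ≡ true → S (head k) ≡ true) → sumℤ (λ u → 𝟙 (S u) * b u) ≤ + 0) where

  net : (Fin K → ℤ) → Fin N → ℤ
  net F u = sumℤ (λ k → (δ (head k) u - δ (tail k) u) * F k)

  excess : (Fin K → ℤ) → Fin N → ℤ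
  excess F u = b u + net F u

  net-+ : ∀ F G u → net (λ k → F k + G k) u ≡ net F u + net G u
  net-+ F G u = trans (sum-cong (λ k → ℤP.*-distribˡ-+ (δ (head k) u - δ (tail k) u) (F k) (G k)))
    (sum-+ (λ k → (δ (head k) u - δ (tail k) u) * F k) (λ k → (δ (head k) u - δ (tail k) u) * G k))

  pairing : ∀ (t : Fin N → ℤ) F → sumℤ (λ u → t u * excess F u) ≡ sumℤ (λ u → t u * b u) + sumℤ (λ k → (t (head k) - t (tail k)) * F k)
  pairing t F = begin
    sumℤ (λ u → t u * (b u + net F u)) ≡⟨ sum-cong (λ u → ℤP.*-distribˡ-+ (t u) (b u) (net F u)) ⟩
    sumℤ (λ u → t u * b u + t u * net F u) ≡⟨ sum-+ (λ u → t u * b u) (λ u → t u * net F u) ⟩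
    sumℤ (λ u → t u * b u) + sumℤ (λ u → t u * net F u) ≡⟨ cong (_+_ (sumℤ (λ u → t u * b u))) (begin
      sumℤ (λ u → t u * net F u) ≡⟨ sum-cong (λ u → sym (sum-* (t u) (λ k → (δ (head k) u - δ (tail k) u) * F k))) ⟩
      sumℤ (λ u → sumℤ (λ k → t u * ((δ (head k) u - δ (tail k) u) * F k))) ≡⟨ sum-swap
        (λ u k → t u * ((δ (head k) u - δ (tail k) u) * F k)) ⟩
      sumℤ (λ k → sumℤ (λ u → t u * ((δ (head k) u - δ (tail k) u) * F k))) ≡⟨ sum-cong arc ⟩
      sumℤ (λ k → (t (head k) - t (tail k)) * F k) ∎) ⟩
    sumℤ (λ u → t u * b u) + sumℤ (λ k → (t (head k) - t (tail k)) * F k) ∎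
    where
      open ≡-Reasoning
      shuffle : ∀ t p q x → t * ((p - q) * x) ≡ x * (p * t - q * t)
      shuffle = solve-∀
      arc : ∀ k → sumℤ (λ u → t u * ((δ (head k) u - δ (tail k) u) * F k)) ≡ (t (head k) - t (tail k)) * F k
      arc k = trans (sum-cong (λ u → shuffle (t u) (δ (head k) u) (δ (tail k) u) (F k)))
        (trans (sum-* (F k) (λ u → δ (head k) u * t u - δ (tail k) u * t u))
          (trans (cong (F k *_) (trans (sum-sub (λ u → δ (head k) u * t u) (λ u → δ (tail k) u * t u))
            (cong₂ _-_ (sum-δ (head k) t) (sum-δ (tail k) t))))
            (ℤP.*-comm (F k) (t (head k) - t (tail k)))))

  Nonneg : (Fin K → ℤ) → Set
  Nonneg F = ∀ k → + 0 ≤ F k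

  net-unit : ∀ k c u → net (λ j → δ k j * c) u ≡ (δ (head k) u - δ (tail k) u) * c
  net-unit k c u = trans (sum-cong (λ j → shuffle (δ (head j) u - δ (tail j) u) (δ k j) c))
    (sum-δ k (λ j → (δ (head j) u - δ (tail j) u) * c))
    where
      shuffle : ∀ x d c → x * (d * c) ≡ d * (x * c)
      shuffle = solve-∀

  module Augment (F : Fin K → ℤ) (F≥0 : Nonneg F) (u₀ : Fin N) where

    Residual : Fin N → Fin N → Set
    Residual u v = ∃ λ k → ((tail k ≡ u) × (head k ≡ v)) ⊎ ((head k ≡ u) × (tail k ≡ v) × (+ 0 < F k))

    residual? : ∀ u v → Dec (Residual u v)
    residual? u v = FinP.any? (λ k → ((tail k FinP.≟ u) ×-dec (head k FinP.≟ v)) ⊎-dec ((head k FinP.≟ u) ×-dec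
      (tail k FinP.≟ v) ×-dec (+ 0 <? F k)))

    -- Changing the flow only on arcs inside S keeps the residual arcs that leave S usable.
    Movable : Mask N → Fin N → Set
    Movable S v = ∃ λ G → Nonneg G × (∀ z → excess G z ≡ excess F z - δ u₀ z + δ v z) ×
      (∀ k → (S (tail k) ≡ false) ⊎ (S (head k) ≡ false) → G k ≡ F k)

    Inv : Mask N → Set
    Inv S = (S u₀ ≡ true) × (∀ v → S v ≡ true → Movable S v)

    private
      push : ∀ (S : Mask N) x y → S y ≡ false → Movable S x → ∀ k c → (∀ z → (δ (head k) z - δ (tail k) z) * c ≡ δ y z - δ x z) →
        (insert y S (tail k) ≡ true) → (insert y S (head k) ≡ true) → (∀ G → (G k ≡ F k) → Nonneg G → + 0 ≤ G k + c) →
          (S (tail k) ≡ false) ⊎ (S (head k) ≡ false) →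
        Movable (insert y S) y
      push S x y y∉ (G , G≥0 , ex , same) k c shift tin hin ok out = G′ , G′≥0 , ex′ , same′
        where
          G′ : Fin K → ℤ
          G′ j = G j + δ k j * c
          at : ∀ j → (k ≡ j) ⊎ (k ≢ j)
          at j with k FinP.≟ j
          ... | yes e = inj₁ e
          ... | no ¬e = inj₂ ¬e
          off : ∀ {j} → k ≢ j → G′ j ≡ G j
          off {j} ¬e = trans (cong (λ z → G j + z * c) (δ-≢ ¬e)) (trans (cong (_+_ (G j)) (ℤP.*-zeroˡ c)) (ℤP.+-identityʳ (G j)))
          on : G′ k ≡ G k + c
          on = trans (cong (λ z → G k + z * c) (δ-refl k)) (cong (_+_ (G k)) (ℤP.*-identityˡ c))
          G′≥0 : Nonneg G′
          G′≥0 j = [ (λ { refl → subst (+ 0 ≤_) (sym on) (ok G (same k out) G≥0) }) , (λ ¬e → subst (+ 0 ≤_) (sym (off ¬e))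
            (G≥0 j)) ]′ (at j)
          ex′ : ∀ z → excess G′ z ≡ excess F z - δ u₀ z + δ y z
          ex′ z = trans (cong (_+_ (b z)) (trans (net-+ G (λ j → δ k j * c) z) (cong (_+_ (net G z)) (trans (net-unit k c z) (shift z)))))
            (trans (sym (ℤP.+-assoc (b z) (net G z) (δ y z - δ x z))) (trans (cong (_+ (δ y z - δ x z)) (ex z))
              (excess-shift (excess F z) (δ u₀ z) (δ x z) (δ y z))))
          weaken : ∀ {z} → insert y S z ≡ false → S z ≡ false
          weaken {z} e = not-true (λ p → true≢false (insert-there y S {z} p) e)
          same′ : ∀ j → (insert y S (tail j) ≡ false) ⊎ (insert y S (head j) ≡ false) → G′ j ≡ F j
          same′ j o = [ (λ { refl → ⊥-elim ([ true≢false tin , true≢false hin ]′ o) })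
                      , (λ ¬e → trans (off ¬e) (same j ([ (λ q → inj₁ (weaken q)) , (λ q → inj₂ (weaken q)) ]′ o))) ]′ (at j)

      extend : ∀ S x y → Inv S → S x ≡ true → S y ≡ false → Residual x y → Inv (insert y S)
      extend S x y (i₀ , mv) sx sy (k , r) = insert-there y S i₀ , moved
        where
          forward : ∀ z → (tail k ≡ x) → (head k ≡ y) → (δ (head k) z - δ (tail k) z) * + 1 ≡ δ y z - δ x z
          forward z refl refl = ℤP.*-identityʳ _
          backward : ∀ z → (head k ≡ x) → (tail k ≡ y) → (δ (head k) z - δ (tail k) z) * - + 1 ≡ δ y z - δ x z
          backward z refl refl = flip-sign (δ (head k) z) (δ (tail k) z)
            where
              flip-sign : ∀ p q → (p - q) * - + 1 ≡ q - p
              flip-sign = solve-∀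
          in-x : ∀ {z} → z ≡ x → insert y S z ≡ true
          in-x refl = insert-there y S sx
          in-y : ∀ {z} → z ≡ y → insert y S z ≡ true
          in-y refl = insert-here y S
          new : ((tail k ≡ x) × (head k ≡ y)) ⊎ ((head k ≡ x) × (tail k ≡ y) × (+ 0 < F k)) → Movable (insert y S) y
          new (inj₁ (p , q)) = push S x y sy (mv x sx) k (+ 1) (λ z → forward z p q) (in-x p) (in-y q)
            (λ G _ g → 0≤+ (g k) (+≤+ ℕ.z≤n)) (inj₂ (trans (cong S q) sy))
          new (inj₂ (p , q , l)) = push S x y sy (mv x sx) k (- + 1) (λ z → backward z p q) (in-y q) (in-x p)
            (λ G e _ → subst (λ z → + 0 ≤ z - + 1) (sym e) (0≤- (<⇒1+≤ l))) (inj₁ (trans (cong S q) sy))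
          moved : ∀ v → insert y S v ≡ true → Movable (insert y S) v
          moved v e = [ (λ q → subst (Movable (insert y S)) q (new r)) , old ]′ (insert⁻ y S e)
            where
              old : S v ≡ true → Movable (insert y S) v
              old sv = let (G , G≥0 , ex , same) = mv v sv in G , G≥0 , ex ,
                λ j o → same j ([ (λ q → inj₁ (not-true (λ p → true≢false (insert-there y S p) q))) ,
                  (λ q → inj₂ (not-true (λ p → true≢false (insert-there y S p) q))) ]′ o)

      start : Inv (λ z → ⌊ u₀ FinP.≟ z ⌋)
      start = ⌊⌋-true⁺ (u₀ FinP.≟ u₀) refl , λ v e → F , F≥0 ,
        (λ z → trans (cancel (excess F z) (δ u₀ z)) (cong (λ q → excess F z - δ u₀ z + δ q z) (⌊⌋-true⁻ (u₀ FinP.≟ v) e))) , λ k _ → refl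
        where
          cancel : ∀ e p → e ≡ e - p + p
          cancel = solve-∀

    -- If no deficient node is reached in the residual graph, no arc leaves the reached set and the
    -- arcs entering it carry no flow. Its total excess is then its supply, nonpositive by `hall`,
    -- although `u₀` makes it positive.
    augment : + 0 < excess F u₀ → ∃ λ v → (excess F v < + 0) × ∃ λ G → Nonneg G × (∀ z → excess G z ≡ excess F z - δ u₀ z + δ v z)
    augment 0<e = finish (grow Residual residual? Inv extend (λ z → ⌊ u₀ FinP.≟ z ⌋) start)
      where
        finish : (∃ λ S → Inv S × (∀ x → ⌊ u₀ FinP.≟ x ⌋ ≡ true → S x ≡ true) × Closed Residual residual? S) → _
        finish (S , (i₀ , mv) , _ , closed) with FinP.any? (λ v → (S v ≟ᵇ true) ×-dec (excess F v <? + 0))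
        ... | yes (v , sv , l) = let (G , G≥0 , ex , _) = mv v sv in v , l , G , G≥0 , ex
        ... | no ¬neg = ⊥-elim (≤<-absurd total≤0 (ℤP.<-≤-trans 0<e (ℤP.≤-trans (ℤP.≤-reflexive (sym value)) (sum-nonneg-term terms u₀))))
          where
            terms : ∀ u → + 0 ≤ 𝟙 (S u) * excess F u
            terms u = help (true? (S u))
              where
                help : (S u ≡ true) ⊎ (S u ≡ false) → + 0 ≤ 𝟙 (S u) * excess F u
                help (inj₁ e) = 0≤* (0≤𝟙 (S u)) ([ (λ l → l) , (λ l → ⊥-elim (¬neg (u , e , l))) ]′ (≤-cases (+ 0) (excess F u)))
                help (inj₂ e) = ℤP.≤-reflexive (sym (trans (cong (λ z → 𝟙 z * excess F u) e) (ℤP.*-zeroˡ (excess F u))))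
            value : 𝟙 (S u₀) * excess F u₀ ≡ excess F u₀
            value = trans (cong (λ z → 𝟙 z * excess F u₀) i₀) (ℤP.*-identityˡ (excess F u₀))
            fwd : ∀ k → S (tail k) ≡ true → S (head k) ≡ true
            fwd k e = closed _ _ e (k , inj₁ (refl , refl))
            arc0 : ∀ k → (𝟙 (S (head k)) - 𝟙 (S (tail k))) * F k ≡ + 0
            arc0 k = help (true? (S (head k))) (true? (S (tail k))) (nat-≤-or-< (F k) (F≥0 k))
              where
                equal : S (head k) ≡ S (tail k) → (𝟙 (S (head k)) - 𝟙 (S (tail k))) * F k ≡ + 0
                equal e = trans (cong (λ z → (𝟙 z - 𝟙 (S (tail k))) * F k) e)
                  (trans (cong (_* F k) (ℤP.+-inverseʳ (𝟙 (S (tail k))))) (ℤP.*-zeroˡ (F k)))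
                help : (S (head k) ≡ true) ⊎ (S (head k) ≡ false) → (S (tail k) ≡ true) ⊎ (S (tail k) ≡ false) → (F k ≡ + 0) ⊎ (+ 0 < F k) →
                  (𝟙 (S (head k)) - 𝟙 (S (tail k))) * F k ≡ + 0
                help _ _ (inj₁ z) = trans (cong ((𝟙 (S (head k)) - 𝟙 (S (tail k))) *_) z) (ℤP.*-zeroʳ (𝟙 (S (head k)) - 𝟙 (S (tail k))))
                help (inj₁ p) (inj₁ q) _ = equal (trans p (sym q))
                help (inj₁ p) (inj₂ q) (inj₂ l) = ⊥-elim (true≢false (closed _ _ p (k , inj₂ (refl , refl , l))) q)
                help (inj₂ p) (inj₁ q) _ = ⊥-elim (true≢false (fwd k q) p)
                help (inj₂ p) (inj₂ q) _ = equal (trans p (sym q))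
            total≤0 : sumℤ (λ u → 𝟙 (S u) * excess F u) ≤ + 0
            total≤0 = subst (_≤ + 0) (sym (trans (pairing (𝟙 ∘ S) F) (trans (cong (_+_ (sumℤ (λ u → 𝟙 (S u) * b u)))
              (sum-zero arc0)) (ℤP.+-identityʳ _)))) (hall S fwd)

  private
    total-excess : ∀ F → sumℤ (excess F) ≡ + 0
    total-excess F = trans (sum-cong (λ u → sym (ℤP.*-identityˡ (excess F u)))) (trans (pairing (λ _ → + 1) F)
      (cong₂ _+_ (trans (sum-cong (λ u → ℤP.*-identityˡ (b u))) b-total) (sum-zero (λ k → ℤP.*-zeroˡ (F k)))))

    surplus : (Fin K → ℤ) → ℤ
    surplus F = sumℤ (λ u → pos (excess F u))

    pos-drop : ∀ e → + 0 < e → pos (e - + 1) ≤ pos e - + 1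
    pos-drop e 0<e with sign-view (e - + 1) | sign-view e
    ... | positive _ p _    | positive _ q _ rewrite p | q = ℤP.≤-refl
    ... | nonpositive _ p _ | positive _ q _ rewrite p | q = 0≤- (<⇒1+≤ 0<e)
    ... | _                 | nonpositive l _ _ = ⊥-elim (≤<-absurd l 0<e)

    drop : ∀ e (u v : ℤ) {e′} → e′ ≡ e - u + v → (u ≡ + 0) × (v ≡ + 0) ⊎ ((u ≡ + 1) × (v ≡ + 0) × (+ 0 < e)) ⊎
      ((u ≡ + 0) × (v ≡ + 1) × (e < + 0)) →
      pos e′ ≤ pos e - u
    drop e u v refl (inj₁ (refl , refl)) = ℤP.≤-reflexive (trans (cong pos (zeros e)) (sym (ℤP.+-identityʳ (pos e))))
      where
        zeros : ∀ e → e - + 0 + + 0 ≡ e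
        zeros = solve-∀
    drop e u v refl (inj₂ (inj₁ (refl , refl , l))) = subst (λ q → pos q ≤ pos e - + 1) (sym (ℤP.+-identityʳ (e - + 1))) (pos-drop e l)
    drop e u v refl (inj₂ (inj₂ (refl , refl , l))) = ℤP.≤-trans (ℤP.≤-reflexive (pos≡0 {e - + 0 + + 1}
      (subst (_≤ + 0) (sym (cong (_+ + 1) (ℤP.+-identityʳ e))) (<⇒1+≤ l))))
      (subst (+ 0 ≤_) (sym (ℤP.+-identityʳ (pos e))) (0≤pos e))

    -- `surplus` drops by at least one with every augmentation. When no excess is positive none is
    -- negative either, since they add up to zero.
    route-from : ∀ k F → Nonneg F → surplus F ≤ + k → ∃ λ G → Nonneg G × (∀ u → excess G u ≡ + 0)
    route-from k F F≥0 bound with FinP.any? (λ u → + 0 <? excess F u)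
    route-from k F F≥0 bound | no ¬e = F , F≥0 , λ u → trans (sym (ℤP.neg-involutive (excess F u))) (cong -_
      (sum-nonneg-zero {f = λ u → - excess F u} (λ u → ℤP.neg-mono-≤ (ℤP.≮⇒≥ (λ l → ¬e (u , l)))) (trans (sum-neg (excess F))
        (cong -_ (total-excess F))) u))
    route-from k F F≥0 bound | yes (u₀ , l) = next k bound (Augment.augment F F≥0 u₀ l)
      where
        next : ∀ k → surplus F ≤ + k → (∃ λ v → (excess F v < + 0) × ∃ λ G → Nonneg G × (∀ z → excess G z ≡ excess F z - δ u₀ z + δ v z)) →
          ∃ λ G → Nonneg G × (∀ u → excess G u ≡ + 0)
        next k bd (v , lv , G , G≥0 , ex) = recurse k less
          where
            u₀≢v : u₀ ≢ v
            u₀≢v refl = ℤP.<-asym l lv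
            pointwise : ∀ z → pos (excess G z) ≤ pos (excess F z) - δ u₀ z
            pointwise z = drop (excess F z) (δ u₀ z) (δ v z) (ex z) (cases (u₀ FinP.≟ z) (v FinP.≟ z))
              where
                cases : Dec (u₀ ≡ z) → Dec (v ≡ z) → (δ u₀ z ≡ + 0) × (δ v z ≡ + 0) ⊎ ((δ u₀ z ≡ + 1) × (δ v z ≡ + 0) ×
                  (+ 0 < excess F z)) ⊎ ((δ u₀ z ≡ + 0) × (δ v z ≡ + 1) × (excess F z < + 0))
                cases (yes refl) (yes refl) = ⊥-elim (u₀≢v refl)
                cases (yes refl) (no q)     = inj₂ (inj₁ (δ-refl z , δ-≢ q , l))
                cases (no p) (yes refl)     = inj₂ (inj₂ (δ-≢ p , δ-refl z , lv))
                cases (no p) (no q)         = inj₁ (δ-≢ p , δ-≢ q)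
            less : surplus G + + 1 ≤ + k
            less = ℤP.≤-trans (ℤP.+-monoˡ-≤ (+ 1) (subst (surplus G ≤_) (trans (sum-sub (λ z → pos (excess F z)) (δ u₀))
              (cong (_-_ (surplus F)) (trans (sum-cong (λ z → sym (ℤP.*-identityʳ (δ u₀ z)))) (sum-δ u₀ (λ _ → + 1)))))
              (sum-mono pointwise)))
              (subst (_≤ + k) (sym (back (surplus F))) bd)
              where
                back : ∀ x → x - + 1 + + 1 ≡ x
                back = solve-∀
            recurse : ∀ k → surplus G + + 1 ≤ + k → ∃ λ G → Nonneg G × (∀ u → excess G u ≡ + 0)
            recurse zero le = ⊥-elim (≤<-absurd (ℤP.≤-trans (ℤP.+-monoˡ-≤ (+ 1) (sum-nonneg (λ u → 0≤pos (excess G u)))) le)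
              (+<+ (ℕ.s≤s ℕ.z≤n)))
            recurse (suc k) le = route-from k G G≥0 (+1-cancel-≤ (surplus G) (+ k) (subst (surplus G + + 1 ≤_)
              (cong +_ (ℕP.+-comm 1 k)) le))

  -- Conservation is returned in weak form, tested against node functions: those constant on orbits
  -- make the auxiliary arcs within orbits drop out.
  route : ∃ λ F → Nonneg F × (∀ (t : Fin N → ℤ) → sumℤ (λ u → t u * b u) + sumℤ (λ k → (t (head k) - t (tail k)) * F k) ≡ + 0)
  route = let (G , G≥0 , z) = route-from (ℤ.∣ surplus (λ _ → + 0) ∣) (λ _ → + 0) (λ _ → ℤP.≤-refl) (ℤP.≤-reflexive (sym (ℤP.0≤i⇒+∣i∣≡i (sum-nonneg (λ u → 0≤pos (excess (λ _ → + 0) u))))))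
    in G , G≥0 , λ t → trans (sym (pairing t G)) (sum-zero (λ u → trans (cong (t u *_) (z u)) (ℤP.*-zeroʳ (t u))))

_⊕_ : ∀ {A : Set} {m k} → (Fin m → A) → (Fin k → A) → Fin (m ℕ.+ k) → A
_⊕_ {m = m} g h i = [ g , h ]′ (splitAt m i)

⊕-ˡ : ∀ {A : Set} {m k} (g : Fin m → A) (h : Fin k → A) i → (g ⊕ h) (i ↑ˡ k) ≡ g i
⊕-ˡ {m = m} {k} g h i = cong [ g , h ]′ (FinP.splitAt-↑ˡ m i k)

⊕-ʳ : ∀ {A : Set} {m k} (g : Fin m → A) (h : Fin k → A) i → (g ⊕ h) (m ↑ʳ i) ≡ h i
⊕-ʳ {m = m} {k} g h i = cong [ g , h ]′ (FinP.splitAt-↑ʳ m k i)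

sum-↑ : ∀ m {k} (F : Fin (m ℕ.+ k) → ℤ) → sumℤ F ≡ sumℤ (λ i → F (i ↑ˡ k)) + sumℤ (λ i → F (m ↑ʳ i))
sum-↑ zero    F = sym (ℤP.+-identityˡ (sumℤ F))
sum-↑ (suc m) {k} F = trans (cong (_+_ (F zero)) (sum-↑ m (F ∘ suc)))
  (sym (ℤP.+-assoc (F zero) (sumℤ (λ i → F (suc i ↑ˡ k))) (sumℤ (λ i → F (suc m ↑ʳ i)))))

sum-⊕ : ∀ {m k} (F : Fin (m ℕ.+ k) → ℤ) (G : Fin m → ℤ) (H : ℤ) →
  (∀ i → F (i ↑ˡ k) ≡ G i) → sumℤ (λ i → F (m ↑ʳ i)) ≡ H → sumℤ F ≡ sumℤ G + H
sum-⊕ {m} F G H p q = trans (sum-↑ m F) (cong₂ _+_ (sum-cong p) q)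

module Networks (M : PlaneMap) where
  open Flows M public

  -- Faces send flow to their edges and edges to their endpoints.  Every vertex, edge or face is
  -- represented by the free cycle of its half-edges, so that closed sets of nodes are unions of orbits;
  -- a forbidden arc is made into a loop.
  module _ (mx my : Mask n) (bV bE bF : Fin n → ℤ) (b-total : sumℤ bV + (sumℤ bE + sumℤ bF) ≡ + 0)
    (hall : ∀ (U B A : Mask n) → (∀ h → U h ≡ true → U (s h) ≡ true) → (∀ h → B h ≡ true → B (a h) ≡ true) → FaceMask A →
      (∀ h → mx h ≡ true → B h ≡ true → U h ≡ true) → (∀ h → my h ≡ true → A h ≡ true → B h ≡ true) →
      sumℤ (λ h → 𝟙 (U h) * bV h) + (sumℤ (λ h → 𝟙 (B h) * bE h) + sumℤ (λ h → 𝟙 (A h) * bF h)) ≤ + 0) where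

    private
      N₀ K₀ : ℕ
      N₀ = n ℕ.+ (n ℕ.+ n)
      K₀ = n ℕ.+ (n ℕ.+ (n ℕ.+ (n ℕ.+ n)))

      nV nE nF : Fin n → Fin N₀
      nV h = h ↑ˡ (n ℕ.+ n)
      nE h = n ↑ʳ (h ↑ˡ n)
      nF h = n ↑ʳ (n ↑ʳ h)

      eV eF : Fin n → Fin N₀
      eV h = if mx h then nV h else nE h
      eF c = if my c then nE c else nF c

      tl hd : Fin K₀ → Fin N₀
      tl = nV ⊕ (nE ⊕ (nF ⊕ (nE ⊕ nF)))
      hd = (nV ∘ s) ⊕ ((nE ∘ a) ⊕ ((nF ∘ f) ⊕ (eV ⊕ eF)))

      b : Fin N₀ → ℤ
      b = bV ⊕ (bE ⊕ bF)

      k₁ k₂ k₃ k₄ k₅ : Fin n → Fin K₀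
      k₁ h = h ↑ˡ (n ℕ.+ (n ℕ.+ (n ℕ.+ n)))
      k₂ h = n ↑ʳ (h ↑ˡ (n ℕ.+ (n ℕ.+ n)))
      k₃ h = n ↑ʳ (n ↑ʳ (h ↑ˡ (n ℕ.+ n)))
      k₄ h = n ↑ʳ (n ↑ʳ (n ↑ʳ (h ↑ˡ n)))
      k₅ h = n ↑ʳ (n ↑ʳ (n ↑ʳ (n ↑ʳ h)))

      at₁ : ∀ {A : Set} (p q r u v : Fin n → A) h → (p ⊕ (q ⊕ (r ⊕ (u ⊕ v)))) (k₁ h) ≡ p h
      at₁ p q r u v h = ⊕-ˡ p (q ⊕ (r ⊕ (u ⊕ v))) h
      at₂ : ∀ {A : Set} (p q r u v : Fin n → A) h → (p ⊕ (q ⊕ (r ⊕ (u ⊕ v)))) (k₂ h) ≡ q h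
      at₂ p q r u v h = trans (⊕-ʳ p (q ⊕ (r ⊕ (u ⊕ v))) (h ↑ˡ (n ℕ.+ (n ℕ.+ n)))) (⊕-ˡ q (r ⊕ (u ⊕ v)) h)
      at₃ : ∀ {A : Set} (p q r u v : Fin n → A) h → (p ⊕ (q ⊕ (r ⊕ (u ⊕ v)))) (k₃ h) ≡ r h
      at₃ p q r u v h = trans (⊕-ʳ p (q ⊕ (r ⊕ (u ⊕ v))) (n ↑ʳ (h ↑ˡ (n ℕ.+ n)))) (trans (⊕-ʳ q (r ⊕ (u ⊕ v)) (h ↑ˡ (n ℕ.+ n)))
        (⊕-ˡ r (u ⊕ v) h))
      at₄ : ∀ {A : Set} (p q r u v : Fin n → A) h → (p ⊕ (q ⊕ (r ⊕ (u ⊕ v)))) (k₄ h) ≡ u h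
      at₄ p q r u v h = trans (⊕-ʳ p (q ⊕ (r ⊕ (u ⊕ v))) (n ↑ʳ (n ↑ʳ (h ↑ˡ n)))) (trans (⊕-ʳ q (r ⊕ (u ⊕ v)) (n ↑ʳ (h ↑ˡ n)))
        (trans (⊕-ʳ r (u ⊕ v) (h ↑ˡ n)) (⊕-ˡ u v h)))
      at₅ : ∀ {A : Set} (p q r u v : Fin n → A) h → (p ⊕ (q ⊕ (r ⊕ (u ⊕ v)))) (k₅ h) ≡ v h
      at₅ p q r u v h = trans (⊕-ʳ p (q ⊕ (r ⊕ (u ⊕ v))) (n ↑ʳ (n ↑ʳ (n ↑ʳ h)))) (trans (⊕-ʳ q (r ⊕ (u ⊕ v)) (n ↑ʳ (n ↑ʳ h)))
        (trans (⊕-ʳ r (u ⊕ v) (n ↑ʳ h)) (⊕-ʳ u v h)))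

      b-sum : ∀ (t : Fin N₀ → ℤ) → sumℤ (λ u → t u * b u) ≡ sumℤ (λ h → t (nV h) * bV h) + (sumℤ (λ h → t (nE h) * bE h) + sumℤ
        (λ h → t (nF h) * bF h))
      b-sum t = sum-⊕ (λ u → t u * b u) (λ h → t (nV h) * bV h) _ (λ h → cong (t (nV h) *_) (⊕-ˡ bV (bE ⊕ bF) h))
        (sum-⊕ (λ u → t (n ↑ʳ u) * b (n ↑ʳ u)) (λ h → t (nE h) * bE h) _ (λ h → cong (t (nE h) *_)
          (trans (⊕-ʳ bV (bE ⊕ bF) (h ↑ˡ n)) (⊕-ˡ bE bF h)))
          (sum-cong (λ h → cong (t (nF h) *_) (trans (⊕-ʳ bV (bE ⊕ bF) (n ↑ʳ h)) (⊕-ʳ bE bF h)))))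

      ones : ∀ (F : Fin n → ℤ) → sumℤ (λ h → + 1 * F h) ≡ sumℤ F
      ones F = sum-cong (λ h → ℤP.*-identityˡ (F h))

      total : sumℤ b ≡ + 0
      total = trans (sum-cong (λ u → sym (ℤP.*-identityˡ (b u)))) (trans (b-sum (λ _ → + 1))
        (trans (cong₂ _+_ (ones bV) (cong₂ _+_ (ones bE) (ones bF))) b-total))

      hall′ : ∀ (S : Mask N₀) → (∀ k → S (tl k) ≡ true → S (hd k) ≡ true) → sumℤ (λ u → 𝟙 (S u) * b u) ≤ + 0
      hall′ S c = subst (_≤ + 0) (sym (b-sum (𝟙 ∘ S))) (hall (S ∘ nV) (S ∘ nE) (S ∘ nF)
        (λ h e → via (k₁ h) (at₁ nV nE nF nE nF h) (at₁ (nV ∘ s) (nE ∘ a) (nF ∘ f) eV eF h) e)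
        (λ h e → via (k₂ h) (at₂ nV nE nF nE nF h) (at₂ (nV ∘ s) (nE ∘ a) (nF ∘ f) eV eF h) e)
        (λ h e → via (k₃ h) (at₃ nV nE nF nE nF h) (at₃ (nV ∘ s) (nE ∘ a) (nF ∘ f) eV eF h) e)
        (λ h m e → via (k₄ h) (at₄ nV nE nF nE nF h) (trans (at₄ (nV ∘ s) (nE ∘ a) (nF ∘ f) eV eF h)
          (cong (λ z → if z then nV h else nE h) m)) e)
        (λ h m e → via (k₅ h) (at₅ nV nE nF nE nF h) (trans (at₅ (nV ∘ s) (nE ∘ a) (nF ∘ f) eV eF h)
          (cong (λ z → if z then nE h else nF h) m)) e))
        where
          via : ∀ k {u v} → tl k ≡ u → hd k ≡ v → S u ≡ true → S v ≡ true
          via k p q e = trans (cong S (sym q)) (c k (trans (cong S p) e))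

      arc-sum : ∀ (t : Node) (F : Fin K₀ → ℤ) → let tt = tV t ⊕ (tE t ⊕ tF t) in
        sumℤ (λ k → (tt (hd k) - tt (tl k)) * F k) ≡
        ⟨ ∇ᵛ t , ∇ᶠ t ∣ (λ h → 𝟙 (mx h) * F (k₄ h)) , (λ h → 𝟙 (my h) * F (k₅ h)) ⟩
      arc-sum t F = begin
        sumℤ Φ ≡⟨ sum-⊕ Φ (λ _ → + 0) _ (λ h → zero-arc (k₁ h) (at₁ nV nE nF nE nF h) (at₁ (nV ∘ s) (nE ∘ a) (nF ∘ f) eV eF h)
          (trans (ttV (s h)) (trans (tV-inv t h) (sym (ttV h)))))
          (sum-⊕ (λ k → Φ (n ↑ʳ k)) (λ _ → + 0) _ (λ h → zero-arc (k₂ h) (at₂ nV nE nF nE nF h) (at₂ (nV ∘ s) (nE ∘ a)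
            (nF ∘ f) eV eF h) (trans (ttE (a h)) (trans (tE-inv t h) (sym (ttE h)))))
          (sum-⊕ (λ k → Φ (n ↑ʳ (n ↑ʳ k))) (λ _ → + 0) _ (λ h → zero-arc (k₃ h) (at₃ nV nE nF nE nF h) (at₃ (nV ∘ s) (nE ∘ a)
            (nF ∘ f) eV eF h) (trans (ttF (f h)) (trans (tF-inv t h) (sym (ttF h)))))
          (sum-⊕ (λ k → Φ (n ↑ʳ (n ↑ʳ (n ↑ʳ k)))) (λ h → ∇ᵛ t h * (𝟙 (mx h) * F (k₄ h))) _ vertex-arc
          (sum-cong face-arc)))) ⟩
        sumℤ {n} (λ _ → + 0) + (sumℤ {n} (λ _ → + 0) + (sumℤ {n} (λ _ → + 0) +
          (sumℤ (λ h → ∇ᵛ t h * (𝟙 (mx h) * F (k₄ h))) + sumℤ (λ h → ∇ᶠ t h * (𝟙 (my h) * F (k₅ h))))))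
          ≡⟨ cong (λ z → z + (z + (z + (sumℤ (λ h → ∇ᵛ t h * (𝟙 (mx h) * F (k₄ h))) + sumℤ
            (λ h → ∇ᶠ t h * (𝟙 (my h) * F (k₅ h))))))) (sum-0 {n}) ⟩
        + 0 + (+ 0 + (+ 0 + (sumℤ (λ h → ∇ᵛ t h * (𝟙 (mx h) * F (k₄ h))) + sumℤ (λ h → ∇ᶠ t h * (𝟙 (my h) * F (k₅ h))))))
          ≡⟨ trans (ℤP.+-identityˡ _) (trans (ℤP.+-identityˡ _) (ℤP.+-identityˡ _)) ⟩
        sumℤ (λ h → ∇ᵛ t h * (𝟙 (mx h) * F (k₄ h))) + sumℤ (λ h → ∇ᶠ t h * (𝟙 (my h) * F (k₅ h)))
          ≡⟨ sym (sum-+ (λ h → ∇ᵛ t h * (𝟙 (mx h) * F (k₄ h))) (λ h → ∇ᶠ t h * (𝟙 (my h) * F (k₅ h)))) ⟩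
        ⟨ ∇ᵛ t , ∇ᶠ t ∣ (λ h → 𝟙 (mx h) * F (k₄ h)) , (λ h → 𝟙 (my h) * F (k₅ h)) ⟩ ∎
        where
          open ≡-Reasoning
          tt : Fin N₀ → ℤ
          tt = tV t ⊕ (tE t ⊕ tF t)
          Φ : Fin K₀ → ℤ
          Φ k = (tt (hd k) - tt (tl k)) * F k
          ttV : ∀ h → tt (nV h) ≡ tV t h
          ttV h = ⊕-ˡ (tV t) (tE t ⊕ tF t) h
          ttE : ∀ h → tt (nE h) ≡ tE t h
          ttE h = trans (⊕-ʳ (tV t) (tE t ⊕ tF t) (h ↑ˡ n)) (⊕-ˡ (tE t) (tF t) h)
          ttF : ∀ h → tt (nF h) ≡ tF t h
          ttF h = trans (⊕-ʳ (tV t) (tE t ⊕ tF t) (n ↑ʳ h)) (⊕-ʳ (tE t) (tF t) h)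
          zero-arc : ∀ k {u v} → tl k ≡ u → hd k ≡ v → tt v ≡ tt u → Φ k ≡ + 0
          zero-arc k p q e = trans (cong (_* F k) (ℤP.i≡j⇒i-j≡0 (trans (cong tt q) (trans e (cong tt (sym p)))))) (ℤP.*-zeroˡ (F k))
          chosen : ∀ b′ (u v : Fin N₀) z → (tt (if b′ then v else u) - tt u) * z ≡ (tt v - tt u) * (𝟙 b′ * z)
          chosen true  u v z = cong ((tt v - tt u) *_) (sym (ℤP.*-identityˡ z))
          chosen false u v z = trans (trans (cong (_* z) (ℤP.+-inverseʳ (tt u))) (ℤP.*-zeroˡ z))
            (sym (trans (cong ((tt v - tt u) *_) (ℤP.*-zeroˡ z)) (ℤP.*-zeroʳ (tt v - tt u))))
          vertex-arc : ∀ h → Φ (k₄ h) ≡ ∇ᵛ t h * (𝟙 (mx h) * F (k₄ h))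
          vertex-arc h = trans (cong₂ (λ u v → (tt u - tt v) * F (k₄ h)) (at₄ (nV ∘ s) (nE ∘ a) (nF ∘ f) eV eF h) (at₄ nV nE nF nE nF h))
            (trans (chosen (mx h) (nE h) (nV h) (F (k₄ h))) (cong₂ (λ u v → (u - v) * (𝟙 (mx h) * F (k₄ h))) (ttV h) (ttE h)))
          face-arc : ∀ h → Φ (k₅ h) ≡ ∇ᶠ t h * (𝟙 (my h) * F (k₅ h))
          face-arc h = trans (cong₂ (λ u v → (tt u - tt v) * F (k₅ h)) (at₅ (nV ∘ s) (nE ∘ a) (nF ∘ f) eV eF h) (at₅ nV nE nF nE nF h))
            (trans (chosen (my h) (nF h) (nE h) (F (k₅ h))) (cong₂ (λ u v → (u - v) * (𝟙 (my h) * F (k₅ h))) (ttE h) (ttF h)))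

      node-sum : ∀ (t : Node) → let tt = tV t ⊕ (tE t ⊕ tF t) in
        sumℤ (λ u → tt u * b u) ≡ sumℤ (λ h → tV t h * bV h) + (sumℤ (λ h → tE t h * bE h) + sumℤ (λ h → tF t h * bF h))
      node-sum t = trans (b-sum tt) (cong₂ _+_ (sum-cong (λ h → cong (_* bV h) (⊕-ˡ (tV t) (tE t ⊕ tF t) h)))
        (cong₂ _+_ (sum-cong (λ h → cong (_* bE h) (trans (⊕-ʳ (tV t) (tE t ⊕ tF t) (h ↑ˡ n)) (⊕-ˡ (tE t) (tF t) h))))
          (sum-cong (λ h → cong (_* bF h) (trans (⊕-ʳ (tV t) (tE t ⊕ tF t) (n ↑ʳ h)) (⊕-ʳ (tE t) (tF t) h))))))
        where
          tt : Fin N₀ → ℤ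
          tt = tV t ⊕ (tE t ⊕ tF t)

    relaxed-flow : ∃ λ x → ∃ λ y → (∀ h → + 0 ≤ x h) × (∀ h → + 0 ≤ y h) × (∀ h → mx h ≡ false → x h ≡ + 0) ×
      (∀ h → my h ≡ false → y h ≡ + 0) ×
      (∀ t → (sumℤ (λ h → tV t h * bV h) + (sumℤ (λ h → tE t h * bE h) + sumℤ (λ h → tF t h * bF h))) + ⟨ ∇ᵛ t , ∇ᶠ t ∣ x , y ⟩ ≡ + 0)
    relaxed-flow = let (F , F≥0 , bal) = Transport.route tl hd b total hall′ in
      (λ h → 𝟙 (mx h) * F (k₄ h)) , (λ h → 𝟙 (my h) * F (k₅ h)) , (λ h → 0≤* (0≤𝟙 (mx h)) (F≥0 (k₄ h))) , (λ h → 0≤* (0≤𝟙 (my h))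
        (F≥0 (k₅ h))) ,
      (λ h e → trans (cong (λ z → 𝟙 z * F (k₄ h)) e) (ℤP.*-zeroˡ (F (k₄ h)))) , (λ h e → trans (cong (λ z → 𝟙 z * F (k₅ h)) e)
        (ℤP.*-zeroˡ (F (k₅ h)))) ,
      (λ t → trans (cong₂ _+_ (sym (node-sum t)) (sym (arc-sum t F))) (bal (tV t ⊕ (tE t ⊕ tF t))))

  -- Potentials are bounded, so Q can be raised only finitely often on the set that tight moves do not
  -- reach from the root.
  module _ (ℓ₁ ℓ₂ : Fin n → ℤ) (ℓ₁≥0 : ∀ h → + 0 ≤ ℓ₁ h) (ℓ₂≥0 : ∀ h → + 0 ≤ ℓ₂ h) where

    record Potential (Q : Fin n → ℤ) : Set where
      field
        nonneg : ∀ h → + 0 ≤ Q h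
        atRoot : Q root ≡ + 0
        short₁ : ∀ h → Q (s⁻ h) ≤ Q h + ℓ₁ h
        short₂ : ∀ h → Q (f⁻ h) ≤ Q h + ℓ₂ h
    open Potential

    Tight : (Fin n → ℤ) → Fin n → Fin n → Set
    Tight Q x y = ((Q (s⁻ x) ≡ Q x + ℓ₁ x) × (y ≡ s⁻ x)) ⊎ ((Q (f⁻ x) ≡ Q x + ℓ₂ x) × (y ≡ f⁻ x))

    tight? : ∀ Q x y → Dec (Tight Q x y)
    tight? Q x y = ((Q (s⁻ x) ℤ.≟ Q x + ℓ₁ x) ×-dec (y FinP.≟ s⁻ x)) ⊎-dec ((Q (f⁻ x) ℤ.≟ Q x + ℓ₂ x) ×-dec (y FinP.≟ f⁻ x))

    private
      module V⁻ = Orbits s⁻ s s⁻s ss⁻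

      -- One bound serves all potentials. It spreads from the root along `s⁻` and `f⁻`, and these
      -- moves connect all corners because `s` is an iterate of `s⁻` on each orbit.
      Bounded : Fin n → Set
      Bounded h = ∃ λ B → ∀ Q → Potential Q → Q h ≤ B

      bounded-s⁻ : ∀ h → Bounded h → Bounded (s⁻ h)
      bounded-s⁻ h (B , le) = B + ℓ₁ h , λ Q v → ℤP.≤-trans (short₁ v h) (ℤP.+-monoˡ-≤ (ℓ₁ h) (le Q v))

      bounded-f⁻ : ∀ h → Bounded h → Bounded (f⁻ h)
      bounded-f⁻ h (B , le) = B + ℓ₂ h , λ Q v → ℤP.≤-trans (short₂ v h) (ℤP.+-monoˡ-≤ (ℓ₂ h) (le Q v))

      bounded-s : ∀ h → Bounded h → Bounded (s h)
      bounded-s h = V⁻.~-ind Bounded bounded-s⁻ (V⁻.~-f⁻ h)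

      bounded-a : ∀ h → Bounded h → Bounded (a h)
      bounded-a h p = subst Bounded (ss⁻ (a h)) (bounded-s (f⁻ h) (bounded-f⁻ h p))

      bounded : ∀ h → Bounded h
      bounded h = connected-ind Bounded bounded-s bounded-a root h (+ 0 , λ Q v → ℤP.≤-reflexive (atRoot v))

      L : ℤ
      L = sumℤ (λ h → proj₁ (bounded h))

      sum-bounded : ∀ Q → Potential Q → sumℤ Q ≤ L
      sum-bounded Q v = sum-mono (λ h → proj₂ (bounded h) Q v)

      -- An inequality could only fail for a move out of `S`; such a move is not tight, so by
      -- integrality it has slack at least 1.
      raise : ∀ Q → Potential Q → (S : Mask n) → S root ≡ true → (∀ x y → S x ≡ true → Tight Q x y → S y ≡ true) →
        Potential (λ h → Q h + 𝟙 (not (S h)))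
      raise Q v S S-root closed = record
        { nonneg = λ h → 0≤+ (nonneg v h) (0≤𝟙 (not (S h)))
        ; atRoot = cong₂ _+_ (atRoot v) (cong (𝟙 ∘ not) S-root)
        ; short₁ = λ h → move {x = Q h} {l = ℓ₁ h} (true? (S h)) (true? (S (s⁻ h))) (short₁ v h) (λ p e → closed h (s⁻ h) p
          (inj₁ (e , refl)))
        ; short₂ = λ h → move {x = Q h} {l = ℓ₂ h} (true? (S h)) (true? (S (f⁻ h))) (short₂ v h) (λ p e → closed h (f⁻ h) p
          (inj₂ (e , refl)))
        }
        where
          move : ∀ {p q : Bool} {x y l : ℤ} → (p ≡ true) ⊎ (p ≡ false) → (q ≡ true) ⊎ (q ≡ false) → y ≤ x + l →
            (p ≡ true → y ≡ x + l → q ≡ true) →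
            y + 𝟙 (not q) ≤ (x + 𝟙 (not p)) + l
          move {x = x} {y} {l} (inj₁ refl) (inj₁ refl) le _ = subst₂ _≤_ (sym (ℤP.+-identityʳ y)) (cong (_+ l) (sym (ℤP.+-identityʳ x))) le
          move {x = x} {y} {l} (inj₁ refl) (inj₂ refl) le t = subst (y + + 1 ≤_) (cong (_+ l) (sym (ℤP.+-identityʳ x)))
            (<⇒1+≤ (ℤP.≤∧≢⇒< le (λ e → true≢false (t refl e) refl)))
          move {x = x} {y} {l} (inj₂ refl) (inj₁ refl) le _ = ≤-by (((x + l) - y) + + 1) (0≤+ (0≤- le) (+≤+ ℕ.z≤n)) (lemma x y l)
            where
              lemma : ∀ x y l → (x + + 1) + l ≡ (y + + 0) + (((x + l) - y) + + 1)
              lemma = solve-∀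
          move {x = x} {y} {l} (inj₂ refl) (inj₂ refl) le _ = subst (y + + 1 ≤_) (swap x l) (ℤP.+-monoˡ-≤ (+ 1) le)
            where
              swap : ∀ x l → (x + l) + + 1 ≡ (x + + 1) + l
              swap = solve-∀

      search : ∀ k Q → Potential Q → L ≤ sumℤ Q + + k → ∃ λ Q′ → Potential Q′ × (∀ h → Star (Tight Q′) root h)
      search k Q v le = step k le (reach-set (Tight Q) (tight? Q) root)
        where
          step : ∀ k → L ≤ sumℤ Q + + k → (∃ λ S → (S root ≡ true) × (∀ x → S x ≡ true → Star (Tight Q) root x) × Closed
            (Tight Q) (tight? Q) S) →
            ∃ λ Q′ → Potential Q′ × (∀ h → Star (Tight Q′) root h)
          step k le (S , S-root , S-reach , closed) with FinP.any? (λ h → S h ≟ᵇ false)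
          ... | no ¬e = Q , v , λ h → S-reach h (not-false (λ e → ¬e (h , e)))
          ... | yes (h , e) = continue k le
            where
              Q′ : Fin n → ℤ
              Q′ h = Q h + 𝟙 (not (S h))
              v′ : Potential Q′
              v′ = raise Q v S S-root closed
              more : sumℤ Q + + 1 ≤ sumℤ Q′
              more = subst (sumℤ Q + + 1 ≤_) (sym (sum-+ Q (𝟙 ∘ not ∘ S))) (ℤP.+-monoʳ-≤ (sumℤ Q)
                (subst (_≤ # (not ∘ S)) (cong (𝟙 ∘ not) e) (sum-nonneg-term (λ h → 0≤𝟙 (not (S h))) h)))
              continue : ∀ k → L ≤ sumℤ Q + + k → ∃ λ Q′ → Potential Q′ × (∀ h → Star (Tight Q′) root h)
              continue zero le = ⊥-elim (≤<-absurd (ℤP.≤-trans (sum-bounded Q′ v′) (subst (L ≤_) (ℤP.+-identityʳ (sumℤ Q)) le))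
                (1+≤⇒< more))
              continue (suc k) le = search k Q′ v′
                (ℤP.≤-trans le (ℤP.≤-trans (ℤP.≤-reflexive (sym (ℤP.+-assoc (sumℤ Q) (+ 1) (+ k)))) (ℤP.+-monoˡ-≤ (+ k) more)))

    distances : ∃ λ Q → Potential Q × (∀ h → Star (Tight Q) root h)
    distances = search ℤ.∣ L ∣ (λ _ → + 0) zero-potential (subst (L ≤_) (sym (trans (cong (_+ + ℤ.∣ L ∣) (sum-0 {n}))
      (ℤP.+-identityˡ (+ ℤ.∣ L ∣)))) (≤-abs L))
      where
        ≤-abs : ∀ z → z ≤ + ℤ.∣ z ∣
        ≤-abs (+ _) = ℤP.≤-refl
        ≤-abs -[1+ _ ] = ℤ.-≤+
        zero-potential : Potential (λ _ → + 0)
        zero-potential = record { nonneg = λ _ → ℤP.≤-refl ; atRoot = refl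
          ; short₁ = λ h → subst (+ 0 ≤_) (sym (ℤP.+-identityˡ (ℓ₁ h))) (ℓ₁≥0 h) ; short₂ = λ h → subst (+ 0 ≤_)
            (sym (ℤP.+-identityˡ (ℓ₂ h))) (ℓ₂≥0 h) }

-- Supplies, demands and the cut condition

private
  hall-arith : ∀ d u b₂ b g → (d - + 2) * ((d + d) + b) + + 2 * (g + d) + + 2 * d ≤ + 2 * d * (d + u) → + 2 * b₂ ≡ (d - + 2) * b →
    - d * u + (b₂ + g) ≤ + 0
  hall-arith d u b₂ b g p q = ℤP.*-cancelˡ-≤-pos (- d * u + (b₂ + g)) (+ 0) (+ 2)
    (≤-by (+ 2 * d * (d + u) - ((d - + 2) * ((d + d) + b) + + 2 * (g + d) + + 2 * d)) (0≤- p)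
      (sym (trans (lemma₁ d u b₂ b g) (trans (cong (_- (d - + 2) * b) q) (ℤP.+-inverseʳ ((d - + 2) * b))))))
    where
      lemma₁ : ∀ d u b₂ b g → + 2 * (- d * u + (b₂ + g)) + (+ 2 * d * (d + u) - ((d - + 2) * ((d + d) + b) + + 2 *
        (g + d) + + 2 * d)) ≡ + 2 * b₂ - (d - + 2) * b
      lemma₁ = solve-∀

  total-arith : ∀ d v f n e₂ e → + 2 * (v + f) ≡ n + + 4 → + 2 * e₂ ≡ (d - + 2) * e → e ≡ n - (d + d) →
    - d * (v - d) + (e₂ + ((n - d) - d * (f - + 1))) ≡ + 0
  total-arith d v f n e₂ e p q r = ℤP.*-cancelˡ-≡ (+ 2) (- d * (v - d) + (e₂ + ((n - d) - d * (f - + 1)))) (+ 0)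
    (trans (lemma₁ d v f n e₂) (trans (cong₂ (λ y z → z - d * y + (+ 2 * d * d + + 2 * n)) p (trans q (cong ((d - + 2) *_) r)))
      (lemma₂ d n)))
    where
      lemma₁ : ∀ d v f n e₂ → + 2 * (- d * (v - d) + (e₂ + ((n - d) - d * (f - + 1)))) ≡ + 2 * e₂ - d * (+ 2 * (v + f)) +
        (+ 2 * d * d + + 2 * n)
      lemma₁ = solve-∀
      lemma₂ : ∀ d n → (d - + 2) * (n - (d + d)) - d * (n + + 4) + (+ 2 * d * d + + 2 * n) ≡ + 0
      lemma₂ = solve-∀

  𝟙-disjoint : ∀ x y → 𝟙 (x ∨ (not x ∧ y)) ≡ 𝟙 x + 𝟙 (not x ∧ y)
  𝟙-disjoint true  y = refl
  𝟙-disjoint false y = sym (ℤP.+-identityˡ (𝟙 y))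

  times-assoc : ∀ x c l → x * (c * l) ≡ c * (l * x)
  times-assoc = solve-∀

module Outer (M : PlaneMap) where
  open Networks M public

  outerVertex? : ∀ h → Dec (OuterVertex M h)
  outerVertex? h = FinP.any? (λ g → sameVertex? M h g ×-dec sameFace? M g root)

  ov oe : Mask n
  ov h = ⌊ outerVertex? h ⌋
  oe h = ρ h ∨ ρ (a h)

  ov⁺ : ∀ {h} → OuterVertex M h → ov h ≡ true
  ov⁺ {h} = ⌊⌋-true⁺ (outerVertex? h)

  ov⁻ : ∀ {h} → ov h ≡ true → OuterVertex M h
  ov⁻ {h} = ⌊⌋-true⁻ (outerVertex? h)

  ov-~ : ∀ {h g} → SameVertex M h g → ov h ≡ true → ov g ≡ true
  ov-~ v e = let (g′ , u , o) = ov⁻ e in ov⁺ (g′ , V.~-trans (V.~-sym v) u , o)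

  ov-s : ∀ h → ov h ≡ true → ov (s h) ≡ true
  ov-s h = ov-~ (V.~-f h)

  ρ⊆ov : ∀ {h} → ρ h ≡ true → ov h ≡ true
  ρ⊆ov {h} e = ov⁺ (h , V.~-refl h , ρ⁻ e)

  oe-a : ∀ h → oe h ≡ true → oe (a h) ≡ true
  oe-a h e = [ (λ p → ∨-trueʳ {ρ (a h)} (trans (cong ρ (aa h)) p)) , (λ p → ∨-trueˡ p) ]′ (∨-true⁻ {ρ h} e)

  oe⊆ov : ∀ h → oe h ≡ true → ov h ≡ true
  oe⊆ov h e = [ ρ⊆ov , (λ p → ov⁺ (s⁻ h , V.~-f⁻ h , ρ⁻ (subst (λ z → ρ (s⁻ z) ≡ true) (aa h) (ρ-f⁻ (a h) p)))) ]′ (∨-true⁻ {ρ h} e)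

  oe-false : ∀ {h} → oe h ≡ false → (ρ h ≡ false) × (ρ (a h) ≡ false)
  oe-false {h} e = not-true (λ p → true≢false (∨-trueˡ {ρ h} p) e) , not-true (λ p → true≢false (∨-trueʳ {ρ h} p) e)

  oe-not : ∀ {h} → ¬ OuterEdge M h → oe h ≡ false
  oe-not {h} ¬o = not-true (λ e → [ (λ p → ¬o (inj₁ (ρ⁻ p))) , (λ p → ¬o (inj₂ (ρ⁻ p))) ]′ (∨-true⁻ {ρ h} e))

  module _ (contour : SimpleOuterContour M w₀) where

    #oe : # oe ≡ # ρ + # ρ
    #oe = trans (sum-cong (λ h → term h (true? (ρ h)))) (trans (sum-+ (𝟙 ∘ ρ) (𝟙 ∘ ρ ∘ a)) (cong (_+_ (# ρ)) (sum-a (𝟙 ∘ ρ))))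
      where
        term : ∀ h → (ρ h ≡ true) ⊎ (ρ h ≡ false) → 𝟙 (oe h) ≡ 𝟙 (ρ h) + 𝟙 (ρ (a h))
        term h (inj₁ e) = trans (cong (λ z → 𝟙 (z ∨ ρ (a h))) e) (sym (cong₂ (λ y z → 𝟙 y + 𝟙 z) e (one-sided contour e)))
        term h (inj₂ e) = trans (cong (λ z → 𝟙 (z ∨ ρ (a h))) e) (sym (trans (cong (λ z → 𝟙 z + 𝟙 (ρ (a h))) e) (ℤP.+-identityˡ _)))

    #ov : # (λ h → V.least h ∧ ov h) ≡ # ρ
    #ov = trans (sum-cong (λ r → trans (𝟙-∧ (V.least r) (ov r)) (cong (𝟙 (V.least r) *_) (sym (unique-ρ r (outerVertex? r))))))
      (sym (V.sum-by-class (𝟙 ∘ ρ)))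
      where
        unique-ρ : ∀ r (o : Dec (OuterVertex M r)) → V.class-sum (𝟙 ∘ ρ) r ≡ 𝟙 ⌊ o ⌋
        unique-ρ r (no ¬o) = V.class-sum-zero r (λ g v → cong 𝟙 (not-true (λ e → ¬o (g , v , ρ⁻ e))))
        unique-ρ r (yes (g , v , o)) = trans (sum-single g _ (λ j j≢ → help j j≢ (sameVertex? M r j) (true? (ρ j))))
          (cong₂ _*_ (V.[]-yes v) (cong 𝟙 (ρ⁺ o)))
          where
            help : ∀ j → j ≢ g → (d : Dec (SameVertex M r j)) → (ρ j ≡ true) ⊎ (ρ j ≡ false) → 𝟙 ⌊ d ⌋ * 𝟙 (ρ j) ≡ + 0
            help j j≢ (no _) _ = ℤP.*-zeroˡ (𝟙 (ρ j))
            help j j≢ (yes u) (inj₁ e) = ⊥-elim (j≢ (proj₁ contour j g (ρ⁻ e) o (V.~-trans (V.~-sym u) v)))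
            help j j≢ (yes u) (inj₂ e) = cong (λ z → + 1 * 𝟙 z) e

  module Supplies (contour : SimpleOuterContour M w₀) (d : ℕ) (no-short : ∀ k → k ℕ.< d → ¬ HasCycle M k) (#ρ≡d : # ρ ≡ + d) where

    -- A vertex or an edge puts its whole supply on its representative. A face has 1 on each
    -- half-edge and an additional `- d` on the representative, in total its degree minus `d`.
    bV bE bF : Fin n → ℤ
    bV h = - + d * 𝟙 (V.least h ∧ not (ov h))
    bE h = (+ d - + 2) * 𝟙 (E.least h ∧ not (oe h))
    bF h = 𝟙 (not (ρ h)) * (+ 1 - + d * 𝟙 (F.least h))

    -- The weights on outer edges are fixed in advance, so these edges take no part; outer vertices
    -- receive nothing because inner half-edges at them must be outgoing.
    mx my : Mask n
    mx h = not (oe h) ∧ not (ov h)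
    my h = not (oe h)

    private
      V-sum : ∀ (U : Mask n) → sumℤ (λ h → 𝟙 (U h) * bV h) ≡ - + d * # (λ h → V.least h ∧ (not (ov h) ∧ U h))
      V-sum U = trans (sum-cong (λ h → trans (times-assoc (𝟙 (U h)) (- + d) (𝟙 (V.least h ∧ not (ov h))))
        (cong (- + d *_) (trans (sym (𝟙-∧ (V.least h ∧ not (ov h)) (U h))) (cong 𝟙 (∧-assoc (V.least h) (not (ov h)) (U h)))))))
        (sum-* (- + d) (λ h → 𝟙 (V.least h ∧ (not (ov h) ∧ U h))))

      E-sum : ∀ (B : Mask n) → (∀ h → B h ≡ true → B (a h) ≡ true) → + 2 * sumℤ (λ h → 𝟙 (B h) * bE h) ≡ (+ d - + 2) * #
        (λ h → not (oe h) ∧ B h)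
      E-sum B B-a = trans (cong (+ 2 *_)
        (trans (sum-cong (λ h → trans (times-assoc (𝟙 (B h)) (+ d - + 2) (𝟙 (E.least h ∧ not (oe h)))) (cong ((+ d - + 2) *_)
            (trans (sym (𝟙-∧ (E.least h ∧ not (oe h)) (B h))) (trans (cong 𝟙 (∧-assoc (E.least h) (not (oe h)) (B h)))
              (𝟙-∧ (E.least h) (not (oe h) ∧ B h)))))))
          (sum-* (+ d - + 2) (λ h → 𝟙 (E.least h) * 𝟙 (not (oe h) ∧ B h)))))
        (trans (pull₂ (+ d - + 2) (sumℤ (λ h → 𝟙 (E.least h) * 𝟙 (not (oe h) ∧ B h))))
          (cong ((+ d - + 2) *_) (twice-edge-reps (λ h → 𝟙 (not (oe h) ∧ B h)) (λ h → cong₂ (λ y z → 𝟙 (not y ∧ z))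
            (mask-a oe oe-a h) (mask-a B B-a h)))))
        where
          pull₂ : ∀ c x → + 2 * (c * x) ≡ c * (+ 2 * x)
          pull₂ = solve-∀

    -- Outer vertices, outer edges and the root face have no supply, so adding the former two and
    -- removing the latter changes no supply and yields the hypotheses of `Density`. The added `d`
    -- vertices and `2 d` half-edges and the `d` root half-edges in `G` absorb exactly the constant
    -- `2 d` of `density`.
    hall : ∀ (U B A : Mask n) → (∀ h → U h ≡ true → U (s h) ≡ true) → (∀ h → B h ≡ true → B (a h) ≡ true) → FaceMask A →
      (∀ h → mx h ≡ true → B h ≡ true → U h ≡ true) → (∀ h → my h ≡ true → A h ≡ true → B h ≡ true) →
      sumℤ (λ h → 𝟙 (U h) * bV h) + (sumℤ (λ h → 𝟙 (B h) * bE h) + sumℤ (λ h → 𝟙 (A h) * bF h)) ≤ + 0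
    hall U B A U-s B-a A-f cx cy = subst (λ z → z + (sumℤ (λ h → 𝟙 (B h) * bE h) + sumℤ (λ h → 𝟙 (A h) * bF h)) ≤ + 0) (sym (V-sum U))
      (hall-arith (+ d) (# (λ h → V.least h ∧ (not (ov h) ∧ U h))) (sumℤ (λ h → 𝟙 (B h) * bE h)) (# (λ h → not (oe h) ∧ B h))
        (sumℤ (λ h → 𝟙 (A h) * bF h)) dense (E-sum B B-a))
      where
        U⁺ B⁺ A⁺ : Mask n
        U⁺ h = ov h ∨ (not (ov h) ∧ U h)
        B⁺ h = oe h ∨ (not (oe h) ∧ B h)
        A⁺ h = not (ρ h) ∧ A h
        U⁺-s : ∀ h → U⁺ h ≡ true → U⁺ (s h) ≡ true
        U⁺-s h e = trans (cong₂ (λ y z → y ∨ (not y ∧ z)) (V.mask-const ov ov-s h) (V.mask-const U U-s h)) e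
        B⁺-a : ∀ h → B⁺ h ≡ true → B⁺ (a h) ≡ true
        B⁺-a h e = trans (cong₂ (λ y z → y ∨ (not y ∧ z)) (mask-a oe oe-a h) (mask-a B B-a h)) e
        A⁺-f : FaceMask A⁺
        A⁺-f h e = trans (cong₂ (λ y z → not y ∧ z) (F.mask-const ρ ρ-f h) (F.mask-const A A-f h)) e
        B⊆U : ∀ h → B⁺ h ≡ true → U⁺ h ≡ true
        B⊆U h e = [ (λ p → ∨-trueˡ (oe⊆ov h p)) , inner (true? (ov h)) ]′ (∨-true⁻ {oe h} e)
          where
            inner : (ov h ≡ true) ⊎ (ov h ≡ false) → not (oe h) ∧ B h ≡ true → U⁺ h ≡ true
            inner (inj₁ o) _ = ∨-trueˡ o
            inner (inj₂ o) q = let (q₁ , q₂) = ∧-true⁻ {not (oe h)} q in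
              ∨-trueʳ {ov h} (∧-true⁺ (not-true⁺ o) (cx h (∧-true⁺ q₁ (not-true⁺ o)) q₂))
        A⊆B : ∀ h → A⁺ h ≡ true → B⁺ h ≡ true
        A⊆B h e = [ (λ p → ∨-trueˡ p) , (λ p → ∨-trueʳ {oe h} (∧-true⁺ (not-true⁺ p) (cy h (not-true⁺ p)
          (proj₂ (∧-true⁻ {not (ρ h)} e))))) ]′ (true? (oe h))
        module D = Density d no-short U⁺ B⁺ A⁺ U⁺-s B⁺-a B⊆U A⁺-f A⊆B (cong (λ z → not z ∧ A root) ρ-root) root (∨-trueˡ (ρ⊆ov ρ-root))
        disjoint : ∀ (p q : Mask n) → # (λ h → p h ∨ (not (p h) ∧ q h)) ≡ # p + # (λ h → not (p h) ∧ q h)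
        disjoint p q = trans (sum-cong (λ h → 𝟙-disjoint (p h) (q h))) (sum-+ (𝟙 ∘ p) (λ h → 𝟙 (not (p h) ∧ q h)))
        #B : # B⁺ ≡ (+ d + + d) + # (λ h → not (oe h) ∧ B h)
        #B = trans (disjoint oe B) (cong (_+ # (λ h → not (oe h) ∧ B h)) (trans (#oe contour) (cong₂ _+_ #ρ≡d #ρ≡d)))
        #U : # (λ h → V.least h ∧ U⁺ h) ≡ + d + # (λ h → V.least h ∧ (not (ov h) ∧ U h))
        #U = trans (sum-cong (λ h → trans (𝟙-∧ (V.least h) (U⁺ h)) (trans (cong (𝟙 (V.least h) *_) (𝟙-disjoint (ov h) (U h)))
          (trans (ℤP.*-distribˡ-+ (𝟙 (V.least h)) (𝟙 (ov h)) (𝟙 (not (ov h) ∧ U h)))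
            (cong₂ _+_ (sym (𝟙-∧ (V.least h) (ov h))) (sym (𝟙-∧ (V.least h) (not (ov h) ∧ U h))))))))
          (trans (sum-+ (λ h → 𝟙 (V.least h ∧ ov h)) (λ h → 𝟙 (V.least h ∧ (not (ov h) ∧ U h))))
            (cong (_+ # (λ h → V.least h ∧ (not (ov h) ∧ U h))) (trans (#ov contour) #ρ≡d)))
        #G : sumℤ D.G ≡ sumℤ (λ h → 𝟙 (A h) * bF h) + + d
        #G = trans (sum-+ (λ h → 𝟙 (A⁺ h) * (+ 1 - + d * 𝟙 (F.least h))) (λ h → 𝟙 (ρ h ∧ B⁺ h)))
          (cong₂ _+_ (sum-cong (λ h → trans (cong (_* (+ 1 - + d * 𝟙 (F.least h))) (𝟙-∧ (not (ρ h)) (A h)))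
            (shuffle (𝟙 (not (ρ h))) (𝟙 (A h)) (+ 1 - + d * 𝟙 (F.least h)))))
            (trans (sum-cong (λ h → cong 𝟙 (absorb (ρ h) (ρ (a h)) (not (oe h) ∧ B h)))) #ρ≡d))
          where
            shuffle : ∀ x y z → (x * y) * z ≡ y * (x * z)
            shuffle = solve-∀
            absorb : ∀ x y z → x ∧ ((x ∨ y) ∨ z) ≡ x
            absorb true  y z = refl
            absorb false y z = refl
        dense : (+ d - + 2) * ((+ d + + d) + # (λ h → not (oe h) ∧ B h)) + + 2 *
          (sumℤ (λ h → 𝟙 (A h) * bF h) + + d) + + 2 * + d ≤ + 2 * + d * (+ d + # (λ h → V.least h ∧ (not (ov h) ∧ U h)))
        dense = subst₂ _≤_ (cong₂ (λ y z → (+ d - + 2) * y + + 2 * z + + 2 * + d) #B #G) (cong (+ 2 * + d *_) #U) D.density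

    balance-total : sumℤ bV + (sumℤ bE + sumℤ bF) ≡ + 0
    balance-total = trans (cong₂ _+_ v-total (cong (_+_ (sumℤ bE)) f-total)) (total-arith (+ d) (# V.least) (# F.least) (+ n)
      (sumℤ bE) (# (not ∘ oe)) euler e-total (trans (#-not oe) (cong (_-_ (+ n)) (trans (#oe contour) (cong₂ _+_ #ρ≡d #ρ≡d)))))
      where
        minus : ∀ x y z → x ≡ y + z → z ≡ x - y
        minus x y z refl = lemma y z
          where
            lemma : ∀ y z → z ≡ (y + z) - y
            lemma = solve-∀
        v-total : sumℤ bV ≡ - + d * (# V.least - + d)
        v-total = trans (sum-* (- + d) (λ h → 𝟙 (V.least h ∧ not (ov h))))
          (cong (- + d *_) (trans (minus (# V.least) (# (λ h → V.least h ∧ ov h)) (# (λ h → V.least h ∧ not (ov h)))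
          (#-split V.least ov)) (cong (_-_ (# V.least)) (trans (#ov contour) #ρ≡d))))
        e-total : + 2 * sumℤ bE ≡ (+ d - + 2) * # (not ∘ oe)
        e-total = trans (cong (+ 2 *_) (sum-cong (λ h → sym (ℤP.*-identityˡ (bE h))))) (trans (E-sum (λ _ → true) (λ _ _ → refl))
          (cong ((+ d - + 2) *_) (sum-cong (λ h → cong 𝟙 (∧-identityʳ (not (oe h)))))))
        root-face : # (λ h → F.least h ∧ ρ h) ≡ + 1
        root-face = trans (sum-cong (λ h → 𝟙-∧ (F.least h) (ρ h))) (F.one-rep root)
        f-total : sumℤ bF ≡ (+ n - + d) - + d * (# F.least - + 1)
        f-total = trans (sum-cong (λ h → expand (𝟙 (not (ρ h))) (+ d) (𝟙 (F.least h))))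
          (trans (sum-sub (𝟙 ∘ not ∘ ρ) (λ h → + d * (𝟙 (F.least h) * 𝟙 (not (ρ h)))))
          (cong₂ _-_ (trans (#-not ρ) (cong (_-_ (+ n)) #ρ≡d)) (trans (sum-* (+ d) (λ h → 𝟙 (F.least h) * 𝟙 (not (ρ h)))) (cong (+ d *_)
            (trans (sum-cong (λ h → sym (𝟙-∧ (F.least h) (not (ρ h))))) (trans (minus (# F.least) (# (λ h → F.least h ∧ ρ h))
              (# (λ h → F.least h ∧ not (ρ h))) (#-split F.least ρ)) (cong (_-_ (# F.least)) root-face)))))))
          where
            expand : ∀ x d l → x * (+ 1 - d * l) ≡ x - d * (l * x)
            expand = solve-∀

-- From a relaxed flow to a flooded orientation

private
  curl-edge : ∀ q q⁻ r r⁻ → (q - q⁻) + (r - r⁻) ≡ (q - r⁻) + (r - q⁻)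
  curl-edge = solve-∀

  edge-balance : ∀ b x x′ y y′ → b + (- (x + x′) + (y + y′)) ≡ + 0 → x + x′ ≡ b + (y + y′)
  edge-balance b x x′ y y′ e = trans (lemma b x x′ y y′) (trans (cong (λ z → (b + (y + y′)) - z) e) (ℤP.+-identityʳ (b + (y + y′))))
    where
      lemma : ∀ b x x′ y y′ → x + x′ ≡ (b + (y + y′)) - (b + (- (x + x′) + (y + y′)))
      lemma = solve-∀

  pick-V : ∀ v x y → (v - + 0) * x + (+ 0 - + 0) * y ≡ v * x
  pick-V = solve-∀

  pick-E : ∀ e x y → (+ 0 - e) * x + (e - + 0) * y ≡ e * (- x + y)
  pick-E = solve-∀

  pick-F : ∀ q x y → (+ 0 - + 0) * x + (+ 0 - q) * y ≡ - (q * y)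
  pick-F = solve-∀

  edge-total′ : ∀ x x′ c c′ y y′ e e′ d → x + x′ ≡ (d - + 2) + (y + y′) → c + c′ ≡ e + e′ → (x + + 0 + c) + (x′ + + 0 + c′) ≡
    (d - + 2) + ((y + e) + (y′ + e′))
  edge-total′ x x′ c c′ y y′ e e′ d p q = trans (lemma₁ x x′ c c′) (trans (cong₂ _+_ p q) (lemma₂ (d - + 2) y y′ e e′))
    where
      lemma₁ : ∀ x x′ c c′ → (x + + 0 + c) + (x′ + + 0 + c′) ≡ (x + x′) + (c + c′)
      lemma₁ = solve-∀
      lemma₂ : ∀ k y y′ e e′ → (k + (y + y′)) + (e + e′) ≡ k + ((y + e) + (y′ + e′))
      lemma₂ = solve-∀

  pair-weight : ∀ X X′ Y Y′ d → X + X′ ≡ (d - + 2) + (Y + Y′) → (X - Y′) + (X′ - Y) ≡ d - + 2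
  pair-weight X X′ Y Y′ d e = trans (lemma₁ X X′ Y Y′) (trans (cong (_- (Y + Y′)) e) (lemma₂ (d - + 2) (Y + Y′)))
    where
      lemma₁ : ∀ X X′ Y Y′ → (X - Y′) + (X′ - Y) ≡ (X + X′) - (Y + Y′)
      lemma₁ = solve-∀
      lemma₂ : ∀ k z → (k + z) - z ≡ k
      lemma₂ = solve-∀

  two-bound : ∀ d X Y Y′ → X ≡ (d - + 2) + (Y + Y′) → X ≤ d → + 0 ≤ Y → Y′ ≤ + 2
  two-bound d X Y Y′ refl p q = ≤-by ((d - ((d - + 2) + (Y + Y′))) + Y) (0≤+ (0≤- p) q) (lemma d Y Y′)
    where
      lemma : ∀ d Y Y′ → + 2 ≡ Y′ + ((d - ((d - + 2) + (Y + Y′))) + Y)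
      lemma = solve-∀

pos-difference : ∀ {X Y} → + 0 ≤ X → + 0 ≤ Y → (X ≡ + 0) ⊎ (Y ≡ + 0) → (pos (X - Y) ≡ X) × (neg (X - Y) ≡ Y)
pos-difference {X} {Y} 0≤X 0≤Y (inj₁ refl) = pos≡0 Z≤0 , trans (help (sign-view (+ 0 - Y)))
  (trans (cong -_ (ℤP.+-identityˡ (- Y))) (ℤP.neg-involutive Y))
  where
    Z≤0 : + 0 - Y ≤ + 0
    Z≤0 = subst (_≤ + 0) (sym (ℤP.+-identityˡ (- Y))) (ℤP.neg-mono-≤ 0≤Y)
    help : SignView (+ 0 - Y) → neg (+ 0 - Y) ≡ - (+ 0 - Y)
    help (positive l _ _)    = ⊥-elim (≤<-absurd Z≤0 l)
    help (nonpositive _ _ q) = q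
pos-difference {X} {Y} 0≤X 0≤Y (inj₂ refl) = trans (help (sign-view (X - + 0))) (ℤP.+-identityʳ X) , neg≡0
  (subst (+ 0 ≤_) (sym (ℤP.+-identityʳ X)) 0≤X)
  where
    help : SignView (X - + 0) → pos (X - + 0) ≡ X - + 0
    help (positive _ q _)    = q
    help (nonpositive l q _) = trans q (ℤP.≤-antisym (subst (+ 0 ≤_) (sym (ℤP.+-identityʳ X)) 0≤X) l)

module Existence (M : PlaneMap) where
  open Outer M public

  module Construct (contour : SimpleOuterContour M w₀) (d : ℕ) (no-short : ∀ k → k ℕ.< d → ¬ HasCycle M k) (#ρ≡d : # ρ ≡ + d) where
    open Supplies contour d no-short #ρ≡d

    module Weights (x y : Fin n → ℤ) (x≥0 : ∀ h → + 0 ≤ x h) (y≥0 : ∀ h → + 0 ≤ y h)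
      (x-masked : ∀ h → mx h ≡ false → x h ≡ + 0) (y-masked : ∀ h → my h ≡ false → y h ≡ + 0)
      (balanced : ∀ t → (sumℤ (λ h → tV t h * bV h) + (sumℤ (λ h → tE t h * bE h) + sumℤ
        (λ h → tF t h * bF h))) + ⟨ ∇ᵛ t , ∇ᶠ t ∣ x , y ⟩ ≡ + 0) where

      private
        no-sum : ∀ (F : Fin n → ℤ) → sumℤ (λ h → + 0 * F h) ≡ + 0
        no-sum F = sum-zero (λ h → ℤP.*-zeroˡ (F h))

      -- The weak balance is tested against the indicator of a single vertex; `edge-xy` and `face-y`
      -- use an edge and a face.
      vertex-x : ∀ r → ov r ≡ false → V.class-sum x r ≡ + d
      vertex-x r e = solve₁ (+ d) (V.class-sum x r) (trans (sym evaluate) (balanced t))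
        where
          t : Node
          t = node (λ h → V.[ r ~ h ]) (λ _ → + 0) (λ _ → + 0) (λ h → V.[]-cong {r} {s h} {r} {h} (λ v → V.~-trans v
            (V.~-sym (V.~-f h))) V.~-next) (λ _ → refl) (λ _ → refl)
          supply : sumℤ (λ h → V.[ r ~ h ] * bV h) ≡ - + d
          supply = trans (V.class-sum-≡ {bV} {λ h → - + d * 𝟙 (V.least h)} r (λ h v → cong (λ z → - + d * 𝟙 z) (inner h v)))
            (trans (sum-cong (λ h → shuffle V.[ r ~ h ] (- + d) (𝟙 (V.least h))))
            (trans (sum-* (- + d) (λ h → V.[ r ~ h ] * 𝟙 (V.least h))) (trans (cong (- + d *_) (V.one-rep-sym r))
              (ℤP.*-identityʳ (- + d)))))
            where
              inner : ∀ h → SameVertex M r h → V.least h ∧ not (ov h) ≡ V.least h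
              inner h v = trans (cong (λ z → V.least h ∧ not z) (not-true (λ o → true≢false (ov-~ (V.~-sym v) o) e)))
                (∧-identityʳ (V.least h))
              shuffle : ∀ u c l → u * (c * l) ≡ c * (u * l)
              shuffle = solve-∀
          evaluate : (sumℤ (λ h → tV t h * bV h) + (sumℤ (λ h → tE t h * bE h) + sumℤ
            (λ h → tF t h * bF h))) + ⟨ ∇ᵛ t , ∇ᶠ t ∣ x , y ⟩ ≡ (- + d + (+ 0 + + 0)) + V.class-sum x r
          evaluate = cong₂ _+_ (cong₂ _+_ supply (cong₂ _+_ (no-sum bE) (no-sum bF))) (sum-cong (λ h → pick-V V.[ r ~ h ] (x h) (y h)))
          solve₁ : ∀ d z → (- d + (+ 0 + + 0)) + z ≡ + 0 → z ≡ d
          solve₁ d z q = trans (lemma d z) (trans (cong (_+ d) q) (ℤP.+-identityˡ d))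
            where
              lemma : ∀ d z → z ≡ ((- d + (+ 0 + + 0)) + z) + d
              lemma = solve-∀

      edge-xy : ∀ h → oe h ≡ false → x h + x (a h) ≡ (+ d - + 2) + (y h + y (a h))
      edge-xy h e = edge-balance (+ d - + 2) (x h) (x (a h)) (y h) (y (a h)) (trans (sym evaluate) (balanced t))
        where
          t : Node
          t = node (λ _ → + 0) (λ g → E.[ h ~ g ]) (λ _ → + 0) (λ _ → refl)
            (λ g → E.[]-cong {h} {a g} {h} {g} (λ { (inj₁ q) → inj₂ (trans (cong a q) (aa g)) ; (inj₂ q) → inj₁
              (a-injective q) }) (λ { (inj₁ q) → inj₂ (cong a q) ; (inj₂ q) → inj₁ (trans (sym (aa h)) (cong a q)) })) (λ _ → refl)
          supply : sumℤ (λ g → E.[ h ~ g ] * bE g) ≡ + d - + 2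
          supply = trans (E.class-sum-≡ {bE} {λ g → (+ d - + 2) * 𝟙 (E.least g)} h (λ g v → cong (λ z → (+ d - + 2) * 𝟙 z)
            (inner g v))) (trans (sum-cong (λ g → shuffle E.[ h ~ g ] (+ d - + 2) (𝟙 (E.least g))))
            (trans (sum-* (+ d - + 2) (λ g → E.[ h ~ g ] * 𝟙 (E.least g))) (trans (cong ((+ d - + 2) *_) (E.one-rep-sym h))
              (ℤP.*-identityʳ (+ d - + 2)))))
            where
              inner : ∀ g → h ~ₑ g → E.least g ∧ not (oe g) ≡ E.least g
              inner g v = trans (cong (λ z → E.least g ∧ not z) ([ (λ q → trans (cong oe (sym q)) e) ,
                (λ q → trans (cong oe (sym q)) (trans (mask-a oe oe-a h) e)) ]′ v)) (∧-identityʳ (E.least g))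
              shuffle : ∀ u c l → u * (c * l) ≡ c * (u * l)
              shuffle = solve-∀
          evaluate : (sumℤ (λ h → tV t h * bV h) + (sumℤ (λ h → tE t h * bE h) + sumℤ
            (λ h → tF t h * bF h))) + ⟨ ∇ᵛ t , ∇ᶠ t ∣ x , y ⟩ ≡ (+ d - + 2) + (- (x h + x (a h)) + (y h + y (a h)))
          evaluate = cong₂ _+_ (trans (cong₂ _+_ (no-sum bV) (cong₂ _+_ supply (no-sum bF))) (tidy (+ d - + 2)))
            (trans (sum-cong (λ g → pick-E E.[ h ~ g ] (x g) (y g))) (trans (edge-class-sum (λ g → - x g + y g) h)
              (regroup′ (x h) (y h) (x (a h)) (y (a h)))))
            where
              tidy : ∀ k → + 0 + (k + + 0) ≡ k
              tidy = solve-∀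
              regroup′ : ∀ x y x′ y′ → (- x + y) + (- x′ + y′) ≡ - (x + x′) + (y + y′)
              regroup′ = solve-∀

      face-y : ∀ r → ρ r ≡ false → F.class-sum (λ c → + 1 - y c) r ≡ + d
      face-y r e = trans (F.class-sum-+ (λ _ → + 1) (λ c → - y c) r) (trans (cong (_+_ (F.class-sum (λ _ → + 1) r)) (F.class-sum-neg y r))
        (solve₁ (F.class-sum (λ _ → + 1) r) (+ d) (F.class-sum y r) (trans (sym evaluate) (balanced t))))
        where
          t : Node
          t = node (λ _ → + 0) (λ _ → + 0) (λ h → F.[ r ~ h ]) (λ _ → refl) (λ _ → refl) (λ h → F.[]-cong {r} {f h} {r} {h}
            (λ v → F.~-trans v (F.~-sym (F.~-f h))) F.~-next)
          supply : sumℤ (λ h → F.[ r ~ h ] * bF h) ≡ F.class-sum (λ _ → + 1) r - + d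
          supply = trans (F.class-sum-≡ {bF} {λ h → + 1 + - (+ d * 𝟙 (F.least h))} r inner)
            (trans (F.class-sum-+ (λ _ → + 1) (λ h → - (+ d * 𝟙 (F.least h))) r)
            (cong (_+_ (F.class-sum (λ _ → + 1) r)) (trans (F.class-sum-neg (λ h → + d * 𝟙 (F.least h)) r)
              (cong -_ (trans (sum-cong (λ h → shuffle F.[ r ~ h ] (+ d) (𝟙 (F.least h))))
              (trans (sum-* (+ d) (λ h → F.[ r ~ h ] * 𝟙 (F.least h))) (trans (cong (+ d *_) (F.one-rep-sym r))
                (ℤP.*-identityʳ (+ d)))))))))
            where
              inner : ∀ h → SameFace M r h → bF h ≡ + 1 + - (+ d * 𝟙 (F.least h))
              inner h v = trans (cong (λ z → 𝟙 (not z) * (+ 1 - + d * 𝟙 (F.least h)))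
                (not-true (λ o → true≢false (ρ⁺ (F.~-trans v (ρ⁻ o))) e))) (ℤP.*-identityˡ _)
              shuffle : ∀ u c l → u * (c * l) ≡ c * (u * l)
              shuffle = solve-∀
          evaluate : (sumℤ (λ h → tV t h * bV h) + (sumℤ (λ h → tE t h * bE h) + sumℤ
            (λ h → tF t h * bF h))) + ⟨ ∇ᵛ t , ∇ᶠ t ∣ x , y ⟩ ≡ (+ 0 + (+ 0 + (F.class-sum (λ _ → + 1) r - + d))) + - F.class-sum y r
          evaluate = cong₂ _+_ (cong₂ _+_ (no-sum bV) (cong₂ _+_ (no-sum bE) supply))
            (trans (sum-cong (λ h → pick-F F.[ r ~ h ] (x h) (y h))) (sum-neg (λ h → F.[ r ~ h ] * y h)))
          solve₁ : ∀ o d z → (+ 0 + (+ 0 + (o - d))) + - z ≡ + 0 → o + - z ≡ d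
          solve₁ o d z q = trans (lemma o d z) (trans (cong (_+ d) q) (ℤP.+-identityˡ d))
            where
              lemma : ∀ o d z → o + - z ≡ ((+ 0 + (+ 0 + (o - d))) + - z) + d
              lemma = solve-∀

      -- The added unit is the weight 1 on the ingoing half-edges of a clockwise contour, which the
      -- flow does not provide.
      ℓ : Fin n → ℤ
      ℓ h = x h + 𝟙 (ρ (a h))

      ℓ≥0 : ∀ h → + 0 ≤ ℓ h
      ℓ≥0 h = 0≤+ (x≥0 h) (0≤𝟙 (ρ (a h)))

      x-outer : ∀ {h} → ov h ≡ true → x h ≡ + 0
      x-outer {h} e = x-masked h (trans (cong (λ z → not (oe h) ∧ not z) e) (∧-zeroʳ (not (oe h))))

      y-outer : ∀ {h} → oe h ≡ true → y h ≡ + 0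
      y-outer {h} e = y-masked h (cong not e)

      module Minimised (Q : Fin n → ℤ) (pot : Potential ℓ y ℓ≥0 y≥0 Q) (tight : ∀ h → Star (Tight ℓ y ℓ≥0 y≥0 Q) root h) where
        open Potential pot

        private
          module V⁻ = Orbits s⁻ s s⁻s ss⁻
          module F⁻ = Orbits f⁻ f f⁻f ff⁻

          ~⇒V⁻ : ∀ {g h} → SameVertex M g h → g V⁻.~ h
          ~⇒V⁻ {g} e = V.~-ind (g V⁻.~_) (λ z p → V⁻.~-trans p (V⁻.~-f⁻ z)) e (V⁻.~-refl g)

          ~⇒F⁻ : ∀ {g h} → SameFace M g h → g F⁻.~ h
          ~⇒F⁻ {g} e = F.~-ind (g F⁻.~_) (λ z p → F⁻.~-trans p (F⁻.~-f⁻ z)) e (F⁻.~-refl g)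

        Q-ρ : ∀ h → ρ h ≡ true → Q h ≡ + 0
        Q-ρ h e = ℤP.≤-antisym (proj₂ (F⁻.~-ind (λ z → (ρ z ≡ true) × (Q z ≤ + 0)) step (~⇒F⁻ (F.~-sym (ρ⁻ e)))
          (ρ-root , ℤP.≤-reflexive atRoot))) (nonneg h)
          where
            step : ∀ z → (ρ z ≡ true) × (Q z ≤ + 0) → (ρ (f⁻ z) ≡ true) × (Q (f⁻ z) ≤ + 0)
            step z (p , q) = ρ-f⁻ z p , ℤP.≤-trans (short₂ z) (subst (λ u → Q z + u ≤ + 0) (sym (y-outer (∨-trueˡ p)))
              (subst (_≤ + 0) (sym (ℤP.+-identityʳ (Q z))) q))

        -- Around an outer vertex every move has length 0 except the one across the ingoing contour
        -- half-edge, and that move ends in the root face, where `Q` is 0 by `Q-ρ`. So the curl of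
        -- `Q` leaves the contour weights alone.
        Q-outer : ∀ h → ov h ≡ true → Q h ≡ + 0
        Q-outer h e = let (g , v , o) = ov⁻ e in
          ℤP.≤-antisym (proj₂ (V⁻.~-ind (λ z → (ov z ≡ true) × (Q z ≤ + 0)) step (~⇒V⁻ (V.~-sym v)) (ρ⊆ov (ρ⁺ o) , ℤP.≤-reflexive
            (Q-ρ g (ρ⁺ o))))) (nonneg h)
          where
            step : ∀ z → (ov z ≡ true) × (Q z ≤ + 0) → (ov (s⁻ z) ≡ true) × (Q (s⁻ z) ≤ + 0)
            step z (p , q) = ov-~ (V.~-f⁻ z) p , [ (λ r → ℤP.≤-reflexive (Q-ρ (s⁻ z) (subst (λ u → ρ (s⁻ u) ≡ true) (aa z) (ρ-f⁻ (a z) r))))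
                                                  , (λ r → ℤP.≤-trans (short₁ z) (subst (λ u → Q z + u ≤ + 0)
                                                    (sym (cong₂ (λ u v → u + 𝟙 v) (x-outer p) r))
                                                    (subst (_≤ + 0) (sym (ℤP.+-identityʳ (Q z))) q))) ]′ (true? (ρ (a z)))

        X Y w : Fin n → ℤ
        X h = ℓ h + curlᵛ Q h
        Y h = y h + curlᶠ Q h
        w h = X h - Y (a h)

        private
          slack : ∀ q q⁻ l → q⁻ ≤ q + l → + 0 ≤ l + (q - q⁻)
          slack q q⁻ l p = subst (+ 0 ≤_) (lemma q q⁻ l) (0≤- p)
            where
              lemma : ∀ q q⁻ l → (q + l) - q⁻ ≡ l + (q - q⁻)
              lemma = solve-∀
          tight-zero : ∀ q q⁻ l → q⁻ ≡ q + l → l + (q - q⁻) ≡ + 0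
          tight-zero q q⁻ l refl = lemma q l
            where
              lemma : ∀ q l → l + (q - (q + l)) ≡ + 0
              lemma = solve-∀

        X≥0 : ∀ h → + 0 ≤ X h
        X≥0 h = slack (Q h) (Q (s⁻ h)) (ℓ h) (short₁ h)

        Y≥0 : ∀ h → + 0 ≤ Y h
        Y≥0 h = slack (Q h) (Q (f⁻ h)) (y h) (short₂ h)

        X-outer : ∀ {h} → ov h ≡ true → X h ≡ 𝟙 (ρ (a h))
        X-outer {h} e = trans (cong₂ (λ u v → (u + 𝟙 (ρ (a h))) + v) (x-outer e) (cong₂ _-_ (Q-outer h e)
          (Q-outer (s⁻ h) (ov-~ (V.~-f⁻ h) e)))) (trans (ℤP.+-identityʳ _) (ℤP.+-identityˡ _))

        Y-outer : ∀ {h} → oe h ≡ true → Y h ≡ + 0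
        Y-outer {h} e = cong₂ _+_ (y-outer e) (cong₂ _-_ (Q-outer h (oe⊆ov h e)) (Q-outer (f⁻ h) (ov-~ (V.~-f⁻ (a h))
          (oe⊆ov (a h) (oe-a h e)))))

        -- A shortest path to the corner `s⁻ h` arrives from `h` or from `a h` by a tight move, and
        -- tightness makes `X h` or `Y (a h)` zero. An empty path means that this corner is the
        -- root, and then `a h` is on the root face.
        complementary : ∀ h → (X h ≡ + 0) ⊎ (Y (a h) ≡ + 0)
        complementary h = last (tight (s⁻ h))
          (λ q → inj₂ (Y-outer (∨-trueˡ (trans (cong ρ (trans (sym (fs⁻ h)) (cong f (sym q)))) (ρ-f root ρ-root)))))
          where
            last : ∀ {u} → Star (Tight ℓ y ℓ≥0 y≥0 Q) u (s⁻ h) → (u ≡ s⁻ h → (X h ≡ + 0) ⊎ (Y (a h) ≡ + 0)) → (X h ≡ + 0) ⊎ (Y (a h) ≡ + 0)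
            last ε k = k refl
            last {u} (inj₁ (t , refl) ◅ r) k = last r (λ q → inj₁ (subst (λ z → X z ≡ + 0) (trans (sym (ss⁻ u)) (trans (cong s q)
              (ss⁻ h))) (tight-zero (Q u) (Q (s⁻ u)) (ℓ u) t)))
            last {u} (inj₂ (t , refl) ◅ r) k = last r (λ q → inj₂ (subst (λ z → Y z ≡ + 0) (trans (sym (ff⁻ u)) (trans (cong f q)
              (fs⁻ h))) (tight-zero (Q u) (Q (f⁻ u)) (y u) t)))

        x-part : ∀ h → xOf w h ≡ X h
        x-part h = proj₁ (pos-difference (X≥0 h) (Y≥0 (a h)) (complementary h))

        y-part : ∀ h → yOf w h ≡ Y (a h)
        y-part h = proj₂ (pos-difference (X≥0 h) (Y≥0 (a h)) (complementary h))

        flood : ∀ h → Star (FloodStep w) root h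
        flood h = go (tight h)
          where
            go : ∀ {u v} → Star (Tight ℓ y ℓ≥0 y≥0 Q) u v → Star (FloodStep w) u v
            go ε = ε
            go {u} (inj₁ (t , e) ◅ r) = inj₁
              (subst (_≤ + 0) (sym (trans (cong (_- Y (a u)) (tight-zero (Q u) (Q (s⁻ u)) (ℓ u) t)) (ℤP.+-identityˡ _)))
              (ℤP.neg-mono-≤ (Y≥0 (a u))) , e) ◅ go r
            go {u} (inj₂ (t , e) ◅ r) = inj₂
              (subst (+ 0 ≤_) (sym (trans (cong (_-_ (X (a u))) (trans (cong Y (aa u)) (tight-zero (Q u) (Q (f⁻ u)) (y u) t)))
              (ℤP.+-identityʳ _))) (X≥0 (a u)) , e) ◅ go r

        clockwise : Clockwise w
        clockwise g e = cong₂ _-_ (trans (X-outer (ρ⊆ov e)) (cong 𝟙 (one-sided contour e))) (Y-outer (oe-a g (∨-trueˡ e))) ,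
          cong₂ _-_ (trans (X-outer (oe⊆ov (a g) (oe-a g (∨-trueˡ e)))) (cong 𝟙 (trans (cong ρ (aa g)) e)))
            (trans (cong Y (aa g)) (Y-outer (∨-trueˡ e)))

        vertex-X : ∀ r → ov r ≡ false → V.class-sum X r ≡ + d
        vertex-X r e = trans (V.class-sum-+ ℓ (curlᵛ Q) r) (trans (cong₂ _+_ (trans (V.class-sum-+ x (𝟙 ∘ ρ ∘ a) r)
          (cong₂ _+_ (vertex-x r e)
            (V.class-sum-zero r (λ g v → cong 𝟙 (not-true (λ o → true≢false (ov-~ (V.~-sym v) (oe⊆ov g (∨-trueʳ {ρ g} o))) e)))))) curl0)
          (trans (ℤP.+-identityʳ _) (ℤP.+-identityʳ _)))
          where
            curl0 : V.class-sum (curlᵛ Q) r ≡ + 0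
            curl0 = trans (V.class-sum-+ Q (λ h → - Q (s⁻ h)) r) (trans (cong (_+_ (V.class-sum Q r))
              (trans (V.class-sum-neg (Q ∘ s⁻) r) (cong -_ (trans (sym (V.class-sum-shift (Q ∘ s⁻) r))
              (sum-cong (λ g → cong (λ z → V.[ r ~ g ] * Q z) (s⁻s g)))))))
              (ℤP.+-inverseʳ (V.class-sum Q r)))

        face-Y : ∀ r → ρ r ≡ false → F.class-sum (λ c → + 1 - Y c) r ≡ + d
        face-Y r e = trans (sum-cong (λ c → cong (F.[ r ~ c ] *_) (expand (y c) (curlᶠ Q c))))
          (trans (F.class-sum-+ (λ c → + 1 - y c) (λ c → - curlᶠ Q c) r)
          (trans (cong₂ _+_ (face-y r e) (trans (F.class-sum-neg (curlᶠ Q) r) (cong -_ curl0))) (ℤP.+-identityʳ (+ d))))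
          where
            expand : ∀ y c → + 1 - (y + c) ≡ (+ 1 - y) + - c
            expand = solve-∀
            curl0 : F.class-sum (curlᶠ Q) r ≡ + 0
            curl0 = trans (F.class-sum-+ Q (λ h → - Q (f⁻ h)) r) (trans (cong (_+_ (F.class-sum Q r))
              (trans (F.class-sum-neg (Q ∘ f⁻) r) (cong -_ (trans (sym (F.class-sum-shift (Q ∘ f⁻) r))
              (sum-cong (λ g → cong (λ z → F.[ r ~ g ] * Q z) (f⁻f g)))))))
              (ℤP.+-inverseʳ (F.class-sum Q r)))

        edge-XY : ∀ h → oe h ≡ false → X h + X (a h) ≡ (+ d - + 2) + (Y h + Y (a h))
        edge-XY h e = trans (cong₂ (λ u v → ((x h + 𝟙 u) + curlᵛ Q h) + ((x (a h) + 𝟙 v) + curlᵛ Q (a h))) (proj₂ (oe-false e))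
          (trans (cong ρ (aa h)) (proj₁ (oe-false e))))
          (edge-total′ (x h) (x (a h)) (curlᵛ Q h) (curlᵛ Q (a h)) (y h) (y (a h)) (curlᶠ Q h) (curlᶠ Q (a h)) (+ d) (edge-xy h e)
            (trans (curl-edge (Q h) (Q (s⁻ h)) (Q (a h)) (Q (s⁻ (a h)))) (cong (λ z → curlᶠ Q h + (Q (a h) - Q (s⁻ z))) (sym (aa h)))))

        admissible : Admissible M w
        admissible = contour , outer , inner
          where
            outer : ∀ h → OuterEdge M h → (w h ≡ + 0 × w (a h) ≡ + 1) ⊎ (w h ≡ + 1 × w (a h) ≡ + 0)
            outer h (inj₁ o) = inj₁ (clockwise h (ρ⁺ o))
            outer h (inj₂ o) = let (p , q) = clockwise (a h) (ρ⁺ o) in inj₂ (trans (cong w (sym (aa h))) q , p)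
            inner : ∀ h → ¬ OuterEdge M h → OuterVertex M h → w h ≤ + 0
            inner h ¬o v = subst (_≤ + 0)
              (sym (trans (cong (_- Y (a h)) (trans (X-outer (ov⁺ v)) (cong 𝟙 (proj₂ (oe-false (oe-not ¬o))))))
              (ℤP.+-identityˡ _))) (ℤP.neg-mono-≤ (Y≥0 (a h)))

        X≤d : ∀ h → ρ (a h) ≡ false → X h ≤ + d
        X≤d h p = [ (λ e → ℤP.≤-trans (ℤP.≤-reflexive (trans (X-outer e) (cong 𝟙 p))) (+≤+ ℕ.z≤n)) , inside ]′ (true? (ov h))
          where
            inside : ov h ≡ false → X h ≤ + d
            inside e = subst₂ _≤_ (trans (cong (_* X h) (V.[]-yes (V.~-refl h))) (ℤP.*-identityˡ (X h))) (vertex-X h e)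
              (sum-nonneg-term (λ g → 0≤* (0≤𝟙 ⌊ sameVertex? M h g ⌋) (X≥0 g)) h)

        orientation : IsDOrientation M w d
        orientation = admissible , lower , edges , vertices , faces
          where
            lower : ∀ h → w h ≤ + 0 → - + 2 ≤ w h
            lower h _ = [ low , (λ z → subst (- + 2 ≤_) (sym (trans (cong (_-_ (X h)) z) (ℤP.+-identityʳ (X h))))
              (ℤP.≤-trans ℤ.-≤+ (X≥0 h))) ]′ (complementary h)
              where
                low : X h ≡ + 0 → - + 2 ≤ w h
                low z = subst (- + 2 ≤_) (sym (trans (cong (_- Y (a h)) z) (ℤP.+-identityˡ _)))
                  (ℤP.neg-mono-≤ ([ outer , inner ]′ (true? (oe h))))
                  where
                    outer : oe h ≡ true → Y (a h) ≤ + 2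
                    outer e = ℤP.≤-trans (ℤP.≤-reflexive (Y-outer (oe-a h e))) (+≤+ ℕ.z≤n)
                    inner : oe h ≡ false → Y (a h) ≤ + 2
                    -- The origin of -2: with `X h` zero, the other end receives
                    -- `(d - 2) + Y h + Y (a h)`, but at most `d` by the vertex condition.
                    inner e = two-bound (+ d) (X (a h)) (Y h) (Y (a h))
                      (trans (sym (trans (cong (_+ X (a h)) z) (ℤP.+-identityˡ (X (a h))))) (edge-XY h e))
                      (X≤d (a h) (trans (cong ρ (aa h)) (proj₁ (oe-false e)))) (Y≥0 h)
            edges : ∀ h → ¬ OuterEdge M h → w h + w (a h) ≡ + d - + 2
            edges h ¬o = trans (cong (λ z → (X h - Y (a h)) + (X (a h) - Y z)) (aa h)) (pair-weight (X h) (X (a h)) (Y h)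
              (Y (a h)) (+ d) (edge-XY h (oe-not ¬o)))
            vertices : ∀ h → ¬ OuterVertex M h → vertexWeight M w h ≡ + d
            vertices h ¬o = trans (vertexWeight≡ w h) (trans (sum-cong (λ g → cong (V.[ h ~ g ] *_) (x-part g)))
              (vertex-X h (⌊⌋-false⁺ (outerVertex? h) ¬o)))
            faces : ∀ h → ¬ InRootFace M h → + faceDeg M h + faceWeight M w h ≡ + d
            faces h ¬o = trans (face-sum w h) (trans (sum-cong (λ c → cong (λ z → F.[ h ~ c ] * (+ 1 - z)) (trans (y-part (a c))
              (cong Y (aa c))))) (face-Y h (⌊⌋-false⁺ (sameFace? M h root) ¬o)))

    construct : ∃ λ w → IsDOrientation M w d × Clockwise w × (∀ h → Star (FloodStep w) root h)
    construct = let (x , y , x≥0 , y≥0 , xm , ym , bal) = relaxed-flow mx my bV bE bF balance-total hall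
                    module W = Weights x y x≥0 y≥0 xm ym bal
                    (Q , pot , tight) = distances W.ℓ y W.ℓ≥0 y≥0
                    module R = W.Minimised Q pot tight
                in R.w , R.orientation , R.clockwise , R.flood

  -- The flood cannot enter a counterclockwise circuit. A move `s⁻` at `h` amounts to crossing the
  -- edge of `h` and following a face; on the circuit, `h` is either on the inner side, hence not
  -- reached before, or ingoing, and then the move is not allowed.
  flood⇒minimal : ∀ w → (∀ h → Star (FloodStep w) root h) → Minimal M w
  flood⇒minimal w fl m hs (cyc , ccw) = proj₂ (ccw zero) (go (fl (hs zero)) ε)
    where
      open Cycle cyc
      back-f : ∀ h → Star (DualStep M w hs) root h → Star (DualStep M w hs) root (f⁻ h)
      back-f h st = F.~-ind (Star (DualStep M w hs) root) (λ z p → p ◅◅ (inj₁ refl ◅ ε)) (F.~-f⁻ h) st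
      cross : ∀ h → w h ≤ + 0 → Star (DualStep M w hs) root h → Star (DualStep M w hs) root (s⁻ h)
      cross h l st with onCycle? h
      ... | no ¬c = subst (λ z → Star (DualStep M w hs) root (s⁻ z)) (aa h) (back-f (a h) (st ◅◅ (inj₂ (¬c , refl) ◅ ε)))
      ... | yes (i , inj₁ refl) = ⊥-elim (proj₂ (ccw i) st)
      ... | yes (i , inj₂ refl) = ⊥-elim (≤<-absurd l (proj₁ (ccw i)))
      go : ∀ {x y} → Star (FloodStep w) x y → Star (DualStep M w hs) root x → Star (DualStep M w hs) root y
      go ε st = st
      go {x} (inj₁ (l , refl) ◅ r) st = go r (cross x l st)
      go {x} (inj₂ (_ , refl) ◅ r) st = go r (back-f x st)

-- Accessibility

private
  acc-arith : ∀ d e g v x w y → + 0 < d → (d - + 2) * e + + 2 * g + + 2 * d ≤ + 2 * d * v → x ≡ d * v → + 2 * w ≡ (d - + 2) * e →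
    x ≡ w + y → y ≡ g → ⊥
  acc-arith d e g v x w y 0<d p q r t refl = ≤<-absurd bound (pos-mult {+ 2} (+<+ (ℕ.s≤s ℕ.z≤n)) 0<d)
    where
      lemma₁ : ∀ d v → + 2 * d * v ≡ + 2 * (d * v)
      lemma₁ = solve-∀
      lemma₂ : ∀ w y → + 2 * (w + y) ≡ + 2 * w + + 2 * y
      lemma₂ = solve-∀
      value : + 2 * d * v ≡ (d - + 2) * e + + 2 * y
      value = trans (lemma₁ d v) (trans (cong (+ 2 *_) (trans (sym q) t)) (trans (lemma₂ w y) (cong (_+ + 2 * y) r)))
      bound : + 2 * d ≤ + 0
      bound = ≤-by (((d - + 2) * e + + 2 * y) - ((d - + 2) * e + + 2 * y + + 2 * d))
        (0≤- (subst ((d - + 2) * e + + 2 * y + + 2 * d ≤_) value p)) (lemma₃ ((d - + 2) * e + + 2 * y) (+ 2 * d))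
        where
          lemma₃ : ∀ z k → + 0 ≡ k + (z - (z + k))
          lemma₃ = solve-∀

  pair-δᵛ : ∀ u z q z′ r → (u + z) * q + z′ * r ≡ u * q + (z * q + z′ * r)
  pair-δᵛ = solve-∀

  pair-δᶠ : ∀ z q u z′ r → z * q + (u + z′) * r ≡ u * r + (z * q + z′ * r)
  pair-δᶠ = solve-∀

  walk-cancel : ∀ r b c g h → ((r - b) + (b - c)) + ((c - g) + ((h - r) - (h - g))) ≡ + 0
  walk-cancel = solve-∀

  loop-expand : ∀ p p′ u v v′ x x′ y y′ q r → (((p + u) + (v + (x - y)))) * q + (p′ + (v′ + (x′ - y′))) * r ≡
    ((p * q + p′ * r) + u * q) + ((v * q + v′ * r) + ((x * q + x′ * r) - (y * q + y′ * r)))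
  loop-expand = solve-∀

  neg-δ : ∀ u q → - u * q ≡ - (u * q)
  neg-δ = solve-∀

module Access (M : PlaneMap) where
  open Existence M public

  private
    negSingle : ∀ u (G : Fin n → ℤ) → sumℤ (λ h → - δ u h * G h) ≡ - G u
    negSingle u G = trans (sum-cong (λ h → neg-δ (δ u h) (G h))) (trans (sum-neg (λ h → δ u h * G h)) (cong -_ (sum-δ u G)))

    addᵛ : ∀ (u p q Q : Fin n → ℤ) → ⟨ (λ h → u h + p h) , q ∣ curlᵛ Q , curlᶠ Q ⟩ ≡ sumℤ
      (λ h → u h * curlᵛ Q h) + ⟨ p , q ∣ curlᵛ Q , curlᶠ Q ⟩
    addᵛ u p q Q = trans (sum-cong (λ h → pair-δᵛ (u h) (p h) (curlᵛ Q h) (q h) (curlᶠ Q h))) (sum-+ (λ h → u h * curlᵛ Q h)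
      (λ h → p h * curlᵛ Q h + q h * curlᶠ Q h))

    addᶠ : ∀ (u p q Q : Fin n → ℤ) → ⟨ p , (λ h → u h + q h) ∣ curlᵛ Q , curlᶠ Q ⟩ ≡ sumℤ
      (λ h → u h * curlᶠ Q h) + ⟨ p , q ∣ curlᵛ Q , curlᶠ Q ⟩
    addᶠ u p q Q = trans (sum-cong (λ h → pair-δᶠ (p h) (curlᵛ Q h) (u h) (q h) (curlᶠ Q h))) (sum-+ (λ h → u h * curlᶠ Q h)
      (λ h → p h * curlᵛ Q h + q h * curlᶠ Q h))

    nil : ∀ (Q : Fin n → ℤ) x → ⟨ (λ _ → + 0) , (λ _ → + 0) ∣ curlᵛ Q , curlᶠ Q ⟩ ≡ Q x - Q x
    nil Q x = trans (sum-zero (λ h → cong₂ _+_ (ℤP.*-zeroˡ (curlᵛ Q h)) (ℤP.*-zeroˡ (curlᶠ Q h)))) (sym (ℤP.+-inverseʳ (Q x)))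

    advance : ∀ (q q′ q″ : ℤ) {z p} → z ≡ q - q′ → p ≡ q′ - q″ → z + p ≡ q - q″
    advance q q′ q″ refl refl = step-cancel q q′ q″

    minus-swap : ∀ p q → - (p - q) ≡ q - p
    minus-swap = solve-∀

  module _ (w : ZBiorientation M) where

    -- A flood path as the chain of derived edges that it crosses, with both kinds of moves counted,
    -- so that pairing it with a curl telescopes (`flood-div`).
    floodᵛ floodᶠ : ∀ {x y} → Star (FloodStep w) x y → Fin n → ℤ
    floodᵛ ε h = + 0
    floodᵛ {x} (inj₁ _ ◅ r) h = δ x h + floodᵛ r h
    floodᵛ (inj₂ _ ◅ r) h = floodᵛ r h
    floodᶠ ε h = + 0
    floodᶠ (inj₁ _ ◅ r) h = floodᶠ r h
    floodᶠ {x} (inj₂ _ ◅ r) h = δ x h + floodᶠ r h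

    0≤floodᵛ : ∀ {x y} (r : Star (FloodStep w) x y) h → + 0 ≤ floodᵛ r h
    0≤floodᵛ ε h = ℤP.≤-refl
    0≤floodᵛ {x} (inj₁ _ ◅ r) h = 0≤+ (0≤δ x h) (0≤floodᵛ r h)
    0≤floodᵛ (inj₂ _ ◅ r) h = 0≤floodᵛ r h

    0≤floodᶠ : ∀ {x y} (r : Star (FloodStep w) x y) h → + 0 ≤ floodᶠ r h
    0≤floodᶠ ε h = ℤP.≤-refl
    0≤floodᶠ (inj₁ _ ◅ r) h = 0≤floodᶠ r h
    0≤floodᶠ {x} (inj₂ _ ◅ r) h = 0≤+ (0≤δ x h) (0≤floodᶠ r h)

    floodᵛ-zero : ∀ {x y} (r : Star (FloodStep w) x y) h → + 0 < w h → floodᵛ r h ≡ + 0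
    floodᵛ-zero ε h p = refl
    floodᵛ-zero {x} (inj₁ (l , _) ◅ r) h p = cong₂ _+_ (δ-≢ {i = x} {h} (λ { refl → ≤<-absurd l p })) (floodᵛ-zero r h p)
    floodᵛ-zero (inj₂ _ ◅ r) h p = floodᵛ-zero r h p

    floodᶠ-zero : ∀ {x y} (r : Star (FloodStep w) x y) h → w (a h) < + 0 → floodᶠ r h ≡ + 0
    floodᶠ-zero ε h p = refl
    floodᶠ-zero (inj₁ _ ◅ r) h p = floodᶠ-zero r h p
    floodᶠ-zero {x} (inj₂ (l , _) ◅ r) h p = cong₂ _+_ (δ-≢ {i = x} {h} (λ { refl → ≤<-absurd l p })) (floodᶠ-zero r h p)

    flood-div : ∀ (Q : Fin n → ℤ) {x y} (r : Star (FloodStep w) x y) → ⟨ floodᵛ r , floodᶠ r ∣ curlᵛ Q , curlᶠ Q ⟩ ≡ Q x - Q y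
    flood-div Q {x} ε = nil Q x
    flood-div Q {x} {y} (inj₁ (_ , refl) ◅ r) = trans (addᵛ (δ x) (floodᵛ r) (floodᶠ r) Q) (advance (Q x) (Q (s⁻ x)) (Q y)
      (sum-δ x (curlᵛ Q)) (flood-div Q r))
    flood-div Q {x} {y} (inj₂ (_ , refl) ◅ r) = trans (addᶠ (δ x) (floodᵛ r) (floodᶠ r) Q) (advance (Q x) (Q (f⁻ x)) (Q y)
      (sum-δ x (curlᶠ Q)) (flood-div Q r))

    accStep? : ∀ x y → Dec (AccStep M w x y)
    accStep? x y = (y FinP.≟ s x) ⊎-dec ((+ 0 <? w (a x)) ×-dec (y FinP.≟ a x))

  -- Acc is the set of half-edges at vertices accessible from h₀.  A corner c between an edge with
  -- inaccessible endpoints and a face touching Acc, with w (a c) < 0, is crossed by a closed walk that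
  -- follows the flood to c and returns through Acc.  The sum of these walks has a potential t on
  -- vertices, edges and faces, and the vertices, edges and faces where t is maximal receive no flow
  -- from outside, which is too much for density.
  module Inaccessible {d : ℕ} {w : ZBiorientation M} (1≤d : 1 ℕ.≤ d) (no-short : ∀ k → k ℕ.< d → ¬ HasCycle M k)
    (or : IsDOrientation M w d) (cw : Clockwise w)
    (flood : ∀ h → Star (FloodStep w) root h) (h₀ : Fin n) (h₀-outer : OuterVertex M h₀)
    (Acc : Mask n) (Acc-h₀ : Acc h₀ ≡ true) (Acc-reach : ∀ x → Acc x ≡ true → Star (AccStep M w) h₀ x)
    (Acc-closed : ∀ x y → Acc x ≡ true → AccStep M w x y → Acc y ≡ true) where

    private
      Acc-s : ∀ h → Acc h ≡ true → Acc (s h) ≡ true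
      Acc-s h e = Acc-closed h (s h) e (inj₁ refl)

      Acc-~ : ∀ {h g} → SameVertex M h g → Acc h ≡ Acc g
      Acc-~ = V.~-const Acc (V.mask-const Acc Acc-s)

      module F⁻ = Orbits f⁻ f f⁻f ff⁻

      -- The clockwise contour leads from the vertex of `h₀` to all other outer vertices.
      Acc-ρ : ∀ h → ρ h ≡ true → Acc h ≡ true
      Acc-ρ h e = let (g , v , o) = h₀-outer in
        proj₂ (F⁻.~-ind (λ z → (ρ z ≡ true) × (Acc z ≡ true)) step
          (F.~-ind (g F⁻.~_) (λ z p → F⁻.~-trans p (F⁻.~-f⁻ z)) (F.~-trans o (F.~-sym (ρ⁻ e))) (F⁻.~-refl g))
            (ρ⁺ o , trans (sym (Acc-~ v)) Acc-h₀))
        where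
          step : ∀ z → (ρ z ≡ true) × (Acc z ≡ true) → (ρ (f⁻ z) ≡ true) × (Acc (f⁻ z) ≡ true)
          step z (p , q) = ρ-f⁻ z p , trans (sym (Acc-~ (V.~-f⁻ (a z)))) (Acc-closed z (a z) q
            (inj₂ (subst (+ 0 <_) (sym (proj₂ (cw z p))) (+<+ (ℕ.s≤s ℕ.z≤n)) , refl)))

      Acc-ov : ∀ h → ov h ≡ true → Acc h ≡ true
      Acc-ov h e = let (g , v , o) = ov⁻ e in trans (Acc-~ v) (Acc-ρ g (ρ⁺ o))

      U eN fX fN T : Mask n
      U h  = not (Acc h)
      eN h = U h ∧ U (a h)
      fX c = ⌊ FinP.any? (λ g → sameFace? M c g ×-dec (Acc g ≟ᵇ true)) ⌋
      fN c = not (fX c)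
      T c  = eN c ∧ (fX c ∧ ⌊ w (a c) <? + 0 ⌋)

      U-s : ∀ h → U h ≡ true → U (s h) ≡ true
      U-s h = trans (cong not (V.mask-const Acc Acc-s h))

      eN⁻ : ∀ {h} → eN h ≡ true → (Acc h ≡ false) × (Acc (a h) ≡ false)
      eN⁻ {h} e = let (p , q) = ∧-true⁻ {U h} e in not-true⁻ p , not-true⁻ q

      eN⁺ : ∀ {h} → Acc h ≡ false → Acc (a h) ≡ false → eN h ≡ true
      eN⁺ p q = ∧-true⁺ (not-true⁺ p) (not-true⁺ q)

      eN-a : ∀ h → eN h ≡ true → eN (a h) ≡ true
      eN-a h e = let (p , q) = eN⁻ e in eN⁺ q (trans (cong Acc (aa h)) p)

      fX⁺ : ∀ {c g} → SameFace M c g → Acc g ≡ true → fX c ≡ true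
      fX⁺ {c} {g} v e = ⌊⌋-true⁺ (FinP.any? (λ g → sameFace? M c g ×-dec (Acc g ≟ᵇ true))) (g , v , e)

      fX⁻ : ∀ {c} → fX c ≡ true → ∃ λ g → SameFace M c g × (Acc g ≡ true)
      fX⁻ {c} = ⌊⌋-true⁻ (FinP.any? (λ g → sameFace? M c g ×-dec (Acc g ≟ᵇ true)))

      fX-f : FaceMask fX
      fX-f c e = let (g , v , p) = fX⁻ e in fX⁺ (F.~-trans (F.~-sym (F.~-f c)) v) p

      fN⊆eN : ∀ c → fN c ≡ true → eN c ≡ true
      fN⊆eN c e = eN⁺ (untouched (F.~-refl c)) (trans (Acc-~ (V.~-f⁻ (a c))) (untouched (F.~-f⁻ c)))
        where
          untouched : ∀ {g} → SameFace M c g → Acc g ≡ false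
          untouched v = not-true (λ p → true≢false (fX⁺ v p) (not-true⁻ e))

      T⁻ : ∀ {c} → T c ≡ true → (eN c ≡ true) × (fX c ≡ true) × (w (a c) < + 0)
      T⁻ {c} e = let (p , q) = ∧-true⁻ {eN c} e ; (q₁ , q₂) = ∧-true⁻ {fX c} q in p , q₁ , ⌊⌋-true⁻ (w (a c) <? + 0) q₂

      -- Return moves may cross flow. Each crosses a derived edge at an accessible vertex, at an
      -- edge with an accessible end or at a touched face, so the return leaves no trace among
      -- inaccessible vertices, the edges `eN` and the faces `fN`.
      RStep : Fin n → Fin n → Set
      RStep x y = ((y ≡ f x) × (fX x ≡ true)) ⊎ (((y ≡ s x) × (Acc x ≡ true)) ⊎ ((y ≡ f⁻ x) × (Acc x ≡ true)))

      retᵛ retᶠ : ∀ {x y} → Star RStep x y → Fin n → ℤ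
      retᵛ ε h = + 0
      retᵛ (inj₁ _ ◅ r) h = retᵛ r h
      retᵛ {x} (inj₂ (inj₁ _) ◅ r) h = - δ (s x) h + retᵛ r h
      retᵛ (inj₂ (inj₂ _) ◅ r) h = retᵛ r h
      retᶠ ε h = + 0
      retᶠ {x} (inj₁ _ ◅ r) h = - δ (f x) h + retᶠ r h
      retᶠ (inj₂ (inj₁ _) ◅ r) h = retᶠ r h
      retᶠ {x} (inj₂ (inj₂ _) ◅ r) h = δ x h + retᶠ r h

      ret-div : ∀ (Q : Fin n → ℤ) {x y} (r : Star RStep x y) → ⟨ retᵛ r , retᶠ r ∣ curlᵛ Q , curlᶠ Q ⟩ ≡ Q x - Q y
      ret-div Q {x} ε = nil Q x
      ret-div Q {x} {y} (inj₁ (refl , _) ◅ r) = trans (addᶠ (λ h → - δ (f x) h) (retᵛ r) (retᶠ r) Q) (advance (Q x) (Q (f x)) (Q y)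
        (trans (negSingle (f x) (curlᶠ Q)) (trans (minus-swap (Q (f x)) (Q (f⁻ (f x)))) (cong (λ z → Q z - Q (f x)) (f⁻f x))))
          (ret-div Q r))
      ret-div Q {x} {y} (inj₂ (inj₁ (refl , _)) ◅ r) = trans (addᵛ (λ h → - δ (s x) h) (retᵛ r) (retᶠ r) Q) (advance (Q x) (Q (s x)) (Q y)
        (trans (negSingle (s x) (curlᵛ Q)) (trans (minus-swap (Q (s x)) (Q (s⁻ (s x)))) (cong (λ z → Q z - Q (s x)) (s⁻s x))))
          (ret-div Q r))
      ret-div Q {x} {y} (inj₂ (inj₂ (refl , _)) ◅ r) = trans (addᶠ (δ x) (retᵛ r) (retᶠ r) Q) (advance (Q x) (Q (f⁻ x)) (Q y)
        (sum-δ x (curlᶠ Q)) (ret-div Q r))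

      retᵛ-zero : ∀ {x y} (r : Star RStep x y) h → eN h ≡ true → retᵛ r h ≡ + 0
      retᵛ-zero ε h e = refl
      retᵛ-zero (inj₁ _ ◅ r) h e = retᵛ-zero r h e
      retᵛ-zero {x} (inj₂ (inj₁ (_ , p)) ◅ r) h e = cong₂ _+_
        (cong -_ (δ-≢ {i = s x} {h} (λ { refl → true≢false (Acc-s x p) (proj₁ (eN⁻ e)) }))) (retᵛ-zero r h e)
      retᵛ-zero (inj₂ (inj₂ _) ◅ r) h e = retᵛ-zero r h e

      retᶠ-zero : ∀ {x y} (r : Star RStep x y) h → eN h ≡ true → fN h ≡ true → retᶠ r h ≡ + 0
      retᶠ-zero ε h e e′ = refl
      retᶠ-zero {x} (inj₁ (_ , p) ◅ r) h e e′ = cong₂ _+_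
        (cong -_ (δ-≢ {i = f x} {h} (λ { refl → true≢false (fX-f x p) (not-true⁻ e′) }))) (retᶠ-zero r h e e′)
      retᶠ-zero (inj₂ (inj₁ _) ◅ r) h e e′ = retᶠ-zero r h e e′
      retᶠ-zero {x} (inj₂ (inj₂ (_ , p)) ◅ r) h e e′ = cong₂ _+_ (δ-≢ {i = x} {h} (λ { refl → true≢false p (proj₁ (eN⁻ e)) }))
        (retᶠ-zero r h e e′)

      acc⇒R : ∀ {x y} → Star (AccStep M w) x y → Acc x ≡ true → Star RStep x y
      acc⇒R ε p = ε
      acc⇒R (st@(inj₁ e) ◅ r) p = inj₂ (inj₁ (e , p)) ◅ acc⇒R r (Acc-closed _ _ p st)
      acc⇒R {x} (st@(inj₂ (_ , refl)) ◅ r) p = inj₂ (inj₂ (refl , p)) ◅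
        (inj₂ (inj₁ (sym (ss⁻ (a x)) , trans (sym (Acc-~ (V.~-f⁻ (a x)))) p′)) ◅ acc⇒R r p′)
        where
          p′ : Acc (a x) ≡ true
          p′ = Acc-closed _ _ p st

      face⇒R : ∀ {x g} → SameFace M x g → fX x ≡ true → Star RStep x g
      face⇒R {x} v p = proj₂ (F.~-ind (λ z → (fX z ≡ true) × Star RStep x z) (λ z q → fX-f z (proj₁ q) ,
        (proj₂ q ◅◅ (inj₁ (refl , proj₁ q) ◅ ε))) v (p , ε))

      toRoot : Star RStep h₀ root
      toRoot = acc⇒R (Acc-reach root (Acc-ρ root ρ-root)) Acc-h₀

      Return : Fin n → Set
      Return c = ∃ λ g → Star RStep (f⁻ c) g × Star RStep h₀ g

      return : ∀ c → fX c ≡ true → Return c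
      return c e = let (g , v , p) = fX⁻ e in g ,
        face⇒R (F.~-trans (F.~-sym (F.~-f⁻ c)) v) (F.mask-inverse fX fX-f c e) , acc⇒R (Acc-reach g p) Acc-h₀

      Rᵛ Rᶠ : ∀ {c} → Return c → Fin n → ℤ
      Rᵛ (g , r , r′) h = retᵛ r h + (retᵛ toRoot h - retᵛ r′ h)
      Rᶠ (g , r , r′) h = retᶠ r h + (retᶠ toRoot h - retᶠ r′ h)

      Rᵛ-zero : ∀ {c} (R : Return c) h → eN h ≡ true → Rᵛ R h ≡ + 0
      Rᵛ-zero (g , r , r′) h e = cong₂ _+_ (retᵛ-zero r h e) (cong₂ _-_ (retᵛ-zero toRoot h e) (retᵛ-zero r′ h e))

      Rᶠ-zero : ∀ {c} (R : Return c) h → eN h ≡ true → fN h ≡ true → Rᶠ R h ≡ + 0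
      Rᶠ-zero (g , r , r′) h e e′ = cong₂ _+_ (retᶠ-zero r h e e′) (cong₂ _-_ (retᶠ-zero toRoot h e e′) (retᶠ-zero r′ h e e′))

      ret : ∀ c → (fX c ≡ true) ⊎ (fX c ≡ false) → (Fin n → ℤ) × (Fin n → ℤ)
      ret c (inj₁ e) = Rᵛ (return c e) , Rᶠ (return c e)
      ret c (inj₂ _) = (λ _ → + 0) , (λ _ → + 0)

      -- `δ (a c)` is the flood move `s⁻` at `a c`, which ends in the corner `f⁻ c` of the touched
      -- face, where the return starts.
      A B : Fin n → Fin n → ℤ
      A c h = (floodᵛ w (flood (a c)) h + δ (a c) h) + proj₁ (ret c (true? (fX c))) h
      B c h = floodᶠ w (flood (a c)) h + proj₂ (ret c (true? (fX c))) h

      loop : ∀ c → T c ≡ true → ∀ (Q : Fin n → ℤ) → ⟨ A c , B c ∣ curlᵛ Q , curlᶠ Q ⟩ ≡ + 0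
      loop c e Q = go (true? (fX c))
        where
          go : ∀ (o : (fX c ≡ true) ⊎ (fX c ≡ false)) → ⟨ (λ h → (floodᵛ w (flood (a c)) h + δ (a c) h) + proj₁ (ret c o) h) ,
            (λ h → floodᶠ w (flood (a c)) h + proj₂ (ret c o) h) ∣ curlᵛ Q , curlᶠ Q ⟩ ≡ + 0
          go (inj₂ p) = ⊥-elim (true≢false (proj₁ (proj₂ (T⁻ e))) p)
          go (inj₁ p) = close (return c p)
            where
              close : ∀ (R : Return c) → ⟨ (λ h → (floodᵛ w (flood (a c)) h + δ (a c) h) + Rᵛ R h) ,
                (λ h → floodᶠ w (flood (a c)) h + Rᶠ R h) ∣ curlᵛ Q , curlᶠ Q ⟩ ≡ + 0
              close (g , r , r′) = begin
                ⟨ (λ h → (φᵛ h + δ (a c) h) + (retᵛ r h + (retᵛ toRoot h - retᵛ r′ h))) ,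
                  (λ h → φᶠ h + (retᶠ r h + (retᶠ toRoot h - retᶠ r′ h))) ∣ curlᵛ Q , curlᶠ Q ⟩
                  ≡⟨ sum-cong (λ h → loop-expand (φᵛ h) (φᶠ h) (δ (a c) h) (retᵛ r h) (retᶠ r h) (retᵛ toRoot h) (retᶠ toRoot h)
                    (retᵛ r′ h) (retᶠ r′ h) (curlᵛ Q h) (curlᶠ Q h)) ⟩
                sumℤ (λ h → (Pair φᵛ φᶠ h + δ (a c) h * curlᵛ Q h) + (Pair (retᵛ r) (retᶠ r) h + (Pair (retᵛ toRoot)
                  (retᶠ toRoot) h - Pair (retᵛ r′) (retᶠ r′) h)))
                  ≡⟨ trans (sum-+ (λ h → Pair φᵛ φᶠ h + δ (a c) h * curlᵛ Q h) (λ h → Pair (retᵛ r) (retᶠ r) h +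
                    (Pair (retᵛ toRoot) (retᶠ toRoot) h - Pair (retᵛ r′) (retᶠ r′) h)))
                       (cong₂ _+_ (sum-+ (Pair φᵛ φᶠ) (λ h → δ (a c) h * curlᵛ Q h)) (trans (sum-+ (Pair (retᵛ r) (retᶠ r))
                         (λ h → Pair (retᵛ toRoot) (retᶠ toRoot) h - Pair (retᵛ r′) (retᶠ r′) h))
                         (cong (_+_ (sumℤ (Pair (retᵛ r) (retᶠ r)))) (sum-sub (Pair (retᵛ toRoot) (retᶠ toRoot))
                           (Pair (retᵛ r′) (retᶠ r′)))))) ⟩
                (sumℤ (Pair φᵛ φᶠ) + sumℤ (λ h → δ (a c) h * curlᵛ Q h)) + (sumℤ (Pair (retᵛ r) (retᶠ r)) +
                  (sumℤ (Pair (retᵛ toRoot) (retᶠ toRoot)) - sumℤ (Pair (retᵛ r′) (retᶠ r′))))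
                  ≡⟨ cong₂ _+_ (cong₂ _+_ (flood-div w Q (flood (a c))) (sum-δ (a c) (curlᵛ Q))) (cong₂ _+_ (ret-div Q r)
                    (cong₂ _-_ (ret-div Q toRoot) (ret-div Q r′))) ⟩
                ((Q root - Q (a c)) + (Q (a c) - Q (f⁻ c))) + ((Q (f⁻ c) - Q g) + ((Q h₀ - Q root) - (Q h₀ - Q g)))
                  ≡⟨ walk-cancel (Q root) (Q (a c)) (Q (f⁻ c)) (Q g) (Q h₀) ⟩
                + 0 ∎
                where
                  open ≡-Reasoning
                  φᵛ φᶠ : Fin n → ℤ
                  φᵛ = floodᵛ w (flood (a c))
                  φᶠ = floodᶠ w (flood (a c))
                  Pair : (p q : Fin n → ℤ) → Fin n → ℤ
                  Pair p q h = p h * curlᵛ Q h + q h * curlᶠ Q h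

      za zb : Fin n → ℤ
      za = sum-all T A
      zb = sum-all T B

      orth : ∀ Q → ⟨ za , zb ∣ curlᵛ Q , curlᶠ Q ⟩ ≡ + 0
      orth Q = begin
        sumℤ (λ h → za h * curlᵛ Q h + zb h * curlᶠ Q h)
          ≡⟨ sum-cong (λ h → trans (cong₂ _+_ (push (curlᵛ Q h) (λ c → 𝟙 (T c) * A c h)) (push (curlᶠ Q h) (λ c → 𝟙 (T c) * B c h)))
               (sym (sum-+ (λ c → curlᵛ Q h * (𝟙 (T c) * A c h)) (λ c → curlᶠ Q h * (𝟙 (T c) * B c h))))) ⟩
        sumℤ (λ h → sumℤ (λ c → curlᵛ Q h * (𝟙 (T c) * A c h) + curlᶠ Q h * (𝟙 (T c) * B c h)))
          ≡⟨ sum-swap (λ h c → curlᵛ Q h * (𝟙 (T c) * A c h) + curlᶠ Q h * (𝟙 (T c) * B c h)) ⟩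
        sumℤ (λ c → sumℤ (λ h → curlᵛ Q h * (𝟙 (T c) * A c h) + curlᶠ Q h * (𝟙 (T c) * B c h)))
          ≡⟨ sum-cong (λ c → trans (sum-cong (λ h → shuffle (curlᵛ Q h) (curlᶠ Q h) (𝟙 (T c)) (A c h) (B c h)))
            (sum-* (𝟙 (T c)) (λ h → A c h * curlᵛ Q h + B c h * curlᶠ Q h))) ⟩
        sumℤ (λ c → 𝟙 (T c) * ⟨ A c , B c ∣ curlᵛ Q , curlᶠ Q ⟩)
          ≡⟨ sum-zero (λ c → trans (𝟙*-cong (T c) (λ e → loop c e Q)) (ℤP.*-zeroʳ (𝟙 (T c)))) ⟩
        + 0 ∎
        where
          open ≡-Reasoning
          push : ∀ q (F : Fin n → ℤ) → sumℤ F * q ≡ sumℤ (λ c → q * F c)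
          push q F = trans (ℤP.*-comm (sumℤ F) q) (sym (sum-* q F))
          shuffle : ∀ q r b x y → q * (b * x) + r * (b * y) ≡ b * (x * q + y * r)
          shuffle = solve-∀

      retᵛ0 : ∀ c h → eN h ≡ true → proj₁ (ret c (true? (fX c))) h ≡ + 0
      retᵛ0 c h e = go (true? (fX c))
        where
          go : ∀ o → proj₁ (ret c o) h ≡ + 0
          go (inj₁ p) = Rᵛ-zero (return c p) h e
          go (inj₂ _) = refl

      retᶠ0 : ∀ c h → eN h ≡ true → fN h ≡ true → proj₂ (ret c (true? (fX c))) h ≡ + 0
      retᶠ0 c h e e′ = go (true? (fX c))
        where
          go : ∀ o → proj₂ (ret c o) h ≡ + 0
          go (inj₁ p) = Rᶠ-zero (return c p) h e e′
          go (inj₂ _) = refl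

      A-inside : ∀ c h → eN h ≡ true → A c h ≡ floodᵛ w (flood (a c)) h + δ (a c) h
      A-inside c h e = trans (cong (_+_ (floodᵛ w (flood (a c)) h + δ (a c) h)) (retᵛ0 c h e)) (ℤP.+-identityʳ _)

      B-inside : ∀ c h → eN h ≡ true → fN h ≡ true → B c h ≡ floodᶠ w (flood (a c)) h
      B-inside c h e e′ = trans (cong (_+_ (floodᶠ w (flood (a c)) h)) (retᶠ0 c h e e′)) (ℤP.+-identityʳ _)

      0≤A : ∀ h → eN h ≡ true → ∀ c → + 0 ≤ A c h
      0≤A h e c = subst (+ 0 ≤_) (sym (A-inside c h e)) (0≤+ (0≤floodᵛ w (flood (a c)) h) (0≤δ (a c) h))

      0≤za : ∀ h → eN h ≡ true → + 0 ≤ za h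
      0≤za h e = sum-all-nonneg T A h (0≤A h e)

      0≤zb : ∀ h → eN h ≡ true → fN h ≡ true → + 0 ≤ zb h
      0≤zb h e e′ = sum-all-nonneg T B h (λ c → subst (+ 0 ≤_) (sym (B-inside c h e e′)) (0≤floodᶠ w (flood (a c)) h))

      za-zero : ∀ h → eN h ≡ true → + 0 < w h → za h ≡ + 0
      za-zero h e l = sum-all-zero T A h (λ c t → trans (A-inside c h e) (cong₂ _+_ (floodᵛ-zero w (flood (a c)) h l)
        (δ-≢ (λ q → ℤP.<-asym l (subst (λ z → w z < + 0) q (proj₂ (proj₂ (T⁻ t))))))))

      zb-zero : ∀ h → eN h ≡ true → fN h ≡ true → w (a h) < + 0 → zb h ≡ + 0
      zb-zero h e e′ l = sum-all-zero T B h (λ c t → trans (B-inside c h e e′) (floodᶠ-zero w (flood (a c)) h l))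

      za-entry : ∀ c → T c ≡ true → + 1 ≤ za (a c)
      za-entry c t = ℤP.≤-trans (subst (+ 1 ≤_) (sym (A-inside c (a c) e)) (≤-by (floodᵛ w (flood (a c)) (a c))
        (0≤floodᵛ w (flood (a c)) (a c))
          (trans (cong (_+_ (floodᵛ w (flood (a c)) (a c))) (δ-refl (a c))) (ℤP.+-comm (floodᵛ w (flood (a c)) (a c)) (+ 1)))))
        (sum-all-term T A (a c) (0≤A (a c) e) c t)
        where
          e : eN (a c) ≡ true
          e = eN-a c (proj₁ (T⁻ t))

      module _ (μ : ℤ) (0<μ : + 0 < μ) (t : Node) (t-a : ∀ h → μ * za h ≡ ∇ᵛ t h) (t-b : ∀ h → μ * zb h ≡ ∇ᶠ t h)
        (x₀ : Fin n) (x₀∈ : U x₀ ≡ true) (x₀-max : ∀ h → U h ≡ true → tV t h ≤ tV t x₀) where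

        private
          m₀ : ℤ
          m₀ = tV t x₀

          0≤μ : + 0 ≤ μ
          0≤μ = ℤP.<⇒≤ 0<μ

          from-diff : ∀ {x y z} → z ≡ x - y → + 0 ≤ z → y ≤ x
          from-diff {x} {y} refl p = ≤-by (x - y) p (lemma x y)
            where
              lemma : ∀ x y → x ≡ y + (x - y)
              lemma = solve-∀

          -- Within the inaccessible part the walks consist of flood moves only, so the chain is
          -- nonnegative and `t` weakly increases from faces to edges to vertices. This makes the
          -- sets `F′`, `E′`, `U′` nested.
          E≤V : ∀ {h} → eN h ≡ true → tE t h ≤ tV t h
          E≤V {h} e = from-diff (t-a h) (0≤* 0≤μ (0≤za h e))

          F≤E : ∀ {c} → fN c ≡ true → tF t c ≤ tE t c
          F≤E {c} e = from-diff (t-b c) (0≤* 0≤μ (0≤zb c (fN⊆eN c e) e))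

          V≤m : ∀ {h} → Acc h ≡ false → tV t h ≤ m₀
          V≤m {h} e = x₀-max h (not-true⁺ e)

          U′ E′ F′ : Mask n
          U′ h = U h ∧ ⌊ tV t h ℤ.≟ m₀ ⌋
          E′ h = eN h ∧ ⌊ tE t h ℤ.≟ m₀ ⌋
          F′ h = fN h ∧ ⌊ tF t h ℤ.≟ m₀ ⌋

          U′⁻ : ∀ {h} → U′ h ≡ true → (Acc h ≡ false) × (tV t h ≡ m₀)
          U′⁻ {h} e = let (p , q) = ∧-true⁻ {U h} e in not-true⁻ p , ⌊⌋-true⁻ (tV t h ℤ.≟ m₀) q

          E′⁻ : ∀ {h} → E′ h ≡ true → (eN h ≡ true) × (tE t h ≡ m₀)
          E′⁻ {h} e = let (p , q) = ∧-true⁻ {eN h} e in p , ⌊⌋-true⁻ (tE t h ℤ.≟ m₀) q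

          F′⁻ : ∀ {h} → F′ h ≡ true → (fN h ≡ true) × (tF t h ≡ m₀)
          F′⁻ {h} e = let (p , q) = ∧-true⁻ {fN h} e in p , ⌊⌋-true⁻ (tF t h ℤ.≟ m₀) q

          U′⁺ : ∀ {h} → Acc h ≡ false → tV t h ≡ m₀ → U′ h ≡ true
          U′⁺ {h} p q = ∧-true⁺ (not-true⁺ p) (⌊⌋-true⁺ (tV t h ℤ.≟ m₀) q)

          E′⁺ : ∀ {h} → eN h ≡ true → tE t h ≡ m₀ → E′ h ≡ true
          E′⁺ {h} p q = ∧-true⁺ p (⌊⌋-true⁺ (tE t h ℤ.≟ m₀) q)

          F′⁺ : ∀ {h} → fN h ≡ true → tF t h ≡ m₀ → F′ h ≡ true
          F′⁺ {h} p q = ∧-true⁺ p (⌊⌋-true⁺ (tF t h ℤ.≟ m₀) q)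

          U′-s : ∀ h → U′ h ≡ true → U′ (s h) ≡ true
          U′-s h e = let (p , q) = U′⁻ e in U′⁺ (trans (V.mask-const Acc Acc-s h) p) (trans (tV-inv t h) q)

          E′-a : ∀ h → E′ h ≡ true → E′ (a h) ≡ true
          E′-a h e = let (p , q) = E′⁻ e in E′⁺ (eN-a h p) (trans (tE-inv t h) q)

          F′-f : FaceMask F′
          F′-f h e = let (p , q) = F′⁻ e in F′⁺ (trans (cong not (F.mask-const fX fX-f h)) p) (trans (tF-inv t h) q)

          E′⊆U′ : ∀ h → E′ h ≡ true → U′ h ≡ true
          E′⊆U′ h e = let (p , q) = E′⁻ e in U′⁺ (proj₁ (eN⁻ p)) (ℤP.≤-antisym (V≤m (proj₁ (eN⁻ p))) (subst (_≤ tV t h) q (E≤V p)))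

          F′⊆E′ : ∀ h → F′ h ≡ true → E′ h ≡ true
          F′⊆E′ h e = let (p , q) = F′⁻ e ; en = fN⊆eN h p in
            E′⁺ en (ℤP.≤-antisym (ℤP.≤-trans (E≤V en) (V≤m (proj₁ (eN⁻ en)))) (subst (_≤ tE t h) q (F≤E p)))

          root∉F′ : F′ root ≡ false
          root∉F′ = not-true (λ e → true≢false (fX⁺ (F.~-refl root) (Acc-ρ root ρ-root)) (not-true⁻ (proj₁ (F′⁻ e))))

          strict : ∀ {x y z} → z ≡ + 0 → μ * z ≡ x - y → x ≡ y
          strict refl e = a-b≡0⇒a≡b (trans (sym e) (ℤP.*-zeroʳ μ))

          -- Flow out of an edge with an accessible end would make the vertex accessible. From
          -- another edge, flow blocks the flood at this half-edge, so `t` takes the same value on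
          -- both sides and the edge is maximal too.
          no-x : ∀ h → U′ h ≡ true → E′ h ≡ false → xOf w h ≡ + 0
          no-x h e e′ = pos≡0 ([ (λ l → l) , (λ l → ⊥-elim (inflow l (true? (Acc (a h))))) ]′ (≤-cases (w h) (+ 0)))
            where
              inflow : + 0 < w h → (Acc (a h) ≡ true) ⊎ (Acc (a h) ≡ false) → ⊥
              inflow l (inj₁ p) = true≢false (subst (λ z → Acc z ≡ true) (aa h) (Acc-closed (a h) (a (a h)) p
                (inj₂ (subst (λ z → + 0 < w z) (sym (aa h)) l , refl)))) (proj₁ (U′⁻ e))
              inflow l (inj₂ p) = true≢false (E′⁺ en (trans (sym (strict (za-zero h en l) (t-a h))) (proj₂ (U′⁻ e)))) e′
                where
                  en : eN h ≡ true
                  en = eN⁺ (proj₁ (U′⁻ e)) p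

          -- From an untouched face, flow blocks the flood and forces equal values of `t`, as in
          -- `no-x`. From a touched face, `c` is in `T`, and its walk puts an endpoint of the edge
          -- above the maximum.
          no-y : ∀ c → E′ c ≡ true → F′ c ≡ false → yOf w (a c) ≡ + 0
          no-y c e e′ = neg≡0 ([ (λ l → l) , (λ l → ⊥-elim (inflow l (true? (fX c)))) ]′ (≤-cases (+ 0) (w (a c))))
            where
              en : eN c ≡ true
              en = proj₁ (E′⁻ e)
              inflow : w (a c) < + 0 → (fX c ≡ true) ⊎ (fX c ≡ false) → ⊥
              inflow l (inj₂ p) = true≢false (F′⁺ (not-true⁺ p) (trans (sym (strict (zb-zero c en (not-true⁺ p) l) (t-b c)))
                (proj₂ (E′⁻ e)))) e′
              inflow l (inj₁ p) = ≤<-absurd (V≤m (proj₂ (eN⁻ en))) (subst (_< tV t (a c)) (trans (tE-inv t c) (proj₂ (E′⁻ e)))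
                (sub-pos⁻ (subst (+ 0 <_) (t-a (a c)) (pos-mult 0<μ (ℤP.<-≤-trans (+<+ (ℕ.s≤s ℕ.z≤n))
                  (za-entry c (∧-true⁺ en (∧-true⁺ p (⌊⌋-true⁺ (w (a c) <? + 0) l)))))))))

          same-sum : ∀ (P P′ : Mask n) (Z : Fin n → ℤ) → (∀ h → P′ h ≡ true → P h ≡ true) → (∀ h → P h ≡ true → P′ h ≡ false → Z h ≡ + 0) →
            sumℤ (λ h → 𝟙 (P h) * Z h) ≡ sumℤ (λ h → 𝟙 (P′ h) * Z h)
          same-sum P P′ Z sub z = sum-cong (λ h → help h (true? (P h)) (true? (P′ h)))
            where
              help : ∀ h → (P h ≡ true) ⊎ (P h ≡ false) → (P′ h ≡ true) ⊎ (P′ h ≡ false) → 𝟙 (P h) * Z h ≡ 𝟙 (P′ h) * Z h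
              help h (inj₁ p) (inj₁ q) = cong (λ b → 𝟙 b * Z h) (trans p (sym q))
              help h (inj₁ p) (inj₂ q) = trans (cong (𝟙 (P h) *_) (z h p q)) (trans (ℤP.*-zeroʳ (𝟙 (P h)))
                (sym (trans (cong (λ b → 𝟙 b * Z h) q) (ℤP.*-zeroˡ (Z h)))))
              help h (inj₂ p) (inj₁ q) = ⊥-elim (true≢false (sub h q) p)
              help h (inj₂ p) (inj₂ q) = cong (λ b → 𝟙 b * Z h) (trans p (sym q))

          module D = Density d no-short U′ E′ F′ U′-s E′-a E′⊆U′ F′-f F′⊆E′ root∉F′ x₀ (U′⁺ (not-true⁻ x₀∈) refl)

          Xsum Wsum Ysum Gsum : ℤ
          Xsum = sumℤ (λ h → 𝟙 (U′ h) * xOf w h)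
          Wsum = sumℤ (λ h → 𝟙 (E′ h) * w h)
          Ysum = sumℤ (λ h → 𝟙 (E′ h) * yOf w h)
          Gsum = sumℤ D.G

          x-total : Xsum ≡ + d * # (λ h → V.least h ∧ U′ h)
          x-total = V.orbit-total U′ (xOf w) (+ d) U′-s (λ r e → vertex-class or r (λ o → true≢false (Acc-ov r (ov⁺ o)) (proj₁ (U′⁻ e))))

          w-total : + 2 * Wsum ≡ (+ d - + 2) * # E′
          w-total = edge-total E′ w (+ d - + 2) E′-a (λ h e → edge-weight or h λ where
            (inj₁ o) → true≢false (Acc-ρ h (ρ⁺ o)) (proj₁ (eN⁻ (proj₁ (E′⁻ e))))
            (inj₂ o) → true≢false (Acc-ρ (a h) (ρ⁺ o)) (proj₂ (eN⁻ (proj₁ (E′⁻ e)))))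

          xw : Xsum ≡ Wsum + Ysum
          xw = trans (same-sum U′ E′ (xOf w) E′⊆U′ no-x)
            (trans (sum-cong (λ h → trans (cong (𝟙 (E′ h) *_) (trans (back (xOf w h) (yOf w h)) (cong (_+ yOf w h)
            (pos-neg (w h))))) (ℤP.*-distribˡ-+ (𝟙 (E′ h)) (w h) (yOf w h))))
            (sum-+ (λ h → 𝟙 (E′ h) * w h) (λ h → 𝟙 (E′ h) * yOf w h)))
            where
              back : ∀ x y → x ≡ (x - y) + y
              back = solve-∀

          yG : Ysum ≡ Gsum
          yG = begin
            Ysum ≡⟨ sym (edge-swap E′ E′-a (yOf w)) ⟩
            sumℤ (λ h → 𝟙 (E′ h) * yOf w (a h)) ≡⟨ same-sum E′ F′ (yOf w ∘ a) F′⊆E′ no-y ⟩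
            sumℤ (λ h → 𝟙 (F′ h) * yOf w (a h)) ≡⟨ y-faces (sumℤ (λ h → 𝟙 (F′ h) * yOf w (a h))) (# F′)
              (trans (sym (trans (sum-cong (λ h → distrib (𝟙 (F′ h)) (yOf w (a h)))) (sum-sub (𝟙 ∘ F′) (λ h → 𝟙 (F′ h) * yOf w (a h)))))
                (F.orbit-total F′ (λ c → + 1 - yOf w (a c)) (+ d) F′-f (λ r e → face-class or r
                  (not-true (λ o → true≢false (fX⁺ (F.~-refl r) (Acc-ρ r o)) (not-true⁻ (proj₁ (F′⁻ e)))))))) ⟩
            # F′ - + d * # (λ h → F.least h ∧ F′ h) ≡⟨ sym (trans (sum-cong (λ h → term h))
              (trans (sum-sub (𝟙 ∘ F′) (λ h → + d * 𝟙 (F.least h ∧ F′ h))) (cong (_-_ (# F′))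
              (sum-* (+ d) (λ h → 𝟙 (F.least h ∧ F′ h)))))) ⟩
            Gsum ∎
            where
              open ≡-Reasoning
              distrib : ∀ b y → b * (+ 1 - y) ≡ b - b * y
              distrib = solve-∀
              y-faces : ∀ y p {q} → p - y ≡ q → y ≡ p - q
              y-faces y p refl = lemma y p
                where
                  lemma : ∀ y p → y ≡ p - (p - y)
                  lemma = solve-∀
              expand : ∀ b d l → b * (+ 1 - d * l) + + 0 ≡ b - d * (l * b)
              expand = solve-∀
              no-root : ∀ h → ρ h ∧ E′ h ≡ false
              no-root h = not-true (λ e → let (p , q) = ∧-true⁻ {ρ h} e in true≢false (Acc-ρ h p) (proj₁ (eN⁻ (proj₁ (E′⁻ q)))))
              term : ∀ h → D.G h ≡ 𝟙 (F′ h) - + d * 𝟙 (F.least h ∧ F′ h)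
              term h = trans (cong (λ z → 𝟙 (F′ h) * (+ 1 - + d * 𝟙 (F.least h)) + 𝟙 z) (no-root h))
                (trans (expand (𝟙 (F′ h)) (+ d) (𝟙 (F.least h))) (cong (λ z → 𝟙 (F′ h) - + d * z) (sym (𝟙-∧ (F.least h) (F′ h)))))

        -- With no flow from outside, the demand of the three sets equals their supply exactly,
        -- whereas `density` leaves a gap of `2 d`.
        absurd : ⊥
        absurd = acc-arith (+ d) (# E′) Gsum (# (λ h → V.least h ∧ U′ h)) Xsum Wsum Ysum (+<+ 1≤d) D.density x-total w-total xw yG

    accessible : ∀ h → Acc h ≡ true
    accessible h = not-false λ h∉ →
      let (μ , 0<μ , t , t-a , t-b) = node-potential za zb orth
          (x₀ , x₀∈ , mx) = argmax U (tV t) {h} (not-true⁺ h∉)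
      in absurd μ 0<μ t t-a t-b x₀ x₀∈ mx

  flood⇒accessible : ∀ {d w} → 1 ℕ.≤ d → (∀ k → k ℕ.< d → ¬ HasCycle M k) → IsDOrientation M w d → Clockwise w →
    (∀ h → Star (FloodStep w) root h) → ∀ h₀ → OuterVertex M h₀ → AccessibleFrom M w h₀
  flood⇒accessible {d} {w} 1≤d no-short or cw fl h₀ o g =
    let (Acc , p , q , r) = reach-set (AccStep M w) (accStep? w) h₀ in
    q g (Inaccessible.accessible 1≤d no-short or cw fl h₀ o Acc p q r g)

  girth⇒suitable : ∀ {d} → 1 ℕ.≤ d → outerDeg M ≡ d → Girth M d → ∃ λ w → (IsDOrientation M w d × Suitable M w) × Clockwise w ×
    (∀ h → Star (FloodStep w) root h)
  girth⇒suitable {suc m} 1≤d od ((hs , cyc) , no-short) =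
    let (w , or , cw , fl) = Construct.construct contour (suc m) no-short (trans #ρ (cong +_ od))
    in w , (or , (flood⇒minimal w fl , proj₁ or , flood⇒accessible 1≤d no-short or cw fl)) , cw , fl
    where
      open Cycle cyc
      -- `outer-contour` needs a second face; the inside of the given cycle of length `d` provides
      -- it.
      inner : ∃ λ h → ρ h ≡ false
      inner = let (S , p , q , r) = reach-set (DualStep M w₀ hs) dualStep? root
                  outside = λ {h} (e : S h ≡ false) → not-true (λ o → true≢false (RootIn {S} (λ h e → r h (f h) e (inj₁ refl)) p o) e)
              in [ (λ j → a (hs zero) , outside (proj₂ (j zero))) , (λ j → hs zero , outside (proj₁ (j zero))) ]′ (Side.jordan S p q r)
      contour : SimpleOuterContour M w₀
      contour = proj₁ (outer-contour (suc m) no-short od inner)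

theorem4p7 : (d : ℕ) → 1 ℕ.≤ d → (M : PlaneMap) → outerDeg M ≡ d →
    (∀ h → d ℕ.≤ faceDeg M h) →
    ((∃ λ w → IsDOrientation M w d) ⇔ Girth M d) ×
    (Girth M d → ∃ λ w → (IsDOrientation M w d × Suitable M w) ×
      (∀ w′ → IsDOrientation M w′ d × Suitable M w′ → ∀ h → w′ h ≡ w h))
theorem4p7 d 1≤d M od _ = mk⇔ (λ { (w , or) → orientation⇒girth or od }) (λ g → let (w , (or , _) , _) = girth⇒suitable 1≤d od g in w , or) ,
  λ g → let (w , os , cw , fl) = girth⇒suitable 1≤d od g in w , os , λ { w′ (or′ , suit′) →
    unique (proj₁ os) or′ cw (suitable⇒clockwise suit′) fl (flood-all w′ (proj₁ suit′) (proj₂ (proj₂ suit′) root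
      (root , V.~-refl root , F.~-refl root))) }
  where open Access M
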